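{- For all integers $n\ge 0$ and $\alpha\ge 1$, $$PDN1\left(7^{2\alpha-1}n+\frac{17\cdot 7^{2\alpha-1}+1}{24}\right)\equiv 0\pmod{7^{\alpha}}$$ and $$PDN1\left(7^{2\alpha}n+\frac{23\cdot 7^{2\alpha}+1}{24}\right)\equiv 0\pmod{7^{\alpha+1}}.$$
   Context: $PDN1(N)$ is Andrews and Paule's function counting partition diamonds with $(n+1)$ copies of $n$ in which the parts at the links sum to $N$. Its generating function is $$\sum_{n\ge 0}PDN1(n)q^n=\frac{J_2^2}{J_1^5},\qquad J_k:=\prod_{m\ge1}(1-q^{km}),$$ and this identity may be taken as the definition of $PDN1(n)$. -}

module Defs where

open import Data.Nat as ℕ using (ℕ; zero; suc; _≤ᵇ_; _∸_)
open import Data.Nat.Divisibility using (_∣?_)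
open import Data.Integer as ℤ using (ℤ; +_; _+_; _-_; -_)
open import Data.List using (List; []; _∷_; upTo; map; foldr)
open import Data.Bool using (if_then_else_)
open import Relation.Nullary.Decidable using (does)

Series : Set
Series = ℕ → ℤ

one : Series
one zero    = + 1
one (suc _) = + 0

mul1-q^ : ℕ → Series → Series
mul1-q^ k a n = if k ≤ᵇ n then a n - a (n ∸ k) else a n

-- Multiplication by 1/(1 - q^k) = Σ_{j ≥ 0} q^{kj}, for k ≥ 1
-- (Cauchy product with the geometric series):
-- coefficient n is Σ_{0 ≤ i ≤ n, k ∣ i} a(n - i).
div1-q^ : ℕ → Series → Series
div1-q^ k a n = foldr _+_ (+ 0) (map (λ i → if does (k ∣? i) then a (n ∸ i) else + 0) (upTo (suc n)))

-- One factor of J_2^2 / J_1^5 at index m (m ≥ 1):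
-- (1 - q^{2m})^2 / (1 - q^m)^5.
factor : ℕ → Series → Series
factor m a =
  mul1-q^ (2 ℕ.* m) (mul1-q^ (2 ℕ.* m)
    (div1-q^ m (div1-q^ m (div1-q^ m (div1-q^ m (div1-q^ m a))))))

partialProd : ℕ → Series
partialProd zero    = one
partialProd (suc N) = factor (suc N) (partialProd N)

-- PDN1(n) = coefficient of q^n in J_2^2/J_1^5.  Factors with m > n are
-- ≡ 1 mod q^{n+1}, so the partial product up to m = n gives the exact
-- coefficient.
PDN1 : ℕ → ℤ
PDN1 n = partialProd n n

-- With φ = J²/J(q²) = Σ (-1)ⁿ q^{n²}, the generating function of PDN1 is 1/(J φ²). Let V f = f(q⁷), let U keep the
-- coefficients of q^{7n}, and put ξ = q⁻² J/J(q⁴⁹), ξ₂ = ξ(q²), η = φ/φ(q⁴⁹) = ξ²/ξ₂, u = 1/ξ, Z = u η⁻². Up to unit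
-- factors the two families of coefficients are those of the alternating iterates L₁ = U Z, L₂ₐ = U L₂ₐ₋₁,
-- L₂ₐ₊₁ = U (Z L₂ₐ).
--
-- The 7-dissections of J, φ and J³ (Euler, Gauss, Jacobi), compared in the identity η ξ₂ = ξ², yield functions α, β, γ
-- with α + β - γ = 1 and αβ - βγ - αγ + 2αβγ = 0 such that ξ, η and ξ₂ are explicit elements of the extension of
-- V(ℤ[h, h⁻¹, α, β]), h = αβγ, by an element E with E⁷ in the base. In this ring equality is decidable; it gives the
-- degree 7 equation of ξ and the values of U on ξᵏ, ξᵏη, ξᵏη², ξᵏξ₂ and ξᵏξ₂² for k ≤ 6.
--
-- Let t = q + … be the inverse of g = y/x + 1/y - x - 8, where x and y = 1 + x come from the components of ξ, and let
-- κ = 1 + 7t - 7th. The two functional equations t = u⁴ V(1/t) and h = η u V(κ) hold because both sides solve the same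
-- pair of equations relating t, h and t(q²), whose solution with the given leading terms is unique. They turn
-- U(Zᵉ tⁿ hʲ) into tabulated quantities, and the recurrence from the equation of ξ shows that U maps the span of
-- 7ᵛ tⁱ hʲ, with i bounded linearly in terms of v, into such a span with 7-adic valuation gaining one at every second
-- step (up to a factor 4ᵏ, which is invertible modulo 7).

module Submission where

-- The curve X₀(14) has genus 1, so its functions are not polynomials in a single generator: hence
-- the pair t, h, tied by a relation that is cubic in h (so j ≤ 2) with leading coefficient -64 (so
-- that reduction brings in only powers of 2 as denominators). The two functional equations amount
-- to the eta quotients t = q J(q⁷)⁴/J⁴ and h = q² J J(q¹⁴)⁷/(J(q²) J(q⁷)⁷); then κ = J(q²)⁷
-- J(q⁷)/(J⁷ J(q¹⁴)). Zero counting on modular curves is replaced by finite ring computations and by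
-- the remark that M f = N f(q²) with M(0) ≠ 0 and f(0) = 0 forces f = 0. The exponent 2 in ξ = q⁻²
-- J/J(q⁴⁹) is (49 - 1)/24. In the weights, u⁷ counts as t² because the equation of ξ has constant
-- term -V(g)², and a factor 7 pays for 4/7 of a power of t, the least rate that the coefficients
-- 21, 147 and 343 allow. U divides exponents by about 7, which leaves room to keep i ≤ 4(e - a) +
-- 2. The crux is the gain: at the minimal valuation e = a only t, t² and t² h occur, and on each of
-- them U gains a factor 7.

open import Defs
open import Algebra.Bundles using (CommutativeRing)
open import Algebra.Structures using (IsCommutativeRing)
open import Data.Bool using (Bool; true; false; if_then_else_; T)
open import Data.Empty using (⊥; ⊥-elim)
open import Data.Integer as ℤ using (ℤ; +_; -[1+_])
open import Data.Integer.Divisibility using (_∣_)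
import Data.Integer.Properties as ℤₚ
open import Data.List using (List; []; _∷_; map; _++_; length)
open import Data.List.Properties using (length-map)
open import Data.List.Relation.Unary.All.Properties using (map⁻)
open import Data.List.Relation.Unary.All using (All; []; _∷_)
open import Data.Nat using (ℕ; zero; suc; _+_; _*_; _^_; _/_; _≥_; _∸_; _≤_; _<_; z≤n; s≤s; _≡ᵇ_; _<ᵇ_; _≤ᵇ_)
import Data.Nat.Properties as ℕₚ
open import Data.Product using (_×_; _,_; proj₁; proj₂; uncurry)
open import Data.Sum using (inj₁; inj₂)
open import Data.Unit using (⊤; tt)
open import Data.Vec using (Vec; []; _∷_)
open import Function using (_∘_; case_of_)
open import Level using (0ℓ)
open import Relation.Binary.PropositionalEquality using (_≡_; _≢_; refl; sym; trans; cong; cong₂; subst; subst₂)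
open import Relation.Nullary using (yes; no)

-- Normalisation of polynomial expressions

infixl 6 _:+_ _:-_
infixl 7 _:*_
infixr 9 _:^_
infix 25 #_

data Expr : Set where
  con       : ℤ → Expr
  var       : ℕ → Expr
  _:+_ _:*_ : Expr → Expr → Expr
  :-_       : Expr → Expr

_:-_ : Expr → Expr → Expr
a :- b = a :+ (:- b)

_:^_ : Expr → ℕ → Expr
a :^ zero  = con (+ 1)
a :^ suc n = a :* (a :^ n)

#_ : ℕ → Expr
# n = con (+ n)

v : ℕ → Expr
v = var

Mono Poly : Set
Mono = List ℕ
Poly = List (ℤ × Mono)

data Cmp : Set where
  ≺ ≃ ≻ : Cmp

cmp : Mono → Mono → Cmp
cmp []       []       = ≃
cmp []       (_ ∷ _)  = ≺
cmp (_ ∷ _)  []       = ≻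
cmp (a ∷ as) (b ∷ bs) = if a ≡ᵇ b then cmp as bs else (if a <ᵇ b then ≺ else ≻)

cmp-eq : ∀ m n → cmp m n ≡ ≃ → m ≡ n
cmp-eq []       []       _ = refl
cmp-eq (a ∷ as) (b ∷ bs) p with a ≡ᵇ b in e
... | true  = cong₂ _∷_ (ℕₚ.≡ᵇ⇒≡ a b (subst T (sym e) tt)) (cmp-eq as bs p)
... | false with a <ᵇ b | p
...   | true  | ()
...   | false | ()

cons : ℤ → Mono → Poly → Poly
cons (+ zero) m p = p
cons c        m p = (c , m) ∷ p

mutual
  add : Poly → Poly → Poly
  add []      q = q
  add (s ∷ p) q = addTo s p q

  addTo : ℤ × Mono → Poly → Poly → Poly
  addTo s p [] = s ∷ p
  addTo (c , m) p ((d , n) ∷ q) with cmp m n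
  ... | ≺ = (c , m) ∷ add p ((d , n) ∷ q)
  ... | ≃ = cons (c ℤ.+ d) m (add p q)
  ... | ≻ = (d , n) ∷ addTo (c , m) p q

mulM : Mono → Mono → Mono
mulM []       n        = n
mulM (a ∷ m)  []       = a ∷ m
mulM (a ∷ m)  (b ∷ n)  = (a + b) ∷ mulM m n

-- Multiplication by a monomial respects the lexicographic order, and a nonzero integer factor kills
-- no coefficient, so the result is again sorted and free of zero terms. Canonicity of normal forms
-- rests on this, but only soundness is proved: a defect could only make a check fail.
scale : ℤ → Mono → Poly → Poly
scale c m []            = []
scale c m ((d , n) ∷ p) = (c ℤ.* d , mulM m n) ∷ scale c m p

mul : Poly → Poly → Poly
mul []            q = []
mul ((c , m) ∷ p) q = add (scale c m q) (mul p q)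

varM : ℕ → Mono
varM zero    = 1 ∷ []
varM (suc i) = 0 ∷ varM i

norm : Expr → Poly
norm (con c)  = cons c [] []
norm (var i)  = (+ 1 , varM i) ∷ []
norm (a :+ b) = add (norm a) (norm b)
norm (a :* b) = mul (norm a) (norm b)
norm (:- a)   = scale -[1+ 0 ] [] (norm a)

null : Poly → Bool
null []      = true
null (_ ∷ _) = false

data Eqn : Set where
  _≐_ : Expr → Expr → Eqn

infix 5 _≐_

combine : List (Expr × Eqn) → Expr
combine []                = con (+ 0)
combine ((c , l ≐ r) ∷ h) = c :* (l :- r) :+ combine h

module RingTools (R : CommutativeRing 0ℓ 0ℓ) (ι : ℤ → CommutativeRing.Carrier R) (ι-+ : ∀ a b → CommutativeRing._≈_ R (ι (a ℤ.+ b)) (CommutativeRing._+_ R (ι a) (ι b))) (ι-* : ∀ a b → CommutativeRing._≈_ R (ι (a ℤ.* b)) (CommutativeRing._*_ R (ι a) (ι b))) (ι-1 : CommutativeRing._≈_ R (ι (+ 1)) (CommutativeRing.1# R)) where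

  open CommutativeRing R public
    using (Carrier; _≈_; 0#; 1#; setoid; +-cong; +-congˡ; +-congʳ; *-cong; *-congˡ; *-congʳ; -‿cong
          ; +-identityˡ; +-identityʳ; *-identityˡ; *-identityʳ; zeroˡ; zeroʳ; -‿inverseʳ; -‿inverseˡ)
    renaming (_+_ to infixl 6 _⊕_; _*_ to infixl 7 _⊗_; -_ to infix 8 ⊖_; refl to ≈-refl; sym to ≈-sym; trans to ≈-trans; reflexive to ≈-reflexive
             ; +-assoc to ⊕-assoc; +-comm to ⊕-comm; *-assoc to ⊗-assoc; *-comm to ⊗-comm; distribˡ to ⊗-distribˡ; distribʳ to ⊗-distribʳ)
  open import Relation.Binary.Reasoning.Setoid setoid public
  open import Algebra.Properties.Ring (CommutativeRing.ring R) public
    using (-0#≈0#; +-cancelˡ; -‿involutive)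

  infixl 6 _⊝_
  infixr 9 _↑_

  _⊝_ : Carrier → Carrier → Carrier
  a ⊝ b = a ⊕ ⊖ b

  -- The base case is `ι (+ 1)` and not `1#`, so that for a literal exponent `a ↑ n` is
  -- definitionally the value of `e :^ n` and statements about powers can serve directly as
  -- certificate hypotheses.
  _↑_ : Carrier → ℕ → Carrier
  a ↑ zero  = ι (+ 1)
  a ↑ suc n = a ⊗ (a ↑ n)

  ↑-cong : ∀ {a b} n → a ≈ b → a ↑ n ≈ b ↑ n
  ↑-cong zero    p = ≈-refl
  ↑-cong (suc n) p = *-cong p (↑-cong n p)

  ↑-+ : ∀ a m n → a ↑ (m + n) ≈ a ↑ m ⊗ a ↑ n
  ↑-+ a zero    n = ≈-sym (≈-trans (*-congʳ ι-1) (*-identityˡ _))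
  ↑-+ a (suc m) n = ≈-trans (*-congˡ (↑-+ a m n)) (≈-sym (⊗-assoc _ _ _))

  ι-0 : ι (+ 0) ≈ 0#
  ι-0 = +-cancelˡ (ι (+ 0)) _ _ (≈-trans (≈-sym (ι-+ (+ 0) (+ 0))) (≈-sym (+-identityʳ _)))

  interchange : ∀ a b c d → (a ⊕ b) ⊕ (c ⊕ d) ≈ (a ⊕ c) ⊕ (b ⊕ d)
  interchange a b c d = begin
    (a ⊕ b) ⊕ (c ⊕ d) ≈⟨ ⊕-assoc a b _ ⟩
    a ⊕ (b ⊕ (c ⊕ d)) ≈⟨ +-congˡ (≈-sym (⊕-assoc b c d)) ⟩
    a ⊕ ((b ⊕ c) ⊕ d) ≈⟨ +-congˡ (+-congʳ (⊕-comm b c)) ⟩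
    a ⊕ ((c ⊕ b) ⊕ d) ≈⟨ +-congˡ (⊕-assoc c b d) ⟩
    a ⊕ (c ⊕ (b ⊕ d)) ≈⟨ ≈-sym (⊕-assoc a c _) ⟩
    (a ⊕ c) ⊕ (b ⊕ d) ∎

  ⊗-interchange : ∀ a b c d → (a ⊗ b) ⊗ (c ⊗ d) ≈ (a ⊗ c) ⊗ (b ⊗ d)
  ⊗-interchange a b c d = begin
    (a ⊗ b) ⊗ (c ⊗ d) ≈⟨ ⊗-assoc a b _ ⟩
    a ⊗ (b ⊗ (c ⊗ d)) ≈⟨ *-congˡ (≈-sym (⊗-assoc b c d)) ⟩
    a ⊗ ((b ⊗ c) ⊗ d) ≈⟨ *-congˡ (*-congʳ (⊗-comm b c)) ⟩
    a ⊗ ((c ⊗ b) ⊗ d) ≈⟨ *-congˡ (⊗-assoc c b d) ⟩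
    a ⊗ (c ⊗ (b ⊗ d)) ≈⟨ ≈-sym (⊗-assoc a c _) ⟩
    (a ⊗ c) ⊗ (b ⊗ d) ∎

  ⊝-move : ∀ {a b} → a ⊝ b ≈ 0# → a ≈ b
  ⊝-move {a} {b} p = begin
    a             ≈⟨ ≈-sym (+-identityʳ a) ⟩
    a ⊕ 0#        ≈⟨ +-congˡ (≈-sym (-‿inverseˡ b)) ⟩
    a ⊕ (⊖ b ⊕ b) ≈⟨ ≈-sym (⊕-assoc _ _ _) ⟩
    (a ⊝ b) ⊕ b   ≈⟨ +-congʳ p ⟩
    0# ⊕ b        ≈⟨ +-identityˡ b ⟩
    b             ∎

  ⊝-zero : ∀ {a b} → a ≈ b → a ⊝ b ≈ 0#
  ⊝-zero p = ≈-trans (+-congʳ p) (-‿inverseʳ _)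

  Env : Set
  Env = ℕ → Carrier

  env : List Carrier → Env
  env []       _       = 0#
  env (x ∷ xs) zero    = x
  env (x ∷ xs) (suc n) = env xs n

  ⟦_⟧ : Expr → Env → Carrier
  ⟦ con c ⟧  ρ = ι c
  ⟦ var i ⟧  ρ = ρ i
  ⟦ a :+ b ⟧ ρ = ⟦ a ⟧ ρ ⊕ ⟦ b ⟧ ρ
  ⟦ a :* b ⟧ ρ = ⟦ a ⟧ ρ ⊗ ⟦ b ⟧ ρ
  ⟦ :- a ⟧   ρ = ⊖ ⟦ a ⟧ ρ

  ⟦⟧-cong : ∀ e {ρ σ : Env} → (∀ i → ρ i ≈ σ i) → ⟦ e ⟧ ρ ≈ ⟦ e ⟧ σ
  ⟦⟧-cong (con c)  p = ≈-refl
  ⟦⟧-cong (var i)  p = p i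
  ⟦⟧-cong (a :+ b) p = +-cong (⟦⟧-cong a p) (⟦⟧-cong b p)
  ⟦⟧-cong (a :* b) p = *-cong (⟦⟧-cong a p) (⟦⟧-cong b p)
  ⟦⟧-cong (:- a)   p = -‿cong (⟦⟧-cong a p)

  evM : Mono → Env → Carrier
  evM []      ρ = 1#
  evM (e ∷ m) ρ = ρ 0 ↑ e ⊗ evM m (ρ ∘ suc)

  ev : Poly → Env → Carrier
  ev []            ρ = 0#
  ev ((c , m) ∷ p) ρ = ι c ⊗ evM m ρ ⊕ ev p ρ

  cons-ev : ∀ c m p ρ → ev (cons c m p) ρ ≈ ι c ⊗ evM m ρ ⊕ ev p ρ
  cons-ev (+ zero)  m p ρ = ≈-sym (≈-trans (+-congʳ (≈-trans (*-congʳ ι-0) (zeroˡ _))) (+-identityˡ _))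
  cons-ev (+ suc n) m p ρ = ≈-refl
  cons-ev -[1+ n ]  m p ρ = ≈-refl

  mutual
    add-ev : ∀ p q ρ → ev (add p q) ρ ≈ ev p ρ ⊕ ev q ρ
    add-ev []      q ρ = ≈-sym (+-identityˡ _)
    add-ev (s ∷ p) q ρ = addTo-ev s p q ρ

    addTo-ev : ∀ s p q ρ → ev (addTo s p q) ρ ≈ ev (s ∷ p) ρ ⊕ ev q ρ
    addTo-ev s p [] ρ = ≈-sym (+-identityʳ _)
    addTo-ev (c , m) p ((d , n) ∷ q) ρ with cmp m n in e
    ... | ≺ = ≈-trans (+-congˡ (add-ev p ((d , n) ∷ q) ρ)) (≈-sym (⊕-assoc _ _ _))
    ... | ≻ = begin
      x ⊕ ev (addTo (c , m) p q) ρ       ≈⟨ +-congˡ (addTo-ev (c , m) p q ρ) ⟩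
      x ⊕ (y ⊕ ev q ρ)                   ≈⟨ ≈-sym (⊕-assoc _ _ _) ⟩
      (x ⊕ y) ⊕ ev q ρ                   ≈⟨ +-congʳ (⊕-comm _ _) ⟩
      (y ⊕ x) ⊕ ev q ρ                   ≈⟨ ⊕-assoc _ _ _ ⟩
      y ⊕ (x ⊕ ev q ρ)                   ∎
      where x = ι d ⊗ evM n ρ
            y = ev ((c , m) ∷ p) ρ
    ... | ≃ with cmp-eq m n e
    ...   | refl = begin
      ev (cons (c ℤ.+ d) m (add p q)) ρ                ≈⟨ cons-ev (c ℤ.+ d) m (add p q) ρ ⟩
      ι (c ℤ.+ d) ⊗ evM m ρ ⊕ ev (add p q) ρ           ≈⟨ +-cong (≈-trans (*-congʳ (ι-+ c d)) (⊗-distribʳ _ _ _)) (add-ev p q ρ) ⟩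
      (ι c ⊗ evM m ρ ⊕ ι d ⊗ evM m ρ) ⊕ (ev p ρ ⊕ ev q ρ) ≈⟨ interchange _ _ _ _ ⟩
      (ι c ⊗ evM m ρ ⊕ ev p ρ) ⊕ (ι d ⊗ evM m ρ ⊕ ev q ρ) ∎

  mulM-ev : ∀ m n ρ → evM (mulM m n) ρ ≈ evM m ρ ⊗ evM n ρ
  mulM-ev []      n       ρ = ≈-sym (*-identityˡ _)
  mulM-ev (a ∷ m) []      ρ = ≈-sym (*-identityʳ _)
  mulM-ev (a ∷ m) (b ∷ n) ρ = ≈-trans (*-cong (↑-+ (ρ 0) a b) (mulM-ev m n (ρ ∘ suc))) (⊗-interchange _ _ _ _)

  scale-ev : ∀ c m p ρ → ev (scale c m p) ρ ≈ (ι c ⊗ evM m ρ) ⊗ ev p ρ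
  scale-ev c m []            ρ = ≈-sym (zeroʳ _)
  scale-ev c m ((d , n) ∷ p) ρ = begin
    ι (c ℤ.* d) ⊗ evM (mulM m n) ρ ⊕ ev (scale c m p) ρ
      ≈⟨ +-cong (≈-trans (*-cong (ι-* c d) (mulM-ev m n ρ)) (⊗-interchange _ _ _ _)) (scale-ev c m p ρ) ⟩
    (ι c ⊗ evM m ρ) ⊗ (ι d ⊗ evM n ρ) ⊕ (ι c ⊗ evM m ρ) ⊗ ev p ρ
      ≈⟨ ≈-sym (⊗-distribˡ _ _ _) ⟩
    (ι c ⊗ evM m ρ) ⊗ (ι d ⊗ evM n ρ ⊕ ev p ρ) ∎

  mul-ev : ∀ p q ρ → ev (mul p q) ρ ≈ ev p ρ ⊗ ev q ρ
  mul-ev []            q ρ = ≈-sym (zeroˡ _)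
  mul-ev ((c , m) ∷ p) q ρ = begin
    ev (add (scale c m q) (mul p q)) ρ          ≈⟨ add-ev (scale c m q) (mul p q) ρ ⟩
    ev (scale c m q) ρ ⊕ ev (mul p q) ρ         ≈⟨ +-cong (scale-ev c m q ρ) (mul-ev p q ρ) ⟩
    (ι c ⊗ evM m ρ) ⊗ ev q ρ ⊕ ev p ρ ⊗ ev q ρ  ≈⟨ ≈-sym (⊗-distribʳ _ _ _) ⟩
    (ι c ⊗ evM m ρ ⊕ ev p ρ) ⊗ ev q ρ           ∎

  varM-ev : ∀ i ρ → evM (varM i) ρ ≈ ρ i
  varM-ev zero    ρ = ≈-trans (*-identityʳ _) (≈-trans (*-congˡ ι-1) (*-identityʳ _))
  varM-ev (suc i) ρ = ≈-trans (*-congʳ ι-1) (≈-trans (*-identityˡ _) (varM-ev i (ρ ∘ suc)))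

  ι-neg1 : ∀ x → (ι -[1+ 0 ] ⊗ 1#) ⊗ x ≈ ⊖ x
  ι-neg1 x = ≈-trans (*-congʳ (*-identityʳ _)) (⊝-move (begin
    ι -[1+ 0 ] ⊗ x ⊝ ⊖ x          ≈⟨ +-congˡ (-‿involutive x) ⟩
    ι -[1+ 0 ] ⊗ x ⊕ x            ≈⟨ +-congˡ (≈-sym (≈-trans (*-congʳ ι-1) (*-identityˡ x))) ⟩
    ι -[1+ 0 ] ⊗ x ⊕ ι (+ 1) ⊗ x  ≈⟨ ≈-sym (⊗-distribʳ _ _ _) ⟩
    (ι -[1+ 0 ] ⊕ ι (+ 1)) ⊗ x    ≈⟨ *-congʳ (≈-trans (≈-sym (ι-+ -[1+ 0 ] (+ 1))) ι-0) ⟩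
    0# ⊗ x                        ≈⟨ zeroˡ x ⟩
    0#                            ∎))

  norm-ev : ∀ e ρ → ev (norm e) ρ ≈ ⟦ e ⟧ ρ
  norm-ev (con c)  ρ = ≈-trans (cons-ev c [] [] ρ) (≈-trans (+-identityʳ _) (*-identityʳ _))
  norm-ev (var i)  ρ = ≈-trans (+-identityʳ _) (≈-trans (*-cong ι-1 (varM-ev i ρ)) (*-identityˡ _))
  norm-ev (a :+ b) ρ = ≈-trans (add-ev (norm a) (norm b) ρ) (+-cong (norm-ev a ρ) (norm-ev b ρ))
  norm-ev (a :* b) ρ = ≈-trans (mul-ev (norm a) (norm b) ρ) (*-cong (norm-ev a ρ) (norm-ev b ρ))
  norm-ev (:- a)   ρ = ≈-trans (scale-ev -[1+ 0 ] [] (norm a) ρ) (≈-trans (ι-neg1 _) (-‿cong (norm-ev a ρ)))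

  null-ev : ∀ p ρ → null p ≡ true → ev p ρ ≈ 0#
  null-ev [] ρ _ = ≈-refl

  solve : ∀ xs e f → null (norm (e :- f)) ≡ true → ⟦ e ⟧ (env xs) ≈ ⟦ f ⟧ (env xs)
  solve xs e f p = ⊝-move (≈-trans (≈-sym (norm-ev (e :- f) (env xs))) (null-ev (norm (e :- f)) (env xs) p))

  Holds : List Carrier → Eqn → Set
  Holds xs (l ≐ r) = ⟦ l ⟧ (env xs) ≈ ⟦ r ⟧ (env xs)

  combine-zero : ∀ xs h → All (Holds xs ∘ proj₂) h → ⟦ combine h ⟧ (env xs) ≈ 0#
  combine-zero xs []                [] = ι-0
  combine-zero xs ((c , l ≐ r) ∷ h) (p ∷ ps) =
    ≈-trans (+-cong (≈-trans (*-congˡ (⊝-zero p)) (zeroʳ _)) (combine-zero xs h ps)) (+-identityˡ _)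

  -- The polynomial identity e - f = Σ cᵢ (lᵢ - rᵢ) is checked by normalisation.
  lincomb : ∀ xs e f h → null (norm ((e :- f) :- combine h)) ≡ true →
            All (Holds xs ∘ proj₂) h → ⟦ e ⟧ (env xs) ≈ ⟦ f ⟧ (env xs)
  lincomb xs e f h p ps = ⊝-move (begin
    ⟦ e :- f ⟧ (env xs)      ≈⟨ ⊝-move (≈-trans (≈-sym (norm-ev ((e :- f) :- combine h) (env xs)))
                                              (null-ev (norm ((e :- f) :- combine h)) (env xs) p)) ⟩
    ⟦ combine h ⟧ (env xs)   ≈⟨ combine-zero xs h ps ⟩
    0#                       ∎)

  record IsHom (F : Carrier → Carrier) : Set where
    field
      F-cong : ∀ {a b} → a ≈ b → F a ≈ F b
      F-⊕    : ∀ a b → F (a ⊕ b) ≈ F a ⊕ F b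
      F-⊗    : ∀ a b → F (a ⊗ b) ≈ F a ⊗ F b
      F-⊖    : ∀ a → F (⊖ a) ≈ ⊖ F a
      F-ι    : ∀ c → F (ι c) ≈ ι c

    F-0 : F 0# ≈ 0#
    F-0 = ≈-trans (F-cong (≈-sym ι-0)) (≈-trans (F-ι (+ 0)) ι-0)

    F-1 : F 1# ≈ 1#
    F-1 = ≈-trans (F-cong (≈-sym ι-1)) (≈-trans (F-ι (+ 1)) ι-1)

    F-↑ : ∀ a n → F (a ↑ n) ≈ F a ↑ n
    F-↑ a zero    = F-ι (+ 1)
    F-↑ a (suc n) = ≈-trans (F-⊗ a (a ↑ n)) (*-congˡ (F-↑ a n))

    F-⊝ : ∀ a b → F (a ⊝ b) ≈ F a ⊝ F b
    F-⊝ a b = ≈-trans (F-⊕ a (⊖ b)) (+-congˡ (F-⊖ b))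

    F-env : ∀ xs i → F (env xs i) ≈ env (map F xs) i
    F-env []       i       = F-0
    F-env (x ∷ xs) zero    = ≈-refl
    F-env (x ∷ xs) (suc i) = F-env xs i

    F-⟦⟧ : ∀ xs e → F (⟦ e ⟧ (env xs)) ≈ ⟦ e ⟧ (env (map F xs))
    F-⟦⟧ xs (con c)  = F-ι c
    F-⟦⟧ xs (var i)  = F-env xs i
    F-⟦⟧ xs (a :+ b) = ≈-trans (F-⊕ _ _) (+-cong (F-⟦⟧ xs a) (F-⟦⟧ xs b))
    F-⟦⟧ xs (a :* b) = ≈-trans (F-⊗ _ _) (*-cong (F-⟦⟧ xs a) (F-⟦⟧ xs b))
    F-⟦⟧ xs (:- a)   = ≈-trans (F-⊖ _) (-‿cong (F-⟦⟧ xs a))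

-- Rings with decidable equality, evaluated in R: ℤ[h, h⁻¹] and monic extensions

module Codes (R : CommutativeRing 0ℓ 0ℓ) (ι : ℤ → CommutativeRing.Carrier R) (ι-+ : ∀ a b → CommutativeRing._≈_ R (ι (a ℤ.+ b)) (CommutativeRing._+_ R (ι a) (ι b))) (ι-* : ∀ a b → CommutativeRing._≈_ R (ι (a ℤ.* b)) (CommutativeRing._*_ R (ι a) (ι b))) (ι-1 : CommutativeRing._≈_ R (ι (+ 1)) (CommutativeRing.1# R)) where

  open RingTools R ι ι-+ ι-* ι-1 public

  one⊗ : ∀ a → ι (+ 1) ⊗ a ≈ a
  one⊗ a = ≈-trans (*-congʳ ι-1) (*-identityˡ a)

  -- Only soundness of the evaluation is asked for. An element may have several codes and `isZero`
  -- may miss a code of zero, so no linear independence over the base ever has to be proved.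
  record CodeRing : Set₁ where
    field
      C             : Set
      zeroᶜ         : C
      addᶜ mulᶜ     : C → C → C
      negᶜ          : C → C
      intᶜ          : ℤ → C
      isZero        : C → Bool
      ⟪_⟫           : C → Carrier
      zeroᶜ-sound   : ⟪ zeroᶜ ⟫ ≈ 0#
      addᶜ-sound    : ∀ a b → ⟪ addᶜ a b ⟫ ≈ ⟪ a ⟫ ⊕ ⟪ b ⟫
      mulᶜ-sound    : ∀ a b → ⟪ mulᶜ a b ⟫ ≈ ⟪ a ⟫ ⊗ ⟪ b ⟫
      negᶜ-sound    : ∀ a → ⟪ negᶜ a ⟫ ≈ ⊖ ⟪ a ⟫
      intᶜ-sound    : ∀ z → ⟪ intᶜ z ⟫ ≈ ι z
      isZero-sound  : ∀ a → isZero a ≡ true → ⟪ a ⟫ ≈ 0#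

    same : C → C → Bool
    same a b = isZero (addᶜ a (negᶜ b))

    same-sound : ∀ a b → same a b ≡ true → ⟪ a ⟫ ≈ ⟪ b ⟫
    same-sound a b p = ⊝-move (≈-trans (≈-sym (≈-trans (addᶜ-sound a (negᶜ b)) (+-congˡ (negᶜ-sound b)))) (isZero-sound _ p))

    look : List C → ℕ → C
    look []       _       = zeroᶜ
    look (c ∷ cs) zero    = c
    look (c ∷ cs) (suc i) = look cs i

    run : List C → Expr → C
    run cs (con z)  = intᶜ z
    run cs (var i)  = look cs i
    run cs (a :+ b) = addᶜ (run cs a) (run cs b)
    run cs (a :* b) = mulᶜ (run cs a) (run cs b)
    run cs (:- a)   = negᶜ (run cs a)

    infixr 5 _⊢_&_

    data Known : List C → List Carrier → Set where
      ∅     : Known [] []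
      _⊢_&_ : ∀ c {cs a as} → ⟪ c ⟫ ≈ a → Known cs as → Known (c ∷ cs) (a ∷ as)

    look-sound : ∀ {cs as} → Known cs as → ∀ i → ⟪ look cs i ⟫ ≈ env as i
    look-sound ∅        i       = zeroᶜ-sound
    look-sound (c ⊢ p & ps) zero    = p
    look-sound (c ⊢ p & ps) (suc i) = look-sound ps i

    run-sound : ∀ {cs as} → Known cs as → ∀ e → ⟪ run cs e ⟫ ≈ ⟦ e ⟧ (env as)
    run-sound ps (con z)  = intᶜ-sound z
    run-sound ps (var i)  = look-sound ps i
    run-sound ps (a :+ b) = ≈-trans (addᶜ-sound _ _) (+-cong (run-sound ps a) (run-sound ps b))
    run-sound ps (a :* b) = ≈-trans (mulᶜ-sound _ _) (*-cong (run-sound ps a) (run-sound ps b))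
    run-sound ps (:- a)   = ≈-trans (negᶜ-sound _) (-‿cong (run-sound ps a))

    decide : ∀ {cs as} → Known cs as → ∀ e f → same (run cs e) (run cs f) ≡ true → ⟦ e ⟧ (env as) ≈ ⟦ f ⟧ (env as)
    decide ps e f p = ≈-trans (≈-sym (run-sound ps e)) (≈-trans (same-sound _ _ p) (run-sound ps f))

  module LaurentPolynomials (h hi : Carrier) (h-hi : h ⊗ hi ≈ ι (+ 1)) where

    poly : List ℤ → Carrier
    poly []      = 0#
    poly (c ∷ p) = ι c ⊕ h ⊗ poly p

    addP mulP : List ℤ → List ℤ → List ℤ
    addP []      r       = r
    addP (c ∷ p) []      = c ∷ p
    addP (c ∷ p) (d ∷ r) = (c ℤ.+ d) ∷ addP p r

    scaleP : ℤ → List ℤ → List ℤ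
    scaleP c []      = []
    scaleP c (d ∷ r) = (c ℤ.* d) ∷ scaleP c r

    push : List ℤ → List ℤ
    push []      = []
    push (d ∷ s) = + 0 ∷ d ∷ s

    mulP []      r = []
    mulP (c ∷ p) r = addP (scaleP c r) (push (mulP p r))

    addP-sound : ∀ p r → poly (addP p r) ≈ poly p ⊕ poly r
    addP-sound []      r       = ≈-sym (+-identityˡ _)
    addP-sound (c ∷ p) []      = ≈-sym (+-identityʳ _)
    addP-sound (c ∷ p) (d ∷ r) = ≈-trans (+-cong (ι-+ c d) (≈-trans (*-congˡ (addP-sound p r)) (⊗-distribˡ _ _ _))) (interchange _ _ _ _)

    scaleP-sound : ∀ c r → poly (scaleP c r) ≈ ι c ⊗ poly r
    scaleP-sound c []      = ≈-sym (zeroʳ _)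
    scaleP-sound c (d ∷ r) = ≈-trans (+-cong (ι-* c d) (*-congˡ (scaleP-sound c r)))
      (solve (ι c ∷ ι d ∷ h ∷ poly r ∷ []) (var 0 :* var 1 :+ var 2 :* (var 0 :* var 3)) (var 0 :* (var 1 :+ var 2 :* var 3)) refl)

    mulP-sound : ∀ p r → poly (mulP p r) ≈ poly p ⊗ poly r
    mulP-sound []      r = ≈-sym (zeroˡ _)
    mulP-sound (c ∷ p) r = ≈-trans (addP-sound (scaleP c r) _) (≈-trans (+-cong (scaleP-sound c r) (≈-trans (push-sound (mulP p r)) (*-congˡ (mulP-sound p r))))
      (solve (ι c ∷ h ∷ poly p ∷ poly r ∷ []) (var 0 :* var 3 :+ var 1 :* (var 2 :* var 3)) ((var 0 :+ var 1 :* var 2) :* var 3) refl))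
      where
      push-sound : ∀ s → poly (push s) ≈ h ⊗ poly s
      push-sound []      = ≈-sym (zeroʳ _)
      push-sound (d ∷ s) = ≈-trans (+-congʳ ι-0) (+-identityˡ _)

    Lau : Set
    Lau = ℕ × List ℤ

    evL : Lau → Carrier
    evL (n , p) = hi ↑ n ⊗ poly p

    -- Cancelling powers of h against h⁻¹ keeps the codes from growing in long computations.
    strip : ℕ → List ℤ → Lau
    strip n       []              = 0 , []
    strip (suc n) (+ zero ∷ p)    = strip n p
    strip n       (c ∷ p)         = n , c ∷ p

    strip-sound : ∀ n p → evL (strip n p) ≈ evL (n , p)
    strip-sound zero    []              = ≈-refl
    strip-sound (suc n) []              = ≈-trans (zeroʳ _) (≈-sym (zeroʳ _))
    strip-sound (suc n) (+ zero ∷ p)    = ≈-trans (strip-sound n p) (≈-sym (≈-trans (*-congˡ (≈-trans (+-congʳ ι-0) (+-identityˡ _)))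
      (lincomb (hi ∷ hi ↑ n ∷ h ∷ poly p ∷ []) (var 0 :* var 1 :* (var 2 :* var 3)) (var 1 :* var 3)
        ((var 1 :* var 3 , var 2 :* var 0 ≐ # 1) ∷ []) refl (h-hi ∷ []))))
    strip-sound zero    (c ∷ p)         = ≈-refl
    strip-sound (suc n) (+ suc c ∷ p)   = ≈-refl
    strip-sound (suc n) (-[1+ c ] ∷ p)  = ≈-refl

    zeros : ℕ → List ℤ → List ℤ
    zeros zero    p = p
    zeros (suc n) p = + 0 ∷ zeros n p

    align : ℕ → ℕ → List ℤ → List ℤ → Lau
    align n       zero    p r = n , addP p (zeros n r)
    align zero    (suc m) p r = suc m , addP (zeros (suc m) p) r
    align (suc n) (suc m) p r = up (align n m p r)
      where
      up : Lau → Lau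
      up (k , s) = suc k , s

    zeros-sound : ∀ n p → evL (n , zeros n p) ≈ poly p
    zeros-sound zero    p = one⊗ _
    zeros-sound (suc n) p = ≈-trans (*-congˡ (≈-trans (+-congʳ ι-0) (+-identityˡ _)))
      (lincomb (hi ∷ hi ↑ n ∷ h ∷ poly (zeros n p) ∷ poly p ∷ []) (var 0 :* var 1 :* (var 2 :* var 3)) (var 4)
        ((var 1 :* var 3 , var 2 :* var 0 ≐ # 1) ∷ (# 1 , var 1 :* var 3 ≐ var 4) ∷ []) refl (h-hi ∷ zeros-sound n p ∷ []))

    align-sound : ∀ n m p r → evL (align n m p r) ≈ evL (n , p) ⊕ evL (m , r)
    align-sound n       zero    p r = ≈-trans (*-congˡ (addP-sound p _)) (≈-trans (⊗-distribˡ _ _ _) (+-congˡ (≈-trans (zeros-sound n r) (≈-sym (one⊗ _)))))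
    align-sound zero    (suc m) p r = ≈-trans (*-congˡ (addP-sound (zeros (suc m) p) r)) (≈-trans (⊗-distribˡ _ _ _)
      (+-congʳ (≈-trans (zeros-sound (suc m) p) (≈-sym (one⊗ _)))))
    align-sound (suc n) (suc m) p r = ≈-trans (⊗-assoc _ _ _) (≈-trans (*-congˡ (align-sound n m p r))
      (solve (hi ∷ hi ↑ n ∷ hi ↑ m ∷ poly p ∷ poly r ∷ []) (var 0 :* (var 1 :* var 3 :+ var 2 :* var 4)) (var 0 :* var 1 :* var 3 :+ var 0 :* var 2 :* var 4) refl))

    addL mulL : Lau → Lau → Lau
    addL (n , []) b        = b
    addL a        (m , []) = a
    addL (n , p)  (m , r)  = uncurry strip (align n m p r)
    mulL (n , []) b        = 0 , []
    mulL a        (m , []) = 0 , []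
    mulL (n , p)  (m , r)  = strip (n + m) (mulP p r)

    allZero : List ℤ → Bool
    allZero []             = true
    allZero (+ zero ∷ p)   = allZero p
    allZero (_ ∷ p)        = false

    allZero-sound : ∀ p → allZero p ≡ true → poly p ≈ 0#
    allZero-sound []           e = ≈-refl
    allZero-sound (+ zero ∷ p) e = ≈-trans (+-cong ι-0 (≈-trans (*-congˡ (allZero-sound p e)) (zeroʳ _))) (+-identityˡ _)

    addL-sound : ∀ a b → evL (addL a b) ≈ evL a ⊕ evL b
    addL-sound (n , [])    b             = ≈-sym (≈-trans (+-congʳ (zeroʳ _)) (+-identityˡ _))
    addL-sound (n , c ∷ p) (m , [])      = ≈-sym (≈-trans (+-congˡ (zeroʳ _)) (+-identityʳ _))
    addL-sound (n , c ∷ p) (m , d ∷ r)   = ≈-trans (strip-sound (proj₁ (align n m (c ∷ p) (d ∷ r))) (proj₂ (align n m (c ∷ p) (d ∷ r)))) (align-sound n m (c ∷ p) (d ∷ r))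

    mulL-sound : ∀ a b → evL (mulL a b) ≈ evL a ⊗ evL b
    mulL-sound (n , [])    b             = ≈-trans (zeroʳ _) (≈-sym (≈-trans (*-congʳ (zeroʳ _)) (zeroˡ _)))
    mulL-sound (n , c ∷ p) (m , [])      = ≈-trans (zeroʳ _) (≈-sym (≈-trans (*-congˡ (zeroʳ _)) (zeroʳ _)))
    mulL-sound (n , c ∷ p) (m , d ∷ r)   = ≈-trans (strip-sound _ (mulP (c ∷ p) (d ∷ r)))
      (≈-trans (*-cong (↑-+ hi n m) (mulP-sound (c ∷ p) (d ∷ r))) (⊗-interchange _ _ _ _))

    laurent : CodeRing
    laurent = record
      { C = Lau ; zeroᶜ = 0 , [] ; addᶜ = addL ; mulᶜ = mulL ; negᶜ = λ { (n , p) → n , scaleP -[1+ 0 ] p }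
      ; intᶜ = λ z → 0 , z ∷ [] ; isZero = λ { (n , p) → allZero p } ; ⟪_⟫ = evL
      ; zeroᶜ-sound = zeroʳ _ ; addᶜ-sound = addL-sound ; mulᶜ-sound = mulL-sound
      ; negᶜ-sound = λ { (n , p) → ≈-trans (*-congˡ (≈-trans (scaleP-sound -[1+ 0 ] p) (≈-trans (*-congʳ (≈-sym (*-identityʳ _))) (ι-neg1 _))))
          (solve (hi ↑ n ∷ poly p ∷ []) (var 0 :* (:- var 1)) (:- (var 0 :* var 1)) refl) }
      ; intᶜ-sound = λ z → ≈-trans (one⊗ _) (≈-trans (+-congˡ (zeroʳ _)) (+-identityʳ _))
      ; isZero-sound = λ { (n , p) e → ≈-trans (*-congˡ (allZero-sound p e)) (zeroʳ _) } }

  -- A vector is a polynomial in θ in Horner form. Coefficients enter through the homomorphism F: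
  -- the identity when α and β are adjoined, and V when E is adjoined, because its coefficients are
  -- series in q⁷.
  module Extension (K : CodeRing) (F : Carrier → Carrier) (F-hom : IsHom F) (θ : Carrier) (d : ℕ) (rel : Vec (CodeRing.C K) (suc d)) where
    open CodeRing K
    open IsHom F-hom

    Ext : ℕ → Set
    Ext n = Vec C n

    evE : ∀ {n} → Ext n → Carrier
    evE []       = 0#
    evE (c ∷ cs) = F ⟪ c ⟫ ⊕ θ ⊗ evE cs

    zeroE : ∀ n → Ext n
    zeroE zero    = []
    zeroE (suc n) = zeroᶜ ∷ zeroE n

    addE : ∀ {n} → Ext n → Ext n → Ext n
    addE []       []       = []
    addE (a ∷ as) (b ∷ bs) = addᶜ a b ∷ addE as bs

    mapE : ∀ {n} → (C → C) → Ext n → Ext n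
    mapE f []       = []
    mapE f (a ∷ as) = f a ∷ mapE f as

    -- Multiplication by θ before reduction; the coefficient pushed out at the top belongs to θⁿ and
    -- is handed to `reduce`.
    shift : ∀ {n} → C → Ext n → Ext n × C
    shift c []       = [] , c
    shift c (x ∷ xs) = cons′ (shift x xs)
      where
      cons′ : Ext _ × C → Ext _ × C
      cons′ (v , l) = c ∷ v , l

    reduce : Ext (suc d) × C → Ext (suc d)
    reduce (v , l) = if isZero l then v else addE v (mapE (mulᶜ l) rel)

    mulθ : Ext (suc d) → Ext (suc d)
    mulθ v = reduce (shift zeroᶜ v)

    mulE : ∀ {n} → Ext n → Ext (suc d) → Ext (suc d)
    mulE []       b = zeroE (suc d)
    mulE (c ∷ cs) b = if isZero c then mulθ (mulE cs b) else addE (mapE (mulᶜ c) b) (mulθ (mulE cs b))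

    allZeroE : ∀ {n} → Ext n → Bool
    allZeroE []       = true
    allZeroE (c ∷ cs) = if isZero c then allZeroE cs else false

    zeroE-sound : ∀ n → evE (zeroE n) ≈ 0#
    zeroE-sound zero    = ≈-refl
    zeroE-sound (suc n) = ≈-trans (+-cong (≈-trans (F-cong zeroᶜ-sound) F-0) (≈-trans (*-congˡ (zeroE-sound n)) (zeroʳ _))) (+-identityˡ _)

    addE-sound : ∀ {n} (a b : Ext n) → evE (addE a b) ≈ evE a ⊕ evE b
    addE-sound []       []       = ≈-sym (+-identityˡ _)
    addE-sound (a ∷ as) (b ∷ bs) = ≈-trans (+-cong (≈-trans (F-cong (addᶜ-sound a b)) (F-⊕ _ _)) (≈-trans (*-congˡ (addE-sound as bs)) (⊗-distribˡ _ _ _)))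
      (interchange _ _ _ _)

    scaleE-sound : ∀ {n} c (a : Ext n) → evE (mapE (mulᶜ c) a) ≈ F ⟪ c ⟫ ⊗ evE a
    scaleE-sound c []       = ≈-sym (zeroʳ _)
    scaleE-sound c (a ∷ as) = ≈-trans (+-cong (≈-trans (F-cong (mulᶜ-sound c a)) (F-⊗ _ _)) (*-congˡ (scaleE-sound c as)))
      (solve (F ⟪ c ⟫ ∷ F ⟪ a ⟫ ∷ θ ∷ evE as ∷ []) (var 0 :* var 1 :+ var 2 :* (var 0 :* var 3)) (var 0 :* (var 1 :+ var 2 :* var 3)) refl)

    negE-sound : ∀ {n} (a : Ext n) → evE (mapE negᶜ a) ≈ ⊖ evE a
    negE-sound []       = ≈-sym -0#≈0#
    negE-sound (a ∷ as) = ≈-trans (+-cong (≈-trans (F-cong (negᶜ-sound a)) (F-⊖ _)) (*-congˡ (negE-sound as)))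
      (solve (F ⟪ a ⟫ ∷ θ ∷ evE as ∷ []) ((:- var 0) :+ var 1 :* (:- var 2)) (:- (var 0 :+ var 1 :* var 2)) refl)

    shift-sound : ∀ {n} c (a : Ext n) → evE (proj₁ (shift c a)) ⊕ θ ↑ n ⊗ F ⟪ proj₂ (shift c a) ⟫ ≈ F ⟪ c ⟫ ⊕ θ ⊗ evE a
    shift-sound c []       = ≈-trans (+-identityˡ _) (≈-trans (one⊗ _) (≈-sym (≈-trans (+-congˡ (zeroʳ _)) (+-identityʳ _))))
    shift-sound {suc n} c (x ∷ xs) = lincomb (F ⟪ c ⟫ ∷ θ ∷ evE (proj₁ (shift x xs)) ∷ θ ↑ n ∷ F ⟪ proj₂ (shift x xs) ⟫ ∷ F ⟪ x ⟫ ∷ evE xs ∷ [])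
      ((var 0 :+ var 1 :* var 2) :+ (var 1 :* var 3) :* var 4) (var 0 :+ var 1 :* (var 5 :+ var 1 :* var 6))
      ((var 1 , var 2 :+ var 3 :* var 4 ≐ var 5 :+ var 1 :* var 6) ∷ []) refl (shift-sound x xs ∷ [])

    ifZero : ∀ l {a b : Ext (suc d)} {x : Carrier} → (isZero l ≡ true → evE a ≈ x) → evE b ≈ x → evE (if isZero l then a else b) ≈ x
    ifZero l p r with isZero l
    ... | true  = p refl
    ... | false = r

    allZeroE-sound : ∀ {n} (a : Ext n) → allZeroE a ≡ true → evE a ≈ 0#
    allZeroE-sound []       e = ≈-refl
    allZeroE-sound (c ∷ cs) e with isZero c in z
    ... | true = ≈-trans (+-cong (≈-trans (F-cong (isZero-sound c z)) F-0) (≈-trans (*-congˡ (allZeroE-sound cs e)) (zeroʳ _))) (+-identityˡ _)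

    module Sound (relation : θ ↑ suc d ≈ evE rel) where

      mulθ-sound : ∀ a → evE (mulθ a) ≈ θ ⊗ evE a
      mulθ-sound a = ≈-trans (ifZero l
          (λ z → ≈-sym (≈-trans (+-congˡ (≈-trans (*-congˡ (≈-trans (F-cong (isZero-sound l z)) F-0)) (zeroʳ _))) (+-identityʳ _)))
          (≈-trans (addE-sound ys (mapE (mulᶜ l) rel)) (+-congˡ (≈-trans (scaleE-sound l rel) (≈-trans (⊗-comm _ _) (*-congʳ (≈-sym relation)))))))
        (≈-trans (shift-sound zeroᶜ a) (≈-trans (+-congʳ (≈-trans (F-cong zeroᶜ-sound) F-0)) (+-identityˡ _)))
        where
        ys = proj₁ (shift zeroᶜ a)
        l = proj₂ (shift zeroᶜ a)

      mulE-sound : ∀ {n} (a : Ext n) b → evE (mulE a b) ≈ evE a ⊗ evE b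
      mulE-sound []       b = ≈-trans (zeroE-sound (suc d)) (≈-sym (zeroˡ _))
      mulE-sound (c ∷ cs) b = ifZero c
        (λ z → ≈-trans rest (≈-sym (≈-trans (*-congʳ (≈-trans (+-congʳ (≈-trans (F-cong (isZero-sound c z)) F-0)) (+-identityˡ _))) (⊗-assoc _ _ _))))
        (≈-trans (addE-sound (mapE (mulᶜ c) b) _) (≈-trans (+-cong (scaleE-sound c b) rest)
          (≈-sym (≈-trans (⊗-distribʳ _ _ _) (+-congˡ (⊗-assoc _ _ _))))))
        where
        rest : evE (mulθ (mulE cs b)) ≈ θ ⊗ (evE cs ⊗ evE b)
        rest = ≈-trans (mulθ-sound (mulE cs b)) (*-congˡ (mulE-sound cs b))

      extension : CodeRing
      extension = record
        { C = Ext (suc d) ; zeroᶜ = zeroE (suc d) ; addᶜ = addE ; mulᶜ = mulE ; negᶜ = mapE negᶜ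
        ; intᶜ = λ z → intᶜ z ∷ zeroE d ; isZero = allZeroE ; ⟪_⟫ = evE
        ; zeroᶜ-sound = zeroE-sound (suc d) ; addᶜ-sound = addE-sound ; mulᶜ-sound = mulE-sound ; negᶜ-sound = negE-sound
        ; intᶜ-sound = λ z → ≈-trans (+-cong (≈-trans (F-cong (intᶜ-sound z)) (F-ι z)) (≈-trans (*-congˡ (zeroE-sound d)) (zeroʳ _))) (+-identityʳ _)
        ; isZero-sound = allZeroE-sound }

-- The 7-dissection of ξ, η and ξ₂ over ℤ[h, h⁻¹, α, β]

-- All that the algebra uses of q-series. `A`, `B`, `C` are the components of ξ with exponents 5, 6,
-- 3 modulo 7, and `a`, `b`, `c` those of η with exponents 1, 4, 2; `A₂`, `B₂`, `C₂`, `x₂`, `g₂`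
-- belong to q². Keeping the ring abstract lets the decision procedure run without touching
-- coefficients.
record Setting : Set₁ where
  field
    R   : CommutativeRing 0ℓ 0ℓ
    ι   : ℤ → CommutativeRing.Carrier R
    ι-+ : ∀ a b → CommutativeRing._≈_ R (ι (a ℤ.+ b)) (CommutativeRing._+_ R (ι a) (ι b))
    ι-* : ∀ a b → CommutativeRing._≈_ R (ι (a ℤ.* b)) (CommutativeRing._*_ R (ι a) (ι b))
    ι-1 : CommutativeRing._≈_ R (ι (+ 1)) (CommutativeRing.1# R)

  open Codes R ι ι-+ ι-* ι-1 public

  field
    V U    : Carrier → Carrier
    V-hom  : IsHom V
    U-cong : ∀ {a b} → a ≈ b → U a ≈ U b
    U-⊕    : ∀ a b → U (a ⊕ b) ≈ U a ⊕ U b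
    U-V    : ∀ a b → U (V a ⊗ b) ≈ a ⊗ U b
    U-1    : U (ι (+ 1)) ≈ ι (+ 1)

    α β γ x hi g x₂ g₂ : Carrier
    h-inv    : α ⊗ β ⊗ γ ⊗ hi ≈ ι (+ 1)
    αβγ-sum  : α ⊕ β ⊝ γ ≈ ι (+ 1)
    αβγ-quad : α ⊗ β ⊝ β ⊗ γ ⊝ α ⊗ γ ⊕ ι (+ 2) ⊗ α ⊗ β ⊗ γ ≈ ι (+ 0)
    xα       : x ⊗ α ≈ γ ⊗ (ι (+ 1) ⊝ ι (+ 2) ⊗ β)

    A B C a b c A₂ B₂ C₂ : Carrier
    ABC  : A ⊗ B ⊗ C ≈ ι (+ 1)
    Vx   : V x ≈ A ⊗ C ↑ 3
    Vy   : ι (+ 1) ⊕ V x ≈ A ↑ 3 ⊗ C ↑ 2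
    Vα   : V α ≈ a ⊗ B
    Vβ   : V β ≈ b ⊗ C
    Vγ   : V γ ≈ c ⊗ A
    bA₂  : b ⊗ A₂ ≈ V α
    cB₂  : c ⊗ B₂ ≈ V β
    aC₂  : a ⊗ C₂ ≈ V γ
    Vx₂  : V x₂ ≈ A₂ ⊗ C₂ ↑ 3
    U-E  : ∀ i → i < 6 → U ((A ⊗ C) ↑ suc i) ≈ 0#

    g-def  : g ⊗ (x ⊗ (ι (+ 1) ⊕ x)) ≈ (ι (+ 1) ⊕ x) ↑ 2 ⊕ x ⊝ x ↑ 2 ⊗ (ι (+ 1) ⊕ x) ⊝ ι (+ 8) ⊗ (x ⊗ (ι (+ 1) ⊕ x))
    g₂-def : g₂ ⊗ (x₂ ⊗ (ι (+ 1) ⊕ x₂)) ≈ (ι (+ 1) ⊕ x₂) ↑ 2 ⊕ x₂ ⊝ x₂ ↑ 2 ⊗ (ι (+ 1) ⊕ x₂) ⊝ ι (+ 8) ⊗ (x₂ ⊗ (ι (+ 1) ⊕ x₂))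

module Tower (S : Setting) where
  open Setting S

  ξ η ξ₂ h w E : Carrier
  ξ  = A ⊝ B ⊝ ι (+ 1) ⊕ C
  η  = ι (+ 1) ⊝ ι (+ 2) ⊗ a ⊕ ι (+ 2) ⊗ b ⊝ ι (+ 2) ⊗ c
  ξ₂ = A₂ ⊝ B₂ ⊝ ι (+ 1) ⊕ C₂
  h  = α ⊗ β ⊗ γ
  w  = g ⊕ ι (+ 7) ⊝ ι (+ 7) ⊗ h
  E  = A ⊗ C

  module VH = IsHom V-hom

  V-injective : ∀ {a b} → V a ≈ V b → a ≈ b
  V-injective {a} {b} p = ≈-trans (≈-sym (UV a)) (≈-trans (U-cong p) (UV b))
    where
    UV : ∀ a → U (V a) ≈ a
    UV a = ≈-trans (U-cong (≈-sym (≈-trans (*-congˡ ι-1) (*-identityʳ _)))) (≈-trans (U-V a (ι (+ 1))) (≈-trans (*-congˡ (≈-trans U-1 ι-1)) (*-identityʳ a)))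

  unit-cancel : ∀ {u u′ a b} → u ⊗ u′ ≈ ι (+ 1) → a ⊗ u ≈ b ⊗ u → a ≈ b
  unit-cancel {u} {u′} {a} {b} p r = lincomb (u ∷ u′ ∷ a ∷ b ∷ []) (var 2) (var 3)
    ((:- (var 2 :- var 3) , var 0 :* var 1 ≐ # 1) ∷ (var 1 , var 2 :* var 0 ≐ var 3 :* var 0) ∷ []) refl (p ∷ r ∷ [])

  module LP = LaurentPolynomials h hi h-inv

  id-hom : IsHom (λ a → a)
  id-hom = record { F-cong = λ p → p ; F-⊕ = λ _ _ → ≈-refl ; F-⊗ = λ _ _ → ≈-refl ; F-⊖ = λ _ → ≈-refl ; F-ι = λ _ → ≈-refl }

  z : LP.Lau
  z = 0 , []

  -- `α`, `β` and `⊖ γ` are the three roots of X³ - X² - 2hX + h: their sum is 1, the sum of the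
  -- products in pairs is -2h and the product is -h.
  α-rel : Vec LP.Lau 3
  α-rel = (0 , + 0 ∷ -[1+ 0 ] ∷ []) ∷ (0 , + 0 ∷ + 2 ∷ []) ∷ (0 , + 1 ∷ []) ∷ []

  module α-Ext = Extension LP.laurent (λ a → a) id-hom α 2 α-rel

  -- Codes evaluate to sums that end in `0#`, which is not the value of a constant expression.
  -- Certificates about codes therefore carry `0#` as a variable, together with this hypothesis.
  0≐ : 0# ≈ ι (+ 0)
  0≐ = ≈-sym ι-0

  α-relation : α ↑ 3 ≈ α-Ext.evE α-rel
  α-relation = lincomb (0# ∷ α ∷ β ∷ γ ∷ []) (var 1 :^ 3) (c₀ :+ var 1 :* (c₁ :+ var 1 :* (c₂ :+ var 1 :* var 0)))
    ((:- (var 1) , var 1 :* var 2 :- var 2 :* var 3 :- var 1 :* var 3 :+ # 2 :* var 1 :* var 2 :* var 3 ≐ # 0)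
      ∷ (var 1 :^ 2 , var 1 :+ var 2 :- var 3 ≐ # 1)
      ∷ (:- (hₑ :^ 2 :+ var 1 :* hₑ :^ 2 :+ var 1 :^ 2 :* hₑ :+ var 1 :^ 3) , var 0 ≐ # 0) ∷ []) refl (αβγ-quad ∷ αβγ-sum ∷ 0≐ ∷ [])
    where
    hₑ = var 1 :* var 2 :* var 3
    c₀ = # 1 :* (# 0 :+ hₑ :* (con -[1+ 0 ] :+ hₑ :* var 0))
    c₁ = # 1 :* (# 0 :+ hₑ :* (# 2 :+ hₑ :* var 0))
    c₂ = # 1 :* (# 1 :+ hₑ :* var 0)

  module α-Sound = α-Ext.Sound α-relation

  -- The cubic of `α` divided by X - α leaves X² - (1 - α)X - (2h + α - α²), which has the root `β`.
  β-rel : Vec (Vec LP.Lau 3) 2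
  β-rel = ((0 , + 0 ∷ + 2 ∷ []) ∷ (0 , + 1 ∷ []) ∷ (0 , -[1+ 0 ] ∷ []) ∷ []) ∷ ((0 , + 1 ∷ []) ∷ (0 , -[1+ 0 ] ∷ []) ∷ z ∷ []) ∷ []

  module β-Ext = Extension α-Sound.extension (λ a → a) id-hom β 1 β-rel

  β-relation : β ↑ 2 ≈ β-Ext.evE β-rel
  β-relation = lincomb (0# ∷ α ∷ β ∷ γ ∷ []) (var 2 :^ 2)
    ((k (# 0 :+ hₑ :* (# 2 :+ o)) :+ var 1 :* (k (# 1 :+ o) :+ var 1 :* (k (con -[1+ 0 ] :+ o) :+ var 1 :* var 0)))
      :+ var 2 :* ((k (# 1 :+ o) :+ var 1 :* (k (con -[1+ 0 ] :+ o) :+ var 1 :* (k (var 0) :+ var 1 :* var 0))) :+ var 2 :* var 0))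
    ((:- # 1 , var 1 :* var 2 :- var 2 :* var 3 :- var 1 :* var 3 :+ # 2 :* var 1 :* var 2 :* var 3 ≐ # 0)
      ∷ (var 1 :+ var 2 , var 1 :+ var 2 :- var 3 ≐ # 1)
      ∷ (:- (hₑ :^ 2 :+ var 1 :* hₑ :+ var 1 :^ 2 :* hₑ :+ var 1 :^ 3 :+ var 2 :* (hₑ :+ var 1 :* hₑ :+ var 1 :^ 2 :+ var 1 :^ 3 :+ var 2)) , var 0 ≐ # 0) ∷ []) refl
    (αβγ-quad ∷ αβγ-sum ∷ 0≐ ∷ [])
    where
    hₑ = var 1 :* var 2 :* var 3
    o = hₑ :* var 0
    k : Expr → Expr
    k e = # 1 :* e

  module β-Sound = β-Ext.Sound β-relation
  module 𝔸 = CodeRing β-Sound.extension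
  open 𝔸 using (⟪_⟫; _⊢_&_)

  αᶜ βᶜ : 𝔸.C
  αᶜ = (z ∷ (0 , + 1 ∷ []) ∷ z ∷ []) ∷ (z ∷ z ∷ z ∷ []) ∷ []
  βᶜ = (z ∷ z ∷ z ∷ []) ∷ ((0 , + 1 ∷ []) ∷ z ∷ z ∷ []) ∷ []

  αᶜ-sound : ⟪ αᶜ ⟫ ≈ α
  αᶜ-sound = lincomb (0# ∷ α ∷ β ∷ γ ∷ []) ((k (var 0) :+ var 1 :* (k (# 1 :+ hₑ :* var 0) :+ var 1 :* (k (var 0) :+ var 1 :* var 0)))
      :+ var 2 :* ((k (var 0) :+ var 1 :* (k (var 0) :+ var 1 :* (k (var 0) :+ var 1 :* var 0))) :+ var 2 :* var 0)) (var 1)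
    ((# 1 :+ var 1 :* hₑ :+ var 1 :^ 2 :+ var 1 :^ 3 :+ var 2 :* (# 1 :+ var 1 :+ var 1 :^ 2 :+ var 1 :^ 3 :+ var 2) , var 0 ≐ # 0) ∷ []) refl (0≐ ∷ [])
    where
    hₑ = var 1 :* var 2 :* var 3
    k : Expr → Expr
    k e = # 1 :* e

  βᶜ-sound : ⟪ βᶜ ⟫ ≈ β
  βᶜ-sound = lincomb (0# ∷ α ∷ β ∷ γ ∷ []) ((k (var 0) :+ var 1 :* (k (var 0) :+ var 1 :* (k (var 0) :+ var 1 :* var 0)))
      :+ var 2 :* ((k (# 1 :+ hₑ :* var 0) :+ var 1 :* (k (var 0) :+ var 1 :* (k (var 0) :+ var 1 :* var 0))) :+ var 2 :* var 0)) (var 2)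
    ((# 1 :+ var 1 :+ var 1 :^ 2 :+ var 1 :^ 3 :+ var 2 :* (hₑ :+ var 1 :+ var 1 :^ 2 :+ var 1 :^ 3 :+ var 2) , var 0 ≐ # 0) ∷ []) refl (0≐ ∷ [])
    where
    hₑ = var 1 :* var 2 :* var 3
    k : Expr → Expr
    k e = # 1 :* e

  γᶜ hᶜ : 𝔸.C
  γᶜ = 𝔸.run (αᶜ ∷ βᶜ ∷ []) (var 0 :+ var 1 :- # 1)
  hᶜ = ((0 , + 0 ∷ + 1 ∷ []) ∷ z ∷ z ∷ []) ∷ (z ∷ z ∷ z ∷ []) ∷ []

  γᶜ-sound : ⟪ γᶜ ⟫ ≈ γ
  γᶜ-sound = ≈-trans (𝔸.run-sound (αᶜ ⊢ αᶜ-sound & βᶜ ⊢ βᶜ-sound & 𝔸.∅) (var 0 :+ var 1 :- # 1))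
    (lincomb (α ∷ β ∷ γ ∷ []) (var 0 :+ var 1 :- # 1) (var 2) ((# 1 , var 0 :+ var 1 :- var 2 ≐ # 1) ∷ []) refl (αβγ-sum ∷ []))

  base : 𝔸.Known (αᶜ ∷ βᶜ ∷ γᶜ ∷ []) (α ∷ β ∷ γ ∷ [])
  base = αᶜ ⊢ αᶜ-sound & βᶜ ⊢ βᶜ-sound & γᶜ ⊢ γᶜ-sound & 𝔸.∅

  hᶜ-sound : ⟪ hᶜ ⟫ ≈ h
  hᶜ-sound = ≈-trans (𝔸.same-sound hᶜ (𝔸.run (αᶜ ∷ βᶜ ∷ γᶜ ∷ []) (var 0 :* var 1 :* var 2)) refl) (𝔸.run-sound base (var 0 :* var 1 :* var 2))

  -- The outer index is the power of β, the inner one that of α, and (n , p) stands for h⁻ⁿ p(h).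
  -- With y = 1 + x the codes stand, in this order, for x, 1/y, g, x₂, 1/(xy), 1/(xy²), xy², α/(βy),
  -- β/(γxy), γ/(αxy²), β/(xy) and γ/y. They are witnesses: each is certified where it is used,
  -- through a product with known elements.
  xᶜ iyᶜ gᶜ x₂ᶜ i₁ᶜ i₂ᶜ xyyᶜ Aᶜ Bᶜ Cᶜ bᶜ cᶜ : 𝔸.C
  xᶜ = ((0 , -[1+ 2 ] ∷ -[1+ 7 ] ∷ []) ∷ (1 , -[1+ 0 ] ∷ -[1+ 1 ] ∷ []) ∷ (1 , + 1 ∷ + 4 ∷ []) ∷ []) ∷ ((0 , + 2 ∷ []) ∷ (1 , + 1 ∷ []) ∷ (1 , -[1+ 0 ] ∷ []) ∷ []) ∷ []
  iyᶜ = ((0 , -[1+ 0 ] ∷ []) ∷ (0 , + 2 ∷ []) ∷ z ∷ []) ∷ ((0 , + 2 ∷ []) ∷ (1 , -[1+ 0 ] ∷ -[1+ 3 ] ∷ []) ∷ (1 , + 1 ∷ []) ∷ []) ∷ []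
  gᶜ = ((0 , -[1+ 4 ] ∷ + 8 ∷ []) ∷ (1 , + 1 ∷ + 2 ∷ []) ∷ (1 , -[1+ 0 ] ∷ []) ∷ []) ∷ ((0 , -[1+ 1 ] ∷ []) ∷ (1 , -[1+ 1 ] ∷ []) ∷ (1 , + 3 ∷ []) ∷ []) ∷ []
  x₂ᶜ = ((1 , -[1+ 0 ] ∷ -[1+ 1 ] ∷ []) ∷ (1 , + 2 ∷ + 2 ∷ []) ∷ (1 , -[1+ 0 ] ∷ []) ∷ []) ∷ ((1 , + 1 ∷ []) ∷ (1 , -[1+ 1 ] ∷ []) ∷ (1 , + 1 ∷ []) ∷ []) ∷ []
  i₁ᶜ = ((0 , + 1 ∷ []) ∷ (0 , -[1+ 3 ] ∷ []) ∷ (0 , + 4 ∷ []) ∷ []) ∷ ((0 , -[1+ 3 ] ∷ []) ∷ (1 , + 1 ∷ + 8 ∷ []) ∷ z ∷ []) ∷ []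
  i₂ᶜ = ((0 , + 5 ∷ + 8 ∷ []) ∷ (1 , -[1+ 0 ] ∷ -[1+ 17 ] ∷ -[1+ 15 ] ∷ []) ∷ (1 , + 1 ∷ + 12 ∷ []) ∷ []) ∷ ((1 , -[1+ 0 ] ∷ -[1+ 13 ] ∷ -[1+ 15 ] ∷ []) ∷ (1 , + 7 ∷ + 40 ∷ + 32 ∷ []) ∷ (1 , -[1+ 4 ] ∷ -[1+ 15 ] ∷ []) ∷ []) ∷ []
  xyyᶜ = ((1 , -[1+ 5 ] ∷ -[1+ 67 ] ∷ -[1+ 303 ] ∷ -[1+ 639 ] ∷ -[1+ 511 ] ∷ []) ∷ (2 , -[1+ 0 ] ∷ -[1+ 14 ] ∷ -[1+ 73 ] ∷ -[1+ 159 ] ∷ -[1+ 127 ] ∷ []) ∷ (2 , + 1 ∷ + 20 ∷ + 116 ∷ + 288 ∷ + 256 ∷ []) ∷ []) ∷ ((1 , + 6 ∷ + 62 ∷ + 240 ∷ + 384 ∷ []) ∷ (2 , + 1 ∷ + 14 ∷ + 60 ∷ + 96 ∷ []) ∷ (2 , -[1+ 0 ] ∷ -[1+ 18 ] ∷ -[1+ 95 ] ∷ -[1+ 191 ] ∷ []) ∷ []) ∷ []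
  Aᶜ = (z ∷ z ∷ z ∷ []) ∷ ((0 , -[1+ 1 ] ∷ []) ∷ (0 , + 4 ∷ []) ∷ (1 , + 1 ∷ []) ∷ []) ∷ []
  Bᶜ = ((0 , -[1+ 2 ] ∷ []) ∷ (1 , + 1 ∷ + 8 ∷ []) ∷ (1 , -[1+ 0 ] ∷ -[1+ 3 ] ∷ []) ∷ []) ∷ ((1 , + 1 ∷ + 4 ∷ []) ∷ (1 , -[1+ 4 ] ∷ -[1+ 11 ] ∷ []) ∷ (1 , + 5 ∷ + 8 ∷ []) ∷ []) ∷ []
  Cᶜ = ((0 , + 4 ∷ []) ∷ (1 , -[1+ 0 ] ∷ -[1+ 11 ] ∷ []) ∷ (1 , + 1 ∷ + 8 ∷ []) ∷ []) ∷ ((1 , -[1+ 0 ] ∷ -[1+ 7 ] ∷ []) ∷ (1 , + 6 ∷ + 20 ∷ []) ∷ (1 , -[1+ 4 ] ∷ -[1+ 7 ] ∷ []) ∷ []) ∷ []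
  bᶜ = ((0 , + 1 ∷ []) ∷ (0 , -[1+ 3 ] ∷ []) ∷ (0 , + 4 ∷ []) ∷ []) ∷ ((0 , -[1+ 2 ] ∷ []) ∷ (1 , + 1 ∷ + 8 ∷ []) ∷ (1 , -[1+ 0 ] ∷ -[1+ 3 ] ∷ []) ∷ []) ∷ []
  cᶜ = (z ∷ z ∷ z ∷ []) ∷ ((0 , -[1+ 0 ] ∷ []) ∷ (0 , + 2 ∷ []) ∷ z ∷ []) ∷ []

  -- x, y⁻¹, … are determined by products with the units α, β, γ
  α-unit : α ⊗ (β ⊗ γ ⊗ hi) ≈ ι (+ 1)
  α-unit = ≈-trans (solve (α ∷ β ∷ γ ∷ hi ∷ []) (var 0 :* (var 1 :* var 2 :* var 3)) (var 0 :* var 1 :* var 2 :* var 3) refl) h-inv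

  β-unit : β ⊗ (α ⊗ γ ⊗ hi) ≈ ι (+ 1)
  β-unit = ≈-trans (solve (α ∷ β ∷ γ ∷ hi ∷ []) (var 1 :* (var 0 :* var 2 :* var 3)) (var 0 :* var 1 :* var 2 :* var 3) refl) h-inv

  γ-unit : γ ⊗ (α ⊗ β ⊗ hi) ≈ ι (+ 1)
  γ-unit = ≈-trans (solve (α ∷ β ∷ γ ∷ hi ∷ []) (var 2 :* (var 0 :* var 1 :* var 3)) (var 0 :* var 1 :* var 2 :* var 3) refl) h-inv

  xᶜ-sound : ⟪ xᶜ ⟫ ≈ x
  xᶜ-sound = unit-cancel α-unit (≈-trans (𝔸.decide (xᶜ ⊢ ≈-refl & base) (var 0 :* var 1) (var 3 :* (# 1 :- # 2 :* var 2)) refl) (≈-sym xα))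

-- Adjunction of E, and the expansions of ξ, η and ξ₂ in its powers

module Heptic (S : Setting) where
  open Setting S
  open Tower S
  open 𝔸 using (⟪_⟫; _⊢_&_)

  o : 𝔸.C
  o = 𝔸.zeroᶜ

  E-rel : Vec 𝔸.C 7
  E-rel = xyyᶜ ∷ o ∷ o ∷ o ∷ o ∷ o ∷ o ∷ []

  module E-Ext = Extension β-Sound.extension V V-hom E 6 E-rel

  Vo : V ⟪ o ⟫ ≈ ι (+ 0)
  Vo = ≈-trans (VH.F-cong 𝔸.zeroᶜ-sound) (≈-trans VH.F-0 0≐)

  V-decide : ∀ {cs as} → 𝔸.Known cs as → ∀ e f → 𝔸.same (𝔸.run cs e) (𝔸.run cs f) ≡ true → ⟦ e ⟧ (env (map V as)) ≈ ⟦ f ⟧ (env (map V as))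
  V-decide {as = as} ps e f p = ≈-trans (≈-sym (VH.F-⟦⟧ as e)) (≈-trans (VH.F-cong (𝔸.decide ps e f p)) (VH.F-⟦⟧ as f))

  -- A⁷ C⁷ = (A C³) (A³ C²)² = V(x y²), so the seventh power of `E` lies in the base.
  E-relation : E ↑ 7 ≈ E-Ext.evE E-rel
  E-relation = lincomb (A ∷ C ∷ V x ∷ V ⟪ xyyᶜ ⟫ ∷ V ⟪ o ⟫ ∷ 0# ∷ [])
    (e :^ 7) (v 3 :+ e :* (v 4 :+ e :* (v 4 :+ e :* (v 4 :+ e :* (v 4 :+ e :* (v 4 :+ e :* (v 4 :+ e :* v 5)))))))
    ((:- # 1 , v 3 ≐ v 2 :* (# 1 :+ v 2) :^ 2) ∷ (:- (m :^ 2) , v 2 ≐ v 0 :* v 1 :^ 3) ∷ (:- (v 2 :* (m :+ # 1 :+ v 2)) , # 1 :+ v 2 ≐ m)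
      ∷ (:- (e :+ e :^ 2 :+ e :^ 3 :+ e :^ 4 :+ e :^ 5 :+ e :^ 6) , v 4 ≐ # 0) ∷ (:- (e :^ 7) , v 5 ≐ # 0) ∷ []) refl
    (V-decide (xyyᶜ ⊢ ≈-refl & xᶜ ⊢ xᶜ-sound & 𝔸.∅) (v 0) (v 1 :* (# 1 :+ v 1) :^ 2) refl ∷ Vx ∷ Vy ∷ Vo ∷ 0≐ ∷ [])
    where
    e = v 0 :* v 1
    m = v 0 :^ 3 :* v 1 :^ 2

  module E-Sound = E-Ext.Sound E-relation
  module 𝕋 = CodeRing E-Sound.extension

  iy i₁ i₂ : Carrier
  iy = V ⟪ iyᶜ ⟫
  i₁ = V ⟪ i₁ᶜ ⟫
  i₂ = V ⟪ i₂ᶜ ⟫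

  iy-unit : (ι (+ 1) ⊕ V x) ⊗ iy ≈ ι (+ 1)
  iy-unit = V-decide (xᶜ ⊢ xᶜ-sound & iyᶜ ⊢ ≈-refl & 𝔸.∅) ((# 1 :+ v 0) :* v 1) (# 1) refl

  i₁-unit : V x ⊗ (ι (+ 1) ⊕ V x) ⊗ i₁ ≈ ι (+ 1)
  i₁-unit = V-decide (xᶜ ⊢ xᶜ-sound & i₁ᶜ ⊢ ≈-refl & 𝔸.∅) (v 0 :* (# 1 :+ v 0) :* v 1) (# 1) refl

  i₂-unit : V x ⊗ (ι (+ 1) ⊕ V x) ↑ 2 ⊗ i₂ ≈ ι (+ 1)
  i₂-unit = V-decide (xᶜ ⊢ xᶜ-sound & i₂ᶜ ⊢ ≈-refl & 𝔸.∅) (v 0 :* (# 1 :+ v 0) :^ 2 :* v 1) (# 1) refl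

  -- Every component of ξ, η and ξ₂ is a power of `E`, determined by its exponents modulo 7, times
  -- an element of the base. The cofactor follows from V x = A C³ and V y = A³ C²; here A³ C³ / V y
  -- = C.
  C-form : E ↑ 3 ⊗ iy ≈ C
  C-form = lincomb (A ∷ C ∷ V x ∷ iy ∷ []) ((v 0 :* v 1) :^ 3 :* v 3) (v 1)
    ((:- (v 1 :* v 3) , # 1 :+ v 2 ≐ v 0 :^ 3 :* v 1 :^ 2) ∷ (v 1 , (# 1 :+ v 2) :* v 3 ≐ # 1) ∷ []) refl (Vy ∷ iy-unit ∷ [])

  A-form : E ↑ 5 ⊗ i₁ ≈ A
  A-form = lincomb (A ∷ C ∷ V x ∷ i₁ ∷ []) ((v 0 :* v 1) :^ 5 :* v 3) (v 0)
    ((:- (v 0 :* v 3 :* m) , v 2 ≐ v 0 :* v 1 :^ 3) ∷ (:- (v 0 :* v 3 :* v 2) , # 1 :+ v 2 ≐ m) ∷ (v 0 , v 2 :* (# 1 :+ v 2) :* v 3 ≐ # 1) ∷ []) refl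
    (Vx ∷ Vy ∷ i₁-unit ∷ [])
    where m = v 0 :^ 3 :* v 1 :^ 2

  E⁷-unit : E ↑ 7 ⊗ i₂ ≈ ι (+ 1)
  E⁷-unit = lincomb (A ∷ C ∷ V x ∷ i₂ ∷ []) ((v 0 :* v 1) :^ 7 :* v 3) (# 1)
    ((:- (v 3 :* m :^ 2) , v 2 ≐ v 0 :* v 1 :^ 3) ∷ (:- (v 3 :* v 2 :* (m :+ # 1 :+ v 2)) , # 1 :+ v 2 ≐ m)
      ∷ (# 1 , v 2 :* (# 1 :+ v 2) :^ 2 :* v 3 ≐ # 1) ∷ []) refl
    (Vx ∷ Vy ∷ i₂-unit ∷ [])
    where m = v 0 :^ 3 :* v 1 :^ 2

  B-form : E ↑ 6 ⊗ i₂ ≈ B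
  B-form = lincomb (A ∷ B ∷ C ∷ i₂ ∷ []) ((v 0 :* v 2) :^ 6 :* v 3) (v 1)
    ((:- ((v 0 :* v 2) :^ 6 :* v 3) , v 0 :* v 1 :* v 2 ≐ # 1) ∷ (v 1 , (v 0 :* v 2) :^ 7 :* v 3 ≐ # 1) ∷ []) refl (ABC ∷ E⁷-unit ∷ [])

  a-form : E ⊗ V α ≈ a
  a-form = lincomb (A ∷ B ∷ C ∷ a ∷ V α ∷ []) (v 0 :* v 2 :* v 4) (v 3)
    ((v 0 :* v 2 , v 4 ≐ v 3 :* v 1) ∷ (v 3 , v 0 :* v 1 :* v 2 ≐ # 1) ∷ []) refl (Vα ∷ ABC ∷ [])

  b-form : E ↑ 4 ⊗ V ⟪ bᶜ ⟫ ≈ b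
  b-form = unit-cancel {C} {A ⊗ B} (≈-trans (solve (A ∷ B ∷ C ∷ []) (v 2 :* (v 0 :* v 1)) (v 0 :* v 1 :* v 2) refl) ABC)
    (lincomb (A ∷ C ∷ V x ∷ V ⟪ bᶜ ⟫ ∷ V β ∷ b ∷ []) ((v 0 :* v 1) :^ 4 :* v 3 :* v 1) (v 5 :* v 1)
      ((:- (v 3 :* m) , v 2 ≐ v 0 :* v 1 :^ 3) ∷ (:- (v 3 :* v 2) , # 1 :+ v 2 ≐ m) ∷ (# 1 , v 3 :* (v 2 :* (# 1 :+ v 2)) ≐ v 4) ∷ (# 1 , v 4 ≐ v 5 :* v 1) ∷ []) refl
      (Vx ∷ Vy ∷ V-decide (bᶜ ⊢ ≈-refl & xᶜ ⊢ xᶜ-sound & βᶜ ⊢ βᶜ-sound & 𝔸.∅) (v 0 :* (v 1 :* (# 1 :+ v 1))) (v 2) refl ∷ Vβ ∷ []))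
    where m = v 0 :^ 3 :* v 1 :^ 2

  c-form : E ↑ 2 ⊗ V ⟪ cᶜ ⟫ ≈ c
  c-form = unit-cancel {A} {B ⊗ C} (≈-trans (≈-sym (⊗-assoc _ _ _)) ABC)
    (lincomb (A ∷ C ∷ V x ∷ V ⟪ cᶜ ⟫ ∷ V γ ∷ c ∷ []) ((v 0 :* v 1) :^ 2 :* v 3 :* v 0) (v 5 :* v 0)
      ((:- (v 3) , # 1 :+ v 2 ≐ v 0 :^ 3 :* v 1 :^ 2) ∷ (# 1 , v 3 :* (# 1 :+ v 2) ≐ v 4) ∷ (# 1 , v 4 ≐ v 5 :* v 0) ∷ []) refl
      (Vy ∷ V-decide (cᶜ ⊢ ≈-refl & xᶜ ⊢ xᶜ-sound & γᶜ ⊢ γᶜ-sound & 𝔸.∅) (v 0 :* (# 1 :+ v 1)) (v 2) refl ∷ Vγ ∷ []))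

  V-unit : ∀ {a b c d e} → V a ≈ b ⊗ c → a ⊗ (d ⊗ e ⊗ hi) ≈ ι (+ 1) → b ⊗ (c ⊗ V (d ⊗ e ⊗ hi)) ≈ ι (+ 1)
  V-unit p r = ≈-trans (≈-sym (⊗-assoc _ _ _)) (≈-trans (*-congʳ (≈-sym p)) (≈-trans (≈-sym (VH.F-⊗ _ _)) (≈-trans (VH.F-cong r) (VH.F-ι (+ 1)))))

  A₂-form : E ↑ 3 ⊗ V ⟪ Aᶜ ⟫ ≈ A₂
  A₂-form = unit-cancel (V-unit Vβ β-unit)
    (lincomb (A ∷ C ∷ V x ∷ V ⟪ Aᶜ ⟫ ∷ V α ∷ V β ∷ b ∷ A₂ ∷ []) ((v 0 :* v 1) :^ 3 :* v 3 :* v 6) (v 7 :* v 6)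
      ((:- (v 1 :* v 6 :* v 3) , # 1 :+ v 2 ≐ v 0 :^ 3 :* v 1 :^ 2) ∷ (:- (v 3 :* (# 1 :+ v 2)) , v 5 ≐ v 6 :* v 1)
        ∷ (# 1 , v 3 :* (v 5 :* (# 1 :+ v 2)) ≐ v 4) ∷ (:- # 1 , v 6 :* v 7 ≐ v 4) ∷ []) refl
      (Vy ∷ Vβ ∷ V-decide (Aᶜ ⊢ ≈-refl & xᶜ ⊢ xᶜ-sound & αᶜ ⊢ αᶜ-sound & βᶜ ⊢ βᶜ-sound & 𝔸.∅) (v 0 :* (v 3 :* (# 1 :+ v 1))) (v 2) refl ∷ bA₂ ∷ []))

  B₂-form : E ↑ 5 ⊗ V ⟪ Bᶜ ⟫ ≈ B₂
  B₂-form = unit-cancel (V-unit Vγ γ-unit)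
    (lincomb (A ∷ C ∷ V x ∷ V ⟪ Bᶜ ⟫ ∷ V β ∷ V γ ∷ c ∷ B₂ ∷ []) ((v 0 :* v 1) :^ 5 :* v 3 :* v 6) (v 7 :* v 6)
      ((:- (v 0 :* v 3 :* v 6 :* m) , v 2 ≐ v 0 :* v 1 :^ 3) ∷ (:- (v 0 :* v 3 :* v 6 :* v 2) , # 1 :+ v 2 ≐ m)
        ∷ (:- (v 3 :* v 2 :* (# 1 :+ v 2)) , v 5 ≐ v 6 :* v 0) ∷ (# 1 , v 3 :* (v 5 :* v 2 :* (# 1 :+ v 2)) ≐ v 4) ∷ (:- # 1 , v 6 :* v 7 ≐ v 4) ∷ []) refl
      (Vx ∷ Vy ∷ Vγ ∷ V-decide (Bᶜ ⊢ ≈-refl & xᶜ ⊢ xᶜ-sound & γᶜ ⊢ γᶜ-sound & βᶜ ⊢ βᶜ-sound & 𝔸.∅) (v 0 :* (v 2 :* v 1 :* (# 1 :+ v 1))) (v 3) refl ∷ cB₂ ∷ []))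
    where m = v 0 :^ 3 :* v 1 :^ 2

  C₂-form : E ↑ 6 ⊗ V ⟪ Cᶜ ⟫ ≈ C₂
  C₂-form = unit-cancel (V-unit Vα α-unit)
    (lincomb (A ∷ B ∷ C ∷ V x ∷ V ⟪ Cᶜ ⟫ ∷ V γ ∷ V α ∷ a ∷ C₂ ∷ []) (e :^ 6 :* v 4 :* v 7) (v 8 :* v 7)
      ((:- (e :^ 6 :* v 4 :* v 7) , v 0 :* v 1 :* v 2 ≐ # 1) ∷ (:- (e :^ 7 :* v 4) , v 6 ≐ v 7 :* v 1)
        ∷ (:- (v 6 :* v 4 :* m :^ 2) , v 3 ≐ v 0 :* v 2 :^ 3) ∷ (:- (v 6 :* v 4 :* v 3 :* (m :+ # 1 :+ v 3)) , # 1 :+ v 3 ≐ m)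
        ∷ (# 1 , v 4 :* (v 6 :* v 3 :* (# 1 :+ v 3) :^ 2) ≐ v 5) ∷ (:- # 1 , v 7 :* v 8 ≐ v 5) ∷ []) refl
      (ABC ∷ Vα ∷ Vx ∷ Vy ∷ V-decide (Cᶜ ⊢ ≈-refl & xᶜ ⊢ xᶜ-sound & γᶜ ⊢ γᶜ-sound & αᶜ ⊢ αᶜ-sound & 𝔸.∅) (v 0 :* (v 3 :* v 1 :* (# 1 :+ v 1) :^ 2)) (v 2) refl ∷ aC₂ ∷ []))
    where
    e = v 0 :* v 2
    m = v 0 :^ 3 :* v 2 :^ 2

  ξᶜ ηᶜ ξ₂ᶜ : 𝕋.C
  ξᶜ  = 𝔸.intᶜ -[1+ 0 ] ∷ o ∷ o ∷ iyᶜ ∷ o ∷ i₁ᶜ ∷ 𝔸.negᶜ i₂ᶜ ∷ []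
  ηᶜ  = 𝔸.intᶜ (+ 1) ∷ 𝔸.mulᶜ (𝔸.intᶜ -[1+ 1 ]) αᶜ ∷ 𝔸.mulᶜ (𝔸.intᶜ -[1+ 1 ]) cᶜ ∷ o ∷ 𝔸.mulᶜ (𝔸.intᶜ (+ 2)) bᶜ ∷ o ∷ o ∷ []
  ξ₂ᶜ = 𝔸.intᶜ -[1+ 0 ] ∷ o ∷ o ∷ Aᶜ ∷ o ∷ 𝔸.negᶜ Bᶜ ∷ Cᶜ ∷ []

  V-int : ∀ n → V ⟪ 𝔸.intᶜ n ⟫ ≈ ι n
  V-int n = ≈-trans (VH.F-cong (𝔸.intᶜ-sound n)) (VH.F-ι n)

  V-neg : ∀ c → V ⟪ 𝔸.negᶜ c ⟫ ≈ ⊖ V ⟪ c ⟫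
  V-neg c = ≈-trans (VH.F-cong (𝔸.negᶜ-sound c)) (VH.F-⊖ _)

  V-scale : ∀ n c → V ⟪ 𝔸.mulᶜ (𝔸.intᶜ n) c ⟫ ≈ ι n ⊗ V ⟪ c ⟫
  V-scale n c = ≈-trans (VH.F-cong (𝔸.mulᶜ-sound (𝔸.intᶜ n) c)) (≈-trans (VH.F-⊗ _ _) (*-congʳ (V-int n)))

  horner : Expr → (p₀ p₁ p₂ p₃ p₄ p₅ p₆ end : Expr) → Expr
  horner e p₀ p₁ p₂ p₃ p₄ p₅ p₆ end = p₀ :+ e :* (p₁ :+ e :* (p₂ :+ e :* (p₃ :+ e :* (p₄ :+ e :* (p₅ :+ e :* (p₆ :+ e :* end))))))

  ξᶜ-sound : 𝕋.⟪ ξᶜ ⟫ ≈ ξ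
  ξᶜ-sound = lincomb (A ∷ B ∷ C ∷ V ⟪ 𝔸.intᶜ -[1+ 0 ] ⟫ ∷ V ⟪ o ⟫ ∷ iy ∷ i₁ ∷ V ⟪ 𝔸.negᶜ i₂ᶜ ⟫ ∷ i₂ ∷ 0# ∷ [])
    (horner e (v 3) (v 4) (v 4) (v 5) (v 4) (v 6) (v 7) (v 9)) (v 0 :- v 1 :- # 1 :+ v 2)
    ((# 1 , v 3 ≐ con -[1+ 0 ]) ∷ (e :+ e :^ 2 :+ e :^ 4 , v 4 ≐ # 0) ∷ (# 1 , e :^ 3 :* v 5 ≐ v 2) ∷ (# 1 , e :^ 5 :* v 6 ≐ v 0)
      ∷ (e :^ 6 , v 7 ≐ :- v 8) ∷ (:- # 1 , e :^ 6 :* v 8 ≐ v 1) ∷ (e :^ 7 , v 9 ≐ # 0) ∷ []) refl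
    (V-int -[1+ 0 ] ∷ Vo ∷ C-form ∷ A-form ∷ V-neg i₂ᶜ ∷ B-form ∷ 0≐ ∷ [])
    where e = v 0 :* v 2

  ηᶜ-sound : 𝕋.⟪ ηᶜ ⟫ ≈ η
  ηᶜ-sound = lincomb (A ∷ C ∷ a ∷ b ∷ c ∷ V ⟪ 𝔸.intᶜ (+ 1) ⟫ ∷ V ⟪ o ⟫ ∷ V ⟪ 𝔸.mulᶜ (𝔸.intᶜ -[1+ 1 ]) αᶜ ⟫ ∷ V ⟪ 𝔸.mulᶜ (𝔸.intᶜ -[1+ 1 ]) cᶜ ⟫
      ∷ V ⟪ 𝔸.mulᶜ (𝔸.intᶜ (+ 2)) bᶜ ⟫ ∷ V α ∷ V ⟪ cᶜ ⟫ ∷ V ⟪ bᶜ ⟫ ∷ 0# ∷ [])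
    (horner e (v 5) (v 7) (v 8) (v 6) (v 9) (v 6) (v 6) (v 13)) (# 1 :- # 2 :* v 2 :+ # 2 :* v 3 :- # 2 :* v 4)
    ((# 1 , v 5 ≐ # 1) ∷ (e :^ 3 :+ e :^ 5 :+ e :^ 6 , v 6 ≐ # 0) ∷ (e , v 7 ≐ con -[1+ 1 ] :* v 10) ∷ (e :^ 2 , v 8 ≐ con -[1+ 1 ] :* v 11)
      ∷ (e :^ 4 , v 9 ≐ # 2 :* v 12) ∷ (:- # 2 , e :* v 10 ≐ v 2) ∷ (:- # 2 , e :^ 2 :* v 11 ≐ v 4) ∷ (# 2 , e :^ 4 :* v 12 ≐ v 3) ∷ (e :^ 7 , v 13 ≐ # 0) ∷ []) refl
    (V-int (+ 1) ∷ Vo ∷ ≈-trans (V-scale -[1+ 1 ] αᶜ) (*-congˡ (VH.F-cong αᶜ-sound)) ∷ V-scale -[1+ 1 ] cᶜ ∷ V-scale (+ 2) bᶜ ∷ a-form ∷ c-form ∷ b-form ∷ 0≐ ∷ [])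
    where e = v 0 :* v 1

  ξ₂ᶜ-sound : 𝕋.⟪ ξ₂ᶜ ⟫ ≈ ξ₂
  ξ₂ᶜ-sound = lincomb (A ∷ C ∷ A₂ ∷ B₂ ∷ C₂ ∷ V ⟪ 𝔸.intᶜ -[1+ 0 ] ⟫ ∷ V ⟪ o ⟫ ∷ V ⟪ Aᶜ ⟫ ∷ V ⟪ 𝔸.negᶜ Bᶜ ⟫ ∷ V ⟪ Bᶜ ⟫ ∷ V ⟪ Cᶜ ⟫ ∷ 0# ∷ [])
    (horner e (v 5) (v 6) (v 6) (v 7) (v 6) (v 8) (v 10) (v 11)) (v 2 :- v 3 :- # 1 :+ v 4)
    ((# 1 , v 5 ≐ con -[1+ 0 ]) ∷ (e :+ e :^ 2 :+ e :^ 4 , v 6 ≐ # 0) ∷ (# 1 , e :^ 3 :* v 7 ≐ v 2) ∷ (e :^ 5 , v 8 ≐ :- v 9)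
      ∷ (:- # 1 , e :^ 5 :* v 9 ≐ v 3) ∷ (# 1 , e :^ 6 :* v 10 ≐ v 4) ∷ (e :^ 7 , v 11 ≐ # 0) ∷ []) refl
    (V-int -[1+ 0 ] ∷ Vo ∷ A₂-form ∷ V-neg Bᶜ ∷ B₂-form ∷ C₂-form ∷ 0≐ ∷ [])
    where e = v 0 :* v 1

  U-tail : ∀ {n} i (cs : Vec 𝔸.C n) → suc i + n ≤ 7 → U (E ↑ suc i ⊗ E-Ext.evE cs) ≈ 0#
  U-tail i []       l = ≈-trans (U-cong (≈-trans (zeroʳ _) (≈-sym VH.F-0))) (≈-trans (U-cong (≈-sym (≈-trans (*-congˡ ι-1) (*-identityʳ _))))
    (≈-trans (U-V 0# (ι (+ 1))) (zeroˡ _)))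
  U-tail i (c ∷ cs) l = ≈-trans (U-cong (solve (E ↑ suc i ∷ V ⟪ c ⟫ ∷ E ∷ E-Ext.evE cs ∷ []) (v 0 :* (v 1 :+ v 2 :* v 3)) (v 1 :* v 0 :+ v 2 :* v 0 :* v 3) refl))
    (≈-trans (U-⊕ _ _) (≈-trans (+-cong (≈-trans (U-V ⟪ c ⟫ _) (≈-trans (*-congˡ (U-E i (ℕₚ.≤-trans (s≤s (ℕₚ.m≤m+n i _)) (ℕₚ.≤-pred l′)))) (zeroʳ _)))
      (U-tail (suc i) cs l′)) (+-identityˡ _)))
    where
    l′ : suc (suc i) + _ ≤ 7
    l′ = ℕₚ.≤-trans (ℕₚ.≤-reflexive (cong suc (sym (ℕₚ.+-suc i _)))) l

  firstᶜ : 𝕋.C → 𝔸.C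
  firstᶜ (c ∷ _) = c

  -- The exponents in `E` are 1 modulo 7, so U annihilates V(R) Eⁱ for 1 ≤ i ≤ 6; only the
  -- coefficient of E⁰ survives.
  U-first : ∀ f → U 𝕋.⟪ f ⟫ ≈ ⟪ firstᶜ f ⟫
  U-first (c ∷ cs) = ≈-trans (U-⊕ _ _) (≈-trans (+-cong
      (≈-trans (U-cong (≈-sym (≈-trans (*-congˡ ι-1) (*-identityʳ _)))) (≈-trans (U-V ⟪ c ⟫ (ι (+ 1))) (≈-trans (*-congˡ (≈-trans U-1 ι-1)) (*-identityʳ _))))
      (≈-trans (U-cong (*-congʳ (≈-sym (≈-trans (*-congˡ ι-1) (*-identityʳ _))))) (U-tail 0 cs ℕₚ.≤-refl))) (+-identityʳ _))

  gᶜ-sound : ⟪ gᶜ ⟫ ≈ g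
  gᶜ-sound = unit-cancel {x ⊗ (ι (+ 1) ⊕ x)} {⟪ i₁ᶜ ⟫} (𝔸.decide (xᶜ ⊢ xᶜ-sound & i₁ᶜ ⊢ ≈-refl & 𝔸.∅) (v 0 :* (# 1 :+ v 0) :* v 1) (# 1) refl)
    (≈-trans (𝔸.decide (xᶜ ⊢ xᶜ-sound & gᶜ ⊢ ≈-refl & 𝔸.∅) (v 1 :* (v 0 :* (# 1 :+ v 0)))
      ((# 1 :+ v 0) :^ 2 :+ v 0 :- v 0 :^ 2 :* (# 1 :+ v 0) :- # 8 :* (v 0 :* (# 1 :+ v 0))) refl) (≈-sym g-def))

  -- V x₂ = A₂ C₂³ = E³ E¹⁸ V(Aᶜ Cᶜ³), and E²¹ is in the base. V can be removed because U is a left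
  -- inverse of it.
  x₂ᶜ-sound : ⟪ x₂ᶜ ⟫ ≈ x₂
  x₂ᶜ-sound = V-injective (lincomb (E ∷ V ⟪ Aᶜ ⟫ ∷ V ⟪ Cᶜ ⟫ ∷ A₂ ∷ C₂ ∷ V ⟪ x₂ᶜ ⟫ ∷ V x₂ ∷ V ⟪ xyyᶜ ⟫ ∷ [])
    (v 5) (v 6)
    ((# 1 , v 5 ≐ v 1 :* v 2 :^ 3 :* v 7 :^ 3) ∷ (:- (v 1 :* v 2 :^ 3 :* (v 0 :^ 14 :+ v 0 :^ 7 :* v 7 :+ v 7 :^ 2)) , v 0 :^ 7 ≐ v 7)
      ∷ (v 0 :^ 18 :* v 2 :^ 3 , v 0 :^ 3 :* v 1 ≐ v 3)
      ∷ (v 3 :* ((v 0 :^ 6 :* v 2) :^ 2 :+ v 0 :^ 6 :* v 2 :* v 4 :+ v 4 :^ 2) , v 0 :^ 6 :* v 2 ≐ v 4) ∷ (:- # 1 , v 6 ≐ v 3 :* v 4 :^ 3) ∷ []) refl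
    (V-decide (x₂ᶜ ⊢ ≈-refl & Aᶜ ⊢ ≈-refl & Cᶜ ⊢ ≈-refl & xyyᶜ ⊢ ≈-refl & 𝔸.∅) (v 0) (v 1 :* v 2 :^ 3 :* v 3 :^ 3) refl
      ∷ E⁷ ∷ A₂-form ∷ C₂-form ∷ Vx₂ ∷ []))
    where
    E⁷ : E ↑ 7 ≈ V ⟪ xyyᶜ ⟫
    E⁷ = ≈-trans E-relation (lincomb (E ∷ V ⟪ xyyᶜ ⟫ ∷ V ⟪ o ⟫ ∷ 0# ∷ []) (horner (v 0) (v 1) (v 2) (v 2) (v 2) (v 2) (v 2) (v 2) (v 3)) (v 1)
      ((v 0 :+ v 0 :^ 2 :+ v 0 :^ 3 :+ v 0 :^ 4 :+ v 0 :^ 5 :+ v 0 :^ 6 , v 2 ≐ # 0) ∷ (v 0 :^ 7 , v 3 ≐ # 0) ∷ []) refl (Vo ∷ 0≐ ∷ []))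

  -- The inverse of x₂ (1 + x₂), which is the denominator in the definition of `g₂`.
  u₂ᶜ : 𝔸.C
  u₂ᶜ = ((0 , -[1+ 2 ] ∷ []) ∷ (1 , -[1+ 0 ] ∷ []) ∷ (1 , + 2 ∷ []) ∷ []) ∷ ((1 , -[1+ 0 ] ∷ -[1+ 1 ] ∷ []) ∷ z ∷ z ∷ []) ∷ []

  -- Times t² this is the equation F. It has degree 3 in h and 2 in g.
  base-F : (ι (+ 1) ⊝ h) ⊗ (ι (+ 1) ⊝ ι (+ 8) ⊗ h) ↑ 2 ≈ h ⊗ g ↑ 2 ⊕ g ⊗ h ⊗ (ι (+ 9) ⊝ ι (+ 16) ⊗ h)
  base-F = 𝔸.decide (gᶜ ⊢ gᶜ-sound & hᶜ ⊢ hᶜ-sound & 𝔸.∅) ((# 1 :- v 1) :* (# 1 :- # 8 :* v 1) :^ 2) (v 1 :* v 0 :^ 2 :+ v 0 :* v 1 :* (# 9 :- # 16 :* v 1)) refl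

  -- Times t² t(q²)² this is the equation G, which ties the functions at q to those at q².
  base-G : g₂ ↑ 2 ⊗ h ≈ g ⊗ w
  base-G = lincomb (g₂ ∷ h ∷ g ∷ u ∷ ⟪ u₂ᶜ ⟫ ∷ x₂ ∷ []) (v 0 :^ 2 :* v 1) (v 2 :* (v 2 :+ # 7 :- # 7 :* v 1))
    ((:- (v 0 :^ 2 :* v 1 :* (v 3 :* v 4 :+ # 1)) , v 3 :* v 4 ≐ # 1) ∷ (v 4 :^ 2 :* v 1 :* (v 0 :* v 3 :+ r) , v 0 :* v 3 ≐ r)
      ∷ (# 1 , (r :* v 4) :^ 2 :* v 1 ≐ v 2 :* (v 2 :+ # 7 :- # 7 :* v 1)) ∷ []) refl
    (𝔸.decide (x₂ᶜ ⊢ x₂ᶜ-sound & u₂ᶜ ⊢ ≈-refl & 𝔸.∅) (v 0 :* (# 1 :+ v 0) :* v 1) (# 1) refl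
      ∷ g₂-def
      ∷ 𝔸.decide (x₂ᶜ ⊢ x₂ᶜ-sound & u₂ᶜ ⊢ ≈-refl & gᶜ ⊢ gᶜ-sound & hᶜ ⊢ hᶜ-sound & 𝔸.∅)
          ((((# 1 :+ v 0) :^ 2 :+ v 0 :- v 0 :^ 2 :* (# 1 :+ v 0) :- # 8 :* (v 0 :* (# 1 :+ v 0))) :* v 1) :^ 2 :* v 3) (v 2 :* (v 2 :+ # 7 :- # 7 :* v 3)) refl ∷ [])
    where
    u = x₂ ⊗ (ι (+ 1) ⊕ x₂)
    y₂ = # 1 :+ v 5
    r = y₂ :^ 2 :+ v 5 :- v 5 :^ 2 :* y₂ :- # 8 :* (v 5 :* y₂)

-- The tabulated values of U on products of ξ, η and ξ₂

Term : Set
Term = ℤ × ℕ × ℕ × ℕ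

if-both : ∀ b {c} → (if b then c else false) ≡ true → b ≡ true × c ≡ true
if-both true e = refl , e

module Tables (S : Setting) where
  open Setting S
  open Tower S
  open Heptic S
  open 𝔸 using (⟪_⟫)

  embed : 𝔸.C → 𝕋.C
  embed c = c ∷ o ∷ o ∷ o ∷ o ∷ o ∷ o ∷ []

  embed-sound : ∀ c {a} → ⟪ c ⟫ ≈ a → 𝕋.⟪ embed c ⟫ ≈ V a
  embed-sound c {a} p = lincomb (E ∷ V ⟪ c ⟫ ∷ V ⟪ o ⟫ ∷ 0# ∷ V a ∷ []) (horner (v 0) (v 1) (v 2) (v 2) (v 2) (v 2) (v 2) (v 2) (v 3)) (v 4)
    ((v 0 :+ v 0 :^ 2 :+ v 0 :^ 3 :+ v 0 :^ 4 :+ v 0 :^ 5 :+ v 0 :^ 6 , v 2 ≐ # 0) ∷ (v 0 :^ 7 , v 3 ≐ # 0) ∷ (# 1 , v 1 ≐ v 4) ∷ []) refl (Vo ∷ 0≐ ∷ VH.F-cong p ∷ [])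

  known : 𝕋.Known (ξᶜ ∷ ηᶜ ∷ ξ₂ᶜ ∷ embed gᶜ ∷ embed hᶜ ∷ []) (ξ ∷ η ∷ ξ₂ ∷ V g ∷ V h ∷ [])
  known = ξᶜ ⊢ ξᶜ-sound & ηᶜ ⊢ ηᶜ-sound & ξ₂ᶜ ⊢ ξ₂ᶜ-sound & embed gᶜ ⊢ embed-sound gᶜ gᶜ-sound & embed hᶜ ⊢ embed-sound hᶜ hᶜ-sound & 𝕋.∅
    where open 𝕋 using (_⊢_&_)

  -- the characteristic polynomial of ξ over the fixed field of q ↦ ζ₇ q
  charpoly : V g ↑ 2 ≈ ξ ↑ 7 ⊕ ι (+ 7) ⊗ ξ ↑ 6 ⊕ ι (+ 21) ⊗ ξ ↑ 5 ⊕ ι (+ 49) ⊗ ξ ↑ 4 ⊕ (ι (+ 147) ⊕ ι (+ 7) ⊗ V g) ⊗ ξ ↑ 3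
    ⊕ (ι (+ 343) ⊕ ι (+ 35) ⊗ V g) ⊗ ξ ↑ 2 ⊕ (ι (+ 343) ⊕ ι (+ 49) ⊗ V g) ⊗ ξ
  charpoly = 𝕋.decide known (v 3 :^ 2) (v 0 :^ 7 :+ # 7 :* v 0 :^ 6 :+ # 21 :* v 0 :^ 5 :+ # 49 :* v 0 :^ 4 :+ (# 147 :+ # 7 :* v 3) :* v 0 :^ 3
    :+ (# 343 :+ # 35 :* v 3) :* v 0 :^ 2 :+ (# 343 :+ # 49 :* v 3) :* v 0) refl

  -- With t′ = V(g)/ξ⁴ and h′ = η V(w)/(ξ V(g)), division by ξ⁷ turns this into (ξ₂/ξ)⁷ V(h) = 1 +
  -- 7t′ - 7h′t′, the right-hand factor of G at t′, h′.
  top-G : ξ₂ ↑ 7 ⊗ V h ⊕ ι (+ 7) ⊗ (η ⊗ (V g ⊕ ι (+ 7) ⊝ ι (+ 7) ⊗ V h) ⊗ ξ ↑ 2) ≈ ξ ↑ 7 ⊕ ι (+ 7) ⊗ (ξ ↑ 3 ⊗ V g)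
  top-G = 𝕋.decide known (v 2 :^ 7 :* v 4 :+ # 7 :* (v 1 :* (v 3 :+ # 7 :- # 7 :* v 4) :* v 0 :^ 2)) (v 0 :^ 7 :+ # 7 :* (v 0 :^ 3 :* v 3)) refl

  -- The equation F at the same t′ and h′, multiplied by ξ¹¹ V(g) to clear denominators.
  top-F : (V g ⊗ ξ ⊝ η ⊗ (V g ⊕ ι (+ 7) ⊝ ι (+ 7) ⊗ V h)) ⊗ (V g ⊗ ξ ⊝ ι (+ 8) ⊗ (η ⊗ (V g ⊕ ι (+ 7) ⊝ ι (+ 7) ⊗ V h))) ↑ 2
    ≈ η ⊗ (V g ⊕ ι (+ 7) ⊝ ι (+ 7) ⊗ V h) ⊗ ξ ↑ 5 ⊗ (ξ ↑ 5 ⊕ ι (+ 9) ⊗ (V g ⊗ ξ) ⊝ ι (+ 16) ⊗ (η ⊗ (V g ⊕ ι (+ 7) ⊝ ι (+ 7) ⊗ V h)))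
  top-F = 𝕋.decide known ((v 3 :* v 0 :- ηw) :* (v 3 :* v 0 :- # 8 :* ηw) :^ 2) (ηw :* v 0 :^ 5 :* (v 0 :^ 5 :+ # 9 :* (v 3 :* v 0) :- # 16 :* ηw)) refl
    where ηw = v 1 :* (v 3 :+ # 7 :- # 7 :* v 4)

  wᶜ : 𝔸.C
  wᶜ = 𝔸.run (gᶜ ∷ hᶜ ∷ []) (v 0 :+ # 7 :- # 7 :* v 1)

  gh : 𝔸.Known (gᶜ ∷ hᶜ ∷ []) (g ∷ h ∷ [])
  gh = gᶜ ⊢ gᶜ-sound & hᶜ ⊢ hᶜ-sound & 𝔸.∅
    where open 𝔸 using (_⊢_&_)

  Rows : Carrier → Carrier → ℕ → List Expr → Set
  Rows m X k []       = ⊤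
  Rows m X k (r ∷ rs) = (m ⊗ U (ξ ↑ k ⊗ X) ≈ ⟦ r ⟧ (env (g ∷ h ∷ []))) × Rows m X (suc k) rs

  -- `f` runs through the codes of X, ξX, ξ²X, ..., so that each row costs a single multiplication
  -- by `ξᶜ`.
  check : 𝔸.C → 𝕋.C → List Expr → Bool
  check m f []       = true
  check m f (r ∷ rs) = if 𝔸.same (𝔸.mulᶜ m (firstᶜ f)) (𝔸.run (gᶜ ∷ hᶜ ∷ []) r) then check m (𝕋.mulᶜ ξᶜ f) rs else false

  check-sound : ∀ {m m′ X} f k rs → ⟪ m ⟫ ≈ m′ → 𝕋.⟪ f ⟫ ≈ ξ ↑ k ⊗ X → check m f rs ≡ true → Rows m′ X k rs
  check-sound f k []       p r e = tt
  check-sound {m} {m′} {X} f k (s ∷ rs) p r e =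
      ≈-trans (≈-sym (≈-trans (𝔸.mulᶜ-sound m (firstᶜ f)) (*-cong p (≈-trans (≈-sym (U-first f)) (U-cong r)))))
        (≈-trans (𝔸.same-sound (𝔸.mulᶜ m (firstᶜ f)) (𝔸.run (gᶜ ∷ hᶜ ∷ []) s) (proj₁ both)) (𝔸.run-sound gh s))
    , check-sound (𝕋.mulᶜ ξᶜ f) (suc k) rs p
        (≈-trans (𝕋.mulᶜ-sound ξᶜ f) (≈-trans (*-cong ξᶜ-sound r) (≈-sym (⊗-assoc _ _ _)))) (proj₂ both)
    where
    both = if-both (𝔸.same (𝔸.mulᶜ m (firstᶜ f)) (𝔸.run (gᶜ ∷ hᶜ ∷ []) s)) e

  -- (c , v , i , j) stands for c 7ᵛ tⁱ hʲ with t = 1/g, here multiplied by gⁿ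
  rowE : ℕ → List Term → Expr
  rowE n []                     = # 0
  rowE n ((c , e , i , j) ∷ ts) = con (c ℤ.* + (7 ^ e)) :* (v 0 :^ (n ∸ i) :* v 1 :^ j) :+ rowE n ts

  -- The first index tells the step, 0 for f ↦ U f and 1 for f ↦ U(Z f); the second is the power j
  -- of h in f. Writing hʲ as V(κ)ʲ ηʲ uʲ leaves ηʲ under U in the first case. In the second, η ξ₂ =
  -- ξ² turns ηʲ ξ₂² into ξ²ʲ ξ₂²⁻ʲ. Multiplied by wʲ, all values become integral polynomials in g
  -- and h, except that η² takes a further factor 4.
  rows₀₀ : List (List Term)
  rows₀₀ = ((+ 1 , 0 , 3 , 0) ∷ [])
    ∷ ((-[1+ 0 ] , 0 , 3 , 0) ∷ [])
    ∷ ((+ 1 , 0 , 3 , 0) ∷ [])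
    ∷ ((-[1+ 0 ] , 1 , 3 , 0) ∷ [])
    ∷ ((-[1+ 3 ] , 0 , 2 , 0) ∷ (-[1+ 0 ] , 1 , 3 , 0) ∷ [])
    ∷ ((+ 10 , 0 , 2 , 0) ∷ (+ 1 , 2 , 3 , 0) ∷ [])
    ∷ ((+ 1 , 2 , 3 , 0) ∷ []) ∷ []

  rows₀₁ : List (List Term)
  rows₀₁ = ((+ 1 , 0 , 3 , 0) ∷ (+ 1 , 1 , 4 , 0) ∷ (-[1+ 0 ] , 1 , 4 , 1) ∷ [])
    ∷ ((+ 1 , 0 , 3 , 0) ∷ (+ 1 , 1 , 4 , 0) ∷ (-[1+ 0 ] , 1 , 4 , 1) ∷ [])
    ∷ ((-[1+ 0 ] , 0 , 3 , 0) ∷ (+ 8 , 0 , 3 , 1) ∷ (-[1+ 0 ] , 1 , 4 , 0) ∷ (+ 9 , 1 , 4 , 1) ∷ (-[1+ 7 ] , 1 , 4 , 2) ∷ [])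
    ∷ ((-[1+ 0 ] , 1 , 3 , 0) ∷ (-[1+ 0 ] , 2 , 4 , 0) ∷ (+ 1 , 2 , 4 , 1) ∷ [])
    ∷ ((-[1+ 5 ] , 0 , 2 , 0) ∷ (-[1+ 0 ] , 0 , 2 , 1) ∷ (-[1+ 82 ] , 0 , 3 , 0) ∷ (-[1+ 22 ] , 0 , 3 , 1) ∷ (+ 8 , 0 , 3 , 2) ∷ (-[1+ 5 ] , 2 , 4 , 0) ∷ (-[1+ 1 ] , 2 , 4 , 1) ∷ (+ 8 , 2 , 4 , 2) ∷ [])
    ∷ ((+ 1 , 2 , 3 , 0) ∷ (+ 1 , 3 , 4 , 0) ∷ (-[1+ 0 ] , 3 , 4 , 1) ∷ [])
    ∷ ((+ 48 , 0 , 2 , 0) ∷ (-[1+ 33 ] , 0 , 2 , 1) ∷ (+ 95 , 1 , 3 , 0) ∷ (-[1+ 77 ] , 1 , 3 , 1) ∷ (+ 32 , 1 , 3 , 2) ∷ (+ 1 , 4 , 4 , 0) ∷ (-[1+ 0 ] , 4 , 4 , 1) ∷ []) ∷ []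

  rows₀₂ : List (List Term)
  rows₀₂ = ((+ 4 , 0 , 3 , 0) ∷ (+ 8 , 1 , 4 , 0) ∷ (-[1+ 7 ] , 1 , 4 , 1) ∷ (+ 4 , 2 , 5 , 0) ∷ (-[1+ 7 ] , 2 , 5 , 1) ∷ (+ 4 , 2 , 5 , 2) ∷ [])
    ∷ ((+ 4 , 1 , 3 , 0) ∷ (+ 8 , 2 , 4 , 0) ∷ (-[1+ 7 ] , 2 , 4 , 1) ∷ (+ 4 , 3 , 5 , 0) ∷ (-[1+ 7 ] , 3 , 5 , 1) ∷ (+ 4 , 3 , 5 , 2) ∷ [])
    ∷ ((-[1+ 3 ] , 1 , 3 , 0) ∷ (-[1+ 7 ] , 2 , 4 , 0) ∷ (+ 8 , 2 , 4 , 1) ∷ (-[1+ 3 ] , 3 , 5 , 0) ∷ (+ 8 , 3 , 5 , 1) ∷ (-[1+ 3 ] , 3 , 5 , 2) ∷ [])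
    ∷ ((+ 2 , 0 , 2 , 1) ∷ (+ 68 , 0 , 3 , 0) ∷ (+ 340 , 0 , 3 , 1) ∷ (-[1+ 15 ] , 0 , 3 , 2) ∷ (+ 22 , 2 , 4 , 0) ∷ (+ 124 , 2 , 4 , 1) ∷ (-[1+ 47 ] , 2 , 4 , 2) ∷ (+ 2 , 4 , 5 , 0) ∷ (+ 10 , 4 , 5 , 1) ∷ (-[1+ 11 ] , 4 , 5 , 2) ∷ [])
    ∷ ((-[1+ 31 ] , 0 , 2 , 0) ∷ (-[1+ 2 ] , 0 , 2 , 1) ∷ (-[1+ 163 ] , 1 , 3 , 0) ∷ (-[1+ 105 ] , 1 , 3 , 1) ∷ (+ 4 , 1 , 3 , 2) ∷ (-[1+ 4 ] , 4 , 4 , 0) ∷ (-[1+ 33 ] , 3 , 4 , 1) ∷ (+ 20 , 3 , 4 , 2) ∷ (-[1+ 16 ] , 4 , 5 , 0) ∷ (-[1+ 14 ] , 4 , 5 , 1) ∷ (+ 32 , 4 , 5 , 2) ∷ [])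
    ∷ ((-[1+ 119 ] , 0 , 2 , 0) ∷ (+ 36 , 0 , 2 , 1) ∷ (-[1+ 179 ] , 1 , 3 , 0) ∷ (+ 710 , 1 , 3 , 1) ∷ (-[1+ 39 ] , 1 , 3 , 2) ∷ (+ 4 , 3 , 4 , 0) ∷ (+ 174 , 3 , 4 , 1) ∷ (-[1+ 79 ] , 3 , 4 , 2) ∷ (+ 2 , 5 , 5 , 0) ∷ (+ 10 , 5 , 5 , 1) ∷ (-[1+ 11 ] , 5 , 5 , 2) ∷ [])
    ∷ ((-[1+ 0 ] , 0 , 1 , 1) ∷ (+ 512 , 0 , 2 , 0) ∷ (-[1+ 323 ] , 0 , 2 , 1) ∷ (+ 8 , 0 , 2 , 2) ∷ (+ 181 , 2 , 3 , 0) ∷ (-[1+ 452 ] , 2 , 3 , 1) ∷ (+ 48 , 2 , 3 , 2) ∷ (+ 19 , 4 , 4 , 0) ∷ (-[1+ 115 ] , 4 , 4 , 1) ∷ (+ 48 , 4 , 4 , 2) ∷ (+ 3 , 5 , 5 , 0) ∷ (-[1+ 54 ] , 5 , 5 , 1) ∷ (+ 52 , 5 , 5 , 2) ∷ []) ∷ []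

  rows₁₂ : List (List Term)
  rows₁₂ = ((+ 1 , 0 , 3 , 0) ∷ (+ 2 , 1 , 4 , 0) ∷ (-[1+ 1 ] , 1 , 4 , 1) ∷ (+ 1 , 2 , 5 , 0) ∷ (-[1+ 1 ] , 2 , 5 , 1) ∷ (+ 1 , 2 , 5 , 2) ∷ [])
    ∷ ((-[1+ 0 ] , 0 , 3 , 0) ∷ (-[1+ 1 ] , 1 , 4 , 0) ∷ (+ 2 , 1 , 4 , 1) ∷ (-[1+ 0 ] , 2 , 5 , 0) ∷ (+ 2 , 2 , 5 , 1) ∷ (-[1+ 0 ] , 2 , 5 , 2) ∷ [])
    ∷ ((+ 1 , 0 , 3 , 0) ∷ (+ 2 , 1 , 4 , 0) ∷ (-[1+ 1 ] , 1 , 4 , 1) ∷ (+ 1 , 2 , 5 , 0) ∷ (-[1+ 1 ] , 2 , 5 , 1) ∷ (+ 1 , 2 , 5 , 2) ∷ [])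
    ∷ ((-[1+ 0 ] , 1 , 3 , 0) ∷ (-[1+ 1 ] , 2 , 4 , 0) ∷ (+ 2 , 2 , 4 , 1) ∷ (-[1+ 0 ] , 3 , 5 , 0) ∷ (+ 2 , 3 , 5 , 1) ∷ (-[1+ 0 ] , 3 , 5 , 2) ∷ [])
    ∷ ((-[1+ 3 ] , 0 , 2 , 0) ∷ (-[1+ 8 ] , 1 , 3 , 0) ∷ (+ 8 , 1 , 3 , 1) ∷ (-[1+ 5 ] , 2 , 4 , 0) ∷ (+ 10 , 2 , 4 , 1) ∷ (-[1+ 3 ] , 2 , 4 , 2) ∷ (-[1+ 0 ] , 3 , 5 , 0) ∷ (+ 2 , 3 , 5 , 1) ∷ (-[1+ 0 ] , 3 , 5 , 2) ∷ [])
    ∷ ((+ 10 , 0 , 2 , 0) ∷ (+ 27 , 1 , 3 , 0) ∷ (-[1+ 19 ] , 1 , 3 , 1) ∷ (+ 24 , 2 , 4 , 0) ∷ (-[1+ 33 ] , 2 , 4 , 1) ∷ (+ 10 , 2 , 4 , 2) ∷ (+ 1 , 4 , 5 , 0) ∷ (-[1+ 1 ] , 4 , 5 , 1) ∷ (+ 1 , 4 , 5 , 2) ∷ [])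
    ∷ ((+ 1 , 2 , 3 , 0) ∷ (+ 2 , 3 , 4 , 0) ∷ (-[1+ 1 ] , 3 , 4 , 1) ∷ (+ 1 , 4 , 5 , 0) ∷ (-[1+ 1 ] , 4 , 5 , 1) ∷ (+ 1 , 4 , 5 , 2) ∷ []) ∷ []

  rows₁₁ : List (List Term)
  rows₁₁ = ((-[1+ 0 ] , 0 , 3 , 0) ∷ (-[1+ 0 ] , 1 , 4 , 0) ∷ (+ 1 , 1 , 4 , 1) ∷ [])
    ∷ ((+ 1 , 0 , 3 , 0) ∷ (+ 1 , 1 , 4 , 0) ∷ (-[1+ 0 ] , 1 , 4 , 1) ∷ [])
    ∷ ((-[1+ 1 ] , 0 , 2 , 0) ∷ (-[1+ 22 ] , 0 , 3 , 0) ∷ (+ 30 , 0 , 3 , 1) ∷ (-[1+ 8 ] , 1 , 4 , 0) ∷ (+ 25 , 1 , 4 , 1) ∷ (-[1+ 15 ] , 1 , 4 , 2) ∷ [])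
    ∷ ((+ 8 , 0 , 2 , 0) ∷ (+ 15 , 1 , 3 , 0) ∷ (-[1+ 15 ] , 1 , 3 , 1) ∷ (+ 1 , 3 , 4 , 0) ∷ (-[1+ 14 ] , 2 , 4 , 1) ∷ (+ 8 , 2 , 4 , 2) ∷ [])
    ∷ ((-[1+ 7 ] , 0 , 2 , 0) ∷ (-[1+ 16 ] , 1 , 3 , 0) ∷ (+ 24 , 1 , 3 , 1) ∷ (-[1+ 8 ] , 2 , 4 , 0) ∷ (+ 25 , 2 , 4 , 1) ∷ (-[1+ 15 ] , 2 , 4 , 2) ∷ [])
    ∷ ((+ 1 , 0 , 1 , 0) ∷ (+ 36 , 0 , 2 , 0) ∷ (-[1+ 14 ] , 0 , 2 , 1) ∷ (+ 43 , 1 , 3 , 0) ∷ (-[1+ 92 ] , 1 , 3 , 1) ∷ (+ 8 , 1 , 3 , 2) ∷ (+ 2 , 3 , 4 , 0) ∷ (-[1+ 9 ] , 3 , 4 , 1) ∷ (+ 8 , 3 , 4 , 2) ∷ [])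
    ∷ ((+ 8 , 0 , 1 , 0) ∷ (+ 8 , 0 , 2 , 0) ∷ (-[1+ 119 ] , 0 , 2 , 1) ∷ (-[1+ 110 ] , 1 , 3 , 0) ∷ (+ 96 , 1 , 3 , 1) ∷ (+ 64 , 1 , 3 , 2) ∷ (-[1+ 8 ] , 3 , 4 , 0) ∷ (+ 25 , 3 , 4 , 1) ∷ (-[1+ 15 ] , 3 , 4 , 2) ∷ []) ∷ []

  rows₁₀ : List (List Term)
  rows₁₀ = ((+ 1 , 0 , 3 , 0) ∷ [])
    ∷ ((+ 2 , 0 , 2 , 0) ∷ (+ 9 , 0 , 3 , 0) ∷ (-[1+ 15 ] , 0 , 3 , 1) ∷ [])
    ∷ ((-[1+ 0 ] , 1 , 3 , 0) ∷ [])
    ∷ ((+ 1 , 0 , 1 , 0) ∷ (-[1+ 2 ] , 0 , 2 , 0) ∷ (-[1+ 15 ] , 0 , 2 , 1) ∷ (-[1+ 47 ] , 0 , 3 , 0) ∷ (-[1+ 15 ] , 0 , 3 , 1) ∷ (+ 64 , 0 , 3 , 2) ∷ [])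
    ∷ ((+ 1 , 2 , 3 , 0) ∷ [])
    ∷ ((-[1+ 25 ] , 0 , 1 , 0) ∷ (-[1+ 249 ] , 0 , 2 , 0) ∷ (+ 320 , 0 , 2 , 1) ∷ (-[1+ 78 ] , 1 , 3 , 0) ∷ (+ 256 , 1 , 3 , 1) ∷ (-[1+ 127 ] , 1 , 3 , 2) ∷ [])
    ∷ ((+ 64 , 0 , 1 , 0) ∷ (+ 128 , 1 , 2 , 0) ∷ (-[1+ 127 ] , 1 , 2 , 1) ∷ (+ 57 , 2 , 3 , 0) ∷ (-[1+ 127 ] , 2 , 3 , 1) ∷ (+ 64 , 2 , 3 , 2) ∷ []) ∷ []

  w-sound : ⟪ wᶜ ⟫ ≈ w
  w-sound = 𝔸.run-sound gh (v 0 :+ # 7 :- # 7 :* v 1)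

  table₀₀ : Rows (ι (+ 1)) (ι (+ 1)) 0 (map (rowE 3) rows₀₀)
  table₀₀ = check-sound {𝔸.intᶜ (+ 1)} (𝕋.intᶜ (+ 1)) 0 (map (rowE 3) rows₀₀) (𝔸.intᶜ-sound (+ 1)) (≈-trans (𝕋.intᶜ-sound (+ 1)) (≈-sym (one⊗ _))) refl

  table₀₁ : Rows w η 0 (map (rowE 4) rows₀₁)
  table₀₁ = check-sound {wᶜ} (ηᶜ) 0 (map (rowE 4) rows₀₁) w-sound (≈-trans ηᶜ-sound (≈-sym (one⊗ _))) refl

  table₀₂ : Rows (ι (+ 4) ⊗ (w ⊗ w)) (η ⊗ η) 0 (map (rowE 5) rows₀₂)
  table₀₂ = check-sound {𝔸.mulᶜ (𝔸.intᶜ (+ 4)) (𝔸.mulᶜ wᶜ wᶜ)} (𝕋.mulᶜ ηᶜ ηᶜ) 0 (map (rowE 5) rows₀₂) (≈-trans (𝔸.mulᶜ-sound (𝔸.intᶜ (+ 4)) (𝔸.mulᶜ wᶜ wᶜ)) (*-cong (𝔸.intᶜ-sound (+ 4)) (≈-trans (𝔸.mulᶜ-sound wᶜ wᶜ) (*-cong w-sound w-sound)))) (≈-trans (≈-trans (𝕋.mulᶜ-sound ηᶜ ηᶜ) (*-cong ηᶜ-sound ηᶜ-sound)) (≈-sym (one⊗ _))) refl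

  table₁₂ : Rows (w ⊗ w) (ι (+ 1)) 0 (map (rowE 5) rows₁₂)
  table₁₂ = check-sound {𝔸.mulᶜ wᶜ wᶜ} (𝕋.intᶜ (+ 1)) 0 (map (rowE 5) rows₁₂) (≈-trans (𝔸.mulᶜ-sound wᶜ wᶜ) (*-cong w-sound w-sound)) (≈-trans (𝕋.intᶜ-sound (+ 1)) (≈-sym (one⊗ _))) refl

  table₁₁ : Rows w ξ₂ 0 (map (rowE 4) rows₁₁)
  table₁₁ = check-sound {wᶜ} (ξ₂ᶜ) 0 (map (rowE 4) rows₁₁) w-sound (≈-trans ξ₂ᶜ-sound (≈-sym (one⊗ _))) refl

  table₁₀ : Rows (ι (+ 1)) (ξ₂ ⊗ ξ₂) 0 (map (rowE 3) rows₁₀)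
  table₁₀ = check-sound {𝔸.intᶜ (+ 1)} (𝕋.mulᶜ ξ₂ᶜ ξ₂ᶜ) 0 (map (rowE 3) rows₁₀) (𝔸.intᶜ-sound (+ 1)) (≈-trans (≈-trans (𝕋.mulᶜ-sound ξ₂ᶜ ξ₂ᶜ) (*-cong ξ₂ᶜ-sound ξ₂ᶜ-sound)) (≈-sym (one⊗ _))) refl

-- Divisibility of the iterates of U

record FullSetting : Set₁ where
  field
    S : Setting
  open Setting S
  open Tower S
  field
    t u    : Carrier
    t-g    : t ⊗ g ≈ ι (+ 1)
    u-ξ    : u ⊗ ξ ≈ ι (+ 1)
    t-func : t ≈ u ↑ 4 ⊗ V g
    h-func : h ≈ η ⊗ u ⊗ V (w ⊗ t)
    η-ξ₂   : η ⊗ ξ₂ ≈ ξ ⊗ ξ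

-- Linear inequalities between the exponents

module ℕ-Arithmetic where
  open import Data.Nat.Tactic.RingSolver using (solve-∀)

  -- Linear arithmetic by Farkas certificates: a ≤ b is a sum of hypotheses with multiplicities, s
  -- is the slack, and the remaining identity is left to the ring solver.
  certificate : ∀ p r s {a b} → a ≤ b → r + a ≡ p + b + s → p ≤ r
  certificate p r s {a} {b} a≤b e = ℕₚ.+-cancelʳ-≤ a p r (ℕₚ.≤-trans (ℕₚ.+-monoʳ-≤ p a≤b) (ℕₚ.≤-trans (ℕₚ.m≤m+n (p + b) s) (ℕₚ.≤-reflexive (sym e))))

  div7 : ∀ a b → 7 * a ≤ 7 * b + 6 → a ≤ b
  div7 a b l with ℕₚ.≤-total a b
  ... | inj₁ a≤b = a≤b
  ... | inj₂ b≤a with ℕₚ.m≤n⇒m<n∨m≡n b≤a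
  ...   | inj₂ refl = ℕₚ.≤-refl
  ...   | inj₁ b<a  = ⊥-elim (ℕₚ.<-irrefl refl (ℕₚ.≤-trans (ℕₚ.≤-trans (ℕₚ.≤-reflexive (eq b)) (ℕₚ.*-monoʳ-≤ 7 b<a)) l))
    where
    eq : ∀ b → suc (7 * b + 6) ≡ 7 * suc b
    eq = solve-∀

  _&_ : ∀ {a b c d} → a ≤ b → c ≤ d → a + c ≤ b + d
  _&_ = ℕₚ.+-mono-≤

  infixr 5 _&_

  upper-step : ∀ v i μ c k e r → 7 * i ≤ 4 * v + 2 * (r + μ) + c → 7 * e + 2 * r ≤ 4 * k + 14 → 7 * (i + e) ≤ 4 * (v + k) + 2 * (7 + μ) + c
  upper-step v i μ c k e r p s = certificate _ _ 0 (p & s) (eq v i μ c k e r)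
    where
    eq : ∀ v i μ c k e r → 4 * (v + k) + 2 * (7 + μ) + c + (7 * i + (7 * e + 2 * r)) ≡ 7 * (i + e) + (4 * v + 2 * (r + μ) + c + (4 * k + 14)) + 0
    eq = solve-∀

  lower-step : ∀ i j μ low e r → 2 * (r + μ) + 7 * j + low ≤ 7 * i → 14 ≤ 7 * e + 2 * r → 2 * (7 + μ) + 7 * j + low ≤ 7 * (i + e)
  lower-step i j μ low e r p s = certificate _ _ 0 (p & s) (eq i j μ low e r)
    where
    eq : ∀ i j μ low e r → 7 * (i + e) + (2 * (r + μ) + 7 * j + low + 14) ≡ 2 * (7 + μ) + 7 * j + low + (7 * i + (7 * e + 2 * r)) + 0
    eq = solve-∀

  -- This permits cancelling gⁿ⁺³ against tⁱ. The constant 15 = 3 · 7 - 6 is what `div7` needs to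
  -- round up to n + 3.
  split-index : ∀ i j n μ₀ low → 15 ≤ 2 * μ₀ + low → 2 * (μ₀ + 4 * n) + 7 * j + low ≤ 7 * i → n + 3 ≤ i
  split-index i j n μ₀ low p l = div7 (n + 3) i (certificate _ _ (n + 7 * j) (p & l) (eq i j n μ₀ low))
    where
    eq : ∀ i j n μ₀ low → 7 * i + 6 + (15 + (2 * (μ₀ + 4 * n) + 7 * j + low)) ≡ 7 * (n + 3) + (2 * μ₀ + low + 7 * i) + (n + 7 * j)
    eq = solve-∀

  upper-shift : ∀ v i′ n μ₀ c → 7 * (i′ + (n + 3)) ≤ 4 * v + 2 * (μ₀ + 4 * n) + c → 7 * i′ + 21 ≤ 4 * v + n + 2 * μ₀ + c
  upper-shift v i′ n μ₀ c p = certificate _ _ 0 p (eq v i′ n μ₀ c)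
    where
    eq : ∀ v i′ n μ₀ c → 4 * v + n + 2 * μ₀ + c + 7 * (i′ + (n + 3)) ≡ 7 * i′ + 21 + (4 * v + 2 * (μ₀ + 4 * n) + c) + 0
    eq = solve-∀

  lower-shift : ∀ i′ j n μ₀ low → 2 * (μ₀ + 4 * n) + 7 * j + low ≤ 7 * (i′ + (n + 3)) → n + 2 * μ₀ + 7 * j + low ≤ 7 * i′ + 21
  lower-shift i′ j n μ₀ low p = certificate _ _ 0 p (eq i′ j n μ₀ low)
    where
    eq : ∀ i′ j n μ₀ low → 7 * i′ + 21 + (2 * (μ₀ + 4 * n) + 7 * j + low) ≡ n + 2 * μ₀ + 7 * j + low + 7 * (i′ + (n + 3)) + 0
    eq = solve-∀

  -- The value 2μ₀ + c is 25, 31 and 31 for j = 0, 1, 2. Since U shrinks the exponent by a factor 7,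
  -- the inequality multiplied by 7 lacks 24 = 28 - 4 copies of a ≤ d + v; the gain, in the form a +
  -- 1 ≤ d + v, supplies them.
  even-bound : ∀ a d v n i′ c → c ≤ 31 → 7 * i′ + 21 ≤ 4 * v + n + c → n + 4 * a ≤ 4 * d + 2 → suc a ≤ d + v → i′ + 4 * a ≤ 4 * (d + v)
  even-bound a d v n i′ c c≤ p r s = div7 _ _ (certificate _ _ 18 (p & r & c≤ & ℕₚ.*-monoʳ-≤ 24 s)
    (eq a d v n i′ c))
    where
    eq : ∀ a d v n i′ c → 7 * (4 * (d + v)) + 6 + (7 * i′ + 21 + (n + 4 * a + (c + 24 * suc a))) ≡ 7 * (i′ + 4 * a) + (4 * v + n + c + (4 * d + 2 + (31 + 24 * (d + v)))) + 18
    eq = solve-∀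

  -- The value 2μ₀ + c is 37 for all three tables of this step (22 + 15, 20 + 17, 18 + 19). With the
  -- rounding of `div7` the estimate holds without slack.
  odd-bound : ∀ a d v n i′ → 7 * i′ + 21 ≤ 4 * v + n + 37 → n + 4 * a ≤ 4 * d → suc a ≤ d + v → i′ + 4 * suc a ≤ 4 * (d + v) + 2
  odd-bound a d v n i′ p r s = div7 _ _ (certificate _ _ 0 (p & r & ℕₚ.*-monoʳ-≤ 24 s) (eq a d v n i′))
    where
    eq : ∀ a d v n i′ → 7 * (4 * (d + v) + 2) + 6 + (7 * i′ + 21 + (n + 4 * a + 24 * suc a)) ≡ 7 * (i′ + 4 * suc a) + (4 * v + n + 37 + (4 * d + 24 * (d + v))) + 0
    eq = solve-∀

  -- The only critical case is v = 0 and d = a. There n ≤ 2, so the upper bound leaves i′ = 0,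
  -- whereas the lower bound and n > 0 force i′ > 0: no term without a factor 7 exists.
  gain₀ : ∀ a d v n i′ j → a ≤ d → 0 < n → n + 4 * a ≤ 4 * d + 2 → 7 * i′ + 21 ≤ 4 * v + n + 25 → n + 21 + 7 * j ≤ 7 * i′ + 21 → suc a ≤ d + v
  gain₀ a d (suc v) n i′ j a≤d 0<n p r s = ℕₚ.≤-trans (s≤s a≤d) (ℕₚ.≤-trans (ℕₚ.m≤m+n (suc d) v) (ℕₚ.≤-reflexive (sym (ℕₚ.+-suc d v))))
  gain₀ a d zero    n i′ j a≤d 0<n p r s with ℕₚ.m≤n⇒m<n∨m≡n a≤d
  ... | inj₁ a<d  = ℕₚ.≤-trans a<d (ℕₚ.m≤m+n d 0)
  ... | inj₂ refl = ⊥-elim (impossible i′ (ℕₚ.≤-trans 0<n n≤) 7i′≤6)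
    where
    n≤2 : n ≤ 2
    n≤2 = ℕₚ.+-cancelʳ-≤ (4 * a) n 2 (ℕₚ.≤-trans p (ℕₚ.≤-reflexive (ℕₚ.+-comm (4 * a) 2)))
    n≤ : n ≤ 7 * i′
    n≤ = certificate _ _ (7 * j) s (eq n i′ j)
      where
      eq : ∀ n i′ j → 7 * i′ + (n + 21 + 7 * j) ≡ n + (7 * i′ + 21) + 7 * j
      eq = solve-∀
    7i′≤6 : 7 * i′ ≤ 6
    7i′≤6 = certificate _ _ 0 (r & n≤2) (eq n i′)
      where
      eq : ∀ n i′ → 6 + (7 * i′ + 21 + n) ≡ 7 * i′ + (4 * 0 + n + 25 + 2) + 0
      eq = solve-∀
    impossible : ∀ i → 0 < 7 * i → 7 * i ≤ 6 → ⊥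
    impossible zero    () _
    impossible (suc i) _ l = ℕₚ.<-irrefl refl (ℕₚ.≤-trans (s≤s l) (ℕₚ.≤-trans (ℕₚ.m≤m+n 7 (7 * i)) (ℕₚ.≤-reflexive (sym (ℕₚ.*-suc 7 i)))))

  -- For j ≥ 1 the condition j < n leaves n = 2 as the only critical exponent at d = a. The bounds
  -- alone do not exclude it; divisibility there is the extra hypothesis.
  gain₁ : ∀ a d v n → a ≤ d → n + 4 * a ≤ 4 * d + 2 → (n ≡ 2 → 1 ≤ v) → 2 ≤ n → suc a ≤ d + v
  gain₁ a d (suc v) n a≤d p f l = ℕₚ.≤-trans (s≤s a≤d) (ℕₚ.≤-trans (ℕₚ.m≤m+n (suc d) v) (ℕₚ.≤-reflexive (sym (ℕₚ.+-suc d v))))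
  gain₁ a d zero    n a≤d p f l with ℕₚ.m≤n⇒m<n∨m≡n a≤d
  ... | inj₁ a<d  = ℕₚ.≤-trans a<d (ℕₚ.m≤m+n d 0)
  ... | inj₂ refl = ⊥-elim (absurd (f (ℕₚ.≤-antisym n≤2 l)))
    where
    n≤2 : n ≤ 2
    n≤2 = ℕₚ.+-cancelʳ-≤ (4 * a) n 2 (ℕₚ.≤-trans p (ℕₚ.≤-reflexive (ℕₚ.+-comm (4 * a) 2)))
    absurd : 1 ≤ 0 → ⊥
    absurd ()

-- Spans of monomials in t and h weighted by powers of 7

module Spans (FS : FullSetting) where
  open FullSetting FS
  open Setting S
  open Tower S
  open Heptic S
  open Tables S
  open ℕ-Arithmetic

  Cond : Set₁
  Cond = ℕ → ℕ → ℕ → Set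

  -- the span of 7ᵉ tⁱ hʲ over ℤ[1/2], intersected with the ring
  data Span (K : Cond) : Carrier → Set where
    zeroˢ   : Span K (ι (+ 0))
    gen     : ∀ c e i j → K e i j → Span K (ι (c ℤ.* + (7 ^ e)) ⊗ (t ↑ i ⊗ h ↑ j))
    _⊞_     : ∀ {f f′} → Span K f → Span K f′ → Span K (f ⊕ f′)
    resp    : ∀ {f f′} → f ≈ f′ → Span K f → Span K f′
    quarter : ∀ {f} → Span K (ι (+ 4) ⊗ f) → Span K f

  record Linear (Φ : Carrier → Carrier) : Set where
    field
      Φ-cong : ∀ {f f′} → f ≈ f′ → Φ f ≈ Φ f′
      Φ-⊕    : ∀ f f′ → Φ (f ⊕ f′) ≈ Φ f ⊕ Φ f′
      Φ-ι    : ∀ c f → Φ (ι c ⊗ f) ≈ ι c ⊗ Φ f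

    Φ-0 : Φ (ι (+ 0)) ≈ ι (+ 0)
    Φ-0 = ≈-trans (Φ-cong (≈-trans ι-0 (≈-sym (≈-trans (*-congʳ ι-0) (zeroˡ (ι (+ 0))))))) (≈-trans (Φ-ι (+ 0) (ι (+ 0))) (≈-trans (*-congʳ ι-0) (≈-trans (zeroˡ _) 0≐)))

  -- A linear map is followed on generators only. Compatibility with integer scalars carries the
  -- claim through `quarter`.
  span-map : ∀ {K K′ Φ} → Linear Φ → (∀ c e i j → K e i j → Span K′ (Φ (ι (c ℤ.* + (7 ^ e)) ⊗ (t ↑ i ⊗ h ↑ j)))) → ∀ {f} → Span K f → Span K′ (Φ f)
  span-map L F zeroˢ           = resp (≈-sym (Linear.Φ-0 L)) zeroˢ
  span-map L F (gen c e i j k) = F c e i j k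
  span-map L F (s ⊞ s′)        = resp (≈-sym (Linear.Φ-⊕ L _ _)) (span-map L F s ⊞ span-map L F s′)
  span-map L F (resp p s)      = resp (Linear.Φ-cong L p) (span-map L F s)
  span-map L F (quarter s)     = quarter (resp (Linear.Φ-ι L (+ 4) _) (span-map L F s))

  mul-linear : ∀ a → Linear (a ⊗_)
  mul-linear a = record { Φ-cong = *-congˡ ; Φ-⊕ = ⊗-distribˡ a
    ; Φ-ι = λ c f → solve (a ∷ ι c ∷ f ∷ []) (v 0 :* (v 1 :* v 2)) (v 1 :* (v 0 :* v 2)) refl }

  U-ι : ∀ c f → U (ι c ⊗ f) ≈ ι c ⊗ U f
  U-ι c f = ≈-trans (U-cong (*-congʳ (≈-sym (VH.F-ι c)))) (U-V (ι c) f)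

  ι-7 : ∀ c c′ e e′ → ι (c ℤ.* + (7 ^ e)) ⊗ ι (c′ ℤ.* + (7 ^ e′)) ≈ ι (c ℤ.* c′ ℤ.* + (7 ^ (e + e′)))
  ι-7 c c′ e e′ = ≈-trans (≈-sym (ι-* _ _)) (≈-reflexive (cong ι (trans (regroup c (+ (7 ^ e)) c′ (+ (7 ^ e′)))
    (cong (λ z → c ℤ.* c′ ℤ.* z) (trans (sym (ℤₚ.pos-* (7 ^ e) (7 ^ e′))) (cong +_ (sym (ℕₚ.^-distribˡ-+-* 7 e e′))))))))
    where
    open import Data.Integer.Tactic.RingSolver using (solve-∀)
    regroup : ∀ a b c d → (a ℤ.* b) ℤ.* (c ℤ.* d) ≡ (a ℤ.* c) ℤ.* (b ℤ.* d)
    regroup = solve-∀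

  -- μ is the power of u under U. Both bounds on i have slope 2/7 in μ because seven steps of the
  -- recurrence cost t²; the constants c and low absorb the tabulated starting values.
  record Bound (m μ c low e i j : ℕ) : Set where
    constructor bound
    field
      val   : m ≤ e
      upper : 7 * i ≤ 4 * e + 2 * μ + c
      lower : 2 * μ + 7 * j + low ≤ 7 * i
      hdeg  : j ≤ 2

  -- One summand of the recurrence. Passing from μ + r to μ + 7 and multiplying by 7ᵏ tᵉ preserves
  -- the bounds as soon as 14 ≤ 7e + 2r ≤ 14 + 4k. The factor 4 is forced by 21 ξ⁵, where k = 1, e =
  -- 2 and r = 2 give equality.
  raise : ∀ {m m′ μ c low f} d k e r → 7 * e + 2 * r ≤ 4 * k + 14 → 14 ≤ 7 * e + 2 * r → m′ ≤ m + k →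
    Span (Bound m (r + μ) c low) f → Span (Bound m′ (7 + μ) c low) (ι (d ℤ.* + (7 ^ k)) ⊗ t ↑ e ⊗ f)
  raise {m} {m′} {μ} {c} {low} d k e r p s l = span-map (mul-linear _) λ c′ e′ i j b → resp
    (≈-sym (lincomb (ι (d ℤ.* + (7 ^ k)) ∷ t ↑ e ∷ ι (c′ ℤ.* + (7 ^ e′)) ∷ t ↑ i ∷ h ↑ j ∷ ι (c′ ℤ.* d ℤ.* + (7 ^ (e′ + k))) ∷ t ↑ (i + e) ∷ [])
      (v 0 :* v 1 :* (v 2 :* (v 3 :* v 4))) (v 5 :* (v 6 :* v 4))
      ((v 1 :* v 3 :* v 4 , v 2 :* v 0 ≐ v 5) ∷ (:- (v 5 :* v 4) , v 6 ≐ v 3 :* v 1) ∷ []) refl (ι-7 c′ d e′ k ∷ ↑-+ t i e ∷ [])))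
    (gen (c′ ℤ.* d) (e′ + k) (i + e) j (bound (ℕₚ.≤-trans l (ℕₚ.+-monoˡ-≤ k (Bound.val b)))
      (upper-step e′ i μ c k e r (Bound.upper b) p) (lower-step i j μ low e r (Bound.lower b) s) (Bound.hdeg b)))

-- The recurrence for U on powers of u = 1/ξ

module Iteration (FS : FullSetting) where
  open FullSetting FS
  open Setting S
  open Tower S
  open Heptic S
  open Tables S
  open ℕ-Arithmetic
  open Spans FS

  -- The factor ξ⁶ makes μ = 0, ..., 6 correspond to the tabulated powers ξ⁶, ..., ξ⁰. The factor
  -- `m` makes the values polynomial in g and h, and tⁿ turns the powers of g into nonnegative
  -- powers of t.
  F : Carrier → Carrier → ℕ → ℕ → Carrier
  F m X n μ = t ↑ n ⊗ (m ⊗ U (u ↑ μ ⊗ (ξ ↑ 6 ⊗ X)))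

  Vsum Usum : List (Carrier × Carrier) → Carrier
  Vsum []            = ι (+ 0)
  Vsum ((p , y) ∷ l) = V p ⊗ y ⊕ Vsum l
  Usum []            = ι (+ 0)
  Usum ((p , y) ∷ l) = p ⊗ U y ⊕ Usum l

  U-Vsum : ∀ l → U (Vsum l) ≈ Usum l
  U-Vsum []            = ≈-trans (U-cong (≈-trans ι-0 (≈-sym (≈-trans (*-congʳ ι-0) (zeroˡ _))))) (≈-trans (U-ι (+ 0) (ι (+ 0))) (≈-trans (*-congʳ ι-0) (≈-trans (zeroˡ _) 0≐)))
  U-Vsum ((p , y) ∷ l) = ≈-trans (U-⊕ _ _) (+-cong (U-V p y) (U-Vsum l))

  -- The degree 7 equation of ξ multiplied by u⁷⁺μ. V(g)² leaves U as g² and is divided off, so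
  -- coefficients free of V(g) acquire t² and those linear in V(g) acquire t.
  recurrence : ∀ m X n μ → F m X n (7 + μ) ≈
    ι (+ 1) ⊗ t ↑ 2 ⊗ F m X n μ ⊕ (ι (+ 7) ⊗ t ↑ 2 ⊗ F m X n (1 + μ) ⊕ (ι (+ 21) ⊗ t ↑ 2 ⊗ F m X n (2 + μ) ⊕ (ι (+ 49) ⊗ t ↑ 2 ⊗ F m X n (3 + μ)
    ⊕ (ι (+ 147) ⊗ t ↑ 2 ⊗ F m X n (4 + μ) ⊕ (ι (+ 7) ⊗ t ↑ 1 ⊗ F m X n (4 + μ) ⊕ (ι (+ 343) ⊗ t ↑ 2 ⊗ F m X n (5 + μ) ⊕ (ι (+ 35) ⊗ t ↑ 1 ⊗ F m X n (5 + μ)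
    ⊕ (ι (+ 343) ⊗ t ↑ 2 ⊗ F m X n (6 + μ) ⊕ ι (+ 49) ⊗ t ↑ 1 ⊗ F m X n (6 + μ)))))))))
  recurrence m X n μ = lincomb (t ∷ g ∷ t ↑ n ∷ m ∷ W 0 ∷ W 1 ∷ W 2 ∷ W 3 ∷ W 4 ∷ W 5 ∷ W 6 ∷ W 7 ∷ [])
    (v 2 :* (v 3 :* v 11))
    (f (# 1) 2 4 :+ (f (# 7) 2 5 :+ (f (# 21) 2 6 :+ (f (# 49) 2 7 :+ (f (# 147) 2 8 :+ (f (# 7) 1 8 :+ (f (# 343) 2 9 :+ (f (# 35) 1 9 :+ (f (# 343) 2 10 :+ f (# 49) 1 10)))))))))
    ((v 2 :* v 3 :* v 0 :^ 2 , v 1 :^ 2 :* v 11 ≐ # 1 :* v 4 :+ (# 7 :* v 5 :+ (# 21 :* v 6 :+ (# 49 :* v 7 :+ ((# 147 :+ # 7 :* v 1) :* v 8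
        :+ ((# 343 :+ # 35 :* v 1) :* v 9 :+ ((# 343 :+ # 49 :* v 1) :* v 10 :+ # 0)))))))
      ∷ (:- (v 2 :* v 3 :* v 11 :* (v 0 :* v 1 :+ # 1)) :+ v 2 :* v 3 :* v 0 :* (# 7 :* v 8 :+ # 35 :* v 9 :+ # 49 :* v 10) , v 0 :* v 1 ≐ # 1) ∷ []) refl
    (≈-trans (≈-sym (U-V (g ↑ 2) (u ↑ (7 + μ) ⊗ Y))) (≈-trans (U-cong top) (U-Vsum terms)) ∷ t-g ∷ [])
    where
    Y = ξ ↑ 6 ⊗ X
    W : ℕ → Carrier
    W r = U (u ↑ (r + μ) ⊗ Y)
    f : Expr → ℕ → ℕ → Expr
    f c e i = c :* v 0 :^ e :* (v 2 :* (v 3 :* v i))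
    p₄ p₅ p₆ : Expr
    p₄ = # 147 :+ # 7 :* v 0
    p₅ = # 343 :+ # 35 :* v 0
    p₆ = # 343 :+ # 49 :* v 0
    terms : List (Carrier × Carrier)
    terms = (ι (+ 1) , u ↑ (0 + μ) ⊗ Y) ∷ (ι (+ 7) , u ↑ (1 + μ) ⊗ Y) ∷ (ι (+ 21) , u ↑ (2 + μ) ⊗ Y) ∷ (ι (+ 49) , u ↑ (3 + μ) ⊗ Y)
      ∷ (⟦ p₄ ⟧ (env (g ∷ [])) , u ↑ (4 + μ) ⊗ Y) ∷ (⟦ p₅ ⟧ (env (g ∷ [])) , u ↑ (5 + μ) ⊗ Y) ∷ (⟦ p₆ ⟧ (env (g ∷ [])) , u ↑ (6 + μ) ⊗ Y) ∷ []
    top : V (g ↑ 2) ⊗ (u ↑ (7 + μ) ⊗ Y) ≈ Vsum terms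
    top = lincomb (u ∷ u ↑ μ ∷ Y ∷ V g ∷ ξ ∷ V (g ↑ 2) ∷ V (ι (+ 1)) ∷ V (ι (+ 7)) ∷ V (ι (+ 21)) ∷ V (ι (+ 49))
        ∷ V (⟦ p₄ ⟧ (env (g ∷ []))) ∷ V (⟦ p₅ ⟧ (env (g ∷ []))) ∷ V (⟦ p₆ ⟧ (env (g ∷ []))) ∷ [])
      (v 5 :* (uu 7 :* v 2))
      (v 6 :* (uu 0 :* v 2) :+ (v 7 :* (uu 1 :* v 2) :+ (v 8 :* (uu 2 :* v 2) :+ (v 9 :* (uu 3 :* v 2) :+ (v 10 :* (uu 4 :* v 2) :+ (v 11 :* (uu 5 :* v 2) :+ (v 12 :* (uu 6 :* v 2) :+ # 0)))))))
      ((uu 7 :* v 2 , v 5 ≐ v 3 :^ 2) ∷ (:- (uu 0 :* v 2) , v 6 ≐ # 1) ∷ (:- (uu 1 :* v 2) , v 7 ≐ # 7) ∷ (:- (uu 2 :* v 2) , v 8 ≐ # 21) ∷ (:- (uu 3 :* v 2) , v 9 ≐ # 49)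
        ∷ (:- (uu 4 :* v 2) , v 10 ≐ P₄) ∷ (:- (uu 5 :* v 2) , v 11 ≐ P₅) ∷ (:- (uu 6 :* v 2) , v 12 ≐ P₆)
        ∷ (uu 7 :* v 2 , v 3 :^ 2 ≐ v 4 :^ 7 :+ # 7 :* v 4 :^ 6 :+ # 21 :* v 4 :^ 5 :+ # 49 :* v 4 :^ 4 :+ P₄ :* v 4 :^ 3 :+ P₅ :* v 4 :^ 2 :+ P₆ :* v 4)
        ∷ (v 2 :* (uu 0 :* geo 7 :+ # 7 :* uu 1 :* geo 6 :+ # 21 :* uu 2 :* geo 5 :+ # 49 :* uu 3 :* geo 4 :+ P₄ :* uu 4 :* geo 3 :+ P₅ :* uu 5 :* geo 2 :+ P₆ :* uu 6) , v 0 :* v 4 ≐ # 1) ∷ []) refl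
      (VH.F-↑ g 2 ∷ VH.F-ι (+ 1) ∷ VH.F-ι (+ 7) ∷ VH.F-ι (+ 21) ∷ VH.F-ι (+ 49) ∷ VH.F-⟦⟧ (g ∷ []) p₄ ∷ VH.F-⟦⟧ (g ∷ []) p₅ ∷ VH.F-⟦⟧ (g ∷ []) p₆ ∷ charpoly ∷ u-ξ ∷ [])
      where
      P₄ = # 147 :+ # 7 :* v 3
      P₅ = # 343 :+ # 35 :* v 3
      P₆ = # 343 :+ # 49 :* v 3
      uu : ℕ → Expr
      uu zero    = v 1
      uu (suc r) = v 0 :* uu r
      geo : ℕ → Expr
      geo zero    = # 0
      geo (suc k) = # 1 :+ v 0 :* v 4 :* geo k

  -- Only the leading coefficient 1 of the equation is prime to 7, so for k = 1 the extra factor 7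
  -- is required of the oldest of the seven values alone.
  step : ∀ {m X n μ c low} k → k ≤ 1 → Span (Bound k μ c low) (F m X n μ) → Span (Bound 0 (1 + μ) c low) (F m X n (1 + μ)) → Span (Bound 0 (2 + μ) c low) (F m X n (2 + μ))
    → Span (Bound 0 (3 + μ) c low) (F m X n (3 + μ)) → Span (Bound 0 (4 + μ) c low) (F m X n (4 + μ)) → Span (Bound 0 (5 + μ) c low) (F m X n (5 + μ))
    → Span (Bound 0 (6 + μ) c low) (F m X n (6 + μ)) → Span (Bound k (7 + μ) c low) (F m X n (7 + μ))
  step {m} {X} {n} {μ} k k≤1 s₀ s₁ s₂ s₃ s₄ s₅ s₆ = resp (≈-sym (recurrence m X n μ))
    -- The arguments are cofactor, valuation, power of t and offset: 21 = 3 · 7, 49 = 7², 147 = 3 ·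
    -- 7², 343 = 7³, 35 = 5 · 7.
    (raise (+ 1) 0 2 0 ok ok (ℕₚ.≤-reflexive (sym (ℕₚ.+-identityʳ k))) s₀ ⊞ (raise (+ 1) 1 2 1 ok ok k≤1 s₁ ⊞ (raise (+ 3) 1 2 2 ok ok k≤1 s₂
      ⊞ (raise (+ 1) 2 2 3 ok ok k≤2 s₃ ⊞ (raise (+ 3) 2 2 4 ok ok k≤2 s₄ ⊞ (raise (+ 1) 1 1 4 ok ok k≤1 s₄ ⊞ (raise (+ 1) 3 2 5 ok ok k≤3 s₅
      ⊞ (raise (+ 5) 1 1 5 ok ok k≤1 s₅ ⊞ (raise (+ 1) 3 2 6 ok ok k≤3 s₆ ⊞ raise (+ 1) 2 1 6 ok ok k≤2 s₆)))))))))
    where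
    ok : ∀ {a b} → {T (a ≤ᵇ b)} → a ≤ b
    ok {a} {b} {p} = ℕₚ.≤ᵇ⇒≤ a b p
    k≤2 : k ≤ 2
    k≤2 = ℕₚ.≤-trans k≤1 (s≤s z≤n)
    k≤3 : k ≤ 3
    k≤3 = ℕₚ.≤-trans k≤1 (s≤s z≤n)

  u-cancel : ∀ X k μ → u ↑ μ ⊗ (ξ ↑ (μ + k) ⊗ X) ≈ ξ ↑ k ⊗ X
  u-cancel X k zero    = one⊗ _
  u-cancel X k (suc μ) = lincomb (u ∷ u ↑ μ ∷ ξ ∷ ξ ↑ (μ + k) ∷ X ∷ ξ ↑ k ∷ []) (v 0 :* v 1 :* (v 2 :* v 3 :* v 4)) (v 5 :* v 4)
    ((v 1 :* v 3 :* v 4 , v 0 :* v 2 ≐ # 1) ∷ (# 1 , v 1 :* (v 3 :* v 4) ≐ v 5 :* v 4) ∷ []) refl (u-ξ ∷ u-cancel X k μ ∷ [])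

  ⟦:^⟧ : ∀ e k ρ → ⟦ e :^ k ⟧ ρ ≈ ⟦ e ⟧ ρ ↑ k
  ⟦:^⟧ e zero    ρ = ≈-refl
  ⟦:^⟧ e (suc k) ρ = *-congˡ (⟦:^⟧ e k ρ)

  tg-cancel : ∀ k → t ↑ k ⊗ g ↑ k ≈ ι (+ 1)
  tg-cancel zero    = one⊗ _
  tg-cancel (suc k) = lincomb (t ∷ g ∷ t ↑ k ∷ g ↑ k ∷ []) (v 0 :* v 2 :* (v 1 :* v 3)) (# 1)
    ((v 2 :* v 3 , v 0 :* v 1 ≐ # 1) ∷ (# 1 , v 2 :* v 3 ≐ # 1) ∷ []) refl (t-g ∷ tg-cancel k ∷ [])

  okRow : (m μ c low n : ℕ) → List Term → Bool
  okRow m μ c low n []                     = true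
  okRow m μ c low n ((z , e , i , j) ∷ ts) = if m ≤ᵇ e then (if 7 * i ≤ᵇ 4 * e + 2 * μ + c then (if 2 * μ + 7 * j + low ≤ᵇ 7 * i then
    (if j ≤ᵇ 2 then (if i ≤ᵇ n then okRow m μ c low n ts else false) else false) else false) else false) else false

  ≤ᵇ-true : ∀ a b → (a ≤ᵇ b) ≡ true → a ≤ b
  ≤ᵇ-true a b e = ℕₚ.≤ᵇ⇒≤ a b (subst T (sym e) tt)

  row-span : ∀ m μ c low n ts → okRow m μ c low n ts ≡ true → Span (Bound m μ c low) (t ↑ n ⊗ ⟦ rowE n ts ⟧ (env (g ∷ h ∷ [])))
  row-span m μ c low n []                     ok = resp (≈-sym (≈-trans (*-congˡ ι-0) (≈-trans (zeroʳ _) 0≐))) zeroˢ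
  row-span m μ c low n ((z , e , i , j) ∷ ts) ok = resp (≈-sym (⊗-distribˡ _ _ _)) (resp (≈-sym first)
      (gen z e i j (bound (≤ᵇ-true m e (proj₁ o₁)) (≤ᵇ-true (7 * i) _ (proj₁ o₂)) (≤ᵇ-true _ (7 * i) (proj₁ o₃)) (≤ᵇ-true j 2 (proj₁ o₄))))
    ⊞ row-span m μ c low n ts (proj₂ o₅))
    where
    o₁ = if-both (m ≤ᵇ e) ok
    o₂ = if-both (7 * i ≤ᵇ 4 * e + 2 * μ + c) (proj₂ o₁)
    o₃ = if-both (2 * μ + 7 * j + low ≤ᵇ 7 * i) (proj₂ o₂)
    o₄ = if-both (j ≤ᵇ 2) (proj₂ o₃)
    o₅ = if-both (i ≤ᵇ n) (proj₂ o₄)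
    ρ = env (g ∷ h ∷ [])
    first : t ↑ n ⊗ (ι (z ℤ.* + (7 ^ e)) ⊗ (⟦ v 0 :^ (n ∸ i) ⟧ ρ ⊗ ⟦ v 1 :^ j ⟧ ρ)) ≈ ι (z ℤ.* + (7 ^ e)) ⊗ (t ↑ i ⊗ h ↑ j)
    first = lincomb (t ↑ n ∷ ι (z ℤ.* + (7 ^ e)) ∷ ⟦ v 0 :^ (n ∸ i) ⟧ ρ ∷ ⟦ v 1 :^ j ⟧ ρ ∷ t ↑ i ∷ h ↑ j ∷ t ↑ (n ∸ i) ∷ g ↑ (n ∸ i) ∷ [])
      (v 0 :* (v 1 :* (v 2 :* v 3))) (v 1 :* (v 4 :* v 5))
      ((v 1 :* v 2 :* v 3 , v 0 ≐ v 4 :* v 6) ∷ (v 1 :* v 4 :* v 6 :* v 3 , v 2 ≐ v 7) ∷ (v 1 :* v 4 :* v 6 :* v 7 , v 3 ≐ v 5) ∷ (v 1 :* v 4 :* v 5 , v 6 :* v 7 ≐ # 1) ∷ []) refl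
      (≈-trans (≈-reflexive (cong (t ↑_) (sym (ℕₚ.m+[n∸m]≡n (≤ᵇ-true i n (proj₁ o₅)))))) (↑-+ t i (n ∸ i)) ∷ ⟦:^⟧ (v 0) (n ∸ i) ρ ∷ ⟦:^⟧ (v 1) j ρ ∷ tg-cancel (n ∸ i) ∷ [])

  base-span : ∀ {m X n c low} k μ μ+k ts → μ + k ≡ μ+k → μ+k ≡ 6 → m ⊗ U (ξ ↑ k ⊗ X) ≈ ⟦ rowE n ts ⟧ (env (g ∷ h ∷ [])) → ∀ b → okRow b μ c low n ts ≡ true →
    Span (Bound b μ c low) (F m X n μ)
  base-span {m} {X} {n} {c} {low} k μ μ+k ts refl e p b ok = resp
    (*-congˡ (≈-sym (≈-trans (*-congˡ (U-cong (≈-trans (*-congˡ (*-congʳ (≈-reflexive (cong (ξ ↑_) (sym e))))) (u-cancel X k μ)))) p)))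
    (row-span b μ c low n ts ok)

  record Window (m X : Carrier) (n c low μ : ℕ) : Set where
    constructor window
    field
      w₀ : Span (Bound 0 (0 + μ) c low) (F m X n (0 + μ))
      w₁ : Span (Bound 0 (1 + μ) c low) (F m X n (1 + μ))
      w₂ : Span (Bound 0 (2 + μ) c low) (F m X n (2 + μ))
      w₃ : Span (Bound 0 (3 + μ) c low) (F m X n (3 + μ))
      w₄ : Span (Bound 0 (4 + μ) c low) (F m X n (4 + μ))
      w₅ : Span (Bound 0 (5 + μ) c low) (F m X n (5 + μ))
      w₆ : Span (Bound 0 (6 + μ) c low) (F m X n (6 + μ))

  advance : ∀ {m X n c low μ} → Window m X n c low μ → Window m X n c low (suc μ)
  advance {m} {X} {n} {c} {low} {μ} (window s₀ s₁ s₂ s₃ s₄ s₅ s₆) = window (re 0 s₁) (re 1 s₂) (re 2 s₃) (re 3 s₄) (re 4 s₅) (re 5 s₆) (re 6 (step {m} {X} {n} {μ} {c} {low} 0 z≤n s₀ s₁ s₂ s₃ s₄ s₅ s₆))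
    where
    re : ∀ r → Span (Bound 0 (suc r + μ) c low) (F m X n (suc r + μ)) → Span (Bound 0 (r + suc μ) c low) (F m X n (r + suc μ))
    re r = subst (λ z → Span (Bound 0 z c low) (F m X n z)) (sym (ℕₚ.+-suc r μ))

  windows : ∀ {m X n c low} → Window m X n c low 0 → ∀ μ → Window m X n c low μ
  windows w zero    = w
  windows w (suc μ) = advance (windows w μ)

-- The two alternating steps and their 7-adic gain

module Divisibility (FS : FullSetting) where
  open FullSetting FS
  open Setting S
  open Tower S
  open Heptic S
  open Tables S
  open ℕ-Arithmetic
  open Spans FS
  open Iteration FS

  okRows : ℕ → ℕ → ℕ → List (List Term) → Bool
  okRows c low n (r₀ ∷ r₁ ∷ r₂ ∷ r₃ ∷ r₄ ∷ r₅ ∷ r₆ ∷ []) = if okRow 0 6 c low n r₀ then (if okRow 0 5 c low n r₁ then (if okRow 0 4 c low n r₂ then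
    (if okRow 0 3 c low n r₃ then (if okRow 0 2 c low n r₄ then (if okRow 0 1 c low n r₅ then (if okRow 0 0 c low n r₆ then true else false) else false) else false)
      else false) else false) else false) else false
  okRows c low n _ = false

  start-window : ∀ {m X} n c low rows → Rows m X 0 (map (rowE n) rows) → okRows c low n rows ≡ true → Window m X n c low 0
  start-window n c low (r₀ ∷ r₁ ∷ r₂ ∷ r₃ ∷ r₄ ∷ r₅ ∷ r₆ ∷ []) (p₀ , p₁ , p₂ , p₃ , p₄ , p₅ , p₆ , _) ok = window
    (base-span 6 0 6 r₆ refl refl p₆ 0 (proj₁ o₆)) (base-span 5 1 6 r₅ refl refl p₅ 0 (proj₁ o₅)) (base-span 4 2 6 r₄ refl refl p₄ 0 (proj₁ o₄))
    (base-span 3 3 6 r₃ refl refl p₃ 0 (proj₁ o₃)) (base-span 2 4 6 r₂ refl refl p₂ 0 (proj₁ o₂)) (base-span 1 5 6 r₁ refl refl p₁ 0 (proj₁ o₁))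
    (base-span 0 6 6 r₀ refl refl p₀ 0 (proj₁ o₀))
    where
    o₀ = if-both (okRow 0 6 c low n r₀) ok
    o₁ = if-both (okRow 0 5 c low n r₁) (proj₂ o₀)
    o₂ = if-both (okRow 0 4 c low n r₂) (proj₂ o₁)
    o₃ = if-both (okRow 0 3 c low n r₃) (proj₂ o₂)
    o₄ = if-both (okRow 0 2 c low n r₄) (proj₂ o₃)
    o₅ = if-both (okRow 0 1 c low n r₅) (proj₂ o₄)
    o₆ = if-both (okRow 0 0 c low n r₆) (proj₂ o₅)

  -- Here and below the constants after the power of t are the smallest c and the largest low that
  -- the seven rows of the table admit.
  windows₀₀ : ∀ μ → Window (ι (+ 1)) (ι (+ 1)) 3 13 9 μ
  windows₀₀ = windows (start-window 3 13 9 rows₀₀ table₀₀ refl)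

  windows₀₁ : ∀ μ → Window w η 4 17 3 μ
  windows₀₁ = windows (start-window 4 17 3 rows₀₁ table₀₁ refl)

  windows₀₂ : ∀ μ → Window (ι (+ 4) ⊗ (w ⊗ w)) (η ⊗ η) 5 15 0 μ
  windows₀₂ = windows (start-window 5 15 0 rows₀₂ table₀₂ refl)

  windows₁₂ : ∀ μ → Window (w ⊗ w) (ι (+ 1)) 5 19 9 μ
  windows₁₂ = windows (start-window 5 19 9 rows₁₂ table₁₂ refl)

  windows₁₁ : ∀ μ → Window w ξ₂ 4 17 5 μ
  windows₁₁ = windows (start-window 4 17 5 rows₁₁ table₁₁ refl)

  windows₁₀ : ∀ μ → Window (ι (+ 1)) (ξ₂ ⊗ ξ₂) 3 15 1 μ
  windows₁₀ = windows (start-window 3 15 1 rows₁₀ table₁₀ refl)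

  -- Divisibility by 7 propagates along a residue class of μ modulo 7. It starts from rows all of
  -- whose terms are multiples of 7: ξ² ξ₂² at μ = 4, which leads to 11, and ξ⁵ η at μ = 1, which
  -- leads to 8 and 15.
  advance₇ : ∀ {m X n c low μ} → Window m X n c low μ → Span (Bound 1 μ c low) (F m X n μ) → Span (Bound 1 (7 + μ) c low) (F m X n (7 + μ))
  advance₇ {m} {X} {n} {c} {low} {μ} (window _ s₁ s₂ s₃ s₄ s₅ s₆) s = step {m} {X} {n} {μ} {c} {low} 1 ℕₚ.≤-refl s s₁ s₂ s₃ s₄ s₅ s₆

  -- Exceptionally these two are divisible by 7.
  special₁₁ : Span (Bound 1 11 15 1) (F (ι (+ 1)) (ξ₂ ⊗ ξ₂) 3 11)
  special₁₁ = advance₇ (windows₁₀ 4) (base-span {n = 3} 2 4 6 ((-[1+ 0 ] , 1 , 3 , 0) ∷ []) refl refl (proj₁ (proj₂ (proj₂ table₁₀))) 1 refl)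

  special₁₅ : Span (Bound 1 15 17 3) (F w η 4 15)
  special₁₅ = advance₇ (windows₀₁ 8) (advance₇ (windows₀₁ 1)
    (base-span {n = 4} 5 1 6 ((+ 1 , 2 , 3 , 0) ∷ (+ 1 , 3 , 4 , 0) ∷ (-[1+ 0 ] , 3 , 4 , 1) ∷ []) refl refl (proj₁ (proj₂ (proj₂ (proj₂ (proj₂ (proj₂ table₀₁)))))) 1 refl))

  -- Pulling tⁿ out of U leaves gⁿ⁺³ in front of `F`. The lower bound on i absorbs it, and the
  -- growth 8n/7 of the bounds becomes n/7 after the shift of i by n + 3.
  lower-span : ∀ {m f K} μ₀ c low z d n → 15 ≤ 2 * μ₀ + low → Span (Bound m (μ₀ + 4 * n) c low) f →
    (∀ e i j → m ≤ e → 7 * i + 21 ≤ 4 * e + n + 2 * μ₀ + c → n + 2 * μ₀ + 7 * j + low ≤ 7 * i + 21 → j ≤ 2 → K (d + e) i j) →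
    Span K (ι (z ℤ.* + (7 ^ d)) ⊗ (g ↑ (n + 3) ⊗ f))
  lower-span {m} {f} {K} μ₀ c low z d n le s k = resp (⊗-assoc _ _ _) (span-map (mul-linear _) go s)
    where
    go : ∀ c′ e i j → Bound m (μ₀ + 4 * n) c low e i j → Span K (ι (z ℤ.* + (7 ^ d)) ⊗ g ↑ (n + 3) ⊗ (ι (c′ ℤ.* + (7 ^ e)) ⊗ (t ↑ i ⊗ h ↑ j)))
    go c′ e i j b = resp (≈-sym term-eq) (gen (z ℤ.* c′) (d + e) i′ j (k e i′ j (Bound.val b)
        (upper-shift e i′ n μ₀ c (subst (λ x → 7 * x ≤ 4 * e + 2 * (μ₀ + 4 * n) + c) i≡ (Bound.upper b)))
        (lower-shift i′ j n μ₀ low (subst (λ x → 2 * (μ₀ + 4 * n) + 7 * j + low ≤ 7 * x) i≡ (Bound.lower b))) (Bound.hdeg b)))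
      where
      i′ = i ∸ (n + 3)
      i≡ : i ≡ i′ + (n + 3)
      i≡ = sym (ℕₚ.m∸n+n≡m (split-index i j n μ₀ low le (Bound.lower b)))
      term-eq : ι (z ℤ.* + (7 ^ d)) ⊗ g ↑ (n + 3) ⊗ (ι (c′ ℤ.* + (7 ^ e)) ⊗ (t ↑ i ⊗ h ↑ j)) ≈ ι (z ℤ.* c′ ℤ.* + (7 ^ (d + e))) ⊗ (t ↑ i′ ⊗ h ↑ j)
      term-eq = lincomb (ι (z ℤ.* + (7 ^ d)) ∷ g ↑ (n + 3) ∷ ι (c′ ℤ.* + (7 ^ e)) ∷ t ↑ i ∷ h ↑ j ∷ ι (z ℤ.* c′ ℤ.* + (7 ^ (d + e))) ∷ t ↑ i′ ∷ t ↑ (n + 3) ∷ [])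
        (v 0 :* v 1 :* (v 2 :* (v 3 :* v 4))) (v 5 :* (v 6 :* v 4))
        ((v 1 :* v 3 :* v 4 , v 0 :* v 2 ≐ v 5) ∷ (v 5 :* v 1 :* v 4 , v 3 ≐ v 6 :* v 7) ∷ (v 5 :* v 6 :* v 4 , v 7 :* v 1 ≐ # 1) ∷ []) refl
        (ι-7 z c′ d e ∷ ≈-trans (≈-reflexive (cong (t ↑_) i≡)) (↑-+ t i′ (n + 3)) ∷ tg-cancel (n + 3) ∷ [])

  -- Since η⁻¹ = ξ₂ u², this is u η⁻² in a form that avoids an inverse of η.
  Z : Carrier
  Z = u ↑ 5 ⊗ (ξ₂ ⊗ ξ₂)

  t-power : ∀ n → t ↑ n ≈ V (g ↑ n) ⊗ u ↑ (4 * n)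
  t-power zero    = ≈-sym (≈-trans (*-congʳ (VH.F-ι (+ 1))) (one⊗ _))
  t-power (suc n) = lincomb (t ∷ t ↑ n ∷ V (g ⊗ g ↑ n) ∷ V g ∷ V (g ↑ n) ∷ u ∷ u ↑ (4 * n) ∷ u ↑ (4 * suc n) ∷ [])
    (v 0 :* v 1) (v 2 :* v 7)
    ((v 1 , v 0 ≐ v 5 :^ 4 :* v 3) ∷ (v 5 :^ 4 :* v 3 , v 1 ≐ v 4 :* v 6) ∷ (:- v 7 , v 2 ≐ v 3 :* v 4) ∷ (:- (v 3 :* v 4) , v 7 ≐ v 5 :^ 4 :* v 6) ∷ []) refl
    (t-func ∷ t-power n ∷ VH.F-⊗ g (g ↑ n) ∷ ≈-trans (≈-reflexive (cong (u ↑_) (ℕₚ.*-suc 4 n))) (↑-+ u 4 (4 * n)) ∷ [])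

  pull : ∀ n y → U (t ↑ n ⊗ y) ≈ g ↑ n ⊗ U (u ↑ (4 * n) ⊗ y)
  pull n y = ≈-trans (U-cong (≈-trans (*-congʳ (t-power n)) (⊗-assoc _ _ _))) (U-V (g ↑ n) _)

  -- With κ = w t, a factor κʲ comes out of U together with the jth power of h = η u V(κ).
  pullᵏ : ∀ n κ y → U (t ↑ n ⊗ (V κ ⊗ y)) ≈ g ↑ n ⊗ (κ ⊗ U (u ↑ (4 * n) ⊗ y))
  pullᵏ n κ y = ≈-trans (pull n _) (*-congˡ (≈-trans (U-cong (solve (u ↑ (4 * n) ∷ V κ ∷ y ∷ []) (v 0 :* (v 1 :* v 2)) (v 1 :* (v 0 :* v 2)) refl)) (U-V κ _)))

  -- μ₀ is the power of u beyond 4n, after 6 is added for the ξ⁶ inside `F`. Each h contributes η u,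
  -- so μ₀ = 6 + j for U; with Z it is 11 - j, as each η ξ₂ = ξ² takes back two powers of u. The
  -- factor `p` is κʲ = wʲ tʲ, whence k = j and the power 3 + j of t.
  to-F : ∀ {y X m s} k μ₀ n p → u ↑ (4 * n) ⊗ y ≈ u ↑ (μ₀ + 4 * n) ⊗ (ξ ↑ 6 ⊗ X) → s ⊗ p ≈ t ↑ k ⊗ m →
    s ⊗ (g ↑ n ⊗ (p ⊗ U (u ↑ (4 * n) ⊗ y))) ≈ g ↑ (n + 3) ⊗ F m X (3 + k) (μ₀ + 4 * n)
  to-F {y} {X} {m} {s} k μ₀ n p e r = lincomb (s ∷ g ↑ n ∷ p ∷ U (u ↑ (4 * n) ⊗ y) ∷ U (u ↑ (μ₀ + 4 * n) ⊗ (ξ ↑ 6 ⊗ X)) ∷ t ↑ k ∷ m ∷ g ↑ (n + 3) ∷ g ∷ t ∷ [])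
    (v 0 :* (v 1 :* (v 2 :* v 3))) (v 7 :* (v 9 :* (v 9 :* (v 9 :* v 5)) :* (v 6 :* v 4)))
    ((v 0 :* v 1 :* v 2 , v 3 ≐ v 4) ∷ (v 1 :* v 4 , v 0 :* v 2 ≐ v 5 :* v 6) ∷ (:- (v 9 :^ 3 :* v 5 :* v 6 :* v 4) , v 7 ≐ v 1 :* v 8 :^ 3)
      ∷ (:- (v 1 :* v 5 :* v 6 :* v 4 :* ((v 9 :* v 8) :^ 2 :+ v 9 :* v 8 :+ # 1)) , v 9 :* v 8 ≐ # 1) ∷ []) refl
    (U-cong e ∷ r ∷ ↑-+ g n 3 ∷ t-g ∷ [])

  -- At the minimal valuation e = a these conditions leave only t, t² and t² h. On the first two
  -- `gain₀` yields a new factor 7, on the last the exceptional value `special₁₅`.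
  record Odd (a e i j : ℕ) : Set where
    constructor odd′
    field
      val   : a ≤ e
      upper : i + 4 * a ≤ 4 * e + 2
      lower : j < i
      hdeg  : j ≤ 2

  record Even (a e i j : ℕ) : Set where
    constructor even′
    field
      val   : suc a ≤ e
      upper : i + 4 * a ≤ 4 * e
      hdeg  : j ≤ 2

  U-step₀ : ∀ n → U (t ↑ n ⊗ h ↑ 0) ≈ g ↑ (n + 3) ⊗ F (ι (+ 1)) (ι (+ 1)) 3 (6 + 4 * n)
  U-step₀ n = ≈-trans (pull n _) (≈-trans (≈-sym (≈-trans (one⊗ _) (*-congˡ (one⊗ _)))) (to-F 0 6 n (ι (+ 1))
    (lincomb (u ∷ ξ ∷ u ↑ (4 * n) ∷ []) (v 2 :* # 1) (v 0 :* (v 0 :* (v 0 :* (v 0 :* (v 0 :* (v 0 :* v 2))))) :* (v 1 :^ 6 :* # 1))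
      ((:- (v 2 :* geo) , v 0 :* v 1 ≐ # 1) ∷ []) refl (u-ξ ∷ [])) ≈-refl))
    where geo = (v 0 :* v 1) :^ 5 :+ (v 0 :* v 1) :^ 4 :+ (v 0 :* v 1) :^ 3 :+ (v 0 :* v 1) :^ 2 :+ v 0 :* v 1 :+ # 1

  h-pull : h ≈ V (w ⊗ t) ⊗ (η ⊗ u)
  h-pull = ≈-trans h-func (⊗-comm _ _)

  h-pull² : h ⊗ (h ⊗ ι (+ 1)) ≈ V ((w ⊗ t) ⊗ (w ⊗ t)) ⊗ (η ⊗ η ⊗ (u ⊗ u))
  h-pull² = lincomb (h ∷ η ∷ u ∷ V (w ⊗ t) ∷ V ((w ⊗ t) ⊗ (w ⊗ t)) ∷ []) (v 0 :* (v 0 :* # 1)) (v 4 :* (v 1 :* v 1 :* (v 2 :* v 2)))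
    ((v 0 :+ v 3 :* (v 1 :* v 2) , v 0 ≐ v 3 :* (v 1 :* v 2)) ∷ (:- (v 1 :^ 2 :* v 2 :^ 2) , v 4 ≐ v 3 :* v 3) ∷ []) refl (h-pull ∷ VH.F-⊗ _ _ ∷ [])

  U-step₁ : ∀ n → U (t ↑ n ⊗ h ↑ 1) ≈ g ↑ (n + 3) ⊗ F w η 4 (7 + 4 * n)
  U-step₁ n = ≈-trans (U-cong (*-congˡ (≈-trans (≈-trans (*-congˡ ι-1) (*-identityʳ h)) h-pull))) (≈-trans (pullᵏ n (w ⊗ t) _) (≈-trans (≈-sym (one⊗ _)) (to-F 1 7 n (w ⊗ t)
    (lincomb (u ∷ ξ ∷ u ↑ (4 * n) ∷ η ∷ []) (v 2 :* (v 3 :* v 0)) (v 0 :* (v 0 :* (v 0 :* (v 0 :* (v 0 :* (v 0 :* (v 0 :* v 2)))))) :* (v 1 :^ 6 :* v 3))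
      ((:- (v 2 :* v 0 :* v 3 :* geo) , v 0 :* v 1 ≐ # 1) ∷ []) refl (u-ξ ∷ []))
    (solve (w ∷ t ∷ []) (# 1 :* (v 0 :* v 1)) (v 1 :^ 1 :* v 0) refl))))
    where geo = (v 0 :* v 1) :^ 5 :+ (v 0 :* v 1) :^ 4 :+ (v 0 :* v 1) :^ 3 :+ (v 0 :* v 1) :^ 2 :+ v 0 :* v 1 :+ # 1

  U-step₂ : ∀ n → ι (+ 4) ⊗ U (t ↑ n ⊗ h ↑ 2) ≈ g ↑ (n + 3) ⊗ F (ι (+ 4) ⊗ (w ⊗ w)) (η ⊗ η) 5 (8 + 4 * n)
  U-step₂ n = ≈-trans (*-congˡ (≈-trans (U-cong (*-congˡ h-pull²)) (pullᵏ n ((w ⊗ t) ⊗ (w ⊗ t)) _))) (to-F 2 8 n ((w ⊗ t) ⊗ (w ⊗ t))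
    (lincomb (u ∷ ξ ∷ u ↑ (4 * n) ∷ η ∷ []) (v 2 :* (v 3 :* v 3 :* (v 0 :* v 0))) (v 0 :* (v 0 :* (v 0 :* (v 0 :* (v 0 :* (v 0 :* (v 0 :* (v 0 :* v 2))))))) :* (v 1 :^ 6 :* (v 3 :* v 3)))
      ((:- (v 2 :* v 0 :^ 2 :* v 3 :^ 2 :* geo) , v 0 :* v 1 ≐ # 1) ∷ []) refl (u-ξ ∷ []))
    (solve (w ∷ t ∷ []) (# 4 :* (v 0 :* v 1 :* (v 0 :* v 1))) (v 1 :^ 2 :* (# 4 :* (v 0 :* v 0))) refl))
    where geo = (v 0 :* v 1) :^ 5 :+ (v 0 :* v 1) :^ 4 :+ (v 0 :* v 1) :^ 3 :+ (v 0 :* v 1) :^ 2 :+ v 0 :* v 1 :+ # 1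

  Z-step₀ : ∀ n → U (Z ⊗ (t ↑ n ⊗ h ↑ 0)) ≈ g ↑ (n + 3) ⊗ F (ι (+ 1)) (ξ₂ ⊗ ξ₂) 3 (11 + 4 * n)
  Z-step₀ n = ≈-trans (U-cong (solve (u ↑ 5 ∷ ξ₂ ∷ t ↑ n ∷ []) (v 0 :* (v 1 :* v 1) :* (v 2 :* # 1)) (v 2 :* (v 0 :* (v 1 :* v 1))) refl))
    (≈-trans (pull n _) (≈-trans (≈-sym (≈-trans (one⊗ _) (*-congˡ (one⊗ _)))) (to-F 0 11 n (ι (+ 1))
    (lincomb (u ∷ ξ ∷ u ↑ (4 * n) ∷ ξ₂ ∷ []) (v 2 :* (v 0 :^ 5 :* (v 3 :* v 3)))
      (v 0 :* (v 0 :* (v 0 :* (v 0 :* (v 0 :* (v 0 :* (v 0 :* (v 0 :* (v 0 :* (v 0 :* (v 0 :* v 2)))))))))) :* (v 1 :^ 6 :* (v 3 :* v 3)))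
      ((:- (v 2 :* v 0 :^ 5 :* v 3 :^ 2 :* geo) , v 0 :* v 1 ≐ # 1) ∷ []) refl (u-ξ ∷ [])) ≈-refl)))
    where geo = (v 0 :* v 1) :^ 5 :+ (v 0 :* v 1) :^ 4 :+ (v 0 :* v 1) :^ 3 :+ (v 0 :* v 1) :^ 2 :+ v 0 :* v 1 :+ # 1

  Z-step₁ : ∀ n → U (Z ⊗ (t ↑ n ⊗ h ↑ 1)) ≈ g ↑ (n + 3) ⊗ F w ξ₂ 4 (10 + 4 * n)
  Z-step₁ n = ≈-trans (U-cong (lincomb (u ↑ 5 ∷ ξ₂ ∷ t ↑ n ∷ h ∷ V (w ⊗ t) ∷ η ∷ u ∷ []) (v 0 :* (v 1 :* v 1) :* (v 2 :* (v 3 :* # 1))) (v 2 :* (v 4 :* (v 5 :* v 6 :* (v 0 :* (v 1 :* v 1)))))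
      ((v 0 :* v 1 :^ 2 :* v 2 , v 3 ≐ v 4 :* (v 5 :* v 6)) ∷ []) refl (h-pull ∷ [])))
    (≈-trans (pullᵏ n (w ⊗ t) _) (≈-trans (≈-sym (one⊗ _)) (to-F 1 10 n (w ⊗ t)
    (lincomb (u ∷ ξ ∷ u ↑ (4 * n) ∷ η ∷ ξ₂ ∷ []) (v 2 :* (v 3 :* v 0 :* (v 0 :^ 5 :* (v 4 :* v 4))))
      (v 0 :* (v 0 :* (v 0 :* (v 0 :* (v 0 :* (v 0 :* (v 0 :* (v 0 :* (v 0 :* (v 0 :* v 2))))))))) :* (v 1 :^ 6 :* v 4))
      ((v 2 :* v 0 :^ 6 :* v 4 , v 3 :* v 4 ≐ v 1 :* v 1) ∷ (:- (v 2 :* v 0 :^ 4 :* v 4 :* ((v 0 :* v 1) :^ 5 :+ (v 0 :* v 1) :^ 4 :+ (v 0 :* v 1) :^ 3 :+ (v 0 :* v 1) :^ 2)) , v 0 :* v 1 ≐ # 1) ∷ []) refl (η-ξ₂ ∷ u-ξ ∷ []))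
    (solve (w ∷ t ∷ []) (# 1 :* (v 0 :* v 1)) (v 1 :^ 1 :* v 0) refl))))

  Z-step₂ : ∀ n → U (Z ⊗ (t ↑ n ⊗ h ↑ 2)) ≈ g ↑ (n + 3) ⊗ F (w ⊗ w) (ι (+ 1)) 5 (9 + 4 * n)
  Z-step₂ n = ≈-trans (U-cong (lincomb (u ↑ 5 ∷ ξ₂ ∷ t ↑ n ∷ h ∷ V ((w ⊗ t) ⊗ (w ⊗ t)) ∷ η ∷ u ∷ []) (v 0 :* (v 1 :* v 1) :* (v 2 :* (v 3 :* (v 3 :* # 1))))
      (v 2 :* (v 4 :* (v 5 :* v 5 :* (v 6 :* v 6) :* (v 0 :* (v 1 :* v 1)))))
      ((v 0 :* v 1 :^ 2 :* v 2 , v 3 :* (v 3 :* # 1) ≐ v 4 :* (v 5 :* v 5 :* (v 6 :* v 6))) ∷ []) refl (h-pull² ∷ [])))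
    (≈-trans (pullᵏ n ((w ⊗ t) ⊗ (w ⊗ t)) _) (≈-trans (≈-sym (one⊗ _)) (to-F 2 9 n ((w ⊗ t) ⊗ (w ⊗ t))
    (lincomb (u ∷ ξ ∷ u ↑ (4 * n) ∷ η ∷ ξ₂ ∷ []) (v 2 :* (v 3 :* v 3 :* (v 0 :* v 0) :* (v 0 :^ 5 :* (v 4 :* v 4))))
      (v 0 :* (v 0 :* (v 0 :* (v 0 :* (v 0 :* (v 0 :* (v 0 :* (v 0 :* (v 0 :* v 2)))))))) :* (v 1 :^ 6 :* # 1))
      ((v 2 :* v 0 :^ 7 :* (v 3 :* v 4 :+ v 1 :* v 1) , v 3 :* v 4 ≐ v 1 :* v 1)
        ∷ (:- (v 2 :* v 0 :^ 3 :* ((v 0 :* v 1) :^ 5 :+ (v 0 :* v 1) :^ 4)) , v 0 :* v 1 ≐ # 1) ∷ []) refl (η-ξ₂ ∷ u-ξ ∷ []))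
    (solve (w ∷ t ∷ []) (# 1 :* (v 0 :* v 1 :* (v 0 :* v 1))) (v 1 :^ 2 :* (v 0 :* v 0)) refl))))

  U-linear : Linear U
  U-linear = record { Φ-cong = U-cong ; Φ-⊕ = U-⊕ ; Φ-ι = U-ι }

  UZ-linear : Linear (λ f → U (Z ⊗ f))
  UZ-linear = record { Φ-cong = λ p → U-cong (*-congˡ p) ; Φ-⊕ = λ f f′ → ≈-trans (U-cong (⊗-distribˡ _ _ _)) (U-⊕ _ _)
    ; Φ-ι = λ c f → ≈-trans (U-cong (solve (Z ∷ ι c ∷ f ∷ []) (v 0 :* (v 1 :* v 2)) (v 1 :* (v 0 :* v 2)) refl)) (U-ι c _) }

  odd⇒even : ∀ {a f} → Span (Odd a) f → Span (Even a) (U f)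
  odd⇒even {a} = span-map U-linear go
    where
    go : ∀ z d n j → Odd a d n j → Span (Even a) (U (ι (z ℤ.* + (7 ^ d)) ⊗ (t ↑ n ⊗ h ↑ j)))
    go z d n 0 (odd′ a≤d up lo _) = resp (≈-sym (≈-trans (U-ι _ _) (*-congˡ (U-step₀ n))))
      (lower-span 6 13 9 z d n (≤ᵇ-true 15 21 refl) (Window.w₀ (windows₀₀ (6 + 4 * n))) λ e i j _ p r j≤2 →
        let p′ = reshape₁ e n i p
            g₀ = gain₀ a d e n i j a≤d lo up p′ (reshape₂ n i j r)
        in even′ g₀ (even-bound a d e n i 25 (≤ᵇ-true 25 31 refl) p′ up g₀) j≤2)
      where
      open import Data.Nat.Tactic.RingSolver using (solve-∀)
      reshape₁ : ∀ e n i → 7 * i + 21 ≤ 4 * e + n + 2 * 6 + 13 → 7 * i + 21 ≤ 4 * e + n + 25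
      reshape₁ e n i p = ℕₚ.≤-trans p (ℕₚ.≤-reflexive (ℕₚ.+-assoc (4 * e + n) 12 13))
      reshape₂ : ∀ n i j → n + 2 * 6 + 7 * j + 9 ≤ 7 * i + 21 → n + 21 + 7 * j ≤ 7 * i + 21
      reshape₂ n i j r = ℕₚ.≤-trans (ℕₚ.≤-reflexive (sh n j)) r
        where
        sh : ∀ n j → n + 21 + 7 * j ≡ n + 2 * 6 + 7 * j + 9
        sh = solve-∀
    -- Only n = 2 can occur at the minimal valuation. There μ = 7 + 4 · 2 = 15, the value for which
    -- divisibility by 7 was established separately.
    go z d n 1 (odd′ a≤d up lo _) = case n Data.Nat.≟ 2 of λ
      { (yes refl) → resp (≈-sym (≈-trans (U-ι _ _) (*-congˡ (U-step₁ 2)))) (lower-span 7 17 3 z d 2 (≤ᵇ-true 15 17 refl) special₁₅ λ e i j 1≤e p r j≤2 →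
          finish e i j (gain₁ a d e 2 a≤d up (λ _ → 1≤e) lo) p j≤2)
      ; (no n≢2) → resp (≈-sym (≈-trans (U-ι _ _) (*-congˡ (U-step₁ n)))) (lower-span 7 17 3 z d n (≤ᵇ-true 15 17 refl) (Window.w₀ (windows₀₁ (7 + 4 * n))) λ e i j _ p r j≤2 →
          finish e i j (gain₁ a d e n a≤d up (λ n≡2 → ⊥-elim (n≢2 n≡2)) lo) p j≤2) }
      where
      finish : ∀ e i j → suc a ≤ d + e → 7 * i + 21 ≤ 4 * e + n + 2 * 7 + 17 → j ≤ 2 → Even a (d + e) i j
      finish e i j gn p j≤2 = even′ gn (even-bound a d e n i 31 ℕₚ.≤-refl (ℕₚ.≤-trans p (ℕₚ.≤-reflexive (ℕₚ.+-assoc (4 * e + n) 14 17))) up gn) j≤2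
    -- The table knows only 4 times this value, hence `quarter`. As j = 2 < n, the exponent n = 2
    -- cannot occur.
    go z d n 2 (odd′ a≤d up lo _) = resp (≈-sym (U-ι _ _)) (quarter (resp (≈-sym (≈-trans (swap (ι (+ 4)) _ _) (*-congˡ (U-step₂ n))))
      (lower-span 8 15 0 z d n (≤ᵇ-true 15 16 refl) (Window.w₀ (windows₀₂ (8 + 4 * n))) λ e i j _ p r j≤2 →
        let gn = gain₁ a d e n a≤d up (λ n≡2 → ⊥-elim (ℕₚ.<-irrefl refl (subst (2 <_) n≡2 lo))) (ℕₚ.<⇒≤ lo)
        in even′ gn (even-bound a d e n i 31 ℕₚ.≤-refl (ℕₚ.≤-trans p (ℕₚ.≤-reflexive (ℕₚ.+-assoc (4 * e + n) 16 15))) up gn) j≤2)))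
      where
      swap : ∀ a b c → a ⊗ (b ⊗ c) ≈ b ⊗ (a ⊗ c)
      swap a b c = solve (a ∷ b ∷ c ∷ []) (v 0 :* (v 1 :* v 2)) (v 1 :* (v 0 :* v 2)) refl
    go z d n (suc (suc (suc j))) (odd′ _ _ _ (s≤s (s≤s ())))

  odd-cond : ∀ a d e n i j → suc a ≤ d + e → n + 4 * a ≤ 4 * d → 7 * i + 21 ≤ 4 * e + n + 37 → 22 + 7 * j ≤ 7 * i + 21 → j ≤ 2 → Odd (suc a) (d + e) i j
  odd-cond a d e n i j gn up p r j≤2 = odd′ gn (odd-bound a d e n i p up gn) (div7 (suc j) i (certificate _ _ 0 r (eq₁ i j))) j≤2
    where
    open import Data.Nat.Tactic.RingSolver using (solve-∀)
    eq₁ : ∀ i j → 7 * i + 6 + (22 + 7 * j) ≡ 7 * suc j + (7 * i + 21) + 0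
    eq₁ = solve-∀

  -- With 22 = 21 + 1 the conclusion says 7j < 7i, the condition j < i of `Odd`.
  weaken-lower : ∀ n i j x → 22 ≤ x → n + x + 7 * j ≤ 7 * i + 21 → 22 + 7 * j ≤ 7 * i + 21
  weaken-lower n i j x l p = ℕₚ.≤-trans (ℕₚ.+-monoˡ-≤ (7 * j) (ℕₚ.≤-trans l (ℕₚ.m≤n+m x n))) p

  even⇒odd : ∀ {a f} → Span (Even a) f → Span (Odd (suc a)) (U (Z ⊗ f))
  even⇒odd {a} = span-map UZ-linear go
    where
    open import Data.Nat.Tactic.RingSolver using (solve-∀)
    go : ∀ z d n j → Even a d n j → Span (Odd (suc a)) (U (Z ⊗ (ι (z ℤ.* + (7 ^ d)) ⊗ (t ↑ n ⊗ h ↑ j))))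
    go z d n 0 (even′ vl up _) = resp (≈-sym (≈-trans (Linear.Φ-ι UZ-linear _ _) (*-congˡ (Z-step₀ n))))
      (lower-span 11 15 1 z d n (≤ᵇ-true 15 23 refl) (Window.w₀ (windows₁₀ (11 + 4 * n))) λ e i j _ p r j≤2 →
        odd-cond a d e n i j (ℕₚ.≤-trans vl (ℕₚ.m≤m+n d e)) up (ℕₚ.≤-trans p (ℕₚ.≤-reflexive (ℕₚ.+-assoc (4 * e + n) 22 15)))
          (weaken-lower n i j 23 (≤ᵇ-true 22 23 refl) (ℕₚ.≤-trans (ℕₚ.≤-reflexive (sh n j)) r)) j≤2)
      where
      sh : ∀ n j → n + 23 + 7 * j ≡ n + 2 * 11 + 7 * j + 1
      sh = solve-∀
    go z d n 1 (even′ vl up _) = resp (≈-sym (≈-trans (Linear.Φ-ι UZ-linear _ _) (*-congˡ (Z-step₁ n))))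
      (lower-span 10 17 5 z d n (≤ᵇ-true 15 25 refl) (Window.w₀ (windows₁₁ (10 + 4 * n))) λ e i j _ p r j≤2 →
        odd-cond a d e n i j (ℕₚ.≤-trans vl (ℕₚ.m≤m+n d e)) up (ℕₚ.≤-trans p (ℕₚ.≤-reflexive (ℕₚ.+-assoc (4 * e + n) 20 17)))
          (weaken-lower n i j 25 (≤ᵇ-true 22 25 refl) (ℕₚ.≤-trans (ℕₚ.≤-reflexive (sh n j)) r)) j≤2)
      where
      sh : ∀ n j → n + 25 + 7 * j ≡ n + 2 * 10 + 7 * j + 5
      sh = solve-∀
    go z d n 2 (even′ vl up _) = resp (≈-sym (≈-trans (Linear.Φ-ι UZ-linear _ _) (*-congˡ (Z-step₂ n))))
      (lower-span 9 19 9 z d n (≤ᵇ-true 15 27 refl) (Window.w₀ (windows₁₂ (9 + 4 * n))) λ e i j _ p r j≤2 →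
        odd-cond a d e n i j (ℕₚ.≤-trans vl (ℕₚ.m≤m+n d e)) up (ℕₚ.≤-trans p (ℕₚ.≤-reflexive (ℕₚ.+-assoc (4 * e + n) 18 19)))
          (weaken-lower n i j 27 (≤ᵇ-true 22 27 refl) (ℕₚ.≤-trans (ℕₚ.≤-reflexive (sh n j)) r)) j≤2)
      where
      sh : ∀ n j → n + 27 + 7 * j ≡ n + 2 * 9 + 7 * j + 9
      sh = solve-∀
    go z d n (suc (suc (suc j))) (even′ _ _ (s≤s (s≤s ())))

  -- The step for Z at t⁰ h⁰, where nothing has been gained before; the initial factor 7 is that of
  -- `special₁₁`.
  first-odd : Span (Odd 1) (U Z)
  first-odd = resp (≈-trans (one⊗ _) (≈-trans (≈-sym (Z-step₀ 0)) (U-cong (solve (Z ∷ []) (v 0 :* (# 1 :* # 1)) (v 0) refl))))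
    (lower-span 11 15 1 (+ 1) 0 0 (≤ᵇ-true 15 23 refl) special₁₁ λ e i j 1≤e p r j≤2 →
      odd-cond 0 0 e 0 i j 1≤e ℕₚ.≤-refl (ℕₚ.≤-trans p (ℕₚ.≤-reflexive (ℕₚ.+-assoc (4 * e + 0) 22 15)))
        (weaken-lower 0 i j 23 (≤ᵇ-true 22 23 refl) (ℕₚ.≤-trans (ℕₚ.≤-reflexive (sh j)) r)) j≤2)
    where
    open import Data.Nat.Tactic.RingSolver using (solve-∀)
    sh : ∀ j → 23 + 7 * j ≡ 2 * 11 + 7 * j + 1
    sh = solve-∀

-- The ring of power series

infix 4 _≋_

-- A record rather than a bare function type, so that the two series can be inferred from a proof.
record _≋_ (f g : Series) : Set where
  constructor mk
  field at : ∀ n → f n ≡ g n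

open _≋_ public

tail : Series → Series
tail f n = f (suc n)

const : ℤ → Series
const c zero    = c
const c (suc n) = + 0

-- The Cauchy product is computed by recursion on the index from f = f(0) + q · `tail f`, which
-- avoids finite sums.
addS mulS : Series → Series → Series
addS f g n = f n ℤ.+ g n
mulS f g zero    = f 0 ℤ.* g 0
mulS f g (suc n) = f 0 ℤ.* g (suc n) ℤ.+ mulS (tail f) g n

negS : Series → Series
negS f n = ℤ.- f n

module ℤ-Ring where
  open import Data.Integer.Tactic.RingSolver using (solve-∀)

  swap₁ : ∀ a b c d → a ℤ.+ b ℤ.+ (c ℤ.+ d) ≡ a ℤ.+ c ℤ.+ (b ℤ.+ d)
  swap₁ = solve-∀

  swap₂ : ∀ a b c → a ℤ.+ (b ℤ.+ c) ≡ b ℤ.+ (a ℤ.+ c)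
  swap₂ = solve-∀

  expand : ∀ a b c d e → a ℤ.* b ℤ.* c ℤ.+ (a ℤ.* d ℤ.+ e) ≡ a ℤ.* (b ℤ.* c ℤ.+ d) ℤ.+ e
  expand = solve-∀

open ℤ-Ring

mulS-cong : ∀ n {f f′ g g′} → (∀ i → i ≤ n → f i ≡ f′ i) → (∀ i → i ≤ n → g i ≡ g′ i) → mulS f g n ≡ mulS f′ g′ n
mulS-cong zero    p r = cong₂ ℤ._*_ (p 0 z≤n) (r 0 z≤n)
mulS-cong (suc n) p r = cong₂ ℤ._+_ (cong₂ ℤ._*_ (p 0 z≤n) (r (suc n) ℕₚ.≤-refl))
  (mulS-cong n (λ i i≤n → p (suc i) (s≤s i≤n)) (λ i i≤n → r i (ℕₚ.m≤n⇒m≤1+n i≤n)))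

mulS-distribʳ : ∀ n f g h → mulS (addS f g) h n ≡ mulS f h n ℤ.+ mulS g h n
mulS-distribʳ zero    f g h = ℤₚ.*-distribʳ-+ (h 0) (f 0) (g 0)
mulS-distribʳ (suc n) f g h = trans
  (cong₂ ℤ._+_ (ℤₚ.*-distribʳ-+ (h (suc n)) (f 0) (g 0)) (mulS-distribʳ n (tail f) (tail g) h))
  (swap₁ (f 0 ℤ.* h (suc n)) _ _ _)

mulS-stepʳ : ∀ n f g → mulS f g (suc n) ≡ g 0 ℤ.* f (suc n) ℤ.+ mulS f (tail g) n
mulS-stepʳ zero    f g = trans (ℤₚ.+-comm (f 0 ℤ.* g 1) _) (cong (ℤ._+ (f 0 ℤ.* g 1)) (ℤₚ.*-comm (f 1) (g 0)))
mulS-stepʳ (suc n) f g = trans (cong (λ z → f 0 ℤ.* g (suc (suc n)) ℤ.+ z) (mulS-stepʳ n (tail f) g))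
  (swap₂ (f 0 ℤ.* g (suc (suc n))) (g 0 ℤ.* f (suc (suc n))) (mulS (tail f) (tail g) n))

mulS-comm : ∀ n f g → mulS f g n ≡ mulS g f n
mulS-comm zero    f g = ℤₚ.*-comm (f 0) (g 0)
mulS-comm (suc n) f g = trans (cong (λ z → f 0 ℤ.* g (suc n) ℤ.+ z) (mulS-comm n (tail f) g)) (sym (mulS-stepʳ n g f))

mulS-scale : ∀ n c f g → mulS (λ i → c ℤ.* f i) g n ≡ c ℤ.* mulS f g n
mulS-scale zero    c f g = ℤₚ.*-assoc c (f 0) (g 0)
mulS-scale (suc n) c f g = trans
  (cong₂ ℤ._+_ (ℤₚ.*-assoc c (f 0) (g (suc n))) (mulS-scale n c (tail f) g))
  (sym (ℤₚ.*-distribˡ-+ c (f 0 ℤ.* g (suc n)) _))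

mulS-assoc : ∀ n f g h → mulS (mulS f g) h n ≡ mulS f (mulS g h) n
mulS-assoc zero    f g h = ℤₚ.*-assoc (f 0) (g 0) (h 0)
mulS-assoc (suc n) f g h = trans
  (cong (λ z → f 0 ℤ.* g 0 ℤ.* h (suc n) ℤ.+ z)
    (trans (mulS-distribʳ n (λ i → f 0 ℤ.* tail g i) (mulS (tail f) g) h)
      (cong₂ ℤ._+_ (mulS-scale n (f 0) (tail g) h) (mulS-assoc n (tail f) g h))))
  (expand (f 0) (g 0) (h (suc n)) _ _)

mulS-zeroˡ : ∀ n g → mulS (const (+ 0)) g n ≡ + 0
mulS-zeroˡ zero    g = refl
mulS-zeroˡ (suc n) g = trans (ℤₚ.+-identityˡ _)
  (trans (mulS-cong n {g = g} (λ { zero _ → refl ; (suc i) _ → refl }) (λ _ _ → refl)) (mulS-zeroˡ n g))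

mulS-const : ∀ n c g → mulS (const c) g n ≡ c ℤ.* g n
mulS-const zero    c g = refl
mulS-const (suc n) c g = trans (cong (λ z → c ℤ.* g (suc n) ℤ.+ z)
  (trans (mulS-cong n {g = g} (λ { zero _ → refl ; (suc i) _ → refl }) (λ _ _ → refl)) (mulS-zeroˡ n g))) (ℤₚ.+-identityʳ _)

-- Opacity keeps the type checker from unfolding series into coefficients inside large certificates;
-- `at-⊕`, `at-⊖` and `at-⊗` give access to coefficients.
opaque
  infixl 6 _+ˢ_
  infixl 7 _*ˢ_

  _+ˢ_ _*ˢ_ : Series → Series → Series
  _+ˢ_ = addS
  _*ˢ_ = mulS

  -ˢ_ : Series → Series
  -ˢ_ = negS

  at-⊕ : ∀ f g n → (f +ˢ g) n ≡ f n ℤ.+ g n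
  at-⊕ f g n = refl

  at-⊖ : ∀ f n → (-ˢ f) n ≡ ℤ.- f n
  at-⊖ f n = refl

  at-⊗ : ∀ f g n → (f *ˢ g) n ≡ mulS f g n
  at-⊗ f g n = refl

  series-isCommutativeRing : IsCommutativeRing _≋_ _+ˢ_ _*ˢ_ -ˢ_ (const (+ 0)) (const (+ 1))
  series-isCommutativeRing = record
    { isRing = record
      { +-isAbelianGroup = record
        { isGroup = record
          { isMonoid = record
            { isSemigroup = record
              { isMagma = record
                { isEquivalence = record
                  { refl = mk λ _ → refl ; sym = λ p → mk λ n → sym (at p n) ; trans = λ p r → mk λ n → trans (at p n) (at r n) }
                ; ∙-cong = λ p r → mk λ n → cong₂ ℤ._+_ (at p n) (at r n) }
              ; assoc = λ f g h → mk λ n → ℤₚ.+-assoc (f n) (g n) (h n) }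
            ; identity = (λ f → mk λ { zero → ℤₚ.+-identityˡ _ ; (suc n) → ℤₚ.+-identityˡ _ })
                       , (λ f → mk λ { zero → ℤₚ.+-identityʳ _ ; (suc n) → ℤₚ.+-identityʳ _ }) }
          ; inverse = (λ f → mk λ { zero → ℤₚ.+-inverseˡ (f 0) ; (suc n) → ℤₚ.+-inverseˡ (f (suc n)) })
                    , (λ f → mk λ { zero → ℤₚ.+-inverseʳ (f 0) ; (suc n) → ℤₚ.+-inverseʳ (f (suc n)) })
          ; ⁻¹-cong = λ p → mk λ n → cong ℤ.-_ (at p n) }
        ; comm = λ f g → mk λ n → ℤₚ.+-comm (f n) (g n) }
      ; *-cong = λ p r → mk λ n → mulS-cong n (λ i _ → at p i) (λ i _ → at r i)
      ; *-assoc = λ f g h → mk λ n → mulS-assoc n f g h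
      ; *-identity = one-left , λ f → mk λ n → trans (mulS-comm n f (const (+ 1))) (at (one-left f) n)
      ; distrib = (λ f g h → mk λ n → trans (mulS-comm n f (addS g h)) (trans (mulS-distribʳ n g h f)
                                        (cong₂ ℤ._+_ (mulS-comm n g f) (mulS-comm n h f))))
                , (λ f g h → mk λ n → mulS-distribʳ n g h f) }
    ; *-comm = λ f g → mk λ n → mulS-comm n f g }
    where
    one-left : ∀ f → mulS (const (+ 1)) f ≋ f
    one-left f = mk λ n → trans (mulS-const n (+ 1) f) (ℤₚ.*-identityˡ (f n))

  const-+ : ∀ a b → const (a ℤ.+ b) ≋ const a +ˢ const b
  const-+ a b = mk λ { zero → refl ; (suc n) → refl }

  const-* : ∀ a b → const (a ℤ.* b) ≋ const a *ˢ const b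
  const-* a b = mk λ { zero → refl ; (suc n) → sym (trans (mulS-const (suc n) a (const b)) (ℤₚ.*-zeroʳ a)) }

SeriesRing : CommutativeRing 0ℓ 0ℓ
SeriesRing = record { isCommutativeRing = series-isCommutativeRing }

open RingTools SeriesRing const const-+ const-* (mk λ _ → refl) public

q : Series
q = λ { (suc zero) → + 1 ; _ → + 0 }

q⊗-zero : ∀ f → (q ⊗ f) 0 ≡ + 0
q⊗-zero f = at-⊗ q f 0

q⊗-suc : ∀ f n → (q ⊗ f) (suc n) ≡ f n
q⊗-suc f n = trans (at-⊗ q f (suc n)) (trans (ℤₚ.+-identityˡ _) (trans (mulS-cong n {g = f} (λ { zero _ → refl ; (suc i) _ → refl }) (λ _ _ → refl))
  (trans (mulS-const n (+ 1) f) (ℤₚ.*-identityˡ (f n)))))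

q↑-+ : ∀ k f n → (q ↑ k ⊗ f) (k + n) ≡ f n
q↑-+ zero    f n = at (*-identityˡ f) n
q↑-+ (suc k) f n = trans (at (⊗-assoc q (q ↑ k) f) (suc (k + n))) (trans (q⊗-suc (q ↑ k ⊗ f) (k + n)) (q↑-+ k f n))

q↑-< : ∀ k f n → n < k → (q ↑ k ⊗ f) n ≡ + 0
q↑-< (suc k) f zero    _       = trans (at (⊗-assoc q (q ↑ k) f) 0) (q⊗-zero _)
q↑-< (suc k) f (suc n) (s≤s l) = trans (at (⊗-assoc q (q ↑ k) f) (suc n)) (trans (q⊗-suc (q ↑ k ⊗ f) n) (q↑-< k f n l))

q↑-cancel : ∀ k {f g} → q ↑ k ⊗ f ≋ q ↑ k ⊗ g → f ≋ g
q↑-cancel k {f} {g} p = mk λ n → trans (sym (q↑-+ k f n)) (trans (at p (k + n)) (q↑-+ k g n))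

head-tail : ∀ f → f ≋ const (f 0) ⊕ q ⊗ tail f
head-tail f = mk λ
  { zero    → sym (trans (at-⊕ _ _ 0) (trans (cong (λ z → f 0 ℤ.+ z) (q⊗-zero (tail f))) (ℤₚ.+-identityʳ _)))
  ; (suc n) → sym (trans (at-⊕ _ _ (suc n)) (trans (ℤₚ.+-identityˡ _) (q⊗-suc (tail f) n))) }

-- Congruence modulo qⁿ

infix 4 _≋[_]_

record _≋[_]_ (f : Series) (n : ℕ) (g : Series) : Set where
  constructor mk
  field below : ∀ i → i < n → f i ≡ g i

open _≋[_]_ public

≋⇒[] : ∀ {f g n} → f ≋ g → f ≋[ n ] g
≋⇒[] p = mk λ i _ → at p i

[]⇒≋ : ∀ {f g} → (∀ n → f ≋[ n ] g) → f ≋ g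
[]⇒≋ p = mk λ n → below (p (suc n)) n ℕₚ.≤-refl

[]-sym : ∀ {f g n} → f ≋[ n ] g → g ≋[ n ] f
[]-sym p = mk λ i l → sym (below p i l)

[]-trans : ∀ {f g h n} → f ≋[ n ] g → g ≋[ n ] h → f ≋[ n ] h
[]-trans p r = mk λ i l → trans (below p i l) (below r i l)

[]-weaken : ∀ {f g m n} → m ≤ n → f ≋[ n ] g → f ≋[ m ] g
[]-weaken m≤n p = mk λ i l → below p i (ℕₚ.≤-trans l m≤n)

[]-⊕ : ∀ {f f′ g g′ n} → f ≋[ n ] f′ → g ≋[ n ] g′ → f ⊕ g ≋[ n ] f′ ⊕ g′
[]-⊕ p r = mk λ i l → trans (at-⊕ _ _ i) (trans (cong₂ ℤ._+_ (below p i l) (below r i l)) (sym (at-⊕ _ _ i)))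

[]-⊖ : ∀ {f f′ n} → f ≋[ n ] f′ → ⊖ f ≋[ n ] ⊖ f′
[]-⊖ p = mk λ i l → trans (at-⊖ _ i) (trans (cong ℤ.-_ (below p i l)) (sym (at-⊖ _ i)))

[]-⊗ : ∀ {f f′ g g′ n} → f ≋[ n ] f′ → g ≋[ n ] g′ → f ⊗ g ≋[ n ] f′ ⊗ g′
[]-⊗ p r = mk λ i l → trans (at-⊗ _ _ i) (trans
  (mulS-cong i (λ j j≤i → below p j (ℕₚ.≤-<-trans j≤i l)) (λ j j≤i → below r j (ℕₚ.≤-<-trans j≤i l))) (sym (at-⊗ _ _ i)))

[]-q : ∀ {f g n} → f ≋[ n ] g → q ⊗ f ≋[ suc n ] q ⊗ g
[]-q {f} {g} p = mk λ { zero _ → trans (q⊗-zero f) (sym (q⊗-zero g)) ; (suc i) (s≤s l) → trans (q⊗-suc f i) (trans (below p i l) (sym (q⊗-suc g i))) }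

[]-q↑ : ∀ k {f g n} → f ≋[ n ] g → q ↑ k ⊗ f ≋[ k + n ] q ↑ k ⊗ g
[]-q↑ zero    p = []-⊗ (≋⇒[] ≈-refl) p
[]-q↑ (suc k) {f} {g} p = []-trans (≋⇒[] (⊗-assoc q (q ↑ k) f)) ([]-trans ([]-q ([]-q↑ k p)) (≋⇒[] (≈-sym (⊗-assoc q (q ↑ k) g))))

q↑-small : ∀ {n} k f → n ≤ k → q ↑ k ⊗ f ≋[ n ] 0#
q↑-small k f n≤k = mk λ { zero l → q↑-< k f 0 (ℕₚ.≤-trans l n≤k) ; (suc i) l → q↑-< k f (suc i) (ℕₚ.≤-trans l n≤k) }

-- Stage n + 1 is where coefficient n becomes final, if stages k and k + 1 agree modulo qᵏ.
lim : (ℕ → Series) → Series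
lim s n = s (suc n) n

lim-agrees : ∀ s → (∀ k → s (suc k) ≋[ k ] s k) → ∀ k → lim s ≋[ k ] s k
lim-agrees s p k = mk λ i i<k → sym (subst (λ m → s m i ≡ s (suc i) i) (ℕₚ.m∸n+n≡m i<k) (go i (k ∸ suc i)))
  where
  go : ∀ i j → s (j + suc i) i ≡ s (suc i) i
  go i zero    = refl
  go i (suc j) = trans (below (p (j + suc i)) i (ℕₚ.m≤n+m (suc i) j)) (go i j)

-- The inverse of f, as the fixed point of g ↦ 1 - q (tail f) g, when f has constant term 1

invStep : Series → ℕ → Series
invStep f zero    = 0#
invStep f (suc k) = 1# ⊝ q ⊗ (tail f ⊗ invStep f k)

inv : Series → Series
inv f = lim (invStep f)

inv-fix : ∀ f → inv f ≋ 1# ⊝ q ⊗ (tail f ⊗ inv f)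
inv-fix f = []⇒≋ λ n → []-trans (lim-agrees (invStep f) cauchy n) ([]-trans ([]-sym (cauchy n))
    ([]-⊕ (≋⇒[] ≈-refl) ([]-⊖ ([]-weaken (ℕₚ.n≤1+n n) ([]-q ([]-⊗ (≋⇒[] ≈-refl) ([]-sym (lim-agrees (invStep f) cauchy n))))))))
  where
  cauchy : ∀ k → invStep f (suc k) ≋[ k ] invStep f k
  cauchy zero    = mk λ _ ()
  cauchy (suc k) = []-⊕ (≋⇒[] ≈-refl) ([]-⊖ ([]-q ([]-⊗ (≋⇒[] ≈-refl) (cauchy k))))

inv-inverse : ∀ f → f 0 ≡ + 1 → f ⊗ inv f ≋ 1#
inv-inverse f h = begin
  f ⊗ inv f                                   ≈⟨ *-congʳ (≈-trans (head-tail f) (+-congʳ (≈-reflexive (cong const h)))) ⟩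
  (1# ⊕ q ⊗ tail f) ⊗ inv f                   ≈⟨ lincomb (q ∷ tail f ∷ inv f ∷ []) ((# 1 :+ Q :* t) :* i) (# 1)
                                                   ((# 1 , i ≐ # 1 :- Q :* (t :* i)) ∷ []) refl (inv-fix f ∷ []) ⟩
  1#                                          ∎
  where
  Q = var 0
  t = var 1
  i = var 2

0#-at : ∀ i → 0# i ≡ + 0
0#-at zero    = refl
0#-at (suc i) = refl

leading : ∀ f g i → g ≋[ i ] 0# → (f ⊗ g) i ≡ f 0 ℤ.* g i
leading f g zero    r = at-⊗ f g 0
leading f g (suc i) r = trans (at-⊗ f g (suc i)) (trans (cong (λ z → f 0 ℤ.* g (suc i) ℤ.+ z)
  (trans (mulS-cong i (λ _ _ → refl) (λ j j≤i → below r j (s≤s j≤i)))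
    (trans (sym (at-⊗ (tail f) 0# i)) (trans (at (zeroʳ (tail f)) i) (0#-at i))))) (ℤₚ.+-identityʳ _))

-- Coefficient n of f g is f(0) times that of g once g vanishes below n. Allowing the hypothesis to
-- assume this vanishing makes the lemma fit equations of the form M g = N g(q²).
vanish-by : ∀ f g → f 0 ≢ + 0 → (∀ n → g ≋[ n ] 0# → (f ⊗ g) n ≡ + 0) → g ≋ 0#
vanish-by f g f₀≢0 p = []⇒≋ go
  where
  go : ∀ n → g ≋[ n ] 0#
  go zero    = mk λ _ ()
  go (suc n) = mk λ i l → case ℕₚ.m≤n⇒m<n∨m≡n (ℕₚ.≤-pred l) of λ
    { (inj₁ i<n)  → below (go n) i i<n
    ; (inj₂ refl) → trans (last i (go i)) (sym (0#-at i)) }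
    where
    last : ∀ i → g ≋[ i ] 0# → g i ≡ + 0
    last i r = case ℤₚ.i*j≡0⇒i≡0∨j≡0 (f 0) {g i} (trans (sym (leading f g i r)) (p i r)) of λ
      { (inj₁ z) → ⊥-elim (f₀≢0 z) ; (inj₂ z) → z }

head-nonzero-cancel : ∀ f g → f 0 ≢ + 0 → f ⊗ g ≋ 0# → g ≋ 0#
head-nonzero-cancel f g f₀≢0 p = vanish-by f g f₀≢0 (λ n _ → trans (at p n) (0#-at n))

-- Dilations q ↦ qᵈ and sections, with d = suc k

-- The second argument counts the zeros still to be emitted, which makes the dilation structurally
-- recursive, without division of indices.
spread : ℕ → ℕ → Series → Series
spread k zero    f zero    = f 0
spread k zero    f (suc n) = spread k k (tail f) n
spread k (suc j) f zero    = + 0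
spread k (suc j) f (suc n) = spread k j f n

dil : ℕ → Series → Series
dil k = spread k 0

spread-q : ∀ k j f → spread k j f ≋ q ↑ j ⊗ dil k f
spread-q k zero    f = ≈-sym (*-identityˡ _)
spread-q k (suc j) f = begin
  spread k (suc j) f        ≈⟨ mk (λ { zero → sym (q⊗-zero _) ; (suc n) → sym (q⊗-suc (spread k j f) n) }) ⟩
  q ⊗ spread k j f          ≈⟨ *-congˡ (spread-q k j f) ⟩
  q ⊗ (q ↑ j ⊗ dil k f)     ≈⟨ ≈-sym (⊗-assoc _ _ _) ⟩
  q ↑ suc j ⊗ dil k f       ∎

dil-step : ∀ k f → dil k f ≋ const (f 0) ⊕ q ↑ suc k ⊗ dil k (tail f)
dil-step k f = ≈-trans (head-tail (dil k f)) (+-congˡ (≈-trans (*-congˡ (spread-q k k (tail f))) (≈-sym (⊗-assoc _ _ _))))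

spread-cong : ∀ k j {f g} → (∀ n → f n ≡ g n) → ∀ n → spread k j f n ≡ spread k j g n
spread-cong k zero    p zero    = p 0
spread-cong k zero    p (suc n) = spread-cong k k (p ∘ suc) n
spread-cong k (suc j) p zero    = refl
spread-cong k (suc j) p (suc n) = spread-cong k j p n

spread-+ : ∀ k j {f g h} → (∀ n → h n ≡ f n ℤ.+ g n) → ∀ n → spread k j h n ≡ spread k j f n ℤ.+ spread k j g n
spread-+ k zero    p zero    = p 0
spread-+ k zero    p (suc n) = spread-+ k k (p ∘ suc) n
spread-+ k (suc j) p zero    = refl
spread-+ k (suc j) p (suc n) = spread-+ k j p n

spread-scale : ∀ k j c {f h} → (∀ n → h n ≡ c ℤ.* f n) → ∀ n → spread k j h n ≡ c ℤ.* spread k j f n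
spread-scale k zero    c p zero    = p 0
spread-scale k zero    c p (suc n) = spread-scale k k c (p ∘ suc) n
spread-scale k (suc j) c p zero    = sym (ℤₚ.*-zeroʳ c)
spread-scale k (suc j) c p (suc n) = spread-scale k j c p n

const⊗-at : ∀ c f n → (const c ⊗ f) n ≡ c ℤ.* f n
const⊗-at c f n = trans (at-⊗ (const c) f n) (mulS-const n c f)

⊖-scale : ∀ f n → (⊖ f) n ≡ ℤ.- + 1 ℤ.* f n
⊖-scale f n = trans (at-⊖ f n) (sym (ℤₚ.-1*i≡-i (f n)))

tail-const : ∀ c → tail (const c) ≋ 0#
tail-const c = mk λ { zero → refl ; (suc n) → refl }

tail-⊗ : ∀ f g → tail (f ⊗ g) ≋ const (f 0) ⊗ tail g ⊕ tail f ⊗ g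
tail-⊗ f g = mk λ n → trans (at-⊗ f g (suc n)) (sym (trans (at-⊕ _ _ n)
  (cong₂ ℤ._+_ (const⊗-at (f 0) (tail g) n) (at-⊗ (tail f) g n))))

dil-zero : ∀ k → dil k 0# ≋ 0#
dil-zero k = mk λ n → trans (spread-scale k 0 (+ 0) {f = 0#} (λ { zero → refl ; (suc n) → refl }) n)
  (trans (ℤₚ.*-zeroˡ (dil k 0# n)) (0≡ n))
  where
  0≡ : ∀ n → + 0 ≡ 0# n
  0≡ zero    = refl
  0≡ (suc n) = refl

dil-scale : ∀ k c f → dil k (const c ⊗ f) ≋ const c ⊗ dil k f
dil-scale k c f = mk λ n → trans (spread-scale k 0 c (const⊗-at c f) n) (sym (const⊗-at c _ n))

dil-⊗-mod : ∀ k n f g → dil k (f ⊗ g) ≋[ n ] dil k f ⊗ dil k g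
dil-⊗-mod k zero    f g = mk λ _ ()
dil-⊗-mod k (suc n) f g = []-trans (≋⇒[] unfold) ([]-trans ([]-⊕ (≋⇒[] ≈-refl) ([]-q ([]-⊗ (≋⇒[] ≈-refl)
    ([]-⊕ (≋⇒[] ≈-refl) (dil-⊗-mod k n (tail f) g))))) (≋⇒[] fold))
  where
  X = q ↑ k ⊗ (const (f 0) ⊗ dil k (tail g) ⊕ dil k (tail f ⊗ g))
  unfold : dil k (f ⊗ g) ≋ const (f 0) ⊗ const (g 0) ⊕ q ⊗ X
  unfold = ≈-trans (dil-step k (f ⊗ g)) (+-cong
    (≈-trans (≈-reflexive (cong const (at-⊗ f g 0))) (const-* (f 0) (g 0)))
    (≈-trans (⊗-assoc _ _ _) (*-congˡ (*-congˡ (begin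
      dil k (tail (f ⊗ g))                                   ≈⟨ mk (spread-cong k 0 (at (tail-⊗ f g))) ⟩
      dil k (const (f 0) ⊗ tail g ⊕ tail f ⊗ g)              ≈⟨ mk (λ n → trans (spread-+ k 0 (at-⊕ _ _) n) (sym (at-⊕ _ _ n))) ⟩
      dil k (const (f 0) ⊗ tail g) ⊕ dil k (tail f ⊗ g)      ≈⟨ +-congʳ (dil-scale k (f 0) (tail g)) ⟩
      const (f 0) ⊗ dil k (tail g) ⊕ dil k (tail f ⊗ g)      ∎)))))
  fold : const (f 0) ⊗ const (g 0) ⊕ q ⊗ (q ↑ k ⊗ (const (f 0) ⊗ dil k (tail g) ⊕ dil k (tail f) ⊗ dil k g)) ≋ dil k f ⊗ dil k g
  fold = lincomb (q ∷ q ↑ k ∷ const (f 0) ∷ const (g 0) ∷ dil k (tail f) ∷ dil k (tail g) ∷ dil k f ∷ dil k g ∷ [])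
    (v 2 :* v 3 :+ v 0 :* (v 1 :* (v 2 :* v 5 :+ v 4 :* v 7))) (v 6 :* v 7)
    ((:- v 7 , v 6 ≐ v 2 :+ (v 0 :* v 1) :* v 4) ∷ (:- v 2 , v 7 ≐ v 3 :+ (v 0 :* v 1) :* v 5) ∷ [])
    refl (dil-step k f ∷ dil-step k g ∷ [])

dil-hom : ∀ k → IsHom (dil k)
dil-hom k = record
  { F-cong = λ p → mk (spread-cong k 0 (at p))
  ; F-⊕ = λ f g → mk λ n → trans (spread-+ k 0 (at-⊕ f g) n) (sym (at-⊕ _ _ n))
  ; F-⊗ = λ f g → []⇒≋ λ n → dil-⊗-mod k n f g
  ; F-⊖ = λ f → mk λ n → trans (spread-scale k 0 (ℤ.- + 1) (⊖-scale f) n) (sym (⊖-scale _ n))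
  ; F-ι = λ c → ≈-trans (dil-step k (const c)) (≈-trans (+-congˡ (≈-trans (*-congˡ
            (≈-trans (mk (spread-cong k 0 (at (tail-const c)))) (dil-zero k))) (zeroʳ _))) (+-identityʳ _)) }

dil-q : ∀ k → dil k q ≋ q ↑ suc k
dil-q k = begin
  dil k q                                    ≈⟨ dil-step k q ⟩
  0# ⊕ q ↑ suc k ⊗ dil k (tail q)            ≈⟨ +-identityˡ _ ⟩
  q ↑ suc k ⊗ dil k (tail q)                 ≈⟨ *-congˡ (F-cong (mk λ { zero → refl ; (suc n) → refl })) ⟩
  q ↑ suc k ⊗ dil k 1#                       ≈⟨ *-congˡ F-1 ⟩
  q ↑ suc k ⊗ 1#                             ≈⟨ *-identityʳ _ ⟩
  q ↑ suc k                                  ∎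
  where open IsHom (dil-hom k)

sec : ℕ → Series → Series
sec k f n = f (n * suc k)

sec-cong : ∀ k {f g} → f ≋ g → sec k f ≋ sec k g
sec-cong k p = mk λ n → at p (n * suc k)

sec-⊕ : ∀ k f g → sec k (f ⊕ g) ≋ sec k f ⊕ sec k g
sec-⊕ k f g = mk λ n → trans (at-⊕ f g (n * suc k)) (sym (at-⊕ _ _ n))

sec-q : ∀ k f → sec k (q ↑ suc k ⊗ f) ≋ q ⊗ sec k f
sec-q k f = mk λ { zero → trans (q↑-< (suc k) f 0 (s≤s z≤n)) (sym (q⊗-zero _))
                 ; (suc n) → trans (q↑-+ (suc k) f (n * suc k)) (sym (q⊗-suc (sec k f) n)) }

sec-dil-⊗-mod : ∀ k n f g → sec k (dil k f ⊗ g) ≋[ n ] f ⊗ sec k g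
sec-dil-⊗-mod k zero    f g = mk λ _ ()
sec-dil-⊗-mod k (suc n) f g = []-trans (≋⇒[] unfold) ([]-trans ([]-⊕ (≋⇒[] ≈-refl) ([]-q (sec-dil-⊗-mod k n (tail f) g))) (≋⇒[] fold))
  where
  unfold : sec k (dil k f ⊗ g) ≋ const (f 0) ⊗ sec k g ⊕ q ⊗ sec k (dil k (tail f) ⊗ g)
  unfold = begin
    sec k (dil k f ⊗ g)
      ≈⟨ sec-cong k (≈-trans (*-congʳ (dil-step k f)) (≈-trans (⊗-distribʳ _ _ _) (+-congˡ (⊗-assoc _ _ _)))) ⟩
    sec k (const (f 0) ⊗ g ⊕ q ↑ suc k ⊗ (dil k (tail f) ⊗ g))
      ≈⟨ sec-⊕ k _ _ ⟩
    sec k (const (f 0) ⊗ g) ⊕ sec k (q ↑ suc k ⊗ (dil k (tail f) ⊗ g))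
      ≈⟨ +-cong (mk λ n → trans (const⊗-at (f 0) g (n * suc k)) (sym (const⊗-at (f 0) (sec k g) n))) (sec-q k _) ⟩
    const (f 0) ⊗ sec k g ⊕ q ⊗ sec k (dil k (tail f) ⊗ g) ∎
  fold : const (f 0) ⊗ sec k g ⊕ q ⊗ (tail f ⊗ sec k g) ≋ f ⊗ sec k g
  fold = ≈-sym (≈-trans (*-congʳ (head-tail f)) (≈-trans (⊗-distribʳ _ _ _) (+-congˡ (⊗-assoc _ _ _))))

sec-dil-⊗ : ∀ k f g → sec k (dil k f ⊗ g) ≋ f ⊗ sec k g
sec-dil-⊗ k f g = []⇒≋ λ n → sec-dil-⊗-mod k n f g

sec-dil : ∀ k f → sec k (dil k f) ≋ f
sec-dil k f = begin
  sec k (dil k f)         ≈⟨ sec-cong k (≈-sym (*-identityʳ _)) ⟩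
  sec k (dil k f ⊗ 1#)    ≈⟨ sec-dil-⊗ k f 1# ⟩
  f ⊗ sec k 1#            ≈⟨ *-congˡ (mk λ { zero → refl ; (suc n) → refl }) ⟩
  f ⊗ 1#                  ≈⟨ *-identityʳ f ⟩
  f                       ∎

sec-q↑-dil : ∀ k i f → 0 < i → i ≤ k → sec k (q ↑ i ⊗ dil k f) ≋ 0#
sec-q↑-dil k i f 0<i i≤k = begin
  sec k (q ↑ i ⊗ dil k f)  ≈⟨ sec-cong k (⊗-comm _ _) ⟩
  sec k (dil k f ⊗ q ↑ i)  ≈⟨ sec-dil-⊗ k f _ ⟩
  f ⊗ sec k (q ↑ i)        ≈⟨ *-congˡ (mk vanish) ⟩
  f ⊗ 0#                   ≈⟨ zeroʳ f ⟩
  0#                       ∎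
  where
  vanish : ∀ n → sec k (q ↑ i) n ≡ 0# n
  vanish zero    = trans (sym (at (*-identityʳ (q ↑ i)) 0)) (q↑-< i 1# 0 0<i)
  vanish (suc n) = trans (sym (at (*-identityʳ (q ↑ i)) (suc n * suc k)))
    (trans (cong (q ↑ i ⊗ 1#) split) (q↑-+ i 1# (suc (k ∸ i + n * suc k))))
    where
    split : suc n * suc k ≡ i + suc (k ∸ i + n * suc k)
    split = trans (cong (λ z → suc (z + n * suc k)) (sym (ℕₚ.m+[n∸m]≡n i≤k)))
      (trans (cong suc (ℕₚ.+-assoc i (k ∸ i) _)) (sym (ℕₚ.+-suc i _)))

-- Partial theta series Σ c(m) q^{(κ+1) m + s m (m-1)/2}

thStep : (ℕ → ℤ) → ℕ → ℕ → ℕ → Series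
thStep c κ s zero    = 0#
thStep c κ s (suc N) = const (c 0) ⊕ q ↑ suc κ ⊗ thStep (c ∘ suc) (κ + s) s N

th : (ℕ → ℤ) → ℕ → ℕ → Series
th c κ s = lim (thStep c κ s)

thStep-cauchy : ∀ c κ s k → thStep c κ s (suc k) ≋[ k ] thStep c κ s k
thStep-cauchy c κ s zero    = mk λ _ ()
thStep-cauchy c κ s (suc k) = []-⊕ (≋⇒[] ≈-refl) ([]-weaken (s≤s (ℕₚ.m≤n+m k κ)) ([]-q↑ (suc κ) (thStep-cauchy (c ∘ suc) (κ + s) s k)))

th-agrees : ∀ c κ s k → th c κ s ≋[ k ] thStep c κ s k
th-agrees c κ s = lim-agrees (thStep c κ s) (thStep-cauchy c κ s)

th-fix : ∀ c κ s → th c κ s ≋ const (c 0) ⊕ q ↑ suc κ ⊗ th (c ∘ suc) (κ + s) s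
th-fix c κ s = []⇒≋ λ n → []-trans (th-agrees c κ s n) ([]-trans ([]-sym (thStep-cauchy c κ s n))
  ([]-⊕ (≋⇒[] ≈-refl) ([]-⊗ (≋⇒[] ≈-refl) ([]-sym (th-agrees (c ∘ suc) (κ + s) s n)))))

th-cong : ∀ {c d} κ s → (∀ n → c n ≡ d n) → th c κ s ≋ th d κ s
th-cong κ s p = []⇒≋ λ n → []-trans (th-agrees _ κ s n) ([]-trans (≋⇒[] (go n κ p)) ([]-sym (th-agrees _ κ s n)))
  where
  go : ∀ n κ {c d} → (∀ n → c n ≡ d n) → thStep c κ s n ≋ thStep d κ s n
  go zero    κ p = ≈-refl
  go (suc n) κ p = +-cong (≈-reflexive (cong const (p 0))) (*-congˡ (go n (κ + s) (p ∘ suc)))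

V : Series → Series
V = dil 6

module VH = IsHom (dil-hom 6)

-- For m = 7l + i the exponent (κ + 1)m + s m(m - 1)/2 equals (κ + 1)i + s i(i - 1)/2 plus 7 times
-- (κ + 1 + is + 3s)l + 7s l(l - 1)/2; the latter is again of theta shape, with these parameters.
part piece : (ℕ → ℤ) → ℕ → ℕ → ℕ → Series
part c κ s i = th (λ l → c (l * 7 + i)) (κ + i * s + 3 * s) (7 * s)
piece c κ s i = V (part c κ s i)

ahead : ℕ → (ℕ → ℤ) → ℕ → ℤ
ahead j c n = c (j + n)

dissected : Expr → Expr → (ℕ → Expr) → Expr
dissected K S X = X 0 :+ K :* X 1 :+ K :^ 2 :* S :* X 2 :+ K :^ 3 :* S :^ 3 :* X 3
  :+ K :^ 4 :* S :^ 6 :* X 4 :+ K :^ 5 :* S :^ 10 :* X 5 :+ K :^ 6 :* S :^ 15 :* X 6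

pieces : (ℕ → ℤ) → ℕ → ℕ → List Series
pieces c κ s = piece c κ s 0 ∷ piece c κ s 1 ∷ piece c κ s 2 ∷ piece c κ s 3 ∷ piece c κ s 4 ∷ piece c κ s 5 ∷ piece c κ s 6 ∷ []

-- Seven steps of `th-fix` on the left correspond to one step in each of the seven pieces on the
-- right. Both sides then obey the same recursion from (c, κ) to (c shifted by 7, κ + 7s), whose
-- positive power of q gives agreement modulo every qⁿ.
th-dissect : ∀ c κ s → th c κ s ≋ ⟦ dissected (v 0) (v 1) (λ i → v (2 + i)) ⟧ (env (q ↑ suc κ ∷ q ↑ s ∷ pieces c κ s))
th-dissect c κ s = []⇒≋ λ n → go n c κ
  where
  qK : ∀ κ j → q ↑ suc (κ + j * s) ≋ q ↑ suc κ ⊗ (q ↑ s) ↑ j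
  qK κ zero    = ≈-trans (≈-reflexive (cong (λ m → q ↑ suc m) (ℕₚ.+-identityʳ κ))) (≈-sym (*-identityʳ _))
  qK κ (suc j) = ≈-trans (↑-+ q (suc κ) (s + j * s)) (*-congˡ (≈-trans (↑-+ q s (j * s)) (*-congˡ (qj j))))
    where
    qj : ∀ j → q ↑ (j * s) ≋ (q ↑ s) ↑ j
    qj zero    = ≈-refl
    qj (suc j) = ≈-trans (↑-+ q s (j * s)) (*-congˡ (qj j))

  step : ∀ c κ j → th (ahead j c) (κ + j * s) s ≋ const (c (j + 0)) ⊕ (q ↑ suc κ ⊗ (q ↑ s) ↑ j) ⊗ th (ahead (suc j) c) (κ + suc j * s) s
  step c κ j = ≈-trans (th-fix (ahead j c) (κ + j * s) s) (+-congˡ (*-cong (qK κ j)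
    (≈-trans (th-cong _ s (λ n → cong c (ℕₚ.+-suc j n)))
      (≈-reflexive (cong (λ m → th (ahead (suc j) c) m s) (trans (ℕₚ.+-assoc κ (j * s) s) (cong (λ z → κ + z) (ℕₚ.+-comm (j * s) s))))))))

  next : ∀ c κ i → piece c κ s i ≋ const (c i) ⊕ (q ↑ suc κ ⊗ (q ↑ s) ↑ (i + 3)) ↑ 7 ⊗ piece (ahead 7 c) (κ + 7 * s) s i
  next c κ i = begin
    piece c κ s i
      ≈⟨ VH.F-cong (th-fix (λ l → c (l * 7 + i)) (κ + i * s + 3 * s) (7 * s)) ⟩
    V (const (c i) ⊕ q ↑ suc (κ + i * s + 3 * s) ⊗ X)
      ≈⟨ ≈-trans (VH.F-⊕ _ _) (+-cong (VH.F-ι (c i)) (VH.F-⊗ _ _)) ⟩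
    const (c i) ⊕ V (q ↑ suc (κ + i * s + 3 * s)) ⊗ V X
      ≈⟨ +-congˡ (*-cong (≈-trans (VH.F-cong (≈-trans (≈-reflexive (cong (λ m → q ↑ suc m)
           (trans (ℕₚ.+-assoc κ _ _) (cong (λ z → κ + z) (sym (ℕₚ.*-distribʳ-+ s i 3)))))) (qK κ (i + 3))))
           (≈-trans (VH.F-cong (≈-sym (rep (i + 3)))) (Vpow (i + 3))))
           (≈-reflexive (cong (λ m → V (th (λ l → c (7 + (l * 7 + i))) m (7 * s))) (arith (i * s) (3 * s) (7 * s))))) ⟩
    const (c i) ⊕ (q ↑ suc κ ⊗ (q ↑ s) ↑ (i + 3)) ↑ 7 ⊗ piece (ahead 7 c) (κ + 7 * s) s i ∎
    where
    X = th (λ l → c (suc l * 7 + i)) (κ + i * s + 3 * s + 7 * s) (7 * s)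
    rep : ∀ j → q ↑ suc (κ + j * s) ≋ q ↑ suc κ ⊗ (q ↑ s) ↑ j
    rep = qK κ
    pow-swap : ∀ m → V (q ↑ m) ≋ (q ↑ m) ↑ 7
    pow-swap zero    = ≈-trans VH.F-1 (solve [] (# 1) ((# 1) :^ 7) refl)
    pow-swap (suc m) = ≈-trans (VH.F-⊗ q (q ↑ m)) (≈-trans (*-cong (dil-q 6) (pow-swap m))
      (solve (q ∷ q ↑ m ∷ []) (v 0 :^ 7 :* v 1 :^ 7) ((v 0 :* v 1) :^ 7) refl))
    Vpow : ∀ j → V (q ↑ suc (κ + j * s)) ≋ (q ↑ suc κ ⊗ (q ↑ s) ↑ j) ↑ 7
    Vpow j = ≈-trans (pow-swap (suc (κ + j * s))) (↑-cong 7 (qK κ j))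
    arith : ∀ a b d → κ + a + b + d ≡ κ + d + a + b
    arith a b d = trans (ℕₚ.+-assoc (κ + a) b d) (trans (cong (λ z → κ + a + z) (ℕₚ.+-comm b d))
      (trans (sym (ℕₚ.+-assoc (κ + a) d b)) (cong (_+ b) (trans (ℕₚ.+-assoc κ a d) (trans (cong (λ z → κ + z) (ℕₚ.+-comm a d)) (sym (ℕₚ.+-assoc κ d a)))))))

  go : ∀ n c κ → th c κ s ≋[ n ] ⟦ dissected (v 0) (v 1) (λ i → v (2 + i)) ⟧ (env (q ↑ suc κ ∷ q ↑ s ∷ pieces c κ s))
  go zero    c κ = mk λ _ ()
  go (suc n) c κ = []-trans (≋⇒[] unrolled) ([]-trans ([]-⊕ (≋⇒[] ≈-refl) ([]-q ([]-⊗ (≋⇒[] ≈-refl) (go n (ahead 7 c) (κ + 7 * s))))) (≋⇒[] rolled))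
    where
    K′ = q ↑ κ
    S = q ↑ s
    C : ℕ → Series
    C i = const (c (i + 0))
    tj : ℕ → Series
    tj j = th (ahead j c) (κ + j * s) s
    K = v 0 :* v 1
    xs : List Series
    xs = q ∷ K′ ∷ S ∷ C 0 ∷ C 1 ∷ C 2 ∷ C 3 ∷ C 4 ∷ C 5 ∷ C 6 ∷ []
    front = v 3 :+ K :* (v 4 :+ K :* v 2 :* (v 5 :+ K :* v 2 :^ 2 :* (v 6 :+ K :* v 2 :^ 3 :* (v 7 :+ K :* v 2 :^ 4 :* (v 8 :+ K :* v 2 :^ 5 :* v 9)))))
    coef = v 1 :* (K :^ 6 :* v 2 :^ 21)
    unrolled : th c κ s ≋ ⟦ front ⟧ (env xs) ⊕ q ⊗ (⟦ coef ⟧ (env xs) ⊗ tj 7)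
    unrolled = lincomb (q ∷ K′ ∷ S ∷ C 0 ∷ C 1 ∷ C 2 ∷ C 3 ∷ C 4 ∷ C 5 ∷ C 6 ∷ tj 1 ∷ tj 2 ∷ tj 3 ∷ tj 4 ∷ tj 5 ∷ tj 6 ∷ tj 7 ∷ th c κ s ∷ [])
      (v 17) (front :+ v 0 :* (coef :* v 16))
      ((# 1 , v 17 ≐ v 3 :+ (K :* (v 2 :^ 0)) :* v 10) ∷ eqn 1 K ∷ eqn 2 (K :^ 2 :* v 2) ∷ eqn 3 (K :^ 3 :* v 2 :^ 3)
        ∷ eqn 4 (K :^ 4 :* v 2 :^ 6) ∷ eqn 5 (K :^ 5 :* v 2 :^ 10) ∷ eqn 6 (K :^ 6 :* v 2 :^ 15) ∷ []) refl
      (≈-trans (≈-reflexive (cong (λ m → th c m s) (sym (ℕₚ.+-identityʳ κ)))) (step c κ 0)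
        ∷ step c κ 1 ∷ step c κ 2 ∷ step c κ 3 ∷ step c κ 4 ∷ step c κ 5 ∷ step c κ 6 ∷ [])
      where
      eqn : ℕ → Expr → Expr × Eqn
      eqn j e = e , v (9 + j) ≐ v (3 + j) :+ (K :* (v 2 :^ j)) :* v (10 + j)
    new = pieces (ahead 7 c) (κ + 7 * s) s
    rolled : ⟦ front ⟧ (env xs) ⊕ q ⊗ (⟦ coef ⟧ (env xs) ⊗ ⟦ dissected (v 0) (v 1) (λ i → v (2 + i)) ⟧ (env (q ↑ suc (κ + 7 * s) ∷ q ↑ s ∷ new)))
           ≋ ⟦ dissected (v 0) (v 1) (λ i → v (2 + i)) ⟧ (env (q ↑ suc κ ∷ q ↑ s ∷ pieces c κ s))
    rolled = lincomb (q ∷ K′ ∷ S ∷ C 0 ∷ C 1 ∷ C 2 ∷ C 3 ∷ C 4 ∷ C 5 ∷ C 6 ∷ q ↑ suc (κ + 7 * s)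
        ∷ N 0 ∷ N 1 ∷ N 2 ∷ N 3 ∷ N 4 ∷ N 5 ∷ N 6 ∷ O 0 ∷ O 1 ∷ O 2 ∷ O 3 ∷ O 4 ∷ O 5 ∷ O 6 ∷ [])
      (front :+ v 0 :* (coef :* dissected (v 10) (v 2) (λ i → v (11 + i)))) (dissected K (v 2) (λ i → v (18 + i)))
      ((v 0 :* coef :* dq , v 10 ≐ K :* v 2 :^ 7) ∷ eqn 0 (# 1) ∷ eqn 1 K ∷ eqn 2 (K :^ 2 :* v 2) ∷ eqn 3 (K :^ 3 :* v 2 :^ 3)
        ∷ eqn 4 (K :^ 4 :* v 2 :^ 6) ∷ eqn 5 (K :^ 5 :* v 2 :^ 10) ∷ eqn 6 (K :^ 6 :* v 2 :^ 15) ∷ []) refl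
      (qK κ 7 ∷ next c κ 0 ∷ next c κ 1 ∷ next c κ 2 ∷ next c κ 3 ∷ next c κ 4 ∷ next c κ 5 ∷ next c κ 6 ∷ [])
      where
      N O : ℕ → Series
      N = piece (ahead 7 c) (κ + 7 * s) s
      O = piece c κ s
      L = K :* v 2 :^ 7
      pw : ℕ → Expr
      pw zero    = # 0
      pw (suc i) = v 10 :^ i :+ L :* pw i
      dq = pw 1 :* v 12 :+ pw 2 :* v 2 :* v 13 :+ pw 3 :* v 2 :^ 3 :* v 14 :+ pw 4 :* v 2 :^ 6 :* v 15
        :+ pw 5 :* v 2 :^ 10 :* v 16 :+ pw 6 :* v 2 :^ 15 :* v 17
      eqn : ℕ → Expr → Expr × Eqn
      eqn i e = (:- e) , v (18 + i) ≐ v (3 + i) :+ (K :* v 2 :^ (i + 3)) :^ 7 :* v (11 + i)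

-- Euler's product, and the theta expansions of J, J²/J(q²) and J³

sgn : ℕ → ℤ
sgn zero    = + 1
sgn (suc n) = ℤ.- sgn n

sgn-suc : ∀ n → const (sgn (suc n)) ≋ ⊖ const (sgn n)
sgn-suc n = mk λ { zero → sym (at-⊖ _ 0) ; (suc i) → sym (at-⊖ _ (suc i)) }

sumS : (ℕ → Series) → ℕ → Series
sumS f zero    = 0#
sumS f (suc n) = sumS f n ⊕ f n

sumS-front : ∀ f n → sumS f (suc n) ≋ f 0 ⊕ sumS (f ∘ suc) n
sumS-front f zero    = ⊕-comm _ _
sumS-front f (suc n) = ≈-trans (+-congʳ (sumS-front f n)) (⊕-assoc _ _ _)

sumS-scale : ∀ a f n → a ⊗ sumS f n ≋ sumS (λ k → a ⊗ f k) n
sumS-scale a f zero    = zeroʳ a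
sumS-scale a f (suc n) = ≈-trans (⊗-distribˡ _ _ _) (+-congʳ (sumS-scale a f n))

sumS-cong : ∀ {f g} n → (∀ k → f k ≋ g k) → sumS f n ≋ sumS g n
sumS-cong zero    p = ≈-refl
sumS-cong (suc n) p = +-cong (sumS-cong n p) (p n)

sumS-mod : ∀ {f g m} n → (∀ k → k < n → f k ≋[ m ] g k) → sumS f n ≋[ m ] sumS g n
sumS-mod zero    p = ≋⇒[] ≈-refl
sumS-mod (suc n) p = []-⊕ (sumS-mod n (λ k l → p k (ℕₚ.m≤n⇒m≤1+n l))) (p n ℕₚ.≤-refl)

thMono : ℕ → ℕ → ℕ → Series
thMono κ s zero    = 1#
thMono κ s (suc m) = thMono κ s m ⊗ q ↑ (suc κ + m * s)

thMono-front : ∀ κ s m → thMono κ s (suc m) ≋ q ↑ suc κ ⊗ thMono (κ + s) s m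
thMono-front κ s zero    = ≈-trans (*-identityˡ _) (≈-trans (≈-reflexive (cong (λ z → q ↑ suc z) (ℕₚ.+-identityʳ κ))) (≈-sym (*-identityʳ _)))
thMono-front κ s (suc m) = begin
  thMono κ s (suc m) ⊗ q ↑ (suc κ + (s + m * s))            ≈⟨ *-congʳ (thMono-front κ s m) ⟩
  (q ↑ suc κ ⊗ thMono (κ + s) s m) ⊗ q ↑ (suc κ + (s + m * s)) ≈⟨ ⊗-assoc _ _ _ ⟩
  q ↑ suc κ ⊗ (thMono (κ + s) s m ⊗ q ↑ (suc κ + (s + m * s)))
    ≈⟨ *-congˡ (*-congˡ (≈-reflexive (cong (λ z → q ↑ suc z) (sym (ℕₚ.+-assoc κ s (m * s)))))) ⟩
  q ↑ suc κ ⊗ thMono (κ + s) s (suc m)                      ∎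

thStep-sum : ∀ c κ s n → thStep c κ s n ≋ sumS (λ m → const (c m) ⊗ thMono κ s m) n
thStep-sum c κ s zero    = ≈-refl
thStep-sum c κ s (suc n) = ≈-sym (begin
  sumS (λ m → const (c m) ⊗ thMono κ s m) (suc n)
    ≈⟨ sumS-front _ n ⟩
  const (c 0) ⊗ 1# ⊕ sumS (λ m → const (c (suc m)) ⊗ thMono κ s (suc m)) n
    ≈⟨ +-cong (*-identityʳ _) (sumS-cong n (λ m → ≈-trans (*-congˡ (thMono-front κ s m))
         (solve (const (c (suc m)) ∷ q ↑ suc κ ∷ thMono (κ + s) s m ∷ []) (v 0 :* (v 1 :* v 2)) (v 1 :* (v 0 :* v 2)) refl))) ⟩
  const (c 0) ⊕ sumS (λ m → q ↑ suc κ ⊗ (const (c (suc m)) ⊗ thMono (κ + s) s m)) n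
    ≈⟨ +-congˡ (≈-trans (≈-sym (sumS-scale _ _ n)) (*-congˡ (≈-sym (thStep-sum (c ∘ suc) (κ + s) s n)))) ⟩
  thStep c κ s (suc n) ∎)

th-sum : ∀ c κ s n → th c κ s ≋[ n ] sumS (λ m → const (c m) ⊗ thMono κ s m) n
th-sum c κ s n = []-trans (th-agrees c κ s n) (≋⇒[] (thStep-sum c κ s n))

-- The quotient P(s + r)/P(s) of partial Euler products, written without division.
D : ℕ → ℕ → Series
D s zero    = 1#
D s (suc r) = (1# ⊝ q ↑ suc s) ⊗ D (suc s) r

D-back : ∀ s r → D s (suc r) ≋ D s r ⊗ (1# ⊝ q ↑ suc (s + r))
D-back s zero    = ≈-trans (⊗-comm _ _) (*-congˡ (+-congˡ (-‿cong (≈-reflexive (cong (λ z → q ↑ suc z) (sym (ℕₚ.+-identityʳ s)))))))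
D-back s (suc r) = begin
  (1# ⊝ q ↑ suc s) ⊗ D (suc s) (suc r)                                 ≈⟨ *-congˡ (D-back (suc s) r) ⟩
  (1# ⊝ q ↑ suc s) ⊗ (D (suc s) r ⊗ (1# ⊝ q ↑ suc (suc s + r)))        ≈⟨ ≈-sym (⊗-assoc _ _ _) ⟩
  D s (suc r) ⊗ (1# ⊝ q ↑ suc (suc s + r))
    ≈⟨ *-congˡ (+-congˡ (-‿cong (≈-reflexive (cong (λ z → q ↑ suc z) (sym (ℕₚ.+-suc s r)))))) ⟩
  D s (suc r) ⊗ (1# ⊝ q ↑ suc (s + suc r))                             ∎

P : ℕ → Series
P = D 0

J : Series
J = lim P

q↑-vanish : ∀ k n → n ≤ k → q ↑ k ≋[ n ] 0#
q↑-vanish k n l = []-trans (≋⇒[] (≈-sym (*-identityʳ _))) (q↑-small k 1# l)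

P-cauchy : ∀ k → P (suc k) ≋[ k ] P k
P-cauchy k = []-trans (≋⇒[] (D-back 0 k)) ([]-trans ([]-⊗ (≋⇒[] ≈-refl) ([]-⊕ (≋⇒[] ≈-refl) ([]-⊖ (q↑-vanish (suc k) k (ℕₚ.n≤1+n k)))))
  (≋⇒[] (solve (P k ∷ []) (v 0 :* (# 1 :- # 0)) (v 0) refl)))

J-agrees : ∀ k → J ≋[ k ] P k
J-agrees = lim-agrees P P-cauchy

J-head : J 0 ≡ + 1
J-head = trans (below (J-agrees 1) 0 (s≤s z≤n)) (trans (at (*-identityʳ (1# ⊝ q ↑ 1)) 0) (trans (at-⊕ 1# (⊖ (q ↑ 1)) 0)
  (cong (λ z → + 1 ℤ.+ z) (trans (at-⊖ (q ↑ 1) 0) (cong ℤ.-_ (q⊗-zero 1#))))))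

diagSum : (ℕ → ℕ → Series) → ℕ → ℕ → Series
diagSum F s zero    = F s 0
diagSum F s (suc r) = F s (suc r) ⊕ diagSum F (suc s) r

diagSum-mod : ∀ F n → (∀ s r → F (suc s) r ≋[ suc s + r ] 0#) → diagSum F 0 n ≋[ n ] F 0 n
diagSum-mod F zero    p = ≋⇒[] ≈-refl
diagSum-mod F (suc n) p = []-trans ([]-⊕ (≋⇒[] ≈-refl) (rest 0 n)) (≋⇒[] (+-identityʳ _))
  where
  rest : ∀ s r → diagSum F (suc s) r ≋[ suc s + r ] 0#
  rest s zero    = p s 0
  rest s (suc r) = []-trans ([]-⊕ (p s (suc r)) ([]-weaken (ℕₚ.≤-reflexive (cong suc (ℕₚ.+-suc s r))) (rest (suc s) r))) (≋⇒[] (+-identityʳ _))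

-- Shanks' telescoping proof of the pentagonal number theorem

module Pentagonal where
  M L : ℕ → Series
  M = thMono 1 3
  L = thMono 0 3

  L-M : ∀ m → L m ⊗ q ↑ m ≋ M m
  L-M zero    = *-identityʳ _
  L-M (suc m) = lincomb (q ∷ L m ∷ M m ∷ q ↑ m ∷ q ↑ (m * 3) ∷ [])
    ((v 1 :* (v 0 :* v 4)) :* (v 0 :* v 3)) (v 2 :* (v 0 :* (v 0 :* v 4)))
    ((v 0 :^ 2 :* v 4 , v 1 :* v 3 ≐ v 2) ∷ []) refl (L-M m ∷ [])

  -- With n = s + r this is (-1)ˢ (P(n)/P(s)) q^(s(s + 1)/2 + sn), since `M s` is q^(s(3s + 1)/2);
  -- `L s` is q^(s(3s - 1)/2).
  A : ℕ → ℕ → Series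
  A s r = const (sgn s) ⊗ D s r ⊗ M s ⊗ q ↑ (r * s)

  end : ℕ → Series
  end n = const (sgn (suc n)) ⊗ (M (suc n) ⊕ L (suc n))

  L-suc : ∀ s → L (suc s) ≋ M s ⊗ q ↑ s ⊗ q ↑ suc s
  L-suc s = lincomb (q ∷ L s ∷ M s ∷ q ↑ s ∷ q ↑ (s * 3) ∷ [])
    (v 1 :* (v 0 :* v 4)) (v 2 :* v 3 :* (v 0 :* v 3))
    ((v 0 :* v 3 :^ 2 , v 1 :* v 3 ≐ v 2) ∷ (v 1 :* v 0 , v 4 ≐ v 3 :* (v 3 :* (v 3 :* # 1))) ∷ []) refl (L-M s ∷ cube ∷ [])
    where
    cube : q ↑ (s * 3) ≋ q ↑ s ⊗ (q ↑ s ⊗ (q ↑ s ⊗ 1#))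
    cube = ≈-trans (≈-reflexive (cong (q ↑_) (ℕₚ.*-comm s 3))) (≈-trans (↑-+ q s _) (*-congˡ (≈-trans (↑-+ q s _) (*-congˡ (↑-+ q s 0)))))

  -- A general starting point s is needed for the induction on r. The correction (1 - qˢ) A s r
  -- vanishes at s = 0, where the passage from n to n + 1 adds just two pentagonal terms.
  telescope : ∀ s r → diagSum A s (suc r) ≋ diagSum A s r ⊝ (1# ⊝ q ↑ s) ⊗ A s r ⊕ end (s + r)
  telescope s zero = begin
    const (sgn s) ⊗ ((1# ⊝ q ↑ suc s) ⊗ 1#) ⊗ M s ⊗ q ↑ (s + 0) ⊕ A (suc s) 0
      ≈⟨ lincomb (const (sgn s) ∷ q ↑ s ∷ M s ∷ L (suc s) ∷ M (suc s) ∷ const (sgn (suc s)) ∷ q ↑ (s + 0) ∷ q ↑ suc s ∷ [])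
         (v 0 :* ((# 1 :- v 7) :* # 1) :* v 2 :* v 6 :+ v 5 :* # 1 :* v 4 :* # 1)
         (v 0 :* # 1 :* v 2 :* # 1 :- (# 1 :- v 1) :* (v 0 :* # 1 :* v 2 :* # 1) :+ v 5 :* (v 4 :+ v 3))
         ((v 0 :* (# 1 :- v 7) :* v 2 , v 6 ≐ v 1) ∷ (v 0 , v 3 ≐ v 2 :* v 1 :* v 7) ∷ (:- v 3 , v 5 ≐ :- v 0) ∷ []) refl
         (≈-reflexive (cong (q ↑_) (ℕₚ.+-identityʳ s)) ∷ L-suc s ∷ sgn-suc s ∷ []) ⟩
    A s 0 ⊝ (1# ⊝ q ↑ s) ⊗ A s 0 ⊕ end s
      ≈⟨ +-congˡ (≈-reflexive (cong end (sym (ℕₚ.+-identityʳ s)))) ⟩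
    A s 0 ⊝ (1# ⊝ q ↑ s) ⊗ A s 0 ⊕ end (s + 0) ∎
  telescope s (suc r) = begin
    A s (suc (suc r)) ⊕ diagSum A (suc s) (suc r)
      ≈⟨ +-congˡ (telescope (suc s) r) ⟩
    A s (suc (suc r)) ⊕ (X ⊝ (1# ⊝ q ↑ suc s) ⊗ A (suc s) r ⊕ end (suc s + r))
      ≈⟨ lincomb (q ∷ const (sgn s) ∷ q ↑ s ∷ M s ∷ const (sgn (suc s)) ∷ D (suc s) r ∷ D s (suc (suc r)) ∷ q ↑ r
           ∷ q ↑ (r * s) ∷ q ↑ (r * suc s) ∷ X ∷ end (suc s + r) ∷ q ↑ suc (s + suc r) ∷ q ↑ (suc r * s) ∷ q ↑ (suc (suc r) * s) ∷ M (suc s) ∷ [])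
         (v 1 :* v 6 :* v 3 :* v 14 :+ (v 10 :- (# 1 :- qs) :* (v 4 :* v 5 :* v 15 :* v 9) :+ v 11))
         (a :+ v 10 :- (# 1 :- v 2) :* a :+ v 11)
         ((v 1 :* v 3 :* v 14 , v 6 ≐ (# 1 :- qs) :* v 5 :* (# 1 :- v 12))
           ∷ (v 1 :* (# 1 :- qs) :* v 5 :* v 3 :* (# 1 :- v 12) , v 14 ≐ v 2 :* v 13)
           ∷ (:- (v 1 :* v 2 :* (# 1 :- qs) :* v 5 :* v 3 :* v 13) , v 12 ≐ v 0 :* (v 2 :* (v 0 :* v 7)))
           ∷ (:- ((# 1 :- qs) :* v 5 :* v 15 :* v 9) , v 4 ≐ :- v 1)
           ∷ ((# 1 :- qs) :* v 5 :* v 15 :* v 1 , v 9 ≐ v 7 :* v 8)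
           ∷ ((# 1 :- qs) :* v 5 :* v 1 :* v 7 :* v 8 , v 15 ≐ v 3 :* (v 0 :^ 2 :* (v 2 :* (v 2 :* v 2))))
           ∷ (:- (v 0 :^ 2 :* v 2 :^ 2 :* v 7 :* v 1 :* (# 1 :- qs) :* v 5 :* v 3) , v 13 ≐ v 2 :* v 8) ∷ []) refl
         (D-back s (suc r) ∷ ↑-+ q s (suc r * s) ∷ *-congˡ (↑-+ q s (suc r)) ∷ sgn-suc s
           ∷ ≈-trans (≈-reflexive (cong (q ↑_) (ℕₚ.*-suc r s))) (↑-+ q r (r * s)) ∷ M-suc ∷ ↑-+ q s (r * s) ∷ []) ⟩
    A s (suc r) ⊕ X ⊝ (1# ⊝ q ↑ s) ⊗ A s (suc r) ⊕ end (suc s + r)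
      ≈⟨ +-congˡ (≈-reflexive (cong end (sym (ℕₚ.+-suc s r)))) ⟩
    A s (suc r) ⊕ X ⊝ (1# ⊝ q ↑ s) ⊗ A s (suc r) ⊕ end (s + suc r) ∎
    where
    X = diagSum A (suc s) r
    qs = v 0 :* v 2
    a = v 1 :* ((# 1 :- qs) :* v 5) :* v 3 :* v 13
    M-suc : M (suc s) ≋ M s ⊗ (q ↑ 2 ⊗ (q ↑ s ⊗ (q ↑ s ⊗ q ↑ s)))
    M-suc = *-congˡ (≈-trans (↑-+ q 2 (s * 3)) (*-congˡ (≈-trans (≈-reflexive (cong (q ↑_) (ℕₚ.*-comm s 3)))
      (≈-trans (↑-+ q s _) (*-congˡ (≈-trans (↑-+ q s _) (*-congˡ (≈-reflexive (cong (q ↑_) (ℕₚ.+-identityʳ s))))))))))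

  small : ∀ s r → A (suc s) r ≋[ suc s + r ] 0#
  small s r = []-trans (≋⇒[] shape) (q↑-small (suc (suc (s * 3)) + r * suc s) _
    (ℕₚ.≤-trans (s≤s (ℕₚ.+-mono-≤ (ℕₚ.≤-trans (ℕₚ.m≤m*n s 3) (ℕₚ.n≤1+n _)) (ℕₚ.m≤m*n r (suc s)))) ℕₚ.≤-refl))
    where
    shape : A (suc s) r ≋ q ↑ (suc (suc (s * 3)) + r * suc s) ⊗ (const (sgn (suc s)) ⊗ D (suc s) r ⊗ M s)
    shape = lincomb (const (sgn (suc s)) ∷ D (suc s) r ∷ M s ∷ q ↑ (suc (suc (s * 3))) ∷ q ↑ (r * suc s) ∷ q ↑ (suc (suc (s * 3)) + r * suc s) ∷ [])
      (v 0 :* v 1 :* (v 2 :* v 3) :* v 4) (v 5 :* (v 0 :* v 1 :* v 2)) ((:- (v 0 :* v 1 :* v 2) , v 5 ≐ v 3 :* v 4) ∷ []) refl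
      (↑-+ q (suc (suc (s * 3))) (r * suc s) ∷ [])

  partial : ∀ n → diagSum A 0 n ≋ sumS (λ m → const (sgn m) ⊗ M m) (suc n) ⊕ sumS (λ m → const (sgn m) ⊗ L m) (suc n) ⊝ 1#
  partial zero    = solve [] (# 1 :* # 1 :* # 1 :* # 1) ((# 0 :+ # 1 :* # 1) :+ (# 0 :+ # 1 :* # 1) :- # 1) refl
  partial (suc n) = begin
    diagSum A 0 (suc n)
      ≈⟨ telescope 0 n ⟩
    diagSum A 0 n ⊝ (1# ⊝ 1#) ⊗ A 0 n ⊕ end n
      ≈⟨ +-congʳ (+-congʳ (partial n)) ⟩
    X ⊕ Y ⊝ 1# ⊝ (1# ⊝ 1#) ⊗ A 0 n ⊕ end n
      ≈⟨ solve (X ∷ Y ∷ A 0 n ∷ const (sgn (suc n)) ∷ M (suc n) ∷ L (suc n) ∷ [])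
           (v 0 :+ v 1 :- # 1 :- (# 1 :- # 1) :* v 2 :+ v 3 :* (v 4 :+ v 5)) (v 0 :+ v 3 :* v 4 :+ (v 1 :+ v 3 :* v 5) :- # 1) refl ⟩
    X ⊕ const (sgn (suc n)) ⊗ M (suc n) ⊕ (Y ⊕ const (sgn (suc n)) ⊗ L (suc n)) ⊝ 1# ∎
    where
    X = sumS (λ m → const (sgn m) ⊗ M m) (suc n)
    Y = sumS (λ m → const (sgn m) ⊗ L m) (suc n)

pentagonal : J ≋ th sgn 1 3 ⊕ th sgn 0 3 ⊝ 1#
pentagonal = []⇒≋ λ n → []-trans (J-agrees n) ([]-trans (≋⇒[] (solve (P n ∷ []) (v 0) (# 1 :* v 0 :* # 1 :* # 1) refl))
  ([]-trans (≋⇒[] (*-congˡ (≈-reflexive (cong (q ↑_) (sym (ℕₚ.*-zeroʳ n))))))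
  ([]-trans ([]-sym (diagSum-mod A n small)) ([]-trans (≋⇒[] (partial n))
  ([]-⊕ ([]-⊕ ([]-weaken (ℕₚ.n≤1+n n) ([]-sym (th-sum sgn 1 3 (suc n)))) ([]-weaken (ℕₚ.n≤1+n n) ([]-sym (th-sum sgn 0 3 (suc n))))) (≋⇒[] ≈-refl))))))
  where open Pentagonal

-- Gauss's theta series of the squares, by the same telescoping

module Squares where
  -- `M s` is q^(s²), `B n` is (1 + q)...(1 + qⁿ), and `w s` is (1 + q⁰)(1 + q)...(1 + qˢ⁻¹), whose
  -- first factor is the 2 in its definition.
  M B w : ℕ → Series
  M = thMono 0 2
  B zero    = 1#
  B (suc n) = B n ⊗ (1# ⊕ q ↑ suc n)
  w zero    = 1#
  w (suc n) = const (+ 2) ⊗ B n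

  w-B : ∀ s → w s ⊗ (1# ⊕ q ↑ s) ≋ const (+ 2) ⊗ B s
  w-B zero    = solve [] (# 1 :* (# 1 :+ # 1)) (# 2 :* # 1) refl
  w-B (suc s) = ⊗-assoc _ _ _

  A : ℕ → ℕ → Series
  A s r = const (sgn s) ⊗ w s ⊗ D s r ⊗ (M s ⊗ q ↑ s) ⊗ q ↑ (r * s)

  end : ℕ → Series
  end n = const (+ 2) ⊗ const (sgn (suc n)) ⊗ B (suc n) ⊗ M (suc n)

  M-suc : ∀ s → M (suc s) ≋ M s ⊗ (q ⊗ (q ↑ s ⊗ q ↑ s))
  M-suc s = *-congˡ (*-congˡ (≈-trans (≈-reflexive (cong (q ↑_) (ℕₚ.*-comm s 2)))
    (≈-trans (↑-+ q s _) (*-congˡ (≈-reflexive (cong (q ↑_) (ℕₚ.+-identityʳ s)))))))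

  telescope : ∀ s r → diagSum A s (suc r) ≋ (1# ⊕ q ↑ suc (s + r)) ⊗ diagSum A s r ⊝ (1# ⊝ q ↑ s) ⊗ A s r ⊕ end (s + r)
  telescope s zero = begin
    const (sgn s) ⊗ w s ⊗ ((1# ⊝ q ↑ suc s) ⊗ 1#) ⊗ (M s ⊗ q ↑ s) ⊗ q ↑ (s + 0) ⊕ A (suc s) 0
      ≈⟨ lincomb (q ∷ const (sgn s) ∷ q ↑ s ∷ M s ∷ M (suc s) ∷ const (sgn (suc s)) ∷ q ↑ (s + 0) ∷ w s ∷ B s ∷ [])
         (v 1 :* v 7 :* ((# 1 :- qs) :* # 1) :* (v 3 :* v 2) :* v 6 :+ v 5 :* (# 2 :* v 8) :* # 1 :* (v 4 :* qs) :* # 1)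
         ((# 1 :+ qs) :* a :- (# 1 :- v 2) :* a :+ # 2 :* v 5 :* (v 8 :* (# 1 :+ qs)) :* v 4)
         ((v 1 :* v 7 :* (# 1 :- qs) :* v 3 :* v 2 , v 6 ≐ v 2) ∷ (:- (# 2 :* v 8 :* v 4) , v 5 ≐ :- v 1)
           ∷ (# 2 :* v 8 :* v 1 , v 4 ≐ v 3 :* (v 0 :* (v 2 :* v 2))) ∷ (:- (v 1 :* v 3 :* v 2 :^ 2 :* v 0) , v 7 :* (# 1 :+ v 2) ≐ # 2 :* v 8) ∷ []) refl
         (≈-reflexive (cong (q ↑_) (ℕₚ.+-identityʳ s)) ∷ sgn-suc s ∷ M-suc s ∷ w-B s ∷ []) ⟩
    (1# ⊕ q ↑ suc s) ⊗ A s 0 ⊝ (1# ⊝ q ↑ s) ⊗ A s 0 ⊕ end s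
      ≈⟨ ≈-reflexive (cong (λ z → (1# ⊕ q ↑ suc z) ⊗ A s 0 ⊝ (1# ⊝ q ↑ s) ⊗ A s 0 ⊕ end z) (sym (ℕₚ.+-identityʳ s))) ⟩
    (1# ⊕ q ↑ suc (s + 0)) ⊗ A s 0 ⊝ (1# ⊝ q ↑ s) ⊗ A s 0 ⊕ end (s + 0) ∎
    where
    qs = v 0 :* v 2
    a = v 1 :* v 7 :* # 1 :* (v 3 :* v 2) :* # 1
  telescope s (suc r) = begin
    A s (suc (suc r)) ⊕ diagSum A (suc s) (suc r)
      ≈⟨ +-congˡ (telescope (suc s) r) ⟩
    A s (suc (suc r)) ⊕ ((1# ⊕ q ↑ suc (suc s + r)) ⊗ X ⊝ (1# ⊝ q ↑ suc s) ⊗ A (suc s) r ⊕ end (suc s + r))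
      ≈⟨ lincomb (q ∷ const (sgn s) ∷ q ↑ s ∷ M s ∷ const (sgn (suc s)) ∷ D (suc s) r ∷ D s (suc (suc r)) ∷ q ↑ r
           ∷ q ↑ (r * s) ∷ q ↑ (r * suc s) ∷ X ∷ end (suc s + r) ∷ q ↑ suc (s + suc r) ∷ q ↑ (suc r * s) ∷ q ↑ (suc (suc r) * s) ∷ M (suc s)
           ∷ w s ∷ B s ∷ q ↑ (s + r) ∷ [])
         (v 1 :* v 16 :* v 6 :* (v 3 :* v 2) :* v 14
           :+ ((# 1 :+ v 0 :* (v 0 :* v 18)) :* v 10 :- (# 1 :- qs) :* (v 4 :* (# 2 :* v 17) :* v 5 :* (v 15 :* qs) :* v 9) :+ v 11))
         ((# 1 :+ v 0 :* (v 0 :* v 18)) :* (a :+ v 10) :- (# 1 :- v 2) :* a :+ v 11)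
         ((v 1 :* v 16 :* v 3 :* v 2 :* v 14 , v 6 ≐ d :* (# 1 :- v 12))
           ∷ (v 1 :* v 16 :* d :* v 3 :* v 2 :* (# 1 :- v 12) , v 14 ≐ v 2 :* v 13)
           ∷ (:- (v 1 :* v 16 :* v 2 :^ 2 :* d :* v 3 :* v 13) , v 12 ≐ v 0 :* (v 2 :* (v 0 :* v 7)))
           ∷ (:- (# 2 :* v 17 :* d :* v 15 :* qs :* v 9) , v 4 ≐ :- v 1)
           ∷ (# 2 :* v 17 :* d :* v 15 :* qs :* v 1 , v 9 ≐ v 7 :* v 8)
           ∷ (# 2 :* v 17 :* d :* qs :* v 1 :* v 7 :* v 8 , v 15 ≐ v 3 :* (v 0 :* (v 2 :* v 2)))
           ∷ (:- (# 2 :* v 17 :* d :* qs :* v 1 :* v 7 :* v 3 :* v 0 :* v 2) , v 13 ≐ v 2 :* v 8)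
           ∷ (:- (d :* qs :* v 1 :* v 7 :* v 3 :* v 0 :* v 2 :* v 13) , v 16 :* (# 1 :+ v 2) ≐ # 2 :* v 17)
           ∷ (:- (v 0 :^ 2 :* a) , v 18 ≐ v 2 :* v 7) ∷ []) refl
         (D-back s (suc r) ∷ ↑-+ q s (suc r * s) ∷ *-congˡ (↑-+ q s (suc r)) ∷ sgn-suc s
           ∷ ≈-trans (≈-reflexive (cong (q ↑_) (ℕₚ.*-suc r s))) (↑-+ q r (r * s)) ∷ M-suc s ∷ ↑-+ q s (r * s) ∷ w-B s ∷ ↑-+ q s r ∷ []) ⟩
    (1# ⊕ q ↑ suc (suc s + r)) ⊗ (A s (suc r) ⊕ X) ⊝ (1# ⊝ q ↑ s) ⊗ A s (suc r) ⊕ end (suc s + r)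
      ≈⟨ ≈-reflexive (cong (λ z → (1# ⊕ q ↑ suc z) ⊗ (A s (suc r) ⊕ X) ⊝ (1# ⊝ q ↑ s) ⊗ A s (suc r) ⊕ end z) (sym (ℕₚ.+-suc s r))) ⟩
    (1# ⊕ q ↑ suc (s + suc r)) ⊗ (A s (suc r) ⊕ X) ⊝ (1# ⊝ q ↑ s) ⊗ A s (suc r) ⊕ end (s + suc r) ∎
    where
    X = diagSum A (suc s) r
    qs = v 0 :* v 2
    d = (# 1 :- qs) :* v 5
    a = v 1 :* v 16 :* d :* (v 3 :* v 2) :* v 13

  small : ∀ s r → A (suc s) r ≋[ suc s + r ] 0#
  small s r = []-trans (≋⇒[] shape) (q↑-small (suc s + r * suc s) _ (ℕₚ.+-monoʳ-≤ (suc s) (ℕₚ.m≤m*n r (suc s))))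
    where
    shape : A (suc s) r ≋ q ↑ (suc s + r * suc s) ⊗ (const (sgn (suc s)) ⊗ w (suc s) ⊗ D (suc s) r ⊗ M (suc s))
    shape = lincomb (const (sgn (suc s)) ∷ w (suc s) ∷ D (suc s) r ∷ M (suc s) ∷ q ↑ suc s ∷ q ↑ (r * suc s) ∷ q ↑ (suc s + r * suc s) ∷ [])
      (v 0 :* v 1 :* v 2 :* (v 3 :* v 4) :* v 5) (v 6 :* (v 0 :* v 1 :* v 2 :* v 3))
      ((:- (v 0 :* v 1 :* v 2 :* v 3) , v 6 ≐ v 4 :* v 5) ∷ []) refl (↑-+ q (suc s) (r * suc s) ∷ [])

  squares : ℕ → Series
  squares n = const (+ 2) ⊗ sumS (λ m → const (sgn m) ⊗ M m) (suc n) ⊝ 1#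

  partial : ∀ n → diagSum A 0 n ≋ B n ⊗ squares n
  partial zero    = solve [] (# 1 :* # 1 :* # 1 :* (# 1 :* # 1) :* # 1) (# 1 :* (# 2 :* (# 0 :+ # 1 :* # 1) :- # 1)) refl
  partial (suc n) = lincomb (diagSum A 0 (suc n) ∷ q ↑ suc n ∷ diagSum A 0 n ∷ A 0 n ∷ B n
      ∷ sumS (λ m → const (sgn m) ⊗ M m) (suc n) ∷ const (sgn (suc n)) ∷ M (suc n) ∷ [])
    (v 0) (v 4 :* (# 1 :+ v 1) :* (# 2 :* (v 5 :+ v 6 :* v 7) :- # 1))
    ((# 1 , v 0 ≐ (# 1 :+ v 1) :* v 2 :- (# 1 :- # 1) :* v 3 :+ # 2 :* v 6 :* (v 4 :* (# 1 :+ v 1)) :* v 7)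
      ∷ (# 1 :+ v 1 , v 2 ≐ v 4 :* (# 2 :* v 5 :- # 1)) ∷ []) refl (telescope 0 n ∷ partial n ∷ [])

  P-B : ∀ n → P n ⊗ B n ≋ dil 1 (P n)
  P-B zero    = ≈-trans (*-identityˡ _) (≈-sym (IsHom.F-1 (dil-hom 1)))
  P-B (suc n) = begin
    P (suc n) ⊗ B (suc n)
      ≈⟨ lincomb (P (suc n) ∷ P n ∷ B n ∷ q ↑ suc n ∷ []) (v 0 :* (v 2 :* (# 1 :+ v 3))) (v 1 :* v 2 :* (# 1 :- v 3 :* v 3))
           ((v 2 :* (# 1 :+ v 3) , v 0 ≐ v 1 :* (# 1 :- v 3)) ∷ []) refl (D-back 0 n ∷ []) ⟩
    P n ⊗ B n ⊗ (1# ⊝ q ↑ suc n ⊗ q ↑ suc n)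
      ≈⟨ *-cong (P-B n) (+-congˡ (-‿cong (≈-sym (double (suc n))))) ⟩
    dil 1 (P n) ⊗ (1# ⊝ dil 1 (q ↑ suc n))
      ≈⟨ *-congˡ (+-cong (≈-sym F-1) (≈-sym (F-⊖ _))) ⟩
    dil 1 (P n) ⊗ (dil 1 1# ⊕ dil 1 (⊖ q ↑ suc n))
      ≈⟨ ≈-trans (*-congˡ (≈-sym (F-⊕ _ _))) (≈-sym (F-⊗ _ _)) ⟩
    dil 1 (P n ⊗ (1# ⊝ q ↑ suc n))
      ≈⟨ F-cong (≈-sym (D-back 0 n)) ⟩
    dil 1 (P (suc n)) ∎
    where
    open IsHom (dil-hom 1)
    double : ∀ m → dil 1 (q ↑ m) ≋ q ↑ m ⊗ q ↑ m
    double zero    = ≈-trans F-1 (≈-sym (*-identityˡ _))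
    double (suc m) = ≈-trans (F-⊗ q (q ↑ m)) (≈-trans (*-cong (dil-q 1) (double m))
      (solve (q ∷ q ↑ m ∷ []) (v 0 :^ 2 :* (v 1 :* v 1)) ((v 0 :* v 1) :* (v 0 :* v 1)) refl))

φ : Series
φ = const (+ 2) ⊗ th sgn 0 2 ⊝ 1#

spread-mod : ∀ k j n {f g} → f ≋[ n ] g → ∀ i → i < n → spread k j f i ≡ spread k j g i
spread-mod k zero    (suc n) p zero    _       = below p 0 (s≤s z≤n)
spread-mod k zero    (suc n) p (suc i) (s≤s l) = spread-mod k k n (mk λ m m<n → below p (suc m) (s≤s m<n)) i l
spread-mod k (suc j) n       p zero    _       = refl
spread-mod k (suc j) (suc n) p (suc i) (s≤s l) = spread-mod k j n ([]-weaken (ℕₚ.n≤1+n n) p) i l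

dil-mod : ∀ k {n f g} → f ≋[ n ] g → dil k f ≋[ n ] dil k g
dil-mod k p = mk (spread-mod k 0 _ p)

φ-product : φ ⊗ dil 1 J ≋ J ⊗ J
φ-product = []⇒≋ λ n →
  []-trans ([]-⊗ ([]-⊕ ([]-⊗ (≋⇒[] ≈-refl) ([]-weaken (ℕₚ.n≤1+n n) (th-sum sgn 0 2 (suc n)))) (≋⇒[] ≈-refl)) (dil-mod 1 (J-agrees n)))
  ([]-trans (≋⇒[] (lincomb (squares n ∷ dil 1 (P n) ∷ P n ∷ B n ∷ diagSum A 0 n ∷ []) (v 0 :* v 1) (v 2 :* v 4)
    ((:- v 0 , v 2 :* v 3 ≐ v 1) ∷ (:- v 2 , v 4 ≐ v 3 :* v 0) ∷ []) refl (P-B n ∷ partial n ∷ [])))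
  ([]-⊗ ([]-sym (J-agrees n)) ([]-trans (diagSum-mod A n small) ([]-trans (≋⇒[] (head-term n)) ([]-sym (J-agrees n))))))
  where
  open Squares
  head-term : ∀ n → A 0 n ≋ P n
  head-term n = ≈-trans (*-congˡ (≈-reflexive (cong (q ↑_) (ℕₚ.*-zeroʳ n)))) (solve (P n ∷ []) (# 1 :* # 1 :* v 0 :* (# 1 :* # 1) :* # 1) (v 0) refl)

-- Jacobi's identity: c N k is the coefficient of (-1)ᵏ (z⁻ᵏ + … + zᵏ) in Π_{i ≤ N} (1 - z qⁱ)(1 - z⁻¹ qⁱ), specialised to z = 1

module Cube where
  M : ℕ → Series
  M = thMono 0 1

  mutual
    c : ℕ → ℕ → Series
    c zero    zero    = 1#
    c zero    (suc k) = 0#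
    c (suc N) k       = (1# ⊕ q ↑ suc N ⊗ q ↑ suc N) ⊗ c N k ⊕ q ↑ suc N ⊗ (cprev N k ⊕ c N (suc k))

    -- With χₖ = z⁻ᵏ + ... + zᵏ one has (z + z⁻¹)χₖ = χₖ₊₁ + χₖ₋₁ for k ≥ 1, but (z + z⁻¹)χ₀ = χ₁ -
    -- χ₀. With the alternating signs this amounts to reading index -1 as 0.
    cprev : ℕ → ℕ → Series
    cprev N zero    = c N 0
    cprev N (suc k) = c N k

  odd : ℕ → ℤ
  odd k = sgn k ℤ.* + (k + suc k)

  odd-sgn : ∀ k → const (odd k) ≋ const (sgn k) ⊗ const (+ (k + suc k))
  odd-sgn k = const-* _ _

  F : ℕ → ℕ → Series
  F N K = sumS (λ k → const (odd k) ⊗ c N k) K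

  nat : ∀ k → const (+ suc k) ≋ const (+ k) ⊕ 1#
  nat k = ≈-trans (≈-reflexive (cong (λ z → const (+ z)) (ℕₚ.+-comm 1 k))) (const-+ (+ k) (+ 1))

  lin : ∀ k → const (+ (k + suc k)) ≋ const (+ k) ⊕ const (+ k) ⊕ 1#
  lin k = ≈-trans (const-+ (+ k) (+ suc k)) (≈-trans (+-congˡ (nat k)) (≈-sym (⊕-assoc _ _ _)))

  odd-suc : ∀ k → const (odd (suc k)) ≋ ⊖ const (sgn k) ⊗ (const (+ k) ⊕ const (+ k) ⊕ const (+ 3))
  odd-suc k = lincomb (const (odd (suc k)) ∷ const (sgn (suc k)) ∷ const (+ (suc k + suc (suc k))) ∷ const (sgn k) ∷ const (+ suc k) ∷ const (+ k) ∷ [])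
    (v 0) (:- v 3 :* (v 5 :+ v 5 :+ # 3))
    ((# 1 , v 0 ≐ v 1 :* v 2) ∷ (v 2 , v 1 ≐ :- v 3) ∷ (:- v 3 , v 2 ≐ v 4 :+ v 4 :+ # 1) ∷ (:- (# 2 :* v 3) , v 4 ≐ v 5 :+ # 1) ∷ []) refl
    (odd-sgn (suc k) ∷ sgn-suc k ∷ lin (suc k) ∷ nat k ∷ [])

  -- Summation by parts. The weights satisfy (2k + 3) + (2k - 1) = 2(2k + 1), so every interior term
  -- picks up 1 - 2qᴺ⁺¹ + q²ᴺ⁺² = (1 - qᴺ⁺¹)²; what remains is the boundary at K.
  summation : ∀ N K → F (suc N) (suc K) ≋ (1# ⊝ q ↑ suc N) ⊗ (1# ⊝ q ↑ suc N) ⊗ F N (suc K)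
    ⊕ q ↑ suc N ⊗ const (sgn K) ⊗ ((const (+ K) ⊕ const (+ K) ⊕ 1#) ⊗ c N (suc K) ⊕ (const (+ K) ⊕ const (+ K) ⊕ const (+ 3)) ⊗ c N K)
  summation N zero    = solve (q ↑ suc N ∷ c N 0 ∷ c N 1 ∷ [])
    (# 0 :+ # 1 :* ((# 1 :+ v 0 :* v 0) :* v 1 :+ v 0 :* (v 1 :+ v 2)))
    ((# 1 :- v 0) :* (# 1 :- v 0) :* (# 0 :+ # 1 :* v 1) :+ v 0 :* # 1 :* ((# 0 :+ # 0 :+ # 1) :* v 2 :+ (# 0 :+ # 0 :+ # 3) :* v 1)) refl
  summation N (suc K) = lincomb (q ↑ suc N ∷ c N K ∷ c N (suc K) ∷ c N (suc (suc K)) ∷ F (suc N) (suc K) ∷ F N (suc K)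
      ∷ const (sgn K) ∷ const (sgn (suc K)) ∷ const (+ K) ∷ const (+ suc K) ∷ const (odd (suc K)) ∷ [])
    (v 4 :+ v 10 :* ((# 1 :+ v 0 :* v 0) :* v 2 :+ v 0 :* (v 1 :+ v 3)))
    (x :* (v 5 :+ v 10 :* v 2) :+ v 0 :* v 7 :* ((v 9 :+ v 9 :+ # 1) :* v 3 :+ (v 9 :+ v 9 :+ # 3) :* v 2))
    ((# 1 , v 4 ≐ x :* v 5 :+ v 0 :* v 6 :* ((v 8 :+ v 8 :+ # 1) :* v 2 :+ (v 8 :+ v 8 :+ # 3) :* v 1))
      ∷ (v 0 :* (v 1 :+ v 3) :+ # 2 :* v 0 :* v 2 , v 10 ≐ :- v 6 :* (v 8 :+ v 8 :+ # 3))
      ∷ (:- (v 0 :* ((v 9 :+ v 9 :+ # 1) :* v 3 :+ (v 9 :+ v 9 :+ # 3) :* v 2)) , v 7 ≐ :- v 6)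
      ∷ (# 2 :* v 0 :* v 6 :* (v 3 :+ v 2) , v 9 ≐ v 8 :+ # 1) ∷ []) refl
    (summation N K ∷ odd-suc K ∷ sgn-suc K ∷ nat K ∷ [])
    where x = (# 1 :- v 0) :* (# 1 :- v 0)

  c-zero : ∀ N k → N < k → c N k ≋ 0#
  c-zero zero    (suc k) _       = ≈-refl
  c-zero (suc N) (suc k) (s≤s l) = lincomb (q ↑ suc N ∷ c N (suc k) ∷ c N k ∷ c N (suc (suc k)) ∷ [])
    ((# 1 :+ v 0 :* v 0) :* v 1 :+ v 0 :* (v 2 :+ v 3)) (# 0)
    ((# 1 :+ v 0 :* v 0 , v 1 ≐ # 0) ∷ (v 0 , v 2 ≐ # 0) ∷ (v 0 , v 3 ≐ # 0) ∷ []) refl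
    (c-zero N (suc k) (ℕₚ.m≤n⇒m≤1+n l) ∷ c-zero N k l ∷ c-zero N (suc (suc k)) (ℕₚ.m≤n⇒m≤1+n (ℕₚ.m≤n⇒m≤1+n l)) ∷ [])

  F-product : ∀ N K → N < K → F N K ≋ P N ⊗ P N
  F-product zero    (suc zero)    _ = solve [] (# 0 :+ # 1 :* # 1) (# 1 :* # 1) refl
  F-product zero    (suc (suc K)) _ = ≈-trans (+-cong (F-product zero (suc K) (s≤s z≤n)) (zeroʳ _)) (+-identityʳ _)
  F-product (suc N) (suc K) (s≤s l) = lincomb (q ↑ suc N ∷ F (suc N) (suc K) ∷ F N (suc K) ∷ const (sgn K) ∷ const (+ K) ∷ c N (suc K) ∷ c N K ∷ P N ∷ P (suc N) ∷ [])
    (v 1) (v 8 :* v 8)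
    ((# 1 , v 1 ≐ x :* v 2 :+ v 0 :* v 3 :* ((v 4 :+ v 4 :+ # 1) :* v 5 :+ (v 4 :+ v 4 :+ # 3) :* v 6))
      ∷ (v 0 :* v 3 :* (v 4 :+ v 4 :+ # 1) , v 5 ≐ # 0) ∷ (v 0 :* v 3 :* (v 4 :+ v 4 :+ # 3) , v 6 ≐ # 0)
      ∷ (x , v 2 ≐ v 7 :* v 7) ∷ (:- (v 8 :+ v 7 :* (# 1 :- v 0)) , v 8 ≐ v 7 :* (# 1 :- v 0)) ∷ []) refl
    (summation N K ∷ c-zero N (suc K) (ℕₚ.m≤n⇒m≤1+n l) ∷ c-zero N K l ∷ F-product N (suc K) (ℕₚ.m≤n⇒m≤1+n l) ∷ D-back 0 N ∷ [])
    where x = (# 1 :- v 0) :* (# 1 :- v 0)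

module CubeLimit where
  open Cube

  Mprev : ℕ → Series
  Mprev zero    = 1#
  Mprev (suc k) = M k

  M-q : ∀ k → M k ≋ Mprev k ⊗ q ↑ k
  M-q zero    = ≈-sym (*-identityʳ _)
  M-q (suc k) = *-congˡ (≈-reflexive (cong (λ z → q ↑ suc z) (ℕₚ.*-identityʳ k)))

  P-suc : ∀ n → P (suc n) ≋ P n ⊗ (1# ⊝ q ↑ suc n)
  P-suc = D-back 0

  -- The finite triple product: c N k = q^(k(k + 1)/2) P(2N + 1)/(P(N - k) P(N + k + 1)), cleared of
  -- denominators, with r = N - k. As N grows it tends to q^(k(k + 1)/2)/J.
  closed : ∀ N k r → k + r ≡ N → c N k ⊗ P r ⊗ P (suc (k + N)) ≋ M k ⊗ P (suc (N + N))
  closed zero    zero    zero    refl = solve (P 1 ∷ []) (# 1 :* # 1 :* v 0) (# 1 :* v 0) refl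
  closed (suc N) k       zero    e with trans (sym (ℕₚ.+-identityʳ k)) e
  ... | refl = begin
    c (suc N) (suc N) ⊗ 1# ⊗ P (suc (suc N + suc N))
      ≈⟨ *-congˡ (≈-reflexive (cong P idx)) ⟩
    c (suc N) (suc N) ⊗ 1# ⊗ P (suc (suc (suc (N + N))))
      ≈⟨ lincomb (q ↑ suc N ∷ c N (suc N) ∷ c N N ∷ c N (suc (suc N)) ∷ P (suc (N + N)) ∷ P (suc (suc (N + N))) ∷ P (suc (suc (suc (N + N))))
           ∷ q ↑ suc (suc (N + N)) ∷ q ↑ suc (suc (suc (N + N))) ∷ M N ∷ M (suc N) ∷ [])
         (((# 1 :+ v 0 :* v 0) :* v 1 :+ v 0 :* (v 2 :+ v 3)) :* # 1 :* v 6) (v 10 :* v 6)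
         (((# 1 :+ v 0 :* v 0) :* v 6 , v 1 ≐ # 0) ∷ (v 0 :* v 6 , v 3 ≐ # 0)
           ∷ (v 0 :* v 2 :- v 0 :* v 9 , v 6 ≐ v 5 :* (# 1 :- v 8)) ∷ ((v 0 :* v 2 :- v 0 :* v 9) :* (# 1 :- v 8) , v 5 ≐ v 4 :* (# 1 :- v 7))
           ∷ (v 0 :* (# 1 :- v 8) :* (# 1 :- v 7) , v 2 :* # 1 :* v 4 ≐ v 9 :* v 4) ∷ (:- v 6 , v 10 ≐ v 9 :* v 0) ∷ []) refl
         (c-zero N (suc N) ℕₚ.≤-refl ∷ c-zero N (suc (suc N)) (ℕₚ.n≤1+n _) ∷ P-suc (suc (suc (N + N))) ∷ P-suc (suc (N + N)) ∷ closed N N 0 (ℕₚ.+-identityʳ N) ∷ M-q (suc N) ∷ []) ⟩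
    M (suc N) ⊗ P (suc (suc (suc (N + N))))
      ≈⟨ *-congˡ (≈-reflexive (cong P (sym idx))) ⟩
    M (suc N) ⊗ P (suc (suc N + suc N)) ∎
    where
    idx : suc (suc N + suc N) ≡ suc (suc (suc (N + N)))
    idx = cong (λ z → suc (suc z)) (ℕₚ.+-suc N N)
  closed (suc N) k (suc r) e = begin
    c (suc N) k ⊗ P (suc r) ⊗ P (suc (k + suc N))
      ≈⟨ *-congˡ (≈-reflexive (cong P idx₁)) ⟩
    c (suc N) k ⊗ P (suc r) ⊗ P (suc (suc (k + N)))
      ≈⟨ lincomb (q ∷ q ↑ k ∷ q ↑ r ∷ c N k ∷ cprev N k ∷ c N (suc k) ∷ P r ∷ P (suc r) ∷ P (suc (k + N)) ∷ P (suc (suc (k + N)))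
           ∷ P (suc (N + N)) ∷ P (suc (suc (N + N))) ∷ P (suc (suc (suc (N + N)))) ∷ Mprev k ∷ M k ∷ M (suc k) ∷ c (suc N) k ∷ [])
         (v 16 :* v 7 :* v 9) (v 14 :* v 12)
         ((v 7 :* v 9 , v 16 ≐ (# 1 :+ n :* n) :* v 3 :+ n :* (v 4 :+ v 5))
           ∷ ((# 1 :+ n :* n) :* v 3 :* v 9 , v 7 ≐ v 6 :* (# 1 :- v 0 :* v 2))
           ∷ ((# 1 :+ n :* n) :* v 3 :* v 6 :* (# 1 :- v 0 :* v 2) , v 9 ≐ v 8 :* (# 1 :- v 0 :* (v 0 :* kN)))
           ∷ ((# 1 :+ n :* n) :* (# 1 :- v 0 :* v 2) :* (# 1 :- v 0 :* (v 0 :* kN)) , v 3 :* v 6 :* v 8 ≐ v 14 :* v 10)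
           ∷ (n , v 4 :* v 7 :* v 9 ≐ (# 1 :- v 0 :* kN) :* (# 1 :- v 0 :* (v 0 :* kN)) :* v 13 :* v 10)
           ∷ (n , v 5 :* v 7 :* v 9 ≐ (# 1 :- v 2) :* (# 1 :- v 0 :* v 2) :* v 15 :* v 10)
           ∷ (:- v 14 , v 12 ≐ v 11 :* f₃) ∷ (:- (v 14 :* f₃) , v 11 ≐ v 10 :* f₂)
           ∷ (n :* (# 1 :- v 2) :* (# 1 :- v 0 :* v 2) :* v 10 , v 15 ≐ v 14 :* (v 0 :* v 1))
           ∷ (v 10 :* ((# 1 :+ n :* n) :* (# 1 :- v 0 :* v 2) :* (# 1 :- v 0 :* (v 0 :* kN)) :+ n :* (# 1 :- v 2) :* (# 1 :- v 0 :* v 2) :* v 0 :* v 1 :- f₃ :* f₂) , v 14 ≐ v 13 :* v 1) ∷ []) refl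
         (+-cong (*-congʳ (+-congˡ (*-cong (*-congˡ qN) (*-congˡ qN)))) (*-congʳ (*-congˡ qN))
           ∷ P-suc r ∷ ≈-trans (P-suc (suc (k + N))) (*-congˡ (+-congˡ (-‿cong (*-congˡ (*-congˡ qkN))))) ∷ closed N k r e′
           ∷ ≈-trans (lower k e′) (*-congʳ (*-congʳ (*-cong (+-congˡ (-‿cong (*-congˡ qkN))) (+-congˡ (-‿cong (*-congˡ (*-congˡ qkN)))))))
           ∷ upper r e′ ∷ ≈-trans (P-suc (suc (suc (N + N)))) (*-congˡ (+-congˡ (-‿cong (*-congˡ (*-congˡ (*-congˡ qNN))))))
           ∷ ≈-trans (P-suc (suc (N + N))) (*-congˡ (+-congˡ (-‿cong (*-congˡ (*-congˡ qNN))))) ∷ M-q (suc k) ∷ M-q k ∷ []) ⟩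
    M k ⊗ P (suc (suc (suc (N + N))))
      ≈⟨ *-congˡ (≈-reflexive (cong P (sym idx₂))) ⟩
    M k ⊗ P (suc (suc N + suc N)) ∎
    where
    n = v 0 :* (v 1 :* v 2)
    kN = v 1 :* (v 1 :* v 2)
    f₂ = # 1 :- v 0 :* (v 0 :* ((v 1 :* v 2) :* (v 1 :* v 2)))
    f₃ = # 1 :- v 0 :* (v 0 :* (v 0 :* ((v 1 :* v 2) :* (v 1 :* v 2))))
    e′ : k + r ≡ N
    e′ = ℕₚ.suc-injective (trans (sym (ℕₚ.+-suc k r)) e)
    qN : q ↑ N ≋ q ↑ k ⊗ q ↑ r
    qN = ≈-trans (≈-reflexive (cong (q ↑_) (sym e′))) (↑-+ q k r)
    qkN : q ↑ (k + N) ≋ q ↑ k ⊗ (q ↑ k ⊗ q ↑ r)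
    qkN = ≈-trans (↑-+ q k N) (*-congˡ qN)
    qNN : q ↑ (N + N) ≋ (q ↑ k ⊗ q ↑ r) ⊗ (q ↑ k ⊗ q ↑ r)
    qNN = ≈-trans (↑-+ q N N) (*-cong qN qN)
    idx₁ : suc (k + suc N) ≡ suc (suc (k + N))
    idx₁ = cong suc (ℕₚ.+-suc k N)
    idx₂ : suc (suc N + suc N) ≡ suc (suc (suc (N + N)))
    idx₂ = cong (λ z → suc (suc z)) (ℕₚ.+-suc N N)
    lower : ∀ k → k + r ≡ N → cprev N k ⊗ P (suc r) ⊗ P (suc (suc (k + N)))
      ≋ (1# ⊝ q ↑ suc (k + N)) ⊗ (1# ⊝ q ↑ suc (suc (k + N))) ⊗ Mprev k ⊗ P (suc (N + N))
    lower zero    refl = lincomb (c N 0 ∷ P N ∷ P (suc N) ∷ P (suc (suc N)) ∷ q ↑ suc N ∷ q ↑ suc (suc N) ∷ P (suc (N + N)) ∷ [])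
      (v 0 :* v 2 :* v 3) ((# 1 :- v 4) :* (# 1 :- v 5) :* # 1 :* v 6)
      ((v 0 :* v 2 , v 3 ≐ v 2 :* (# 1 :- v 5)) ∷ (v 0 :* v 2 :* (# 1 :- v 5) , v 2 ≐ v 1 :* (# 1 :- v 4))
        ∷ ((# 1 :- v 4) :* (# 1 :- v 5) , v 0 :* v 1 :* v 2 ≐ # 1 :* v 6) ∷ []) refl
      (P-suc (suc N) ∷ P-suc N ∷ closed N 0 N refl ∷ [])
    lower (suc k) e = lincomb (c N k ∷ P (suc r) ∷ P (suc (k + N)) ∷ P (suc (suc (k + N))) ∷ P (suc (suc (suc (k + N))))
        ∷ q ↑ suc (suc (k + N)) ∷ q ↑ suc (suc (suc (k + N))) ∷ P (suc (N + N)) ∷ M k ∷ [])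
      (v 0 :* v 1 :* v 4) ((# 1 :- v 5) :* (# 1 :- v 6) :* v 8 :* v 7)
      ((v 0 :* v 1 , v 4 ≐ v 3 :* (# 1 :- v 6)) ∷ (v 0 :* v 1 :* (# 1 :- v 6) , v 3 ≐ v 2 :* (# 1 :- v 5))
        ∷ ((# 1 :- v 5) :* (# 1 :- v 6) , v 0 :* v 1 :* v 2 ≐ v 8 :* v 7) ∷ []) refl
      (P-suc (suc (suc (k + N))) ∷ P-suc (suc (k + N)) ∷ closed N k (suc r) (trans (ℕₚ.+-suc k r) e) ∷ [])
    upper : ∀ r → k + r ≡ N → c N (suc k) ⊗ P (suc r) ⊗ P (suc (suc (k + N)))
      ≋ (1# ⊝ q ↑ r) ⊗ (1# ⊝ q ↑ suc r) ⊗ M (suc k) ⊗ P (suc (N + N))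
    upper zero    e = lincomb (c N (suc k) ∷ P 1 ∷ P (suc (suc (k + N))) ∷ q ↑ 1 ∷ M (suc k) ∷ P (suc (N + N)) ∷ [])
      (v 0 :* v 1 :* v 2) ((# 1 :- # 1) :* (# 1 :- v 3) :* v 4 :* v 5) ((v 1 :* v 2 , v 0 ≐ # 0) ∷ []) refl
      (c-zero N (suc k) (s≤s (ℕₚ.≤-reflexive (trans (sym e) (ℕₚ.+-identityʳ k)))) ∷ [])
    upper (suc r) e = lincomb (c N (suc k) ∷ P r ∷ P (suc r) ∷ P (suc (suc r)) ∷ P (suc (suc (k + N))) ∷ q ↑ suc r ∷ q ↑ suc (suc r) ∷ M (suc k) ∷ P (suc (N + N)) ∷ [])
      (v 0 :* v 3 :* v 4) ((# 1 :- v 5) :* (# 1 :- v 6) :* v 7 :* v 8)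
      ((v 0 :* v 4 , v 3 ≐ v 2 :* (# 1 :- v 6)) ∷ (v 0 :* v 4 :* (# 1 :- v 6) , v 2 ≐ v 1 :* (# 1 :- v 5))
        ∷ ((# 1 :- v 5) :* (# 1 :- v 6) , v 0 :* v 1 :* v 4 ≐ v 7 :* v 8) ∷ []) refl
      (P-suc (suc r) ∷ P-suc r ∷ closed N (suc k) r (trans (sym (ℕₚ.+-suc k r)) e) ∷ [])

  c-small : ∀ N k → c N k ≋[ k ] 0#
  c-small zero    zero    = mk λ _ ()
  c-small zero    (suc k) = ≋⇒[] ≈-refl
  c-small (suc N) zero    = mk λ _ ()
  c-small (suc N) (suc k) = []-trans
    ([]-⊕ ([]-⊗ (≋⇒[] ≈-refl) (c-small N (suc k)))
      ([]-trans (≋⇒[] (⊗-assoc _ _ _)) ([]-q ([]-⊗ (≋⇒[] ≈-refl) ([]-⊕ (c-small N k) ([]-weaken (ℕₚ.m≤n⇒m≤1+n (ℕₚ.n≤1+n k)) (c-small N (suc (suc k)))))))))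
    (≋⇒[] (solve (q ∷ q ↑ N ∷ []) ((# 1 :+ (v 0 :* v 1) :* (v 0 :* v 1)) :* # 0 :+ v 0 :* (v 1 :* (# 0 :+ # 0))) (# 0) refl))

  M-small : ∀ k → M k ≋[ k ] 0#
  M-small zero    = mk λ _ ()
  M-small (suc k) = []-trans (≋⇒[] (⊗-comm _ _)) (q↑-small (suc (k * 1)) (M k) (s≤s (ℕₚ.≤-reflexive (sym (ℕₚ.*-identityʳ k)))))

  c-limit : ∀ n k r → n ≤ r → c (k + r) k ⊗ J ≋[ n ] M k
  c-limit n k r n≤r = []-trans (≋⇒[] (lincomb (c (k + r) k ∷ J ∷ inv J ∷ []) (v 0 :* v 1) (v 0 :* v 1 :* v 1 :* v 2)
      ((:- (v 0 :* v 1) , v 1 :* v 2 ≐ # 1) ∷ []) refl (inv-inverse J J-head ∷ [])))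
    ([]-trans ([]-⊗ ([]-trans ([]-⊗ ([]-⊗ (≋⇒[] ≈-refl) (toP n≤r)) (toP (ℕₚ.≤-trans n≤N (ℕₚ.≤-trans (ℕₚ.m≤n+m _ k) (ℕₚ.n≤1+n _)))))
      ([]-trans (≋⇒[] (closed (k + r) k r refl)) ([]-⊗ (≋⇒[] ≈-refl) ([]-sym (toP (ℕₚ.≤-trans n≤N (ℕₚ.≤-trans (ℕₚ.m≤m+n _ _) (ℕₚ.n≤1+n _)))))))) (≋⇒[] ≈-refl))
    (≋⇒[] (lincomb (M k ∷ J ∷ inv J ∷ []) (v 0 :* v 1 :* v 2) (v 0) ((v 0 , v 1 :* v 2 ≐ # 1) ∷ []) refl (inv-inverse J J-head ∷ []))))
    where
    toP : ∀ {m} → n ≤ m → J ≋[ n ] P m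
    toP l = []-weaken l (J-agrees _)
    n≤N : n ≤ k + r
    n≤N = ℕₚ.≤-trans n≤r (ℕₚ.m≤n+m r k)

open Cube public using (odd)

-- Two factors J are replaced by P(2n)² and expanded by `F-product`, the third turns each c(2n, k)
-- into its limit. For k ≤ n there is enough room for `c-limit`; for k ≥ n both sides vanish modulo
-- qⁿ.
jacobi-cube : J ⊗ J ⊗ J ≋ th odd 0 1
jacobi-cube = []⇒≋ λ n →
  []-trans ([]-⊗ ([]-⊗ (toP n) (toP n)) (≋⇒[] ≈-refl))
  ([]-trans (≋⇒[] (≈-trans (*-congʳ (≈-sym (F-product (n + n) (suc (n + n)) ℕₚ.≤-refl))) (≈-trans (⊗-comm _ _) (sumS-scale J _ (suc (n + n))))))
  ([]-trans (sumS-mod (suc (n + n)) (term n)) ([]-weaken (ℕₚ.≤-trans (ℕₚ.m≤m+n n n) (ℕₚ.n≤1+n _)) ([]-sym (th-sum odd 0 1 (suc (n + n)))))))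
  where
  open Cube
  open CubeLimit
  toP : ∀ n → J ≋[ n ] P (n + n)
  toP n = []-weaken (ℕₚ.m≤m+n n n) (J-agrees _)
  term : ∀ n k → k < suc (n + n) → J ⊗ (const (odd k) ⊗ c (n + n) k) ≋[ n ] const (odd k) ⊗ M k
  term n k k≤ = []-trans (≋⇒[] (solve (J ∷ const (odd k) ∷ c (n + n) k ∷ []) (v 0 :* (v 1 :* v 2)) (v 1 :* (v 2 :* v 0)) refl)) ([]-⊗ (≋⇒[] ≈-refl) main)
    where
    main : c (n + n) k ⊗ J ≋[ n ] M k
    main with ℕₚ.≤-total k n
    ... | inj₁ k≤n = subst (λ N → c N k ⊗ J ≋[ n ] M k) (ℕₚ.m+[n∸m]≡n (ℕₚ.≤-pred k≤))
      (c-limit n k (n + n ∸ k) (ℕₚ.≤-trans (ℕₚ.≤-reflexive (sym (ℕₚ.m+n∸n≡m n n))) (ℕₚ.∸-monoʳ-≤ (n + n) k≤n)))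
    ... | inj₂ n≤k = []-trans ([]-⊗ ([]-weaken n≤k (c-small (n + n) k)) (≋⇒[] ≈-refl))
      ([]-trans (≋⇒[] (zeroˡ J)) ([]-sym ([]-weaken n≤k (M-small k))))

-- Constant terms

evZ : Expr → List ℤ → ℤ
evZ (con c)  zs = c
evZ (var i)  zs = look zs i
  where
  look : List ℤ → ℕ → ℤ
  look []       _       = + 0
  look (z ∷ zs) zero    = z
  look (z ∷ zs) (suc i) = look zs i
evZ (a :+ b) zs = evZ a zs ℤ.+ evZ b zs
evZ (a :* b) zs = evZ a zs ℤ.* evZ b zs
evZ (:- a)   zs = ℤ.- evZ a zs

data Heads : List Series → List ℤ → Set where
  []  : Heads [] []
  _∷_ : ∀ {f fs z zs} → f 0 ≡ z → Heads fs zs → Heads (f ∷ fs) (z ∷ zs)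

head-⟦⟧ : ∀ {xs zs} e → Heads xs zs → ⟦ e ⟧ (env xs) 0 ≡ evZ e zs
head-⟦⟧ (con c)        hs       = refl
head-⟦⟧ (var i)        []       = refl
head-⟦⟧ (var zero)     (h ∷ hs) = h
head-⟦⟧ (var (suc i))  (h ∷ hs) = head-⟦⟧ (var i) hs
head-⟦⟧ {xs} (a :+ b) hs = trans (at-⊕ (⟦ a ⟧ (env xs)) (⟦ b ⟧ (env xs)) 0) (cong₂ ℤ._+_ (head-⟦⟧ a hs) (head-⟦⟧ b hs))
head-⟦⟧ {xs} (a :* b) hs = trans (at-⊗ (⟦ a ⟧ (env xs)) (⟦ b ⟧ (env xs)) 0) (cong₂ ℤ._*_ (head-⟦⟧ a hs) (head-⟦⟧ b hs))
head-⟦⟧ {xs} (:- a)   hs = trans (at-⊖ (⟦ a ⟧ (env xs)) 0) (cong ℤ.-_ (head-⟦⟧ a hs))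

inv-head : ∀ f → inv f 0 ≡ + 1
inv-head f = trans (at (inv-fix f) 0) (head-⟦⟧ {q ∷ tail f ∷ inv f ∷ []} (# 1 :- v 0 :* (v 1 :* v 2)) (refl ∷ refl ∷ refl ∷ []))

th-head : ∀ c κ s → th c κ s 0 ≡ c 0
th-head c κ s = trans (at (th-fix c κ s) 0) (trans (head-⟦⟧ {const (c 0) ∷ q ∷ q ↑ κ ∷ th (c ∘ suc) (κ + s) s ∷ []}
  (v 0 :+ v 1 :* v 2 :* v 3) (refl ∷ refl ∷ refl ∷ refl ∷ [])) (ℤₚ.+-identityʳ (c 0)))

-- Dissections modulo 7

th-scale : ∀ a c κ s → th (λ n → a ℤ.* c n) κ s ≋ const a ⊗ th c κ s
th-scale a c κ s = []⇒≋ λ n → []-trans (th-agrees _ κ s n) ([]-trans (≋⇒[] (go n c κ)) ([]-⊗ (≋⇒[] ≈-refl) ([]-sym (th-agrees c κ s n))))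
  where
  go : ∀ n c κ → thStep (λ n → a ℤ.* c n) κ s n ≋ const a ⊗ thStep c κ s n
  go zero    c κ = ≈-sym (zeroʳ _)
  go (suc n) c κ = ≈-trans (+-cong (const-* a (c 0)) (*-congˡ (go n (c ∘ suc) (κ + s))))
    (solve (const a ∷ const (c 0) ∷ q ↑ suc κ ∷ thStep (c ∘ suc) (κ + s) s n ∷ []) (v 0 :* v 1 :+ v 2 :* (v 0 :* v 3)) (v 0 :* (v 1 :+ v 2 :* v 3)) refl)

V-q↑ : ∀ m → V (q ↑ m) ≋ q ↑ (7 * m)
V-q↑ zero    = VH.F-1
V-q↑ (suc m) = ≈-trans (VH.F-⊗ q (q ↑ m)) (≈-trans (*-cong (dil-q 6) (V-q↑ m)) (≈-trans (≈-sym (↑-+ q 7 (7 * m)))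
  (≈-reflexive (cong (q ↑_) (sym (ℕₚ.*-suc 7 m))))))

V-th : ∀ c κ s → V (th c κ s) ≋ th c (6 + 7 * κ) (7 * s)
V-th c κ s = []⇒≋ λ n → go n c κ
  where
  go : ∀ n c κ → V (th c κ s) ≋[ n ] th c (6 + 7 * κ) (7 * s)
  go zero    c κ = mk λ _ ()
  go (suc n) c κ = []-trans (≋⇒[] (≈-trans (VH.F-cong (th-fix c κ s)) (≈-trans (VH.F-⊕ _ _) (+-cong (VH.F-ι (c 0)) (≈-trans (VH.F-⊗ _ _)
      (≈-trans (*-congʳ (≈-trans (V-q↑ (suc κ)) (≈-reflexive (cong (q ↑_) (ℕₚ.*-suc 7 κ))))) (⊗-assoc _ _ _)))))))
    ([]-trans ([]-⊕ (≋⇒[] ≈-refl) ([]-q ([]-⊗ (≋⇒[] ≈-refl) (go n (c ∘ suc) (κ + s)))))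
    (≋⇒[] (≈-sym (≈-trans (th-fix c (6 + 7 * κ) (7 * s)) (+-congˡ (≈-trans (⊗-assoc _ _ _) (*-congˡ (*-congˡ
      (≈-reflexive (cong (λ z → th (c ∘ suc) (6 + z) (7 * s)) (sym (ℕₚ.*-distribˡ-+ 7 κ s))))))))))))

sgn-7 : ∀ l i → sgn (l * 7 + i) ≡ sgn i ℤ.* sgn l
sgn-7 zero    i = sym (ℤₚ.*-identityʳ (sgn i))
sgn-7 (suc l) i = trans (cong ℤ.-_ (trans (ℤₚ.neg-involutive _) (trans (ℤₚ.neg-involutive _) (trans (ℤₚ.neg-involutive _) (sgn-7 l i)))))
  (ℤₚ.neg-distribʳ-* (sgn i) (sgn l))

V-⟦⟧ : ∀ xs e → V (⟦ e ⟧ (env (q ∷ xs))) ≋ ⟦ e ⟧ (env (q ↑ 7 ∷ map V xs))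
V-⟦⟧ xs e = ≈-trans (VH.F-⟦⟧ (q ∷ xs) e) (⟦⟧-cong e (λ { zero → dil-q 6 ; (suc i) → ≈-refl }))

gsum : List Series → Series
gsum []       = 0#
gsum (e ∷ es) = V e ⊕ q ⊗ gsum es

sec-gsum : ∀ i es → 0 < i → i + length es ≤ 7 → sec 6 (q ↑ i ⊗ gsum es) ≋ 0#
sec-gsum i []       0<i l = ≈-trans (sec-cong 6 (zeroʳ _)) (mk λ { zero → refl ; (suc n) → refl })
sec-gsum i (e ∷ es) 0<i l = begin
  sec 6 (q ↑ i ⊗ (V e ⊕ q ⊗ gsum es))
    ≈⟨ sec-cong 6 (solve (q ↑ i ∷ V e ∷ q ∷ gsum es ∷ []) (v 0 :* (v 1 :+ v 2 :* v 3)) (v 0 :* v 1 :+ (v 2 :* v 0) :* v 3) refl) ⟩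
  sec 6 (q ↑ i ⊗ V e ⊕ q ↑ suc i ⊗ gsum es)
    ≈⟨ sec-⊕ 6 _ _ ⟩
  sec 6 (q ↑ i ⊗ V e) ⊕ sec 6 (q ↑ suc i ⊗ gsum es)
    ≈⟨ +-cong (sec-q↑-dil 6 i e 0<i (ℕₚ.≤-pred (ℕₚ.≤-trans (ℕₚ.m≤m+n (suc i) _) l′))) (sec-gsum (suc i) es (s≤s z≤n) l′) ⟩
  0# ⊕ 0#
    ≈⟨ +-identityˡ 0# ⟩
  0# ∎
  where
  l′ : suc i + length es ≤ 7
  l′ = ℕₚ.≤-trans (ℕₚ.≤-reflexive (sym (ℕₚ.+-suc i _))) l

-- The section recovers the first entry, because the others sit at exponents 1 to 6 modulo 7;
-- dividing by q brings the next one to the front.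
gsum-zero : ∀ es → length es ≤ 7 → gsum es ≋ 0# → All (_≋ 0#) es
gsum-zero []       l p = []
gsum-zero (e ∷ es) l p = e≈0 ∷ gsum-zero es (ℕₚ.≤-trans (ℕₚ.n≤1+n _) l) (q↑-cancel 1 (begin
    q ↑ 1 ⊗ gsum es    ≈⟨ *-congʳ (*-identityʳ q) ⟩
    q ⊗ gsum es        ≈⟨ lincomb (V e ∷ q ∷ gsum es ∷ []) (v 1 :* v 2) (# 0) ((# 1 , v 0 :+ v 1 :* v 2 ≐ # 0) ∷ (:- # 1 , v 0 ≐ # 0) ∷ []) refl
                            (p ∷ ≈-trans (VH.F-cong e≈0) VH.F-0 ∷ []) ⟩
    0#                 ≈⟨ ≈-sym (zeroʳ _) ⟩
    q ↑ 1 ⊗ 0#         ∎))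
  where
  e≈0 : e ≋ 0#
  e≈0 = begin
    e                                    ≈⟨ ≈-sym (≈-trans (+-congʳ (sec-dil 6 e)) (≈-trans (+-congˡ (≈-trans (sec-cong 6 (*-congʳ (≈-sym (*-identityʳ q)))) (sec-gsum 1 es (s≤s z≤n) l))) (+-identityʳ e))) ⟩
    sec 6 (V e) ⊕ sec 6 (q ⊗ gsum es)    ≈⟨ ≈-sym (sec-⊕ 6 _ _) ⟩
    sec 6 (gsum (e ∷ es))                ≈⟨ sec-cong 6 p ⟩
    sec 6 0#                             ≈⟨ mk (λ { zero → refl ; (suc n) → refl }) ⟩
    0#                                   ∎

parts : (ℕ → ℤ) → ℕ → ℕ → List Series
parts c κ s = part c κ s 0 ∷ part c κ s 1 ∷ part c κ s 2 ∷ part c κ s 3 ∷ part c κ s 4 ∷ part c κ s 5 ∷ part c κ s 6 ∷ []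

module PentagonalDissection where
  base vbase : List Series
  base = (parts sgn 1 3) ++ (parts sgn 0 3)
  vbase = (pieces sgn 1 3) ++ (pieces sgn 0 3)

  -- The generalised pentagonal numbers m(3m ± 1)/2 are 0, 1, 2 or 5 modulo 7. The powers of Q = q⁷
  -- are the quotients of the exponents for m = 0, ..., 6.
  e₀ e₁ e₂ e₅ : Expr → Expr
  e₀ Q = v 1 :+ Q :* v 3 :+ v 8 :+ Q :^ 5 :* v 13 :- # 1
  e₁ Q = Q :^ 2 :* v 4 :+ Q :^ 8 :* v 7 :+ v 9 :+ Q :^ 3 :* v 12
  e₂ Q = v 2 :+ Q :^ 7 :* v 14
  e₅ Q = Q :^ 3 :* v 5 :+ Q :^ 5 :* v 6 :+ v 10 :+ Q :* v 11

  X₀ X₁ X₂ X₅ : Series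
  X₀ = ⟦ e₀ (v 0) ⟧ (env (q ∷ base))
  X₁ = ⟦ e₁ (v 0) ⟧ (env (q ∷ base))
  X₂ = ⟦ e₂ (v 0) ⟧ (env (q ∷ base))
  X₅ = ⟦ e₅ (v 0) ⟧ (env (q ∷ base))

  -- Residue 2 comes from m = 7l + 1 in one half and m = 7l + 6 in the other; both subseries are
  -- again pentagonal and reassemble to J, dilated and negated.
  X₂-J : X₂ ≋ ⊖ V J
  X₂-J = lincomb (V (th sgn 1 3) ∷ V (th sgn 0 3) ∷ V (th sgn 3 3) ∷ q ∷ part sgn 1 3 1 ∷ part sgn 0 3 6 ∷ V J ∷ [])
    (v 4 :+ v 3 :^ 7 :* v 5) (:- v 6)
    ((# 1 , v 4 ≐ :- v 0) ∷ (v 3 :^ 7 , v 5 ≐ v 2) ∷ (# 1 , v 6 ≐ v 0 :+ v 1 :- # 1) ∷ (# 1 , v 1 ≐ # 1 :- v 3 :^ 7 :* v 2) ∷ []) refl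
    (minus ∷ plus ∷ ≈-trans (VH.F-cong pentagonal) (VH.F-⟦⟧ (th sgn 1 3 ∷ th sgn 0 3 ∷ []) (v 0 :+ v 1 :- # 1))
      ∷ ≈-trans (VH.F-cong zeroth) (V-⟦⟧ (th sgn 3 3 ∷ []) (# 1 :- v 0 :* v 1)) ∷ [])
    where
    neg : ∀ κ s → th (sgn ∘ suc) κ s ≋ ⊖ th sgn κ s
    neg κ s = ≈-trans (th-cong κ s (λ n → sym (ℤₚ.-1*i≡-i (sgn n)))) (≈-trans (th-scale (ℤ.- + 1) sgn κ s)
      (solve (th sgn κ s ∷ []) (con (ℤ.- + 1) :* v 0) (:- v 0) refl))
    minus : part sgn 1 3 1 ≋ ⊖ V (th sgn 1 3)
    minus = ≈-trans (th-cong 13 21 (λ l → trans (sgn-7 l 1) (ℤₚ.-1*i≡-i (sgn l)))) (≈-trans (neg 13 21) (-‿cong (≈-sym (V-th sgn 1 3))))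
    plus : part sgn 0 3 6 ≋ V (th sgn 3 3)
    plus = ≈-trans (th-cong 27 21 (λ l → trans (sgn-7 l 6) (ℤₚ.*-identityˡ (sgn l)))) (≈-sym (V-th sgn 3 3))
    zeroth : th sgn 0 3 ≋ 1# ⊝ q ⊗ th sgn 3 3
    zeroth = ≈-trans (th-fix sgn 0 3) (≈-trans (+-congˡ (*-congˡ (neg 3 3))) (solve (q ∷ th sgn 3 3 ∷ []) (# 1 :+ v 0 :* # 1 :* (:- v 1)) (# 1 :- v 0 :* v 1) refl))

  J-dissect : J ≋ V X₀ ⊕ q ⊗ V X₁ ⊝ q ↑ 2 ⊗ V (V J) ⊕ q ↑ 5 ⊗ V X₅
  J-dissect = begin
    J
      ≈⟨ lincomb ((q ∷ vbase) ++ (J ∷ th sgn 1 3 ∷ th sgn 0 3 ∷ []))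
           (v 15) (e₀ Q :+ v 0 :* e₁ Q :+ v 0 :^ 2 :* e₂ Q :+ v 0 :^ 5 :* e₅ Q)
           ((# 1 , v 15 ≐ v 16 :+ v 17 :- # 1) ∷ (# 1 , v 16 ≐ dissected (v 0 :^ 2) (v 0 :^ 3) (λ i → v (1 + i)))
             ∷ (# 1 , v 17 ≐ dissected (v 0 :^ 1) (v 0 :^ 3) (λ i → v (8 + i))) ∷ []) refl
           (pentagonal ∷ th-dissect sgn 1 3 ∷ th-dissect sgn 0 3 ∷ []) ⟩
    ⟦ e₀ Q ⟧ ρ ⊕ q ⊗ ⟦ e₁ Q ⟧ ρ ⊕ q ↑ 2 ⊗ ⟦ e₂ Q ⟧ ρ ⊕ q ↑ 5 ⊗ ⟦ e₅ Q ⟧ ρ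
      ≈⟨ +-cong (+-cong (+-cong (≈-sym (V-⟦⟧ base (e₀ (v 0)))) (*-congˡ (≈-sym (V-⟦⟧ base (e₁ (v 0))))))
           (*-congˡ (≈-trans (≈-sym (V-⟦⟧ base (e₂ (v 0)))) (≈-trans (VH.F-cong X₂-J) (VH.F-⊖ _))))) (*-congˡ (≈-sym (V-⟦⟧ base (e₅ (v 0))))) ⟩
    V X₀ ⊕ q ⊗ V X₁ ⊕ q ↑ 2 ⊗ ⊖ V (V J) ⊕ q ↑ 5 ⊗ V X₅
      ≈⟨ solve (q ∷ V X₀ ∷ V X₁ ∷ V (V J) ∷ V X₅ ∷ []) (v 1 :+ v 0 :* v 2 :+ v 0 :^ 2 :* (:- v 3) :+ v 0 :^ 5 :* v 4)
           (v 1 :+ v 0 :* v 2 :- v 0 :^ 2 :* v 3 :+ v 0 :^ 5 :* v 4) refl ⟩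
    V X₀ ⊕ q ⊗ V X₁ ⊝ q ↑ 2 ⊗ V (V J) ⊕ q ↑ 5 ⊗ V X₅ ∎
    where
    Q = v 0 :^ 7
    ρ = env ((q ∷ vbase) ++ (J ∷ th sgn 1 3 ∷ th sgn 0 3 ∷ []))

  heads : Heads (q ∷ base) (+ 0 ∷ + 1 ∷ -[1+ 0 ] ∷ + 1 ∷ -[1+ 0 ] ∷ + 1 ∷ -[1+ 0 ] ∷ + 1 ∷ + 1 ∷ -[1+ 0 ] ∷ + 1 ∷ -[1+ 0 ] ∷ + 1 ∷ -[1+ 0 ] ∷ + 1 ∷ [])
  heads = refl ∷ hp 1 0 ∷ hp 1 1 ∷ hp 1 2 ∷ hp 1 3 ∷ hp 1 4 ∷ hp 1 5 ∷ hp 1 6 ∷ hp 0 0 ∷ hp 0 1 ∷ hp 0 2 ∷ hp 0 3 ∷ hp 0 4 ∷ hp 0 5 ∷ hp 0 6 ∷ []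
    where
    hp : ∀ κ i → part sgn κ 3 i 0 ≡ sgn i
    hp κ i = th-head (λ l → sgn (l * 7 + i)) (κ + i * 3 + 9) 21

module SquareDissection where
  base vbase : List Series
  base = parts sgn 0 2
  vbase = pieces sgn 0 2

  -- Each nonzero square modulo 7 is attained by ± m, which pairs the six pieces. The third class is
  -- based at 9 = 3², so the quotients start from Q⁰.
  e₁ e₂ e₃ : Expr → Expr
  e₁ Q = v 2 :+ Q :^ 5 :* v 7
  e₂ Q = v 3 :+ Q :^ 3 :* v 6
  e₃ Q = v 4 :+ Q :* v 5

  Y₁ Y₂ Y₃ : Series
  Y₁ = ⟦ e₁ (v 0) ⟧ (env (q ∷ base))
  Y₂ = ⟦ e₂ (v 0) ⟧ (env (q ∷ base))
  Y₃ = ⟦ e₃ (v 0) ⟧ (env (q ∷ base))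

  φ-dissect : φ ≋ V (V φ) ⊕ const (+ 2) ⊗ (q ⊗ V Y₁ ⊕ q ↑ 4 ⊗ V Y₂ ⊕ q ↑ 9 ⊗ V Y₃)
  φ-dissect = begin
    φ
      ≈⟨ lincomb ((q ∷ vbase) ++ (th sgn 0 2 ∷ V (V (th sgn 0 2)) ∷ V (V φ) ∷ []))
           (# 2 :* v 8 :- # 1) (v 10 :+ # 2 :* (v 0 :* e₁ Q :+ v 0 :^ 4 :* e₂ Q :+ v 0 :^ 9 :* e₃ Q))
           ((# 2 , v 8 ≐ dissected (v 0 :^ 1) (v 0 :^ 2) (λ i → v (1 + i))) ∷ (# 2 , v 1 ≐ v 9) ∷ (:- # 1 , v 10 ≐ # 2 :* v 9 :- # 1) ∷ []) refl
           (th-dissect sgn 0 2 ∷ VH.F-cong (≈-trans (th-cong 6 14 (λ l → trans (sgn-7 l 0) (ℤₚ.*-identityˡ _))) (≈-sym (V-th sgn 0 2)))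
             ∷ ≈-trans (VH.F-cong (VH.F-⟦⟧ (th sgn 0 2 ∷ []) (# 2 :* v 0 :- # 1))) (VH.F-⟦⟧ (V (th sgn 0 2) ∷ []) (# 2 :* v 0 :- # 1)) ∷ []) ⟩
    V (V φ) ⊕ const (+ 2) ⊗ (q ⊗ ⟦ e₁ Q ⟧ ρ ⊕ q ↑ 4 ⊗ ⟦ e₂ Q ⟧ ρ ⊕ q ↑ 9 ⊗ ⟦ e₃ Q ⟧ ρ)
      ≈⟨ +-congˡ (*-congˡ (+-cong (+-cong (*-congˡ (≈-sym (V-⟦⟧ base (e₁ (v 0))))) (*-congˡ (≈-sym (V-⟦⟧ base (e₂ (v 0)))))) (*-congˡ (≈-sym (V-⟦⟧ base (e₃ (v 0))))))) ⟩
    V (V φ) ⊕ const (+ 2) ⊗ (q ⊗ V Y₁ ⊕ q ↑ 4 ⊗ V Y₂ ⊕ q ↑ 9 ⊗ V Y₃) ∎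
    where
    Q = v 0 :^ 7
    ρ = env ((q ∷ vbase) ++ (th sgn 0 2 ∷ V (V (th sgn 0 2)) ∷ V (V φ) ∷ []))

  heads : Heads (q ∷ base) (+ 0 ∷ + 1 ∷ -[1+ 0 ] ∷ + 1 ∷ -[1+ 0 ] ∷ + 1 ∷ -[1+ 0 ] ∷ + 1 ∷ [])
  heads = refl ∷ hp 0 ∷ hp 1 ∷ hp 2 ∷ hp 3 ∷ hp 4 ∷ hp 5 ∷ hp 6 ∷ []
    where
    hp : ∀ i → part sgn 0 2 i 0 ≡ sgn i
    hp i = th-head (λ l → sgn (l * 7 + i)) (i * 2 + 6) 14

module CubeDissection where
  base vbase : List Series
  base = parts odd 0 1
  vbase = pieces odd 0 1

  e₀ e₁ e₃ : Expr → Expr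
  e₀ Q = v 1 :+ Q :^ 3 :* v 7
  e₁ Q = v 2 :+ Q :^ 2 :* v 6
  e₃ Q = v 3 :+ Q :* v 5

  Y₀ Y₁ Y₃ : Series
  Y₀ = ⟦ e₀ (v 0) ⟧ (env (q ∷ base))
  Y₁ = ⟦ e₁ (v 0) ⟧ (env (q ∷ base))
  Y₃ = ⟦ e₃ (v 0) ⟧ (env (q ∷ base))

  -- Triangular numbers that are 6 modulo 7 have index 7l + 3, where the weight 2m + 1 is 7(2l + 1)
  -- and the sign is reversed. So that class of J³ is -7 times J³ dilated.
  odd-7 : ∀ l → odd (l * 7 + 3) ≡ -[1+ 6 ] ℤ.* odd l
  odd-7 l = trans (cong₂ ℤ._*_ (sgn-7 l 3) (cong +_ (double l))) (trans (cong₂ ℤ._*_ (ℤₚ.-1*i≡-i (sgn l)) (ℤₚ.pos-* 7 (l + suc l)))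
    (regroup (sgn l) (+ (l + suc l))))
    where
    open import Data.Nat.Tactic.RingSolver using () renaming (solve-∀ to solveℕ)
    open import Data.Integer.Tactic.RingSolver using () renaming (solve-∀ to solveℤ)
    double : ∀ l → l * 7 + 3 + suc (l * 7 + 3) ≡ 7 * (l + suc l)
    double = solveℕ
    regroup : ∀ s m → (ℤ.- s) ℤ.* (+ 7 ℤ.* m) ≡ -[1+ 6 ] ℤ.* (s ℤ.* m)
    regroup = solveℤ

  J³-dissect : J ⊗ J ⊗ J ≋ V Y₀ ⊕ q ⊗ V Y₁ ⊕ q ↑ 3 ⊗ V Y₃ ⊝ const (+ 7) ⊗ q ↑ 6 ⊗ V (V (J ⊗ J ⊗ J))
  J³-dissect = begin
    J ⊗ J ⊗ J
      ≈⟨ lincomb ((q ∷ vbase) ++ (J ⊗ J ⊗ J ∷ V (V (J ⊗ J ⊗ J)) ∷ []))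
           (v 8) (e₀ Q :+ v 0 :* e₁ Q :+ v 0 :^ 3 :* e₃ Q :- # 7 :* v 0 :^ 6 :* v 9)
           ((# 1 , v 8 ≐ dissected (v 0 :^ 1) (v 0 :^ 1) (λ i → v (1 + i))) ∷ (v 0 :^ 6 , v 4 ≐ con -[1+ 6 ] :* v 9) ∷ []) refl
           (≈-trans jacobi-cube (th-dissect odd 0 1) ∷ ≈-trans (VH.F-cong middle) (≈-trans (VH.F-⊗ _ _) (*-congʳ (VH.F-ι -[1+ 6 ]))) ∷ []) ⟩
    ⟦ e₀ Q ⟧ ρ ⊕ q ⊗ ⟦ e₁ Q ⟧ ρ ⊕ q ↑ 3 ⊗ ⟦ e₃ Q ⟧ ρ ⊝ const (+ 7) ⊗ q ↑ 6 ⊗ V (V (J ⊗ J ⊗ J))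
      ≈⟨ +-congʳ (+-cong (+-cong (≈-sym (V-⟦⟧ base (e₀ (v 0)))) (*-congˡ (≈-sym (V-⟦⟧ base (e₁ (v 0)))))) (*-congˡ (≈-sym (V-⟦⟧ base (e₃ (v 0)))))) ⟩
    V Y₀ ⊕ q ⊗ V Y₁ ⊕ q ↑ 3 ⊗ V Y₃ ⊝ const (+ 7) ⊗ q ↑ 6 ⊗ V (V (J ⊗ J ⊗ J)) ∎
    where
    Q = v 0 :^ 7
    ρ = env ((q ∷ vbase) ++ (J ⊗ J ⊗ J ∷ V (V (J ⊗ J ⊗ J)) ∷ []))
    middle : part odd 0 1 3 ≋ const -[1+ 6 ] ⊗ V (J ⊗ J ⊗ J)
    middle = ≈-trans (th-cong 6 7 odd-7) (≈-trans (th-scale -[1+ 6 ] odd 6 7) (*-congˡ (≈-trans (≈-sym (V-th odd 0 1)) (VH.F-cong (≈-sym jacobi-cube)))))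

const-cancel : ∀ n {f} → const (+ suc n) ⊗ f ≋ 0# → f ≋ 0#
const-cancel n {f} = head-nonzero-cancel (const (+ suc n)) f (λ ())

φ-head : φ 0 ≡ + 1
φ-head = head-⟦⟧ {th sgn 0 2 ∷ []} (# 2 :* v 0 :- # 1) (th-head sgn 0 2 ∷ [])

iJ iφ : Series
iJ = inv J
iφ = inv φ

J-iJ : J ⊗ iJ ≋ 1#
J-iJ = inv-inverse J J-head

φ-iφ : φ ⊗ iφ ≋ 1#
φ-iφ = inv-inverse φ φ-head

V-unit : ∀ {f g} → f ⊗ g ≋ 1# → V f ⊗ V g ≋ 1#
V-unit p = ≈-trans (≈-sym (VH.F-⊗ _ _)) (≈-trans (VH.F-cong p) VH.F-1)

-- J / J(q⁴⁹) = A₀ - q B₀ - q² + q⁵ C₀ and φ / φ(q⁴⁹) = 1 - 2 q a₀ + 2 q⁴ b₀ - 2 q⁹ c₀, with components in q⁷.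

A₀ B₀ C₀ a₀ b₀ c₀ ξ₀ η₀ : Series
A₀ = PentagonalDissection.X₀ ⊗ V iJ
B₀ = ⊖ PentagonalDissection.X₁ ⊗ V iJ
C₀ = PentagonalDissection.X₅ ⊗ V iJ
a₀ = ⊖ SquareDissection.Y₁ ⊗ V iφ
b₀ = SquareDissection.Y₂ ⊗ V iφ
c₀ = ⊖ SquareDissection.Y₃ ⊗ V iφ
ξ₀ = J ⊗ V (V iJ)
η₀ = φ ⊗ V (V iφ)

ξ₀-dissect : ξ₀ ≋ V A₀ ⊝ q ⊗ V B₀ ⊝ q ↑ 2 ⊕ q ↑ 5 ⊗ V C₀
ξ₀-dissect = lincomb (q ∷ J ∷ V (V iJ) ∷ V A₀ ∷ V B₀ ∷ V C₀ ∷ V X₀ ∷ V X₁ ∷ V X₅ ∷ V (V J) ∷ [])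
  (v 1 :* v 2) (v 3 :- v 0 :* v 4 :- v 0 :^ 2 :+ v 0 :^ 5 :* v 5)
  ((v 2 , v 1 ≐ v 6 :+ v 0 :* v 7 :- v 0 :^ 2 :* v 9 :+ v 0 :^ 5 :* v 8) ∷ (:- # 1 , v 3 ≐ v 6 :* v 2) ∷ (v 0 , v 4 ≐ (:- v 7) :* v 2)
    ∷ (:- (v 0 :^ 5) , v 5 ≐ v 8 :* v 2) ∷ (:- (v 0 :^ 2) , v 9 :* v 2 ≐ # 1) ∷ []) refl
  (J-dissect ∷ VH.F-⊗ _ _ ∷ ≈-trans (VH.F-⊗ _ _) (*-congʳ (VH.F-⊖ _)) ∷ VH.F-⊗ _ _ ∷ V-unit (V-unit J-iJ) ∷ [])
  where open PentagonalDissection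

η₀-dissect : η₀ ≋ 1# ⊕ const (+ 2) ⊗ (q ↑ 4 ⊗ V b₀ ⊝ q ⊗ V a₀ ⊝ q ↑ 9 ⊗ V c₀)
η₀-dissect = lincomb (q ∷ φ ∷ V (V iφ) ∷ V a₀ ∷ V b₀ ∷ V c₀ ∷ V Y₁ ∷ V Y₂ ∷ V Y₃ ∷ V (V φ) ∷ [])
  (v 1 :* v 2) (# 1 :+ # 2 :* (v 0 :^ 4 :* v 4 :- v 0 :* v 3 :- v 0 :^ 9 :* v 5))
  ((v 2 , v 1 ≐ v 9 :+ # 2 :* (v 0 :* v 6 :+ v 0 :^ 4 :* v 7 :+ v 0 :^ 9 :* v 8)) ∷ (# 2 :* v 0 , v 3 ≐ (:- v 6) :* v 2)
    ∷ (:- (# 2 :* v 0 :^ 4) , v 4 ≐ v 7 :* v 2) ∷ (# 2 :* v 0 :^ 9 , v 5 ≐ (:- v 8) :* v 2) ∷ (# 1 , v 9 :* v 2 ≐ # 1) ∷ []) refl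
  (φ-dissect ∷ ≈-trans (VH.F-⊗ _ _) (*-congʳ (VH.F-⊖ _)) ∷ VH.F-⊗ _ _ ∷ ≈-trans (VH.F-⊗ _ _) (*-congʳ (VH.F-⊖ _)) ∷ V-unit (V-unit φ-iφ) ∷ [])
  where open SquareDissection

heads-⊗ : ∀ f g → f 0 ≡ + 1 → g 0 ≡ + 1 → (f ⊗ g) 0 ≡ + 1
heads-⊗ f g p r = trans (at-⊗ f g 0) (cong₂ ℤ._*_ p r)

heads-⊖ : ∀ f → f 0 ≡ -[1+ 0 ] → (⊖ f) 0 ≡ + 1
heads-⊖ f p = trans (at-⊖ f 0) (cong ℤ.-_ p)

A₀-head : A₀ 0 ≡ + 1
A₀-head = heads-⊗ X₀ (V iJ) (head-⟦⟧ (e₀ (v 0)) heads) (inv-head J)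
  where open PentagonalDissection

B₀-head : B₀ 0 ≡ + 1
B₀-head = heads-⊗ (⊖ X₁) (V iJ) (heads-⊖ X₁ (head-⟦⟧ (e₁ (v 0)) heads)) (inv-head J)
  where open PentagonalDissection

C₀-head : C₀ 0 ≡ + 1
C₀-head = heads-⊗ X₅ (V iJ) (head-⟦⟧ (e₅ (v 0)) heads) (inv-head J)
  where open PentagonalDissection

a₀-head : a₀ 0 ≡ + 1
a₀-head = heads-⊗ (⊖ Y₁) (V iφ) (heads-⊖ Y₁ (head-⟦⟧ (e₁ (v 0)) heads)) (inv-head φ)
  where open SquareDissection

b₀-head : b₀ 0 ≡ + 1
b₀-head = heads-⊗ Y₂ (V iφ) (head-⟦⟧ (e₂ (v 0)) heads) (inv-head φ)
  where open SquareDissection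

c₀-head : c₀ 0 ≡ + 1
c₀-head = heads-⊗ (⊖ Y₃) (V iφ) (heads-⊖ Y₃ (head-⟦⟧ (e₃ (v 0)) heads)) (inv-head φ)
  where open SquareDissection

-- Relations among the components

gsumE : Expr → List Expr → Expr
gsumE x []       = # 0
gsumE x (e ∷ es) = e :+ x :* gsumE x es

vsum : List Series → List Expr → Series
vsum xs []       = 0#
vsum xs (e ∷ es) = ⟦ e ⟧ (env (q ↑ 7 ∷ map V xs)) ⊕ q ⊗ vsum xs es

residues : ∀ xs es → length es ≤ 7 → vsum xs es ≋ 0# → All (λ e → ⟦ e ⟧ (env (q ∷ xs)) ≋ 0#) es
residues xs es l p = map⁻ (gsum-zero (map (λ e → ⟦ e ⟧ (env (q ∷ xs))) es) (ℕₚ.≤-trans (ℕₚ.≤-reflexive (length-map _ es)) l) (≈-trans (go es) p))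
  where
  go : ∀ es → gsum (map (λ e → ⟦ e ⟧ (env (q ∷ xs))) es) ≋ vsum xs es
  go []       = ≈-refl
  go (e ∷ es) = +-cong (V-⟦⟧ xs e) (*-congˡ (go es))

module CubeRelations where
  open CubeDissection
  y₀ y₁ y₃ : Series
  y₀ = Y₀ ⊗ V iJ ↑ 3
  y₁ = Y₁ ⊗ V iJ ↑ 3
  y₃ = Y₃ ⊗ V iJ ↑ 3

  xs : List Series
  xs = A₀ ∷ B₀ ∷ C₀ ∷ y₀ ∷ y₁ ∷ y₃ ∷ []

  -- The residues of ξ₀³ compared with J³/J(q⁴⁹)³. The right side has unspecified components only in
  -- classes 0, 1 and 3, so the other four give relations among A₀, B₀, C₀ alone.
  es : Expr → List Expr
  es Q = (a :^ 3 :- v 4 :- # 6 :* Q :* a :* c :+ # 3 :* Q :* b :^ 2 :* c)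
    ∷ (:- v 5 :+ # 6 :* Q :* b :* c :- # 3 :* a :^ 2 :* b :+ Q :^ 2 :* c :^ 3)
    ∷ (# 3 :* Q :* c :- # 3 :* a :^ 2 :+ # 3 :* a :* b :^ 2)
    ∷ (:- v 6 :+ # 6 :* a :* b :- b :^ 3 :+ # 3 :* Q :* a :* c :^ 2)
    ∷ (# 3 :* a :- # 3 :* b :^ 2 :- # 3 :* Q :* b :* c :^ 2)
    ∷ (# 3 :* (a :^ 2 :* c :- b :- Q :* c :^ 2))
    ∷ (# 6 :* (# 1 :- a :* b :* c)) ∷ []
    where
    a = v 1
    b = v 2
    c = v 3

  cube : ξ₀ ⊗ ξ₀ ⊗ ξ₀ ≋ V y₀ ⊕ q ⊗ V y₁ ⊕ q ↑ 3 ⊗ V y₃ ⊝ const (+ 7) ⊗ q ↑ 6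
  cube = lincomb (q ∷ J ∷ V (V iJ) ∷ V y₀ ∷ V y₁ ∷ V y₃ ∷ V Y₀ ∷ V Y₁ ∷ V Y₃ ∷ V (V (J ⊗ J ⊗ J)) ∷ V (V J) ∷ [])
    (v 1 :* v 2 :* (v 1 :* v 2) :* (v 1 :* v 2)) (v 3 :+ v 0 :* v 4 :+ v 0 :^ 3 :* v 5 :- # 7 :* v 0 :^ 6)
    ((w :^ 3 , v 1 :* v 1 :* v 1 ≐ v 6 :+ v 0 :* v 7 :+ v 0 :^ 3 :* v 8 :- # 7 :* v 0 :^ 6 :* v 9)
      ∷ (:- # 1 , v 3 ≐ v 6 :* w :^ 3) ∷ (:- v 0 , v 4 ≐ v 7 :* w :^ 3) ∷ (:- (v 0 :^ 3) , v 5 ≐ v 8 :* w :^ 3)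
      ∷ (:- (# 7 :* v 0 :^ 6 :* w :^ 3) , v 9 ≐ v 10 :* v 10 :* v 10)
      ∷ (:- (# 7 :* v 0 :^ 6 :* ((v 10 :* w) :^ 2 :+ v 10 :* w :+ # 1)) , v 10 :* w ≐ # 1) ∷ []) refl
    (J³-dissect ∷ VY Y₀ ∷ VY Y₁ ∷ VY Y₃ ∷ ≈-trans (VH.F-cong (VH.F-⟦⟧ (J ∷ []) (v 0 :* v 0 :* v 0))) (VH.F-⟦⟧ (V J ∷ []) (v 0 :* v 0 :* v 0)) ∷ V-unit (V-unit J-iJ) ∷ [])
    where
    w = v 2
    VY : ∀ Y → V (Y ⊗ V iJ ↑ 3) ≋ V Y ⊗ V (V iJ) ↑ 3
    VY Y = VH.F-⟦⟧ (Y ∷ V iJ ∷ []) (v 0 :* v 1 :^ 3)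

  components : All (λ e → ⟦ e ⟧ (env (q ∷ xs)) ≋ 0#) (es (v 0))
  components = residues xs (es (v 0)) ℕₚ.≤-refl
    (lincomb ((q ∷ map V xs) ++ (ξ₀ ∷ [])) (gsumE (v 0) (es (v 0 :^ 7))) (# 0)
      ((:- (v 7 :* v 7 :+ v 7 :* form :+ form :* form) , v 7 ≐ form)
        ∷ (# 1 , v 7 :* v 7 :* v 7 ≐ v 4 :+ v 0 :* v 5 :+ v 0 :^ 3 :* v 6 :- # 7 :* v 0 :^ 6) ∷ []) refl
      (ξ₀-dissect ∷ cube ∷ []))
    where
    form = v 1 :- v 0 :* v 2 :- v 0 :^ 2 :+ v 0 :^ 5 :* v 3

-- Class 6: the cube of -q² and the six orderings of A₀, -q B₀, q⁵ C₀ give -1 - 6 A₀ B₀ C₀, to be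
-- compared with -7.
ABC : A₀ ⊗ B₀ ⊗ C₀ ≋ 1#
ABC = extract CubeRelations.components
  where
  extract : All _ (CubeRelations.es (v 0)) → A₀ ⊗ B₀ ⊗ C₀ ≋ 1#
  extract (_ ∷ _ ∷ _ ∷ _ ∷ _ ∷ _ ∷ p ∷ []) = ≈-sym (⊝-move (const-cancel 5 p))

AAC : A₀ ↑ 2 ⊗ C₀ ≋ B₀ ⊕ q ⊗ C₀ ↑ 2
AAC = extract CubeRelations.components
  where
  extract : All _ (CubeRelations.es (v 0)) → A₀ ↑ 2 ⊗ C₀ ≋ B₀ ⊕ q ⊗ C₀ ↑ 2
  extract (_ ∷ _ ∷ _ ∷ _ ∷ _ ∷ p ∷ _ ∷ []) = lincomb (q ∷ A₀ ∷ B₀ ∷ C₀ ∷ []) (v 1 :^ 2 :* v 3) (v 2 :+ v 0 :* v 3 :^ 2)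
    ((# 1 , v 1 :^ 2 :* v 3 :- v 2 :- v 0 :* v 3 :^ 2 ≐ # 0) ∷ []) refl (const-cancel 2 p ∷ [])

D₂ : Series → Series
D₂ = dil 1

module DH = IsHom (dil-hom 1)

D₂-V : ∀ f → D₂ (V f) ≋ V (D₂ f)
D₂-V f = []⇒≋ λ n → go n f
  where
  go : ∀ n f → D₂ (V f) ≋[ n ] V (D₂ f)
  go zero    f = mk λ _ ()
  go (suc n) f = []-trans (≋⇒[] left) ([]-trans ([]-⊕ (≋⇒[] ≈-refl) ([]-q ([]-⊗ (≋⇒[] ≈-refl) (go n (tail f))))) (≋⇒[] right))
    where
    left : D₂ (V f) ≋ const (f 0) ⊕ q ⊗ (q ↑ 13 ⊗ D₂ (V (tail f)))
    left = ≈-trans (DH.F-cong (dil-step 6 f)) (≈-trans (DH.F-⊕ _ _) (+-cong (DH.F-ι (f 0)) (≈-trans (DH.F-⊗ _ _)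
      (≈-trans (*-congʳ (≈-trans (DH.F-↑ q 7) (↑-cong 7 (dil-q 1)))) (solve (q ∷ D₂ (V (tail f)) ∷ []) ((v 0 :^ 2) :^ 7 :* v 1) (v 0 :* (v 0 :^ 13 :* v 1)) refl)))))
    right : const (f 0) ⊕ q ⊗ (q ↑ 13 ⊗ V (D₂ (tail f))) ≋ V (D₂ f)
    right = ≈-sym (≈-trans (VH.F-cong (dil-step 1 f)) (≈-trans (VH.F-⊕ _ _) (+-cong (VH.F-ι (f 0)) (≈-trans (VH.F-⊗ _ _)
      (≈-trans (*-congʳ (≈-trans (VH.F-↑ q 2) (↑-cong 2 (dil-q 6)))) (solve (q ∷ V (D₂ (tail f)) ∷ []) ((v 0 :^ 7) :^ 2 :* v 1) (v 0 :* (v 0 :^ 13 :* v 1)) refl))))))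

A₂ B₂ C₂ ξ₂ : Series
A₂ = D₂ A₀
B₂ = D₂ B₀
C₂ = D₂ C₀
ξ₂ = D₂ ξ₀

ξ₂-dissect : ξ₂ ≋ V A₂ ⊝ q ↑ 2 ⊗ V B₂ ⊝ q ↑ 4 ⊕ q ↑ 10 ⊗ V C₂
ξ₂-dissect = ≈-trans (DH.F-cong ξ₀-dissect) (≈-trans (DH.F-⟦⟧ (V A₀ ∷ q ∷ V B₀ ∷ V C₀ ∷ []) (v 0 :- v 1 :* v 2 :- v 1 :^ 2 :+ v 1 :^ 5 :* v 3))
  (≈-trans (⟦⟧-cong (v 0 :- v 1 :* v 2 :- v 1 :^ 2 :+ v 1 :^ 5 :* v 3) {ρ = env (D₂ (V A₀) ∷ D₂ q ∷ D₂ (V B₀) ∷ D₂ (V C₀) ∷ [])} {σ = env (V A₂ ∷ q ↑ 2 ∷ V B₂ ∷ V C₂ ∷ [])}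
      λ { 0 → D₂-V A₀ ; 1 → dil-q 1 ; 2 → D₂-V B₀ ; 3 → D₂-V C₀ ; (suc (suc (suc (suc i)))) → ≈-refl })
    (solve (V A₂ ∷ q ∷ V B₂ ∷ V C₂ ∷ []) (v 0 :- v 1 :^ 2 :* v 2 :- (v 1 :^ 2) :^ 2 :+ (v 1 :^ 2) :^ 5 :* v 3) (v 0 :- v 1 :^ 2 :* v 2 :- v 1 :^ 4 :+ v 1 :^ 10 :* v 3) refl)))

ABC₂ : A₂ ⊗ B₂ ⊗ C₂ ≋ 1#
ABC₂ = ≈-trans (≈-sym (DH.F-⟦⟧ (A₀ ∷ B₀ ∷ C₀ ∷ []) (v 0 :* v 1 :* v 2))) (≈-trans (DH.F-cong ABC) DH.F-1)

η₀-ξ₂ : η₀ ⊗ ξ₂ ≋ ξ₀ ⊗ ξ₀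
η₀-ξ₂ = lincomb (φ ∷ V (V iφ) ∷ D₂ J ∷ V (V (D₂ iJ)) ∷ J ∷ V (V iJ) ∷ ξ₂ ∷ V (V φ) ∷ V (V J) ∷ V (V (D₂ J)) ∷ [])
  (v 0 :* v 1 :* v 6) (v 4 :* v 5 :* (v 4 :* v 5))
  ((v 0 :* v 1 , v 6 ≐ v 2 :* v 3) ∷ (v 1 :* v 3 , v 0 :* v 2 ≐ v 4 :* v 4)
    ∷ (:- (v 4 :^ 2 :* v 5 :^ 2 :* v 1 :* v 3) , v 7 :* v 9 ≐ v 8 :* v 8)
    ∷ (v 4 :^ 2 :* v 5 :^ 2 :* v 9 :* v 3 , v 7 :* v 1 ≐ # 1) ∷ (v 4 :^ 2 :* v 5 :^ 2 , v 9 :* v 3 ≐ # 1)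
    ∷ (:- (v 4 :^ 2 :* v 1 :* v 3 :* (v 8 :* v 5 :+ # 1)) , v 8 :* v 5 ≐ # 1) ∷ []) refl
  (≈-trans (DH.F-⊗ J (V (V iJ))) (*-congˡ (≈-trans (D₂-V (V iJ)) (VH.F-cong (D₂-V iJ)))) ∷ φ-product
    ∷ ≈-trans (≈-sym (VH.F-⊗ _ _)) (≈-trans (VH.F-cong (≈-trans (≈-sym (VH.F-⊗ φ (D₂ J))) (≈-trans (VH.F-cong φ-product) (VH.F-⊗ J J)))) (VH.F-⊗ _ _))
    ∷ V-unit (V-unit φ-iφ) ∷ V-unit (V-unit (≈-trans (≈-sym (DH.F-⊗ J iJ)) (≈-trans (DH.F-cong J-iJ) DH.F-1))) ∷ V-unit (V-unit J-iJ) ∷ [])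

module SquareRelations where
  xs : List Series
  xs = A₀ ∷ B₀ ∷ C₀ ∷ a₀ ∷ b₀ ∷ c₀ ∷ A₂ ∷ B₂ ∷ C₂ ∷ []

  A B C a b c A′ B′ C′ : Expr
  A  = v 1
  B  = v 2
  C  = v 3
  a  = v 4
  b  = v 5
  c  = v 6
  A′ = v 7
  B′ = v 8
  C′ = v 9

  es : Expr → List Expr
  es Q = (A′ :+ # 2 :* Q :* C :- A :^ 2 :+ # 2 :* C′ :* Q :^ 2 :* b)
    ∷ (# 2 :* (A :* B :- A′ :* a :- Q :* b))
    ∷ (# 2 :* A :- B′ :- B :^ 2 :- # 2 :* A′ :* Q :* c)
    ∷ (# 2 :* B′ :* a :- # 2 :* B :+ C′ :* Q :- Q :* C :^ 2)
    ∷ (# 2 :* (A′ :* b :- # 1 :+ B′ :* Q :* c :- C′ :* Q :* a))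
    ∷ (# 2 :* (a :- A :* C :- C′ :* Q :^ 2 :* c))
    ∷ (# 2 :* (Q :* c :- B′ :* b :+ B :* C)) ∷ []

  components : All (λ e → ⟦ e ⟧ (env (q ∷ xs)) ≋ 0#) (es (v 0))
  components = residues xs (es (v 0)) ℕₚ.≤-refl
    (lincomb ((q ∷ map V xs) ++ (ξ₀ ∷ η₀ ∷ ξ₂ ∷ [])) (gsumE (v 0) (es (v 0 :^ 7))) (# 0)
      ((v 10 :+ f , v 10 ≐ f) ∷ (:- g , v 11 ≐ e) ∷ (:- v 11 , v 12 ≐ g) ∷ (# 1 , v 11 :* v 12 ≐ v 10 :* v 10) ∷ []) refl
      (ξ₀-dissect ∷ η₀-dissect ∷ ξ₂-dissect ∷ η₀-ξ₂ ∷ []))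
    where
    f = A :- v 0 :* B :- v 0 :^ 2 :+ v 0 :^ 5 :* C
    e = # 1 :+ # 2 :* (v 0 :^ 4 :* b :- v 0 :* a :- v 0 :^ 9 :* c)
    g = A′ :- v 0 :^ 2 :* B′ :- v 0 :^ 4 :+ v 0 :^ 10 :* C′

-- The functions α, β, γ of X₁(14)

α β γ β̂ γ̂ x x̂ y : Series
α = a₀ ⊗ B₀
β̂ = b₀ ⊗ C₀
γ̂ = c₀ ⊗ A₀
x̂ = A₀ ⊗ C₀ ↑ 3
β = q ⊗ β̂
γ = q ⊗ γ̂
x = q ⊗ x̂
y = 1# ⊕ x

module Unknowns where
  open SquareRelations public

  Pₛ Rₛ Sₛ R̂ : Series
  Pₛ = b₀ ⊗ A₂
  R̂  = c₀ ⊗ B₂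
  Rₛ = q ⊗ R̂
  Sₛ = q ⊗ (a₀ ⊗ C₂)

  atoms : List Series
  atoms = q ∷ xs

  αE βE γE xE yE PE RE SE : Expr
  αE = a :* B
  βE = v 0 :* (b :* C)
  γE = v 0 :* (c :* A)
  xE = v 0 :* (A :* C :^ 3)
  yE = # 1 :+ xE
  PE = b :* A′
  RE = v 0 :* (c :* B′)
  SE = v 0 :* (a :* C′)

  -- the seven residues of η ξ₂ = ξ², those with an even factor halved
  g₀ g₁ g₂ g₃ g₄ g₅ g₆ : Expr
  g₃ = A′ :+ # 2 :* v 0 :* C :- A :^ 2 :+ # 2 :* C′ :* v 0 :^ 2 :* b
  g₄ = A :* B :- A′ :* a :- v 0 :* b
  g₅ = # 2 :* A :- B′ :- B :^ 2 :- # 2 :* A′ :* v 0 :* c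
  g₆ = # 2 :* B′ :* a :- # 2 :* B :+ C′ :* v 0 :- v 0 :* C :^ 2
  g₀ = A′ :* b :- # 1 :+ B′ :* v 0 :* c :- C′ :* v 0 :* a
  g₁ = a :- A :* C :- C′ :* v 0 :^ 2 :* c
  g₂ = v 0 :* c :- B′ :* b :+ B :* C

  holds : All (λ e → ⟦ e ⟧ (env atoms) ≋ 0#) (g₃ ∷ g₄ ∷ g₅ ∷ g₆ ∷ g₀ ∷ g₁ ∷ g₂ ∷ [])
  holds = halve components
    where
    halve : All (λ e → ⟦ e ⟧ (env atoms) ≋ 0#) (es (v 0)) → All (λ e → ⟦ e ⟧ (env atoms) ≋ 0#) (g₃ ∷ g₄ ∷ g₅ ∷ g₆ ∷ g₀ ∷ g₁ ∷ g₂ ∷ [])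
    halve (p₃ ∷ p₄ ∷ p₅ ∷ p₆ ∷ p₀ ∷ p₁ ∷ p₂ ∷ []) =
      p₃ ∷ const-cancel 1 p₄ ∷ p₅ ∷ p₆ ∷ const-cancel 1 p₀ ∷ const-cancel 1 p₁ ∷ const-cancel 1 p₂ ∷ []

  hyps : (c₃ c₄ c₅ c₆ c₀ c₁ c₂ c₇ c₈ c₉ : Expr) → List (Expr × Eqn)
  hyps c₃ c₄ c₅ c₆ c₀ c₁ c₂ c₇ c₈ c₉ = (c₃ , g₃ ≐ # 0) ∷ (c₄ , g₄ ≐ # 0) ∷ (c₅ , g₅ ≐ # 0) ∷ (c₆ , g₆ ≐ # 0) ∷ (c₀ , g₀ ≐ # 0) ∷ (c₁ , g₁ ≐ # 0)
    ∷ (c₂ , g₂ ≐ # 0) ∷ (c₇ , A :* B :* C ≐ # 1) ∷ (c₈ , A :^ 2 :* C ≐ B :+ v 0 :* C :^ 2) ∷ (c₉ , A′ :* B′ :* C′ ≐ # 1) ∷ []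

  -- Ideal membership with explicit cofactors, for the ideal of the seven residues together with
  -- `ABC`, `AAC` and `ABC₂`. It eliminates the nine components in favour of α, β, γ, x and the
  -- three unknown products.
  from : ∀ e f c₃ c₄ c₅ c₆ c₀ c₁ c₂ c₇ c₈ c₉ → null (norm ((e :- f) :- combine (hyps c₃ c₄ c₅ c₆ c₀ c₁ c₂ c₇ c₈ c₉))) ≡ true →
    ⟦ e ⟧ (env atoms) ≋ ⟦ f ⟧ (env atoms)
  from e f c₃ c₄ c₅ c₆ c₀ c₁ c₂ c₇ c₈ c₉ p = lincomb atoms e f (hyps c₃ c₄ c₅ c₆ c₀ c₁ c₂ c₇ c₈ c₉) p (with-rest holds)
    where
    with-rest : All (λ e → ⟦ e ⟧ (env atoms) ≋ 0#) (g₃ ∷ g₄ ∷ g₅ ∷ g₆ ∷ g₀ ∷ g₁ ∷ g₂ ∷ []) →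
      All (Holds atoms ∘ proj₂) (hyps c₃ c₄ c₅ c₆ c₀ c₁ c₂ c₇ c₈ c₉)
    with-rest (p₃ ∷ p₄ ∷ p₅ ∷ p₆ ∷ p₀ ∷ p₁ ∷ p₂ ∷ []) = p₃ ∷ p₄ ∷ p₅ ∷ p₆ ∷ p₀ ∷ p₁ ∷ p₂ ∷ ABC ∷ AAC ∷ ABC₂ ∷ []

  o = # 0

  y-form : A₀ ↑ 3 ⊗ C₀ ↑ 2 ≋ y
  y-form = from (A :^ 3 :* C :^ 2) yE o o o o o o o (# 1) (A :* C) o refl

  eq-I : y ⊗ α ⊗ (α ⊝ 1#) ≋ γ ⊗ Sₛ
  eq-I = from (yE :* αE :* (αE :- # 1)) (γE :* SE) o o o o o (yE :* αE :* B) o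
    (B :* a :+ A :* C′ :* v 0 :^ 2 :* a :* c :+ A :* B :* C :^ 3 :* v 0 :* a :- B :^ 2 :* C′ :* v 0 :^ 2 :* a :* c :+ A :^ 2 :* B :* C :* C′ :* v 0 :^ 2 :* a :* c)
    (:- (A :* C :* αE :* (v 0 :^ 2 :* c :* C′ :* B))) o refl

  eq-II : x ⊗ γ ⊗ (1# ⊕ γ) ≋ y ⊗ β ⊗ Rₛ
  eq-II = from (xE :* γE :* (# 1 :+ γE)) (yE :* βE :* RE) o o o o o o (xE :* γE :* A)
    (B′ :* C :* v 0 :^ 2 :* b :* c :- A :^ 2 :* C :^ 3 :* v 0 :^ 2 :* c) (A :* C :* βE :* RE) o refl

  eq-III : β ⊗ (1# ⊝ β) ≋ x ⊗ α ⊗ Pₛ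
  eq-III = from (βE :* (# 1 :- βE)) (xE :* αE :* PE) o (βE :* C) o o o o o (:- (C :* v 0 :* b) :- A′ :* C :^ 2 :* v 0 :* a :* b) o o refl

  eq-3 : 1# ⊝ β ⊕ const (+ 2) ⊗ β ⊗ Sₛ ≋ α ⊗ (1# ⊝ x)
  eq-3 = from (# 1 :- βE :+ # 2 :* βE :* SE) (αE :* (# 1 :- xE)) (a :* C) C o o o o o
    (B :* a :- # 1 :- A :^ 2 :* C :* a :+ # 2 :* C :^ 2 :* v 0 :* a) (αE :* A :* C) o refl

  eq-5 : x ⊗ (1# ⊕ γ) ⊕ const (+ 2) ⊗ x ⊗ γ ⊗ Pₛ ≋ β ⊗ (1# ⊕ const (+ 2) ⊗ x)
  eq-5 = from (xE :* (# 1 :+ γE) :+ # 2 :* xE :* γE :* PE) (βE :* (# 1 :+ # 2 :* xE)) o o (:- (xE :* b :* A)) o o o (xE :* A)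
    (C :* v 0 :* b :- A :* C :^ 3 :* v 0 :- A :* B :* C :^ 2 :* v 0 :* b) (# 2 :* βE :* A :* C) o refl

  eq-6 : y ⊗ (α ⊝ 1#) ⊕ const (+ 2) ⊗ α ⊗ y ⊗ Rₛ ≋ γ ⊗ (x ⊕ const (+ 2))
  eq-6 = from (yE :* (αE :- # 1) :+ # 2 :* αE :* yE :* RE) (γE :* (xE :+ # 2)) o o o (yE :* v 0 :* c :* B) o (yE :* B) o
    (# 1 :+ # 2 :* A :* v 0 :* c :- # 2 :* B :^ 2 :* v 0 :* c :+ A :* C :^ 3 :* v 0 :+ # 2 :* A :^ 2 :* B :* C :* v 0 :* c
      :- B :* C :^ 2 :* v 0 :^ 2 :* c :+ A :^ 2 :* C :^ 3 :* v 0 :^ 2 :* c)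
    (:- (v 0 :* c :* B :* (v 0 :* C :^ 2 :+ # 2 :* B) :* A :* C)) o refl

  eq-0 : Pₛ ⊕ Rₛ ⊝ Sₛ ≋ 1#
  eq-0 = from (PE :+ RE :- SE) (# 1) o o o o (# 1) o o o o o refl

  eq-4 : Pₛ ⊗ Rₛ ⊗ Sₛ ≋ α ⊗ β ⊗ γ
  eq-4 = from (PE :* RE :* SE) (αE :* βE :* γE) o o o o o o o (:- (v 0 :^ 2 :* a :* b :* c)) o (v 0 :^ 2 :* a :* b :* c) refl

  -- I, II, III, 3, 5, 6 are linear in the defects p = P - α, r = R - β, s = S - γ modulo three syzygies;
  -- the resulting 3 × 3 system has an invertible constant term over ℚ, so the defects vanish.
  p r s : Series
  p = Pₛ ⊝ α
  r = Rₛ ⊝ β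
  s = Sₛ ⊝ γ

  module Linear where
    zs : List Series
    zs = q ∷ α ∷ β̂ ∷ γ̂ ∷ x̂ ∷ Pₛ ∷ R̂ ∷ Sₛ ∷ []

    αₑ βₑ γₑ xₑ yₑ Pₑ Rₑ Sₑ pₑ rₑ sₑ Eₑ r̂ₑ : Expr
    αₑ = v 1
    βₑ = v 0 :* v 2
    γₑ = v 0 :* v 3
    xₑ = v 0 :* v 4
    yₑ = # 1 :+ xₑ
    Pₑ = v 5
    Rₑ = v 0 :* v 6
    Sₑ = v 7
    pₑ = Pₑ :- αₑ
    rₑ = Rₑ :- βₑ
    sₑ = Sₑ :- γₑ
    r̂ₑ = v 6 :- v 2
    Eₑ = αₑ :+ βₑ :- γₑ :- # 1

    I II III L₁ L₂ L₃ e₀ e₄ : Eqn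
    I   = yₑ :* αₑ :* (αₑ :- # 1) ≐ γₑ :* Sₑ
    II  = xₑ :* γₑ :* (# 1 :+ γₑ) ≐ yₑ :* βₑ :* Rₑ
    III = βₑ :* (# 1 :- βₑ) ≐ xₑ :* αₑ :* Pₑ
    L₁  = # 1 :- βₑ :+ # 2 :* βₑ :* Sₑ ≐ αₑ :* (# 1 :- xₑ)
    L₂  = xₑ :* (# 1 :+ γₑ) :+ # 2 :* xₑ :* γₑ :* Pₑ ≐ βₑ :* (# 1 :+ # 2 :* xₑ)
    L₃  = yₑ :* (αₑ :- # 1) :+ # 2 :* αₑ :* yₑ :* Rₑ ≐ γₑ :* (xₑ :+ # 2)
    e₀  = Pₑ :+ Rₑ :- Sₑ ≐ # 1
    e₄  = Pₑ :* Rₑ :* Sₑ ≐ αₑ :* βₑ :* γₑ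

    -- Combinations of the six relations in which every term contains a defect or `Eₑ`, which is
    -- itself s - p - r by `e₀`.
    row₁ row₂ : Expr
    row₁ = (γₑ :+ xₑ :+ yₑ :* αₑ) :* Eₑ :+ (βₑ :- γₑ) :* sₑ :- xₑ :* γₑ :* pₑ :+ yₑ :* αₑ :* rₑ
    row₂ = (αₑ :+ γₑ) :* Eₑ :- # 2 :* αₑ :* βₑ :* sₑ :+ (xₑ :* αₑ :+ # 2 :* βₑ :* γₑ) :* pₑ :+ (αₑ :+ # 2 :* αₑ :* γₑ :- Eₑ :+ # 2 :* γₑ :* pₑ) :* rₑ

    row₁-zero : ⟦ row₁ ⟧ (env zs) ≋ 0#
    row₁-zero = const-cancel 1 (lincomb zs (# 2 :* row₁) (# 0) ((# 2 , I) ∷ (# 1 , L₃) ∷ (:- # 1 , L₂) ∷ (# 1 , L₁) ∷ []) refl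
      (eq-I ∷ eq-6 ∷ eq-5 ∷ eq-3 ∷ []))

    row₂-zero : ⟦ row₂ ⟧ (env zs) ≋ 0#
    row₂-zero = head-nonzero-cancel x̂ _ (λ e → 1≢0 (trans (sym x̂-head) e)) (q↑-cancel 1 (≈-trans
      (lincomb zs (v 0 :* # 1 :* (v 4 :* row₂)) (# 0) ((:- # 1 , II) ∷ (βₑ :+ rₑ , L₂) ∷ (:- xₑ , III) ∷ (:- (xₑ :* αₑ) , L₁) ∷ []) refl
        (eq-II ∷ eq-5 ∷ eq-III ∷ eq-3 ∷ [])) (≈-sym (zeroʳ (q ↑ 1)))))
      where
      1≢0 : + 1 ≢ + 0
      1≢0 ()
      x̂-head : x̂ 0 ≡ + 1
      x̂-head = head-⟦⟧ {A₀ ∷ C₀ ∷ []} (v 0 :* v 1 :^ 3) (A₀-head ∷ C₀-head ∷ [])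

    -- Coefficients of s, p, r after `Eₑ` has been replaced by s - p - r; the third row is PRS - αβγ
    -- expanded in the defects. The last two rows are divided by q, without which the determinant
    -- would vanish at q = 0; now it is -4 there, and Cramer's rule applies.
    m₁₁ m₁₂ m₁₃ m₂₁ m₂₂ m₂₃ m₃₁ m₃₂ m₃₃ det : Expr
    m₁₁ = xₑ :+ yₑ :* αₑ :+ βₑ
    m₁₂ = :- (γₑ :+ xₑ :+ yₑ :* αₑ :+ xₑ :* γₑ)
    m₁₃ = :- (γₑ :+ xₑ)
    m₂₁ = v 3 :- v 4 :- v 4 :* αₑ :- v 2 :- # 2 :* αₑ :* v 2 :- r̂ₑ
    m₂₂ = v 4 :+ # 2 :* v 4 :* αₑ :+ v 4 :* γₑ :+ # 2 :* v 2 :* γₑ :+ r̂ₑ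
    m₂₃ = v 4 :+ # 2 :* αₑ :* v 3 :+ # 2 :* v 3 :* pₑ :+ r̂ₑ
    m₃₁ = Pₑ :* v 6
    m₃₂ = βₑ :* v 3
    m₃₃ = Pₑ :* v 3
    det = m₁₁ :* (m₂₂ :* m₃₃ :- m₂₃ :* m₃₂) :- m₁₂ :* (m₂₁ :* m₃₃ :- m₂₃ :* m₃₁) :+ m₁₃ :* (m₂₁ :* m₃₂ :- m₂₂ :* m₃₁)

    S₁ S₂ S₃ : Expr
    S₁ = m₁₁ :* sₑ :+ m₁₂ :* pₑ :+ m₁₃ :* rₑ
    S₂ = m₂₁ :* sₑ :+ m₂₂ :* pₑ :+ m₂₃ :* rₑ
    S₃ = m₃₁ :* sₑ :+ m₃₂ :* pₑ :+ m₃₃ :* rₑ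

    S₁-zero : ⟦ S₁ ⟧ (env zs) ≋ 0#
    S₁-zero = lincomb zs S₁ (# 0) ((# 1 , row₁ ≐ # 0) ∷ (:- (γₑ :+ xₑ :+ yₑ :* αₑ) , e₀) ∷ []) refl (row₁-zero ∷ eq-0 ∷ [])

    S₂-zero : ⟦ S₂ ⟧ (env zs) ≋ 0#
    S₂-zero = q↑-cancel 1 (≈-trans (lincomb zs (v 0 :* # 1 :* S₂) (# 0)
      ((# 1 , row₂ ≐ # 0) ∷ (:- # 1 , row₁ ≐ # 0) ∷ (xₑ :+ xₑ :* αₑ :+ rₑ , e₀) ∷ []) refl (row₂-zero ∷ row₁-zero ∷ eq-0 ∷ [])) (≈-sym (zeroʳ (q ↑ 1))))

    S₃-zero : ⟦ S₃ ⟧ (env zs) ≋ 0#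
    S₃-zero = q↑-cancel 1 (≈-trans (lincomb zs (v 0 :* # 1 :* S₃) (# 0) ((# 1 , e₄) ∷ []) refl (eq-4 ∷ [])) (≈-sym (zeroʳ (q ↑ 1))))

    det-head : ⟦ det ⟧ (env zs) 0 ≡ -[1+ 3 ]
    det-head = head-⟦⟧ {zs} {+ 0 ∷ + 1 ∷ + 1 ∷ + 1 ∷ + 1 ∷ + 1 ∷ + 1 ∷ + 0 ∷ []} det (refl ∷ heads-⊗ a₀ B₀ a₀-head B₀-head ∷ heads-⊗ b₀ C₀ b₀-head C₀-head
      ∷ heads-⊗ c₀ A₀ c₀-head A₀-head ∷ head-⟦⟧ {A₀ ∷ C₀ ∷ []} (v 0 :* v 1 :^ 3) (A₀-head ∷ C₀-head ∷ [])
      ∷ heads-⊗ b₀ A₂ b₀-head A₀-head ∷ heads-⊗ c₀ B₂ c₀-head B₀-head ∷ q⊗-zero _ ∷ [])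

    cancel-det : ∀ {f} → ⟦ det ⟧ (env zs) ⊗ f ≋ 0# → f ≋ 0#
    cancel-det {f} = head-nonzero-cancel (⟦ det ⟧ (env zs)) f (λ e → absurd (trans (sym det-head) e))
      where
      absurd : -[1+ 3 ] ≢ + 0
      absurd ()

    s-zero : s ≋ 0#
    s-zero = cancel-det (lincomb zs (det :* sₑ) (# 0)
      ((m₂₂ :* m₃₃ :- m₂₃ :* m₃₂ , S₁ ≐ # 0) ∷ (m₁₃ :* m₃₂ :- m₁₂ :* m₃₃ , S₂ ≐ # 0) ∷ (m₁₂ :* m₂₃ :- m₁₃ :* m₂₂ , S₃ ≐ # 0) ∷ []) refl (S₁-zero ∷ S₂-zero ∷ S₃-zero ∷ []))

    p-zero : p ≋ 0#
    p-zero = cancel-det (lincomb zs (det :* pₑ) (# 0)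
      ((m₂₃ :* m₃₁ :- m₂₁ :* m₃₃ , S₁ ≐ # 0) ∷ (m₁₁ :* m₃₃ :- m₁₃ :* m₃₁ , S₂ ≐ # 0) ∷ (m₁₃ :* m₂₁ :- m₁₁ :* m₂₃ , S₃ ≐ # 0) ∷ []) refl (S₁-zero ∷ S₂-zero ∷ S₃-zero ∷ []))

    r-zero : r ≋ 0#
    r-zero = cancel-det (lincomb zs (det :* rₑ) (# 0)
      ((m₂₁ :* m₃₂ :- m₂₂ :* m₃₁ , S₁ ≐ # 0) ∷ (m₁₂ :* m₃₁ :- m₁₁ :* m₃₂ , S₂ ≐ # 0) ∷ (m₁₁ :* m₂₂ :- m₁₂ :* m₂₁ , S₃ ≐ # 0) ∷ []) refl (S₁-zero ∷ S₂-zero ∷ S₃-zero ∷ []))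

bA₂ : b₀ ⊗ A₂ ≋ α
bA₂ = ⊝-move Unknowns.Linear.p-zero

cB₂ : q ⊗ (c₀ ⊗ B₂) ≋ β
cB₂ = ⊝-move Unknowns.Linear.r-zero

aC₂ : q ⊗ (a₀ ⊗ C₂) ≋ γ
aC₂ = ⊝-move Unknowns.Linear.s-zero

y-form : A₀ ↑ 3 ⊗ C₀ ↑ 2 ≋ y
y-form = Unknowns.y-form

αβγ-sum : α ⊕ β ⊝ γ ≋ 1#
αβγ-sum = ≈-trans (+-cong (+-cong (≈-sym bA₂) (≈-sym cB₂)) (-‿cong (≈-sym aC₂))) Unknowns.eq-0

xα : x ⊗ α ≋ γ ⊗ (1# ⊝ const (+ 2) ⊗ β)
xα = lincomb (α ∷ β ∷ γ ∷ x ∷ Unknowns.Sₛ ∷ []) (v 3 :* v 0) (v 2 :* (# 1 :- # 2 :* v 1))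
  ((# 1 , # 1 :- v 1 :+ # 2 :* v 1 :* v 4 ≐ v 0 :* (# 1 :- v 3)) ∷ (:- (# 2 :* v 1) , v 4 ≐ v 2) ∷ (# 1 , v 0 :+ v 1 :- v 2 ≐ # 1) ∷ []) refl
  (Unknowns.eq-3 ∷ aC₂ ∷ αβγ-sum ∷ [])

αβγ-quadratic : α ⊗ β ⊝ β ⊗ γ ⊝ α ⊗ γ ⊕ const (+ 2) ⊗ α ⊗ β ⊗ γ ≋ 0#
αβγ-quadratic = lincomb (α ∷ β ∷ γ ∷ x ∷ Unknowns.Pₛ ∷ []) (v 0 :* v 1 :- v 1 :* v 2 :- v 0 :* v 2 :+ # 2 :* v 0 :* v 1 :* v 2) (# 0)
  ((# 1 , v 1 :* (# 1 :- v 1) ≐ v 3 :* v 0 :* v 4) ∷ (v 3 :* v 0 , v 4 ≐ v 0) ∷ (v 0 , v 3 :* v 0 ≐ v 2 :* (# 1 :- # 2 :* v 1))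
    ∷ (v 1 , v 0 :+ v 1 :- v 2 ≐ # 1) ∷ []) refl
  (Unknowns.eq-III ∷ bA₂ ∷ xα ∷ αβγ-sum ∷ [])

-- Laurent series: f /q^ k stands for q⁻ᵏ f

infix 5 _/q^_

record Laurent : Set where
  constructor _/q^_
  field
    num : Series
    den : ℕ

open Laurent

infix 4 _≈ᴸ_

record _≈ᴸ_ (a b : Laurent) : Set where
  constructor cross
  field crossed : q ↑ den b ⊗ num a ≋ q ↑ den a ⊗ num b

open _≈ᴸ_

same-den : ∀ {f g k l} → f ≋ g → k ≡ l → (f /q^ k) ≈ᴸ (g /q^ l)
same-den p refl = cross (*-congˡ p)

opaque
  infixl 6 _+ᴸ_
  infixl 7 _*ᴸ_

  _+ᴸ_ _*ᴸ_ : Laurent → Laurent → Laurent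
  (f /q^ k) +ᴸ (g /q^ l) = (q ↑ l ⊗ f ⊕ q ↑ k ⊗ g) /q^ (k + l)
  (f /q^ k) *ᴸ (g /q^ l) = (f ⊗ g) /q^ (k + l)

  -ᴸ_ : Laurent → Laurent
  -ᴸ (f /q^ k) = (⊖ f) /q^ k

  embed : Series → Laurent
  embed f = f /q^ 0

  laurent-trans : ∀ {a b c} → a ≈ᴸ b → b ≈ᴸ c → a ≈ᴸ c
  laurent-trans {f /q^ k} {g /q^ l} {e /q^ m} (cross p) (cross r) = cross (q↑-cancel l
    (lincomb (q ↑ k ∷ q ↑ l ∷ q ↑ m ∷ f ∷ g ∷ e ∷ []) (v 1 :* (v 2 :* v 3)) (v 1 :* (v 0 :* v 5))
      ((v 2 , v 1 :* v 3 ≐ v 0 :* v 4) ∷ (v 0 , v 2 :* v 4 ≐ v 1 :* v 5) ∷ []) refl (p ∷ r ∷ [])))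

  laurent-isCommutativeRing : IsCommutativeRing _≈ᴸ_ _+ᴸ_ _*ᴸ_ -ᴸ_ (embed 0#) (embed 1#)
  laurent-isCommutativeRing = record
    { isRing = record
      { +-isAbelianGroup = record
        { isGroup = record
          { isMonoid = record
            { isSemigroup = record
              { isMagma = record
                { isEquivalence = record { refl = cross ≈-refl ; sym = λ { (cross p) → cross (≈-sym p) } ; trans = laurent-trans }
                ; ∙-cong = λ { {f /q^ k} {f′ /q^ k′} {g /q^ l} {g′ /q^ l′} (cross p) (cross r) → cross
                    (lincomb (q ↑ k ∷ q ↑ k′ ∷ q ↑ l ∷ q ↑ l′ ∷ f ∷ f′ ∷ g ∷ g′ ∷ q ↑ (k′ + l′) ∷ q ↑ (k + l) ∷ [])
                      (v 8 :* (v 2 :* v 4 :+ v 0 :* v 6)) (v 9 :* (v 3 :* v 5 :+ v 1 :* v 7))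
                      ((v 2 :* v 4 :+ v 0 :* v 6 , v 8 ≐ v 1 :* v 3) ∷ (:- (v 3 :* v 5 :+ v 1 :* v 7) , v 9 ≐ v 0 :* v 2)
                        ∷ (v 3 :* v 2 , v 1 :* v 4 ≐ v 0 :* v 5) ∷ (v 1 :* v 0 , v 3 :* v 6 ≐ v 2 :* v 7) ∷ []) refl
                      (↑-+ q k′ l′ ∷ ↑-+ q k l ∷ p ∷ r ∷ [])) } }
              ; assoc = λ { (f /q^ k) (g /q^ l) (e /q^ m) → same-den
                  (lincomb (q ↑ k ∷ q ↑ l ∷ q ↑ m ∷ f ∷ g ∷ e ∷ q ↑ (k + l) ∷ q ↑ (l + m) ∷ [])
                    (v 2 :* (v 1 :* v 3 :+ v 0 :* v 4) :+ v 6 :* v 5) (v 7 :* v 3 :+ v 0 :* (v 2 :* v 4 :+ v 1 :* v 5))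
                    ((v 5 , v 6 ≐ v 0 :* v 1) ∷ (:- v 3 , v 7 ≐ v 1 :* v 2) ∷ []) refl (↑-+ q k l ∷ ↑-+ q l m ∷ []))
                  (ℕₚ.+-assoc k l m) } }
            ; identity = (λ { (f /q^ k) → same-den (solve (q ↑ k ∷ f ∷ []) (v 0 :* # 0 :+ # 1 :* v 1) (v 1) refl) refl })
                       , (λ { (f /q^ k) → same-den (solve (q ↑ k ∷ f ∷ []) (# 1 :* v 1 :+ v 0 :* # 0) (v 1) refl) (ℕₚ.+-identityʳ k) }) }
          ; inverse = (λ { (f /q^ k) → cross (solve (q ↑ k ∷ f ∷ q ↑ (k + k) ∷ []) (# 1 :* (v 0 :* (:- v 1) :+ v 0 :* v 1)) (v 2 :* # 0) refl) })
                    , (λ { (f /q^ k) → cross (solve (q ↑ k ∷ f ∷ q ↑ (k + k) ∷ []) (# 1 :* (v 0 :* v 1 :+ v 0 :* (:- v 1))) (v 2 :* # 0) refl) })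
          ; ⁻¹-cong = λ { {f /q^ k} {g /q^ l} (cross p) → cross (lincomb (q ↑ k ∷ q ↑ l ∷ f ∷ g ∷ []) (v 1 :* (:- v 2)) (v 0 :* (:- v 3))
              ((:- # 1 , v 1 :* v 2 ≐ v 0 :* v 3) ∷ []) refl (p ∷ [])) } }
        ; comm = λ { (f /q^ k) (g /q^ l) → same-den (⊕-comm _ _) (ℕₚ.+-comm k l) } }
      ; *-cong = λ { {f /q^ k} {f′ /q^ k′} {g /q^ l} {g′ /q^ l′} (cross p) (cross r) → cross
          (lincomb (q ↑ k ∷ q ↑ k′ ∷ q ↑ l ∷ q ↑ l′ ∷ f ∷ f′ ∷ g ∷ g′ ∷ q ↑ (k′ + l′) ∷ q ↑ (k + l) ∷ [])
            (v 8 :* (v 4 :* v 6)) (v 9 :* (v 5 :* v 7))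
            ((v 4 :* v 6 , v 8 ≐ v 1 :* v 3) ∷ (:- (v 5 :* v 7) , v 9 ≐ v 0 :* v 2)
              ∷ (v 3 :* v 6 , v 1 :* v 4 ≐ v 0 :* v 5) ∷ (v 0 :* v 5 , v 3 :* v 6 ≐ v 2 :* v 7) ∷ []) refl
            (↑-+ q k′ l′ ∷ ↑-+ q k l ∷ p ∷ r ∷ [])) }
      ; *-assoc = λ { (f /q^ k) (g /q^ l) (e /q^ m) → same-den (⊗-assoc f g e) (ℕₚ.+-assoc k l m) }
      ; *-identity = (λ { (f /q^ k) → same-den (*-identityˡ f) refl }) , (λ { (f /q^ k) → same-den (*-identityʳ f) (ℕₚ.+-identityʳ k) })
      ; distrib = (λ { (f /q^ k) (g /q^ l) (e /q^ m) → cross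
                    (lincomb (q ↑ k ∷ q ↑ l ∷ q ↑ m ∷ f ∷ g ∷ e ∷ q ↑ (k + l) ∷ q ↑ (k + m) ∷ q ↑ (l + m) ∷ q ↑ ((k + l) + (k + m)) ∷ q ↑ (k + (l + m)) ∷ [])
                      (v 9 :* (v 3 :* (v 2 :* v 4 :+ v 1 :* v 5))) (v 10 :* (v 7 :* (v 3 :* v 4) :+ v 6 :* (v 3 :* v 5)))
                      ((v 3 :* (v 2 :* v 4 :+ v 1 :* v 5) , v 9 ≐ v 6 :* v 7) ∷ (:- (v 7 :* (v 3 :* v 4) :+ v 6 :* (v 3 :* v 5)) , v 10 ≐ v 0 :* v 8)
                        ∷ (:- (v 0 :* (v 7 :* (v 3 :* v 4) :+ v 6 :* (v 3 :* v 5))) , v 8 ≐ v 1 :* v 2)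
                        ∷ (v 7 :* v 3 :* (v 2 :* v 4 :+ v 1 :* v 5) :- v 0 :* v 1 :* v 2 :* v 3 :* v 5 , v 6 ≐ v 0 :* v 1)
                        ∷ (v 0 :* v 1 :* v 3 :* (v 2 :* v 4 :+ v 1 :* v 5) :- v 0 :* v 1 :* v 2 :* v 3 :* v 4 , v 7 ≐ v 0 :* v 2) ∷ []) refl
                      (↑-+ q (k + l) (k + m) ∷ ↑-+ q k (l + m) ∷ ↑-+ q l m ∷ ↑-+ q k l ∷ ↑-+ q k m ∷ [])) })
                , (λ { (f /q^ k) (g /q^ l) (e /q^ m) → cross
                    (lincomb (q ↑ k ∷ q ↑ l ∷ q ↑ m ∷ f ∷ g ∷ e ∷ q ↑ (l + k) ∷ q ↑ (m + k) ∷ q ↑ (l + m) ∷ q ↑ ((l + k) + (m + k)) ∷ q ↑ ((l + m) + k) ∷ [])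
                      (v 9 :* ((v 2 :* v 4 :+ v 1 :* v 5) :* v 3)) (v 10 :* (v 7 :* (v 4 :* v 3) :+ v 6 :* (v 5 :* v 3)))
                      ((v 3 :* (v 2 :* v 4 :+ v 1 :* v 5) , v 9 ≐ v 6 :* v 7) ∷ (:- (v 7 :* (v 3 :* v 4) :+ v 6 :* (v 3 :* v 5)) , v 10 ≐ v 8 :* v 0)
                        ∷ (:- (v 0 :* (v 7 :* (v 3 :* v 4) :+ v 6 :* (v 3 :* v 5))) , v 8 ≐ v 1 :* v 2)
                        ∷ (v 7 :* v 3 :* (v 2 :* v 4 :+ v 1 :* v 5) :- v 0 :* v 1 :* v 2 :* v 3 :* v 5 , v 6 ≐ v 1 :* v 0)
                        ∷ (v 0 :* v 1 :* v 3 :* (v 2 :* v 4 :+ v 1 :* v 5) :- v 0 :* v 1 :* v 2 :* v 3 :* v 4 , v 7 ≐ v 2 :* v 0) ∷ []) refl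
                      (↑-+ q (l + k) (m + k) ∷ ↑-+ q (l + m) k ∷ ↑-+ q l m ∷ ↑-+ q l k ∷ ↑-+ q m k ∷ [])) }) }
    ; *-comm = λ { (f /q^ k) (g /q^ l) → same-den (⊗-comm f g) (ℕₚ.+-comm k l) } }

  embed-cong : ∀ {f g} → f ≋ g → embed f ≈ᴸ embed g
  embed-cong p = same-den p refl

  embed-injective : ∀ {f g} → embed f ≈ᴸ embed g → f ≋ g
  embed-injective (cross p) = q↑-cancel 0 p

  embed-⊕ : ∀ f g → embed (f ⊕ g) ≈ᴸ embed f +ᴸ embed g
  embed-⊕ f g = same-den (solve (f ∷ g ∷ []) (v 0 :+ v 1) (# 1 :* v 0 :+ # 1 :* v 1) refl) refl

  embed-⊗ : ∀ f g → embed (f ⊗ g) ≈ᴸ embed f *ᴸ embed g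
  embed-⊗ f g = same-den ≈-refl refl

  embed-⊖ : ∀ f → embed (⊖ f) ≈ᴸ -ᴸ embed f
  embed-⊖ f = same-den ≈-refl refl

  q⁻¹ : Laurent
  q⁻¹ = 1# /q^ 1

  q-q⁻¹ : embed q *ᴸ q⁻¹ ≈ᴸ embed 1#
  q-q⁻¹ = cross (solve (q ∷ []) (# 1 :* (v 0 :* # 1)) (v 0 :^ 1 :* # 1) refl)

  -- For U the denominator must be a power of q⁷: q⁻ᵏ f = q⁻⁷ᵏ (q⁶ᵏ f).
  Vᴸ Uᴸ : Laurent → Laurent
  Vᴸ (f /q^ k) = V f /q^ (7 * k)
  Uᴸ (f /q^ k) = sec 6 (q ↑ (6 * k) ⊗ f) /q^ k

  Vᴸ-embed : ∀ f → Vᴸ (embed f) ≈ᴸ embed (V f)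
  Vᴸ-embed f = same-den ≈-refl refl

  Uᴸ-embed : ∀ f → Uᴸ (embed f) ≈ᴸ embed (sec 6 f)
  Uᴸ-embed f = same-den (sec-cong 6 (*-identityˡ f)) refl

  Vᴸ-cong : ∀ {a b} → a ≈ᴸ b → Vᴸ a ≈ᴸ Vᴸ b
  Vᴸ-cong {f /q^ k} {g /q^ l} (cross p) = cross (≈-trans (*-congʳ (≈-sym (V-q↑ l))) (≈-trans (≈-sym (VH.F-⊗ _ _))
    (≈-trans (VH.F-cong p) (≈-trans (VH.F-⊗ _ _) (*-congʳ (V-q↑ k))))))

  Vᴸ-⊕ : ∀ a b → Vᴸ (a +ᴸ b) ≈ᴸ Vᴸ a +ᴸ Vᴸ b
  Vᴸ-⊕ (f /q^ k) (g /q^ l) = same-den (≈-trans (VH.F-⊕ _ _) (+-cong (≈-trans (VH.F-⊗ _ _) (*-congʳ (V-q↑ l))) (≈-trans (VH.F-⊗ _ _) (*-congʳ (V-q↑ k)))))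
    (ℕₚ.*-distribˡ-+ 7 k l)

  Vᴸ-⊗ : ∀ a b → Vᴸ (a *ᴸ b) ≈ᴸ Vᴸ a *ᴸ Vᴸ b
  Vᴸ-⊗ (f /q^ k) (g /q^ l) = same-den (VH.F-⊗ f g) (ℕₚ.*-distribˡ-+ 7 k l)

  Vᴸ-⊖ : ∀ a → Vᴸ (-ᴸ a) ≈ᴸ -ᴸ Vᴸ a
  Vᴸ-⊖ (f /q^ k) = same-den (VH.F-⊖ f) refl

  sec-q↑ : ∀ l f → q ↑ l ⊗ sec 6 f ≋ sec 6 (q ↑ (7 * l) ⊗ f)
  sec-q↑ l f = ≈-trans (≈-sym (sec-dil-⊗ 6 (q ↑ l) f)) (sec-cong 6 (*-congʳ (V-q↑ l)))

  q↑7 : ∀ l → q ↑ (7 * l) ≋ q ↑ l ⊗ q ↑ (6 * l)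
  q↑7 l = ↑-+ q l (6 * l)

  Uᴸ-cong : ∀ {a b} → a ≈ᴸ b → Uᴸ a ≈ᴸ Uᴸ b
  Uᴸ-cong {f /q^ k} {g /q^ l} (cross p) = cross (≈-trans (sec-q↑ l _) (≈-trans (sec-cong 6
    (lincomb (q ↑ k ∷ q ↑ l ∷ q ↑ (6 * k) ∷ q ↑ (6 * l) ∷ f ∷ g ∷ q ↑ (7 * k) ∷ q ↑ (7 * l) ∷ []) (v 7 :* (v 2 :* v 4)) (v 6 :* (v 3 :* v 5))
      ((v 2 :* v 4 , v 7 ≐ v 1 :* v 3) ∷ (:- (v 3 :* v 5) , v 6 ≐ v 0 :* v 2) ∷ (v 2 :* v 3 , v 1 :* v 4 ≐ v 0 :* v 5) ∷ []) refl
      (q↑7 l ∷ q↑7 k ∷ p ∷ []))) (≈-sym (sec-q↑ k _))))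

  Uᴸ-⊕ : ∀ a b → Uᴸ (a +ᴸ b) ≈ᴸ Uᴸ a +ᴸ Uᴸ b
  Uᴸ-⊕ (f /q^ k) (g /q^ l) = same-den (≈-trans (sec-cong 6
    (lincomb (q ↑ k ∷ q ↑ l ∷ q ↑ (6 * k) ∷ q ↑ (6 * l) ∷ f ∷ g ∷ q ↑ (7 * k) ∷ q ↑ (7 * l) ∷ q ↑ (6 * (k + l)) ∷ [])
      (v 8 :* (v 1 :* v 4 :+ v 0 :* v 5)) (v 7 :* (v 2 :* v 4) :+ v 6 :* (v 3 :* v 5))
      ((v 1 :* v 4 :+ v 0 :* v 5 , v 8 ≐ v 2 :* v 3) ∷ (:- (v 2 :* v 4) , v 7 ≐ v 1 :* v 3) ∷ (:- (v 3 :* v 5) , v 6 ≐ v 0 :* v 2) ∷ []) refl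
      (≈-trans (≈-reflexive (cong (q ↑_) (ℕₚ.*-distribˡ-+ 6 k l))) (↑-+ q (6 * k) (6 * l)) ∷ q↑7 l ∷ q↑7 k ∷ [])))
    (≈-trans (sec-⊕ 6 _ _) (+-cong (≈-sym (sec-q↑ l _)) (≈-sym (sec-q↑ k _))))) refl

  Uᴸ-V : ∀ a b → Uᴸ (Vᴸ a *ᴸ b) ≈ᴸ a *ᴸ Uᴸ b
  Uᴸ-V (f /q^ k) (g /q^ l) = cross (≈-trans (*-congˡ (≈-trans (sec-cong 6
      (lincomb (V f ∷ g ∷ q ↑ (6 * (7 * k + l)) ∷ V (q ↑ (6 * k)) ∷ q ↑ (6 * l) ∷ V (q ↑ (6 * k) ⊗ f) ∷ []) (v 2 :* (v 0 :* v 1)) (v 5 :* (v 4 :* v 1))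
        ((v 0 :* v 1 , v 2 ≐ v 3 :* v 4) ∷ (:- (v 4 :* v 1) , v 5 ≐ v 3 :* v 0) ∷ []) refl (expo ∷ VH.F-⊗ _ _ ∷ [])))
      (sec-dil-⊗ 6 (q ↑ (6 * k) ⊗ f) _)))
    (lincomb (q ↑ (k + l) ∷ q ↑ (7 * k + l) ∷ q ↑ (6 * k) ∷ f ∷ sec 6 (q ↑ (6 * l) ⊗ g) ∷ q ↑ k ∷ q ↑ l ∷ q ↑ (7 * k) ∷ [])
      (v 0 :* (v 2 :* v 3 :* v 4)) (v 1 :* (v 3 :* v 4))
      ((v 2 :* v 3 :* v 4 , v 0 ≐ v 5 :* v 6) ∷ (:- (v 3 :* v 4) , v 1 ≐ v 7 :* v 6) ∷ (:- (v 6 :* v 3 :* v 4) , v 7 ≐ v 5 :* v 2) ∷ []) refl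
      (↑-+ q k l ∷ ↑-+ q (7 * k) l ∷ q↑7 k ∷ [])))
    where
    expo : q ↑ (6 * (7 * k + l)) ≋ V (q ↑ (6 * k)) ⊗ q ↑ (6 * l)
    expo = ≈-trans (≈-reflexive (cong (q ↑_) (trans (ℕₚ.*-distribˡ-+ 6 (7 * k) l) (cong (_+ 6 * l) (trans (sym (ℕₚ.*-assoc 6 7 k)) (ℕₚ.*-assoc 7 6 k))))))
      (≈-trans (↑-+ q (7 * (6 * k)) (6 * l)) (*-congʳ (≈-sym (V-q↑ (6 * k)))))

LaurentRing : CommutativeRing 0ℓ 0ℓ
LaurentRing = record { isCommutativeRing = laurent-isCommutativeRing }

ιᴸ : ℤ → Laurent
ιᴸ c = embed (const c)

ιᴸ-+ : ∀ a b → ιᴸ (a ℤ.+ b) ≈ᴸ ιᴸ a +ᴸ ιᴸ b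
ιᴸ-+ a b = CommutativeRing.trans LaurentRing (embed-cong (const-+ a b)) (embed-⊕ _ _)

ιᴸ-* : ∀ a b → ιᴸ (a ℤ.* b) ≈ᴸ ιᴸ a *ᴸ ιᴸ b
ιᴸ-* a b = CommutativeRing.trans LaurentRing (embed-cong (const-* a b)) (embed-⊗ _ _)

module L = RingTools LaurentRing ιᴸ ιᴸ-+ ιᴸ-* (CommutativeRing.refl LaurentRing)

embed-⟦⟧ : ∀ xs e → embed (⟦ e ⟧ (env xs)) ≈ᴸ L.⟦ e ⟧ (L.env (map embed xs))
embed-⟦⟧ xs       (con c)       = L.≈-refl
embed-⟦⟧ []       (var i)       = L.≈-refl
embed-⟦⟧ (x ∷ xs) (var zero)    = L.≈-refl
embed-⟦⟧ (x ∷ xs) (var (suc i)) = embed-⟦⟧ xs (var i)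
embed-⟦⟧ xs       (a :+ b)      = L.≈-trans (embed-⊕ _ _) (L.+-cong (embed-⟦⟧ xs a) (embed-⟦⟧ xs b))
embed-⟦⟧ xs       (a :* b)      = L.≈-trans (embed-⊗ _ _) (L.*-cong (embed-⟦⟧ xs a) (embed-⟦⟧ xs b))
embed-⟦⟧ xs       (:- a)        = L.≈-trans (embed-⊖ _) (L.-‿cong (embed-⟦⟧ xs a))

Vᴸ-hom : L.IsHom Vᴸ
Vᴸ-hom = record { F-cong = Vᴸ-cong ; F-⊕ = Vᴸ-⊕ ; F-⊗ = Vᴸ-⊗ ; F-⊖ = Vᴸ-⊖ ; F-ι = λ c → L.≈-trans (Vᴸ-embed _) (embed-cong (VH.F-ι c)) }

embed-eqn : ∀ xs e f → ⟦ e ⟧ (env xs) ≋ ⟦ f ⟧ (env xs) → L.⟦ e ⟧ (L.env (map embed xs)) ≈ᴸ L.⟦ f ⟧ (L.env (map embed xs))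
embed-eqn xs e f p = L.≈-trans (L.≈-sym (embed-⟦⟧ xs e)) (L.≈-trans (embed-cong p) (embed-⟦⟧ xs f))

-- A hat marks a series from which the leading power of q has been removed (g = q⁻¹ ĝ, t = q t̂, u =
-- q² û, h = q² ĥ), so that its constant term is 1 and it can be inverted.
ĥ ĝ t̂ û h tₛ : Series
ĥ  = α ⊗ β̂ ⊗ γ̂
ĝ  = y ⊗ inv x̂ ⊕ q ⊗ (inv y ⊝ x ⊝ const (+ 8))
t̂  = inv ĝ
û  = inv ξ₀
h  = α ⊗ β ⊗ γ
tₛ = q ⊗ t̂

x̂-head : x̂ 0 ≡ + 1
x̂-head = head-⟦⟧ {A₀ ∷ C₀ ∷ []} (v 0 :* v 1 :^ 3) (A₀-head ∷ C₀-head ∷ [])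

α-head : α 0 ≡ + 1
α-head = heads-⊗ a₀ B₀ a₀-head B₀-head

y-head : y 0 ≡ + 1
y-head = head-⟦⟧ {q ∷ x̂ ∷ []} (# 1 :+ v 0 :* v 1) (refl ∷ x̂-head ∷ [])

ĥ-head : ĥ 0 ≡ + 1
ĥ-head = head-⟦⟧ {α ∷ β̂ ∷ γ̂ ∷ []} (v 0 :* v 1 :* v 2) (α-head ∷ heads-⊗ b₀ C₀ b₀-head C₀-head ∷ heads-⊗ c₀ A₀ c₀-head A₀-head ∷ [])

ĝ-head : ĝ 0 ≡ + 1
ĝ-head = trans (head-⟦⟧ {y ∷ inv x̂ ∷ q ∷ inv y ⊝ x ⊝ const (+ 8) ∷ []} (v 0 :* v 1 :+ v 2 :* v 3) (y-head ∷ inv-head x̂ ∷ refl ∷ refl ∷ [])) refl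

ξ₀-head : ξ₀ 0 ≡ + 1
ξ₀-head = heads-⊗ J (V (V iJ)) J-head (inv-head J)

η₀-head : η₀ 0 ≡ + 1
η₀-head = heads-⊗ φ (V (V iφ)) φ-head (inv-head φ)

h-ĥ : h ≋ q ↑ 2 ⊗ ĥ
h-ĥ = solve (q ∷ α ∷ β̂ ∷ γ̂ ∷ []) (v 1 :* (v 0 :* v 2) :* (v 0 :* v 3)) (v 0 :^ 2 :* (v 1 :* v 2 :* v 3)) refl

ĝ-def : ĝ ⊗ (x ⊗ (1# ⊕ x)) ≋ q ⊗ ((1# ⊕ x) ↑ 2 ⊕ x ⊝ x ↑ 2 ⊗ (1# ⊕ x) ⊝ const (+ 8) ⊗ (x ⊗ (1# ⊕ x)))
ĝ-def = lincomb (q ∷ x̂ ∷ inv x̂ ∷ inv y ∷ []) ((Y :* v 2 :+ v 0 :* (v 3 :- X :- # 8)) :* (X :* Y)) (v 0 :* (Y :^ 2 :+ X :- X :^ 2 :* Y :- # 8 :* (X :* Y)))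
  ((v 0 :* Y :^ 2 , v 1 :* v 2 ≐ # 1) ∷ (v 0 :* X , Y :* v 3 ≐ # 1) ∷ []) refl (inv-inverse x̂ x̂-head ∷ inv-inverse y y-head ∷ [])
  where
  X = v 0 :* v 1
  Y = # 1 :+ X

D₂x : D₂ x ≋ q ↑ 2 ⊗ (A₂ ⊗ C₂ ↑ 3)
D₂x = ≈-trans (DH.F-⟦⟧ (q ∷ A₀ ∷ C₀ ∷ []) (v 0 :* (v 1 :* v 2 :^ 3))) (*-congʳ (dil-q 1))

D₂ĝ-def : D₂ ĝ ⊗ (D₂ x ⊗ (1# ⊕ D₂ x)) ≋ q ↑ 2 ⊗ ((1# ⊕ D₂ x) ↑ 2 ⊕ D₂ x ⊝ D₂ x ↑ 2 ⊗ (1# ⊕ D₂ x) ⊝ const (+ 8) ⊗ (D₂ x ⊗ (1# ⊕ D₂ x)))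
D₂ĝ-def = ≈-trans (≈-sym (DH.F-⟦⟧ (ĝ ∷ x ∷ []) (v 0 :* (v 1 :* (# 1 :+ v 1))))) (≈-trans (DH.F-cong ĝ-def)
  (≈-trans (DH.F-⟦⟧ (q ∷ x ∷ []) (v 0 :* ((# 1 :+ v 1) :^ 2 :+ v 1 :- v 1 :^ 2 :* (# 1 :+ v 1) :- # 8 :* (v 1 :* (# 1 :+ v 1))))) (*-congʳ (dil-q 1))))

qᴸ : Laurent
qᴸ = embed q

-- The abstract setting realised by Laurent series

module Instance where
  open L using () renaming (_⊗_ to infixl 7 _∙_; _⊕_ to infixl 6 _∔_; _⊝_ to infixl 6 _∸ᴸ_; _↑_ to infixr 9 _↟_)

  e : Series → Laurent
  e = embed

  A B C a b c A₂ᴸ B₂ᴸ C₂ᴸ hi gᴸ g₂ᴸ : Laurent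
  A   = e (V A₀) ∙ q⁻¹ ↟ 2
  B   = e (V B₀) ∙ q⁻¹
  C   = qᴸ ↟ 3 ∙ e (V C₀)
  a   = qᴸ ∙ e (V a₀)
  b   = qᴸ ↟ 4 ∙ e (V b₀)
  c   = qᴸ ↟ 9 ∙ e (V c₀)
  A₂ᴸ = e (V A₂) ∙ q⁻¹ ↟ 4
  B₂ᴸ = e (V B₂) ∙ q⁻¹ ↟ 2
  C₂ᴸ = qᴸ ↟ 6 ∙ e (V C₂)
  hi  = e (inv ĥ) ∙ q⁻¹ ↟ 2
  gᴸ  = e ĝ ∙ q⁻¹
  g₂ᴸ = e (D₂ ĝ) ∙ q⁻¹ ↟ 2

  qq : qᴸ ∙ q⁻¹ ≈ᴸ ιᴸ (+ 1)
  qq = q-q⁻¹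

  V-eqn : ∀ xs l r → ⟦ l ⟧ (env xs) ≋ ⟦ r ⟧ (env xs) → L.⟦ l ⟧ (L.env (map e (map V xs))) ≈ᴸ L.⟦ r ⟧ (L.env (map e (map V xs)))
  V-eqn xs l r p = embed-eqn (map V xs) l r (≈-trans (≈-sym (VH.F-⟦⟧ xs l)) (≈-trans (VH.F-cong p) (VH.F-⟦⟧ xs r)))

  V-image : ∀ f xs r → f ≋ ⟦ r ⟧ (env (q ∷ xs)) → Vᴸ (e f) ≈ᴸ L.⟦ r ⟧ (L.env (e (q ↑ 7) ∷ map e (map V xs)))
  V-image f xs r p = L.≈-trans (Vᴸ-embed f) (L.≈-trans (embed-cong (≈-trans (VH.F-cong p) (V-⟦⟧ xs r))) (embed-⟦⟧ (q ↑ 7 ∷ map V xs) r))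

  q⁷ : e (q ↑ 7) ≈ᴸ qᴸ ↟ 7
  q⁷ = embed-⟦⟧ (q ∷ []) (v 0 :^ 7)

  h-inv : e α ∙ e β ∙ e γ ∙ hi ≈ᴸ ιᴸ (+ 1)
  h-inv = L.lincomb (e α ∷ e β ∷ e γ ∷ e (inv ĥ) ∷ qᴸ ∷ q⁻¹ ∷ []) (v 0 :* v 1 :* v 2 :* (v 3 :* v 5 :^ 2)) (# 1)
    ((v 5 :^ 2 , v 0 :* v 1 :* v 2 :* v 3 ≐ v 4 :^ 2) ∷ (v 4 :* v 5 :+ # 1 , v 4 :* v 5 ≐ # 1) ∷ []) refl
    (embed-eqn (α ∷ β ∷ γ ∷ inv ĥ ∷ q ∷ []) (v 0 :* v 1 :* v 2 :* v 3) (v 4 :^ 2)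
      (lincomb (h ∷ inv ĥ ∷ q ∷ ĥ ∷ []) (v 0 :* v 1) (v 2 :^ 2) ((v 1 , v 0 ≐ v 2 :^ 2 :* v 3) ∷ (v 2 :^ 2 , v 3 :* v 1 ≐ # 1) ∷ []) refl
        (h-ĥ ∷ inv-inverse ĥ ĥ-head ∷ [])) ∷ qq ∷ [])

  ABCᴸ : A ∙ B ∙ C ≈ᴸ ιᴸ (+ 1)
  ABCᴸ = L.lincomb (e (V A₀) ∷ e (V B₀) ∷ e (V C₀) ∷ qᴸ ∷ q⁻¹ ∷ []) (v 0 :* v 4 :^ 2 :* (v 1 :* v 4) :* (v 3 :^ 3 :* v 2)) (# 1)
    ((v 4 :^ 3 :* v 3 :^ 3 , v 0 :* v 1 :* v 2 ≐ # 1) ∷ ((v 3 :* v 4) :^ 2 :+ v 3 :* v 4 :+ # 1 , v 3 :* v 4 ≐ # 1) ∷ []) refl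
    (V-eqn (A₀ ∷ B₀ ∷ C₀ ∷ []) (v 0 :* v 1 :* v 2) (# 1) ABC ∷ qq ∷ [])

  Vxᴸ : Vᴸ (e x) ≈ᴸ A ∙ C ↟ 3
  Vxᴸ = L.lincomb (Vᴸ (e x) ∷ e (q ↑ 7) ∷ e (V A₀) ∷ e (V C₀) ∷ qᴸ ∷ q⁻¹ ∷ []) (v 0) (v 2 :* v 5 :^ 2 :* (v 4 :^ 3 :* v 3) :^ 3)
    ((# 1 , v 0 ≐ v 1 :* (v 2 :* v 3 :^ 3)) ∷ (v 2 :* v 3 :^ 3 , v 1 ≐ v 4 :^ 7) ∷ (:- (v 2 :* v 3 :^ 3 :* v 4 :^ 7 :* (v 4 :* v 5 :+ # 1)) , v 4 :* v 5 ≐ # 1) ∷ []) refl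
    (V-image x (A₀ ∷ C₀ ∷ []) (v 0 :* (v 1 :* v 2 :^ 3)) ≈-refl ∷ q⁷ ∷ qq ∷ [])

  Vyᴸ : ιᴸ (+ 1) ∔ Vᴸ (e x) ≈ᴸ A ↟ 3 ∙ C ↟ 2
  Vyᴸ = L.lincomb (Vᴸ (e x) ∷ e (V x) ∷ e (V A₀) ∷ e (V C₀) ∷ qᴸ ∷ q⁻¹ ∷ []) (# 1 :+ v 0) ((v 2 :* v 5 :^ 2) :^ 3 :* (v 4 :^ 3 :* v 3) :^ 2)
    ((# 1 , v 0 ≐ v 1) ∷ (:- # 1 , v 2 :^ 3 :* v 3 :^ 2 ≐ # 1 :+ v 1)
      ∷ (:- (v 2 :^ 3 :* v 3 :^ 2 :* (s :^ 5 :+ s :^ 4 :+ s :^ 3 :+ s :^ 2 :+ s :+ # 1)) , s ≐ # 1) ∷ []) refl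
    (Vᴸ-embed x ∷ V-eqn (x ∷ x ∷ A₀ ∷ C₀ ∷ []) (v 2 :^ 3 :* v 3 :^ 2) (# 1 :+ v 1) y-form ∷ qq ∷ [])
    where s = v 4 :* v 5

  Vαᴸ : Vᴸ (e α) ≈ᴸ a ∙ B
  Vαᴸ = L.lincomb (Vᴸ (e α) ∷ e (V a₀) ∷ e (V B₀) ∷ qᴸ ∷ q⁻¹ ∷ []) (v 0) (v 3 :* v 1 :* (v 2 :* v 4))
    ((# 1 , v 0 ≐ v 1 :* v 2) ∷ (:- (v 1 :* v 2) , v 3 :* v 4 ≐ # 1) ∷ []) refl
    (V-image α (a₀ ∷ B₀ ∷ []) (v 1 :* v 2) ≈-refl ∷ qq ∷ [])

  Vβᴸ : Vᴸ (e β) ≈ᴸ b ∙ C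
  Vβᴸ = L.lincomb (Vᴸ (e β) ∷ e (q ↑ 7) ∷ e (V b₀) ∷ e (V C₀) ∷ qᴸ ∷ []) (v 0) (v 4 :^ 4 :* v 2 :* (v 4 :^ 3 :* v 3))
    ((# 1 , v 0 ≐ v 1 :* (v 2 :* v 3)) ∷ (v 2 :* v 3 , v 1 ≐ v 4 :^ 7) ∷ []) refl
    (V-image β (b₀ ∷ C₀ ∷ []) (v 0 :* (v 1 :* v 2)) ≈-refl ∷ q⁷ ∷ [])

  Vγᴸ : Vᴸ (e γ) ≈ᴸ c ∙ A
  Vγᴸ = L.lincomb (Vᴸ (e γ) ∷ e (q ↑ 7) ∷ e (V c₀) ∷ e (V A₀) ∷ qᴸ ∷ q⁻¹ ∷ []) (v 0) (v 4 :^ 9 :* v 2 :* (v 3 :* v 5 :^ 2))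
    ((# 1 , v 0 ≐ v 1 :* (v 2 :* v 3)) ∷ (v 2 :* v 3 , v 1 ≐ v 4 :^ 7) ∷ (:- (v 2 :* v 3 :* v 4 :^ 7 :* (v 4 :* v 5 :+ # 1)) , v 4 :* v 5 ≐ # 1) ∷ []) refl
    (V-image γ (c₀ ∷ A₀ ∷ []) (v 0 :* (v 1 :* v 2)) ≈-refl ∷ q⁷ ∷ qq ∷ [])

  bA₂ᴸ : b ∙ A₂ᴸ ≈ᴸ Vᴸ (e α)
  bA₂ᴸ = L.lincomb (Vᴸ (e α) ∷ e (V b₀) ∷ e (V A₂) ∷ qᴸ ∷ q⁻¹ ∷ []) (v 3 :^ 4 :* v 1 :* (v 2 :* v 4 :^ 4)) (v 0)
    ((:- # 1 , v 0 ≐ v 1 :* v 2) ∷ (v 1 :* v 2 :* (s :^ 3 :+ s :^ 2 :+ s :+ # 1) , s ≐ # 1) ∷ []) refl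
    (V-image α (b₀ ∷ A₂ ∷ []) (v 1 :* v 2) (≈-sym bA₂) ∷ qq ∷ [])
    where s = v 3 :* v 4

  cB₂ᴸ : c ∙ B₂ᴸ ≈ᴸ Vᴸ (e β)
  cB₂ᴸ = L.lincomb (Vᴸ (e β) ∷ e (q ↑ 7) ∷ e (V c₀) ∷ e (V B₂) ∷ qᴸ ∷ q⁻¹ ∷ []) (v 4 :^ 9 :* v 2 :* (v 3 :* v 5 :^ 2)) (v 0)
    ((:- # 1 , v 0 ≐ v 1 :* (v 2 :* v 3)) ∷ (:- (v 2 :* v 3) , v 1 ≐ v 4 :^ 7) ∷ (v 2 :* v 3 :* v 4 :^ 7 :* (v 4 :* v 5 :+ # 1) , v 4 :* v 5 ≐ # 1) ∷ []) refl
    (V-image β (c₀ ∷ B₂ ∷ []) (v 0 :* (v 1 :* v 2)) (≈-sym cB₂) ∷ q⁷ ∷ qq ∷ [])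

  aC₂ᴸ : a ∙ C₂ᴸ ≈ᴸ Vᴸ (e γ)
  aC₂ᴸ = L.lincomb (Vᴸ (e γ) ∷ e (q ↑ 7) ∷ e (V a₀) ∷ e (V C₂) ∷ qᴸ ∷ []) (v 4 :* v 2 :* (v 4 :^ 6 :* v 3)) (v 0)
    ((:- # 1 , v 0 ≐ v 1 :* (v 2 :* v 3)) ∷ (:- (v 2 :* v 3) , v 1 ≐ v 4 :^ 7) ∷ []) refl
    (V-image γ (a₀ ∷ C₂ ∷ []) (v 0 :* (v 1 :* v 2)) (≈-sym aC₂) ∷ q⁷ ∷ [])

  Vx₂ᴸ : Vᴸ (e (D₂ x)) ≈ᴸ A₂ᴸ ∙ C₂ᴸ ↟ 3
  Vx₂ᴸ = L.lincomb (Vᴸ (e (D₂ x)) ∷ e (q ↑ 7) ∷ e (V A₂) ∷ e (V C₂) ∷ qᴸ ∷ q⁻¹ ∷ []) (v 0) (v 2 :* v 5 :^ 4 :* (v 4 :^ 6 :* v 3) :^ 3)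
    ((# 1 , v 0 ≐ v 1 :^ 2 :* (v 2 :* v 3 :^ 3)) ∷ (v 2 :* v 3 :^ 3 :* (v 1 :+ v 4 :^ 7) , v 1 ≐ v 4 :^ 7)
      ∷ (:- (v 2 :* v 3 :^ 3 :* v 4 :^ 14 :* (s :^ 3 :+ s :^ 2 :+ s :+ # 1)) , s ≐ # 1) ∷ []) refl
    (V-image (D₂ x) (A₂ ∷ C₂ ∷ []) (v 0 :^ 2 :* (v 1 :* v 2 :^ 3)) D₂x ∷ q⁷ ∷ qq ∷ [])
    where s = v 4 :* v 5

  E-series : A ∙ C ≈ᴸ e (q ⊗ V (A₀ ⊗ C₀))
  E-series = L.≈-trans (L.lincomb (e (V A₀) ∷ e (V C₀) ∷ qᴸ ∷ q⁻¹ ∷ []) (v 0 :* v 3 :^ 2 :* (v 2 :^ 3 :* v 1)) (v 2 :* (v 0 :* v 1))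
      ((v 0 :* v 1 :* v 2 :* (v 2 :* v 3 :+ # 1) , v 2 :* v 3 ≐ # 1) ∷ []) refl (qq ∷ []))
    (L.≈-trans (L.≈-sym (embed-⟦⟧ (V A₀ ∷ V C₀ ∷ q ∷ []) (v 2 :* (v 0 :* v 1)))) (embed-cong (*-congˡ (≈-sym (VH.F-⊗ A₀ C₀)))))

  embed-↑ : ∀ f k → e f ↟ k ≈ᴸ e (f ↑ k)
  embed-↑ f zero    = L.≈-refl
  embed-↑ f (suc k) = L.≈-trans (L.*-congˡ (embed-↑ f k)) (L.≈-sym (embed-⊗ f (f ↑ k)))

  U-E : ∀ i → i < 6 → Uᴸ ((A ∙ C) ↟ suc i) ≈ᴸ embed 0#
  U-E i l = L.≈-trans (Uᴸ-cong (L.≈-trans (L.↑-cong (suc i) E-series) (embed-↑ _ (suc i)))) (L.≈-trans (Uᴸ-embed _) (embed-cong (begin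
    sec 6 ((q ⊗ V (A₀ ⊗ C₀)) ↑ suc i)       ≈⟨ sec-cong 6 (split (suc i)) ⟩
    sec 6 (q ↑ suc i ⊗ V ((A₀ ⊗ C₀) ↑ suc i)) ≈⟨ sec-q↑-dil 6 (suc i) _ (s≤s z≤n) l ⟩
    0#                                      ∎)))
    where
    split : ∀ k → (q ⊗ V (A₀ ⊗ C₀)) ↑ k ≋ q ↑ k ⊗ V ((A₀ ⊗ C₀) ↑ k)
    split zero    = ≈-sym (≈-trans (*-congˡ VH.F-1) (*-identityʳ _))
    split (suc k) = ≈-trans (*-congˡ (split k)) (≈-trans (⊗-interchange q _ (q ↑ k) _) (*-congˡ (≈-sym (VH.F-⊗ _ _))))

  g-defᴸ : gᴸ ∙ (e x ∙ (ιᴸ (+ 1) ∔ e x)) ≈ᴸ (ιᴸ (+ 1) ∔ e x) ↟ 2 ∔ e x ∸ᴸ e x ↟ 2 ∙ (ιᴸ (+ 1) ∔ e x) ∸ᴸ ιᴸ (+ 8) ∙ (e x ∙ (ιᴸ (+ 1) ∔ e x))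
  g-defᴸ = L.lincomb (e ĝ ∷ e x ∷ qᴸ ∷ q⁻¹ ∷ []) (v 0 :* v 3 :* (v 1 :* Y)) r
    ((v 3 , v 0 :* (v 1 :* Y) ≐ v 2 :* r) ∷ (r , v 2 :* v 3 ≐ # 1) ∷ []) refl
    (embed-eqn (ĝ ∷ x ∷ q ∷ []) (v 0 :* (v 1 :* Y)) (v 2 :* r) ĝ-def ∷ qq ∷ [])
    where
    Y = # 1 :+ v 1
    r = Y :^ 2 :+ v 1 :- v 1 :^ 2 :* Y :- # 8 :* (v 1 :* Y)

  g₂-defᴸ : g₂ᴸ ∙ (e (D₂ x) ∙ (ιᴸ (+ 1) ∔ e (D₂ x))) ≈ᴸ (ιᴸ (+ 1) ∔ e (D₂ x)) ↟ 2 ∔ e (D₂ x) ∸ᴸ e (D₂ x) ↟ 2 ∙ (ιᴸ (+ 1) ∔ e (D₂ x)) ∸ᴸ ιᴸ (+ 8) ∙ (e (D₂ x) ∙ (ιᴸ (+ 1) ∔ e (D₂ x)))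
  g₂-defᴸ = L.lincomb (e (D₂ ĝ) ∷ e (D₂ x) ∷ qᴸ ∷ q⁻¹ ∷ []) (v 0 :* v 3 :^ 2 :* (v 1 :* Y)) r
    ((v 3 :^ 2 , v 0 :* (v 1 :* Y) ≐ v 2 :^ 2 :* r) ∷ (r :* (v 2 :* v 3 :+ # 1) , v 2 :* v 3 ≐ # 1) ∷ []) refl
    (embed-eqn (D₂ ĝ ∷ D₂ x ∷ q ∷ []) (v 0 :* (v 1 :* Y)) (v 2 :^ 2 :* r) D₂ĝ-def ∷ qq ∷ [])
    where
    Y = # 1 :+ v 1
    r = Y :^ 2 :+ v 1 :- v 1 :^ 2 :* Y :- # 8 :* (v 1 :* Y)

  setting : Setting
  setting = record
    { R = LaurentRing ; ι = ιᴸ ; ι-+ = ιᴸ-+ ; ι-* = ιᴸ-* ; ι-1 = CommutativeRing.refl LaurentRing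
    ; V = Vᴸ ; U = Uᴸ ; V-hom = Vᴸ-hom ; U-cong = Uᴸ-cong ; U-⊕ = Uᴸ-⊕ ; U-V = Uᴸ-V
    ; U-1 = L.≈-trans (Uᴸ-embed _) (embed-cong (mk λ { zero → refl ; (suc n) → refl }))
    ; α = e α ; β = e β ; γ = e γ ; x = e x ; hi = hi ; g = gᴸ ; x₂ = e (D₂ x) ; g₂ = g₂ᴸ
    ; h-inv = h-inv
    ; αβγ-sum = embed-eqn (α ∷ β ∷ γ ∷ []) (v 0 :+ v 1 :- v 2) (# 1) αβγ-sum
    ; αβγ-quad = embed-eqn (α ∷ β ∷ γ ∷ []) (v 0 :* v 1 :- v 1 :* v 2 :- v 0 :* v 2 :+ # 2 :* v 0 :* v 1 :* v 2) (# 0) αβγ-quadratic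
    ; xα = embed-eqn (α ∷ β ∷ γ ∷ x ∷ []) (v 3 :* v 0) (v 2 :* (# 1 :- # 2 :* v 1)) xα
    ; A = A ; B = B ; C = C ; a = a ; b = b ; c = c ; A₂ = A₂ᴸ ; B₂ = B₂ᴸ ; C₂ = C₂ᴸ
    ; ABC = ABCᴸ ; Vx = Vxᴸ ; Vy = Vyᴸ ; Vα = Vαᴸ ; Vβ = Vβᴸ ; Vγ = Vγᴸ ; bA₂ = bA₂ᴸ ; cB₂ = cB₂ᴸ ; aC₂ = aC₂ᴸ ; Vx₂ = Vx₂ᴸ
    ; U-E = U-E ; g-def = g-defᴸ ; g₂-def = g₂-defᴸ }

-- The functional equations t = u⁴ V(1/t) and h = η u V(κ).
-- Both (t, h) and (u⁴ V(1/t), η u V(κ)) satisfy F and G below, and F and G have only one solution with t = q + …, h = q² + ….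

κ t̂′ ĥ′ tₛ′ hₛ′ : Series
κ   = 1# ⊕ const (+ 7) ⊗ tₛ ⊝ const (+ 7) ⊗ (h ⊗ tₛ)
t̂′  = û ↑ 4 ⊗ V ĝ
ĥ′  = η₀ ⊗ û ⊗ V κ
tₛ′ = q ⊗ t̂′
hₛ′ = q ↑ 2 ⊗ ĥ′

Φₑ : Expr → Expr
Φₑ H = (# 1 :- H) :* (# 1 :- # 8 :* H) :^ 2

F-lhs F-rhs : Expr → Expr → Expr
F-lhs T H = T :^ 2 :* Φₑ H
F-rhs T H = H :+ T :* H :* (# 9 :- # 16 :* H)

G-lhs : Expr → Expr → Expr
G-lhs T H = H :* T :^ 2

G-rhs : Expr → Expr → Expr → Expr
G-rhs T H T₂ = T₂ :^ 2 :* (# 1 :+ # 7 :* T :- # 7 :* H :* T)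

module Equations where
  open Instance
  open L using () renaming (_⊗_ to infixl 7 _∙_; _⊕_ to infixl 6 _∔_; _⊝_ to infixl 6 _∸ᴸ_; _↑_ to infixr 9 _↟_)
  module T = Tower setting
  module VL = L.IsHom Vᴸ-hom

  tᴸ uᴸ : Laurent
  tᴸ = e tₛ
  uᴸ = qᴸ ↟ 2 ∙ e û

  ξ-form : T.ξ ≈ᴸ e ξ₀ ∙ q⁻¹ ↟ 2
  ξ-form = L.lincomb (e (V A₀) ∷ e (V B₀) ∷ e (V C₀) ∷ qᴸ ∷ q⁻¹ ∷ e ξ₀ ∷ []) (v 0 :* v 4 :^ 2 :- v 1 :* v 4 :- # 1 :+ v 3 :^ 3 :* v 2) (v 5 :* v 4 :^ 2)
    ((:- (v 4 :^ 2) , v 5 ≐ v 0 :- v 3 :* v 1 :- v 3 :^ 2 :+ v 3 :^ 5 :* v 2)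
      ∷ (v 1 :* v 4 :+ (s :+ # 1) :- v 2 :* v 3 :^ 3 :* (s :+ # 1) , s ≐ # 1) ∷ []) refl
    (embed-eqn (V A₀ ∷ V B₀ ∷ V C₀ ∷ q ∷ ξ₀ ∷ []) (v 4) (v 0 :- v 3 :* v 1 :- v 3 :^ 2 :+ v 3 :^ 5 :* v 2) ξ₀-dissect ∷ qq ∷ [])
    where s = v 3 :* v 4

  η-form : T.η ≈ᴸ e η₀
  η-form = L.lincomb (e (V a₀) ∷ e (V b₀) ∷ e (V c₀) ∷ qᴸ ∷ e η₀ ∷ []) (# 1 :- # 2 :* (v 3 :* v 0) :+ # 2 :* (v 3 :^ 4 :* v 1) :- # 2 :* (v 3 :^ 9 :* v 2)) (v 4)
    ((:- # 1 , v 4 ≐ # 1 :+ # 2 :* (v 3 :^ 4 :* v 1 :- v 3 :* v 0 :- v 3 :^ 9 :* v 2)) ∷ []) refl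
    (embed-eqn (V a₀ ∷ V b₀ ∷ V c₀ ∷ q ∷ η₀ ∷ []) (v 4) (# 1 :+ # 2 :* (v 3 :^ 4 :* v 1 :- v 3 :* v 0 :- v 3 :^ 9 :* v 2)) η₀-dissect ∷ [])

  ξ₂-form : T.ξ₂ ≈ᴸ e ξ₂ ∙ q⁻¹ ↟ 4
  ξ₂-form = L.lincomb (e (V A₂) ∷ e (V B₂) ∷ e (V C₂) ∷ qᴸ ∷ q⁻¹ ∷ e ξ₂ ∷ []) (v 0 :* v 4 :^ 4 :- v 1 :* v 4 :^ 2 :- # 1 :+ v 3 :^ 6 :* v 2) (v 5 :* v 4 :^ 4)
    ((:- (v 4 :^ 4) , v 5 ≐ v 0 :- v 3 :^ 2 :* v 1 :- v 3 :^ 4 :+ v 3 :^ 10 :* v 2)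
      ∷ (v 1 :* v 4 :^ 2 :* (s :+ # 1) :+ geo₄ :- v 2 :* v 3 :^ 6 :* geo₄ , s ≐ # 1) ∷ []) refl
    (embed-eqn (V A₂ ∷ V B₂ ∷ V C₂ ∷ q ∷ ξ₂ ∷ []) (v 4) (v 0 :- v 3 :^ 2 :* v 1 :- v 3 :^ 4 :+ v 3 :^ 10 :* v 2) ξ₂-dissect ∷ qq ∷ [])
    where
    s = v 3 :* v 4
    geo₄ = s :^ 3 :+ s :^ 2 :+ s :+ # 1

  u-ξ : uᴸ ∙ T.ξ ≈ᴸ ιᴸ (+ 1)
  u-ξ = L.lincomb (qᴸ ∷ q⁻¹ ∷ e û ∷ e ξ₀ ∷ T.ξ ∷ []) (v 0 :^ 2 :* v 2 :* v 4) (# 1)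
    ((v 0 :^ 2 :* v 2 , v 4 ≐ v 3 :* v 1 :^ 2) ∷ (v 0 :^ 2 :* v 1 :^ 2 , v 3 :* v 2 ≐ # 1) ∷ (v 0 :* v 1 :+ # 1 , v 0 :* v 1 ≐ # 1) ∷ []) refl
    (ξ-form ∷ embed-eqn (û ∷ ξ₀ ∷ []) (v 1 :* v 0) (# 1) (inv-inverse ξ₀ ξ₀-head) ∷ qq ∷ [])

  t-g : tᴸ ∙ gᴸ ≈ᴸ ιᴸ (+ 1)
  t-g = L.lincomb (tᴸ ∷ e ĝ ∷ qᴸ ∷ q⁻¹ ∷ []) (v 0 :* (v 1 :* v 3)) (# 1)
    ((v 3 , v 0 :* v 1 ≐ v 2) ∷ (# 1 , v 2 :* v 3 ≐ # 1) ∷ []) refl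
    (embed-eqn (tₛ ∷ ĝ ∷ q ∷ []) (v 0 :* v 1) (v 2)
      (lincomb (q ∷ t̂ ∷ ĝ ∷ []) (v 0 :* v 1 :* v 2) (v 0) ((v 0 , v 2 :* v 1 ≐ # 1) ∷ []) refl (inv-inverse ĝ ĝ-head ∷ [])) ∷ qq ∷ [])

  η-ξ₂ : T.η ∙ T.ξ₂ ≈ᴸ T.ξ ∙ T.ξ
  η-ξ₂ = L.lincomb (T.η ∷ T.ξ₂ ∷ T.ξ ∷ e η₀ ∷ e ξ₂ ∷ e ξ₀ ∷ q⁻¹ ∷ []) (v 0 :* v 1) (v 2 :* v 2)
    ((v 1 , v 0 ≐ v 3) ∷ (v 3 , v 1 ≐ v 4 :* v 6 :^ 4) ∷ (:- (v 2 :+ v 5 :* v 6 :^ 2) , v 2 ≐ v 5 :* v 6 :^ 2) ∷ (v 6 :^ 4 , v 3 :* v 4 ≐ v 5 :* v 5) ∷ []) refl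
    (η-form ∷ ξ₂-form ∷ ξ-form ∷ embed-eqn (η₀ ∷ ξ₂ ∷ ξ₀ ∷ []) (v 0 :* v 1) (v 2 :* v 2) η₀-ξ₂ ∷ [])

  Vq⁻¹ : Vᴸ q⁻¹ ≈ᴸ q⁻¹ ↟ 7
  Vq⁻¹ = L.lincomb (Vᴸ q⁻¹ ∷ Vᴸ qᴸ ∷ qᴸ ∷ q⁻¹ ∷ []) (v 0) (v 3 :^ 7)
    ((v 3 :^ 7 , v 1 :* v 0 ≐ # 1) ∷ (:- (v 0 :* v 3 :^ 7) , v 1 ≐ v 2 :^ 7)
      ∷ (:- (v 0 :* (s :^ 6 :+ s :^ 5 :+ s :^ 4 :+ s :^ 3 :+ s :^ 2 :+ s :+ # 1)) , s ≐ # 1) ∷ []) refl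
    (L.≈-trans (L.≈-sym (VL.F-⊗ qᴸ q⁻¹)) (L.≈-trans (VL.F-cong qq) (VL.F-ι (+ 1))) ∷ L.≈-trans (Vᴸ-embed q) (L.≈-trans (embed-cong (dil-q 6)) q⁷) ∷ qq ∷ [])
    where s = v 2 :* v 3

  Vg-form : Vᴸ gᴸ ≈ᴸ e (V ĝ) ∙ q⁻¹ ↟ 7
  Vg-form = L.≈-trans (VL.F-⊗ _ _) (L.*-cong (Vᴸ-embed ĝ) Vq⁻¹)

  Vg₂-form : Vᴸ g₂ᴸ ≈ᴸ e (V (D₂ ĝ)) ∙ (q⁻¹ ↟ 7) ↟ 2
  Vg₂-form = L.≈-trans (VL.F-⊗ _ _) (L.*-cong (Vᴸ-embed (D₂ ĝ)) (L.≈-trans (VL.F-↑ q⁻¹ 2) (L.↑-cong 2 Vq⁻¹)))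

  wt-κ : T.w ∙ tᴸ ≈ᴸ e κ
  wt-κ = L.≈-trans (L.lincomb (gᴸ ∷ T.h ∷ tᴸ ∷ []) ((v 0 :+ # 7 :- # 7 :* v 1) :* v 2) (# 1 :+ # 7 :* v 2 :- # 7 :* (v 1 :* v 2))
      ((# 1 , v 2 :* v 0 ≐ # 1) ∷ []) refl (t-g ∷ []))
    (L.≈-sym (embed-⟦⟧ (α ∷ β ∷ γ ∷ tₛ ∷ []) (# 1 :+ # 7 :* v 3 :- # 7 :* (v 0 :* v 1 :* v 2 :* v 3))))

  t′-form : e tₛ′ ≈ᴸ uᴸ ↟ 4 ∙ Vᴸ gᴸ
  t′-form = L.lincomb (e tₛ′ ∷ qᴸ ∷ q⁻¹ ∷ e û ∷ e (V ĝ) ∷ Vᴸ gᴸ ∷ []) (v 0) ((v 1 :^ 2 :* v 3) :^ 4 :* v 5)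
    ((# 1 , v 0 ≐ v 1 :* (v 3 :^ 4 :* v 4)) ∷ (:- (v 1 :^ 8 :* v 3 :^ 4) , v 5 ≐ v 4 :* v 2 :^ 7)
      ∷ (:- (v 1 :* v 3 :^ 4 :* v 4 :* (s :^ 6 :+ s :^ 5 :+ s :^ 4 :+ s :^ 3 :+ s :^ 2 :+ s :+ # 1)) , s ≐ # 1) ∷ []) refl
    (embed-⟦⟧ (q ∷ û ∷ V ĝ ∷ []) (v 0 :* (v 1 :^ 4 :* v 2)) ∷ Vg-form ∷ qq ∷ [])
    where s = v 1 :* v 2

  h′-form : e hₛ′ ≈ᴸ T.η ∙ uᴸ ∙ Vᴸ (T.w ∙ tᴸ)
  h′-form = L.lincomb (e hₛ′ ∷ qᴸ ∷ e η₀ ∷ e û ∷ e (V κ) ∷ T.η ∷ Vᴸ (T.w ∙ tᴸ) ∷ []) (v 0) (v 5 :* (v 1 :^ 2 :* v 3) :* v 6)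
    ((# 1 , v 0 ≐ v 1 :^ 2 :* (v 2 :* v 3 :* v 4)) ∷ (:- (v 1 :^ 2 :* v 3 :* v 6) , v 5 ≐ v 2) ∷ (:- (v 2 :* v 1 :^ 2 :* v 3) , v 6 ≐ v 4) ∷ []) refl
    (embed-⟦⟧ (q ∷ η₀ ∷ û ∷ V κ ∷ []) (v 0 :^ 2 :* (v 1 :* v 2 :* v 3)) ∷ η-form ∷ L.≈-trans (Vᴸ-cong wt-κ) (Vᴸ-embed κ) ∷ [])

  transfer : ∀ xs l r → L.⟦ l ⟧ (L.env (map e xs)) ≈ᴸ L.⟦ r ⟧ (L.env (map e xs)) → ⟦ l ⟧ (env xs) ≋ ⟦ r ⟧ (env xs)
  transfer xs l r p = embed-injective (L.≈-trans (embed-⟦⟧ xs l) (L.≈-trans p (L.≈-sym (embed-⟦⟧ xs r))))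

  F-eq : ⟦ F-lhs (v 0) (v 1) ⟧ (env (tₛ ∷ h ∷ [])) ≋ ⟦ F-rhs (v 0) (v 1) ⟧ (env (tₛ ∷ h ∷ []))
  F-eq = transfer (tₛ ∷ α ∷ β ∷ γ ∷ []) (F-lhs (v 0) hₑ) (F-rhs (v 0) hₑ)
    (L.lincomb (tᴸ ∷ T.h ∷ gᴸ ∷ []) (F-lhs (v 0) (v 1)) (F-rhs (v 0) (v 1))
      ((v 0 :^ 2 , Φₑ (v 1) ≐ v 1 :* v 2 :^ 2 :+ v 2 :* v 1 :* (# 9 :- # 16 :* v 1))
        ∷ (v 1 :* (v 0 :* v 2 :+ # 1) :+ v 0 :* v 1 :* (# 9 :- # 16 :* v 1) , v 0 :* v 2 ≐ # 1) ∷ []) refl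
      (Heptic.base-F setting ∷ t-g ∷ []))
    where hₑ = v 1 :* v 2 :* v 3

  tg₂ : e (D₂ tₛ) ∙ g₂ᴸ ≈ᴸ ιᴸ (+ 1)
  tg₂ = L.lincomb (e (D₂ tₛ) ∷ e (D₂ ĝ) ∷ qᴸ ∷ q⁻¹ ∷ []) (v 0 :* (v 1 :* v 3 :^ 2)) (# 1)
    ((v 3 :^ 2 , v 0 :* v 1 ≐ v 2 :^ 2) ∷ (v 2 :* v 3 :+ # 1 , v 2 :* v 3 ≐ # 1) ∷ []) refl
    (embed-eqn (D₂ tₛ ∷ D₂ ĝ ∷ q ∷ []) (v 0 :* v 1) (v 2 :^ 2)
      (≈-trans (≈-sym (DH.F-⊗ tₛ ĝ)) (≈-trans (DH.F-cong (lincomb (q ∷ t̂ ∷ ĝ ∷ []) (v 0 :* v 1 :* v 2) (v 0) ((v 0 , v 2 :* v 1 ≐ # 1) ∷ []) refl (inv-inverse ĝ ĝ-head ∷ []))) (dil-q 1))) ∷ qq ∷ [])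

  G-eq : ⟦ G-lhs (v 0) (v 1) ⟧ (env (tₛ ∷ h ∷ D₂ tₛ ∷ [])) ≋ ⟦ G-rhs (v 0) (v 1) (v 2) ⟧ (env (tₛ ∷ h ∷ D₂ tₛ ∷ []))
  G-eq = transfer (tₛ ∷ α ∷ β ∷ γ ∷ D₂ tₛ ∷ []) (G-lhs (v 0) hₑ) (G-rhs (v 0) hₑ (v 4))
    (L.lincomb (tᴸ ∷ T.h ∷ e (D₂ tₛ) ∷ gᴸ ∷ g₂ᴸ ∷ []) (G-lhs (v 0) (v 1)) (G-rhs (v 0) (v 1) (v 2))
      ((v 0 :^ 2 :* v 2 :^ 2 , v 4 :^ 2 :* v 1 ≐ v 3 :* w)
        ∷ (v 2 :^ 2 :* v 0 :* w :+ v 2 :^ 2 , v 0 :* v 3 ≐ # 1)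
        ∷ (:- (v 1 :* v 0 :^ 2 :* (v 2 :* v 4 :+ # 1)) , v 2 :* v 4 ≐ # 1) ∷ []) refl
      (Heptic.base-G setting ∷ t-g ∷ tg₂ ∷ []))
    where
    hₑ = v 1 :* v 2 :* v 3
    w = v 3 :+ # 7 :- # 7 :* v 1

  -- u = 1/ξ, z = η u K and K = V(κ), so that η W = G ξ z with W = V(w) = G K
  G K W Vh z : Laurent
  G  = Vᴸ gᴸ
  K  = Vᴸ (T.w ∙ tᴸ)
  Vh = Vᴸ T.h
  W  = G ∔ ιᴸ (+ 7) ∸ᴸ ιᴸ (+ 7) ∙ Vh
  z  = T.η ∙ uᴸ ∙ K

  G-unit : G ∙ Vᴸ tᴸ ≈ᴸ ιᴸ (+ 1)
  G-unit = L.≈-trans (L.⊗-comm _ _) (L.≈-trans (L.≈-sym (VL.F-⊗ tᴸ gᴸ)) (L.≈-trans (VL.F-cong t-g) (VL.F-ι (+ 1))))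

  W-K : W ≈ᴸ G ∙ K
  W-K = L.lincomb (W ∷ G ∷ K ∷ Vᴸ tᴸ ∷ []) (v 0) (v 1 :* v 2)
    ((:- v 1 , v 2 ≐ v 0 :* v 3) ∷ (:- v 0 , v 1 :* v 3 ≐ # 1) ∷ []) refl
    (L.≈-trans (VL.F-⊗ T.w tᴸ) (L.*-congʳ (VL.F-⟦⟧ (gᴸ ∷ T.h ∷ []) (v 0 :+ # 7 :- # 7 :* v 1))) ∷ G-unit ∷ [])

  ηW : T.η ∙ W ≈ᴸ G ∙ T.ξ ∙ z
  ηW = L.lincomb (T.η ∷ W ∷ G ∷ K ∷ T.ξ ∷ uᴸ ∷ []) (v 0 :* v 1) (v 2 :* v 4 :* (v 0 :* v 5 :* v 3))
    ((v 0 , v 1 ≐ v 2 :* v 3) ∷ (:- (v 0 :* v 2 :* v 3) , v 5 :* v 4 ≐ # 1) ∷ []) refl (W-K ∷ u-ξ ∷ [])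

  -- `top-F` with η W replaced by G ξ z, divided by ξ¹¹ V(g): hence the factor u¹¹ V(t) in the
  -- certificate.
  F-top : L.⟦ F-lhs (v 0) (v 1) ⟧ (L.env (uᴸ ↟ 4 ∙ G ∷ z ∷ [])) ≈ᴸ L.⟦ F-rhs (v 0) (v 1) ⟧ (L.env (uᴸ ↟ 4 ∙ G ∷ z ∷ []))
  F-top = L.lincomb (T.ξ ∷ G ∷ z ∷ uᴸ ∷ Vᴸ tᴸ ∷ []) (F-lhs (v 3 :^ 4 :* v 1) (v 2)) (F-rhs (v 3 :^ 4 :* v 1) (v 2))
    ((v 3 :^ 11 :* v 4 , l ≐ r) ∷ (:- (v 3 :^ 11 :* (v 1 :^ 2 :* v 0 :^ 3 :* Φₑ (v 2) :- v 0 :^ 6 :* v 2 :* (v 0 :^ 5 :+ v 1 :* v 0 :* Ψ))) , v 1 :* v 4 ≐ # 1)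
      ∷ (:- (v 3 :^ 8 :* v 1 :^ 2 :* Φₑ (v 2) :* geo 3) :+ v 2 :* geo 11 :+ v 3 :^ 4 :* v 1 :* v 2 :* Ψ :* geo 7 , v 3 :* v 0 ≐ # 1) ∷ []) refl
    (L.≈-trans (L.⟦⟧-cong e₁ {ρ = L.env (T.ξ ∷ G ∷ G ∙ T.ξ ∙ z ∷ [])} {σ = L.env (T.ξ ∷ G ∷ T.η ∙ W ∷ [])} pointwise)
      (L.≈-trans (Tables.top-F setting) (L.⟦⟧-cong e₂ {ρ = L.env (T.ξ ∷ G ∷ T.η ∙ W ∷ [])} {σ = L.env (T.ξ ∷ G ∷ G ∙ T.ξ ∙ z ∷ [])} (λ i → L.≈-sym (pointwise i))))
      ∷ G-unit ∷ u-ξ ∷ [])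
    where
    Ψ = # 9 :- # 16 :* v 2
    E₁ E₂ : Expr → Expr
    E₁ Y = (v 1 :* v 0 :- Y) :* (v 1 :* v 0 :- # 8 :* Y) :^ 2
    E₂ Y = Y :* v 0 :^ 5 :* (v 0 :^ 5 :+ # 9 :* (v 1 :* v 0) :- # 16 :* Y)
    e₁ = E₁ (v 2)
    e₂ = E₂ (v 2)
    l = E₁ (v 1 :* v 0 :* v 2)
    r = E₂ (v 1 :* v 0 :* v 2)
    geo : ℕ → Expr
    geo zero    = # 0
    geo (suc k) = # 1 :+ v 3 :* v 0 :* geo k
    pointwise : ∀ i → L.env (T.ξ ∷ G ∷ G ∙ T.ξ ∙ z ∷ []) i ≈ᴸ L.env (T.ξ ∷ G ∷ T.η ∙ W ∷ []) i
    pointwise 0 = L.≈-refl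
    pointwise 1 = L.≈-refl
    pointwise 2 = L.≈-sym ηW
    pointwise (suc (suc (suc i))) = L.≈-refl

  F-eq′ : ⟦ F-lhs (v 0) (v 1) ⟧ (env (tₛ′ ∷ hₛ′ ∷ [])) ≋ ⟦ F-rhs (v 0) (v 1) ⟧ (env (tₛ′ ∷ hₛ′ ∷ []))
  F-eq′ = transfer (tₛ′ ∷ hₛ′ ∷ []) (F-lhs (v 0) (v 1)) (F-rhs (v 0) (v 1)) (L.≈-trans
    (L.⟦⟧-cong (F-lhs (v 0) (v 1)) {ρ = L.env (e tₛ′ ∷ e hₛ′ ∷ [])} {σ = L.env (uᴸ ↟ 4 ∙ G ∷ z ∷ [])} pointwise) (L.≈-trans F-top
    (L.⟦⟧-cong (F-rhs (v 0) (v 1)) {ρ = L.env (uᴸ ↟ 4 ∙ G ∷ z ∷ [])} {σ = L.env (e tₛ′ ∷ e hₛ′ ∷ [])} (λ i → L.≈-sym (pointwise i)))))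
    where
    pointwise : ∀ i → L.env (e tₛ′ ∷ e hₛ′ ∷ []) i ≈ᴸ L.env (uᴸ ↟ 4 ∙ G ∷ z ∷ []) i
    pointwise 0 = t′-form
    pointwise 1 = h′-form
    pointwise (suc (suc i)) = L.≈-refl

  u₂ᴸ : Laurent
  u₂ᴸ = qᴸ ↟ 4 ∙ e (D₂ û)

  u₂-ξ₂ : u₂ᴸ ∙ T.ξ₂ ≈ᴸ ιᴸ (+ 1)
  u₂-ξ₂ = L.lincomb (qᴸ ∷ q⁻¹ ∷ e (D₂ û) ∷ e ξ₂ ∷ T.ξ₂ ∷ []) (v 0 :^ 4 :* v 2 :* v 4) (# 1)
    ((v 0 :^ 4 :* v 2 , v 4 ≐ v 3 :* v 1 :^ 4) ∷ (v 0 :^ 4 :* v 1 :^ 4 , v 3 :* v 2 ≐ # 1) ∷ (s :^ 3 :+ s :^ 2 :+ s :+ # 1 , s ≐ # 1) ∷ []) refl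
    (ξ₂-form ∷ embed-eqn (D₂ û ∷ ξ₂ ∷ []) (v 1 :* v 0) (# 1) (≈-trans (≈-sym (DH.F-⊗ ξ₀ û)) (≈-trans (DH.F-cong (inv-inverse ξ₀ ξ₀-head)) DH.F-1)) ∷ qq ∷ [])
    where s = v 0 :* v 1

  u₂-form : u₂ᴸ ≈ᴸ T.η ∙ uᴸ ↟ 2
  u₂-form = L.lincomb (u₂ᴸ ∷ T.η ∷ uᴸ ∷ T.ξ ∷ T.ξ₂ ∷ []) (v 0) (v 1 :* v 2 :^ 2)
    ((:- (v 0 :* (v 2 :* v 3 :+ # 1)) , v 2 :* v 3 ≐ # 1) ∷ (:- (v 0 :* v 2 :^ 2) , v 1 :* v 4 ≐ v 3 :* v 3) ∷ (v 1 :* v 2 :^ 2 , v 0 :* v 4 ≐ # 1) ∷ []) refl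
    (u-ξ ∷ η-ξ₂ ∷ u₂-ξ₂ ∷ [])

  t₂′-form : e (D₂ tₛ′) ≈ᴸ u₂ᴸ ↟ 4 ∙ Vᴸ g₂ᴸ
  t₂′-form = L.lincomb (e (D₂ tₛ′) ∷ qᴸ ∷ q⁻¹ ∷ e (D₂ û) ∷ e (V (D₂ ĝ)) ∷ Vᴸ g₂ᴸ ∷ []) (v 0) ((v 1 :^ 4 :* v 3) :^ 4 :* v 5)
    ((# 1 , v 0 ≐ v 1 :^ 2 :* (v 3 :^ 4 :* v 4)) ∷ (:- (v 1 :^ 16 :* v 3 :^ 4) , v 5 ≐ v 4 :* (v 2 :^ 7) :^ 2)
      ∷ (:- (v 1 :^ 2 :* v 3 :^ 4 :* v 4 :* geo 14) , v 1 :* v 2 ≐ # 1) ∷ []) refl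
    (L.≈-trans (embed-cong (≈-trans (DH.F-⟦⟧ (q ∷ û ∷ V ĝ ∷ []) (v 0 :* (v 1 :^ 4 :* v 2))) (*-cong (dil-q 1) (*-congˡ (D₂-V ĝ)))))
        (embed-⟦⟧ (q ∷ D₂ û ∷ V (D₂ ĝ) ∷ []) (v 0 :^ 2 :* (v 1 :^ 4 :* v 2)))
      ∷ Vg₂-form ∷ qq ∷ [])
    where
    geo : ℕ → Expr
    geo zero    = # 0
    geo (suc k) = # 1 :+ v 1 :* v 2 :* geo k

  -- `top-G` divided by ξ⁷. It shows the right-hand factor of G to be a seventh power times V(h), so
  -- that G at the top follows from V of `base-G` and u(q²) = η u².
  factor-form : ιᴸ (+ 1) ∔ ιᴸ (+ 7) ∙ (uᴸ ↟ 4 ∙ G) ∸ᴸ ιᴸ (+ 7) ∙ z ∙ (uᴸ ↟ 4 ∙ G) ≈ᴸ uᴸ ↟ 7 ∙ T.ξ₂ ↟ 7 ∙ Vh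
  factor-form = L.lincomb (T.ξ ∷ G ∷ z ∷ uᴸ ∷ T.ξ₂ ∷ Vh ∷ T.η ∷ W ∷ []) (# 1 :+ # 7 :* (v 3 :^ 4 :* v 1) :- # 7 :* v 2 :* (v 3 :^ 4 :* v 1)) (v 3 :^ 7 :* v 4 :^ 7 :* v 5)
    ((:- (v 3 :^ 7) , v 4 :^ 7 :* v 5 :+ # 7 :* (v 6 :* v 7 :* v 0 :^ 2) ≐ v 0 :^ 7 :+ # 7 :* (v 0 :^ 3 :* v 1))
      ∷ (# 7 :* v 3 :^ 7 :* v 0 :^ 2 , v 6 :* v 7 ≐ v 1 :* v 0 :* v 2)
      ∷ (:- (geo 7) :- # 7 :* v 3 :^ 4 :* v 1 :* (# 1 :- v 2) :* geo 3 , v 3 :* v 0 ≐ # 1) ∷ []) refl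
    (Tables.top-G setting ∷ ηW ∷ u-ξ ∷ [])
    where
    geo : ℕ → Expr
    geo zero    = # 0
    geo (suc k) = # 1 :+ v 3 :* v 0 :* geo k

  Vg₂² : Vᴸ g₂ᴸ ↟ 2 ∙ Vh ≈ᴸ G ∙ W
  Vg₂² = L.≈-trans (L.≈-sym (VL.F-⟦⟧ (g₂ᴸ ∷ T.h ∷ []) (v 0 :^ 2 :* v 1))) (L.≈-trans (VL.F-cong (Heptic.base-G setting))
    (VL.F-⟦⟧ (gᴸ ∷ T.h ∷ []) (v 0 :* (v 0 :+ # 7 :- # 7 :* v 1))))

  G-top : L.⟦ G-lhs (v 0) (v 1) ⟧ (L.env (uᴸ ↟ 4 ∙ G ∷ z ∷ u₂ᴸ ↟ 4 ∙ Vᴸ g₂ᴸ ∷ [])) ≈ᴸ L.⟦ G-rhs (v 0) (v 1) (v 2) ⟧ (L.env (uᴸ ↟ 4 ∙ G ∷ z ∷ u₂ᴸ ↟ 4 ∙ Vᴸ g₂ᴸ ∷ []))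
  G-top = L.lincomb (T.η ∷ uᴸ ∷ K ∷ G ∷ Vᴸ g₂ᴸ ∷ u₂ᴸ ∷ T.ξ₂ ∷ Vh ∷ W ∷ []) (G-lhs tₑ zₑ) (G-rhs tₑ zₑ (v 5 :^ 4 :* v 4))
    ((:- (v 5 :^ 8 :* v 4 :^ 2) , # 1 :+ # 7 :* tₑ :- # 7 :* zₑ :* tₑ ≐ v 1 :^ 7 :* v 6 :^ 7 :* v 7)
      ∷ (:- (v 5 :^ 8 :* v 1 :^ 7 :* v 6 :^ 7) , v 4 :^ 2 :* v 7 ≐ v 3 :* v 8)
      ∷ (:- (v 5 :^ 8 :* v 1 :^ 7 :* v 6 :^ 7 :* v 3) , v 8 ≐ v 3 :* v 2)
      ∷ (:- (v 5 :* v 1 :^ 7 :* v 3 :^ 2 :* v 2 :* geo 7) , v 5 :* v 6 ≐ # 1)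
      ∷ (:- (v 1 :^ 7 :* v 3 :^ 2 :* v 2) , v 5 ≐ v 0 :* v 1 :^ 2) ∷ []) refl
    (factor-form ∷ Vg₂² ∷ W-K ∷ u₂-ξ₂ ∷ u₂-form ∷ [])
    where
    tₑ = v 1 :^ 4 :* v 3
    zₑ = v 0 :* v 1 :* v 2
    geo : ℕ → Expr
    geo zero    = # 0
    geo (suc k) = # 1 :+ v 5 :* v 6 :* geo k

  G-eq′ : ⟦ G-lhs (v 0) (v 1) ⟧ (env (tₛ′ ∷ hₛ′ ∷ D₂ tₛ′ ∷ [])) ≋ ⟦ G-rhs (v 0) (v 1) (v 2) ⟧ (env (tₛ′ ∷ hₛ′ ∷ D₂ tₛ′ ∷ []))
  G-eq′ = transfer (tₛ′ ∷ hₛ′ ∷ D₂ tₛ′ ∷ []) (G-lhs (v 0) (v 1)) (G-rhs (v 0) (v 1) (v 2)) (L.≈-trans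
    (L.⟦⟧-cong (G-lhs (v 0) (v 1)) {ρ = L.env (e tₛ′ ∷ e hₛ′ ∷ e (D₂ tₛ′) ∷ [])} {σ = L.env top} pointwise) (L.≈-trans G-top
    (L.⟦⟧-cong (G-rhs (v 0) (v 1) (v 2)) {ρ = L.env top} {σ = L.env (e tₛ′ ∷ e hₛ′ ∷ e (D₂ tₛ′) ∷ [])} (λ i → L.≈-sym (pointwise i)))))
    where
    top : List Laurent
    top = uᴸ ↟ 4 ∙ G ∷ z ∷ u₂ᴸ ↟ 4 ∙ Vᴸ g₂ᴸ ∷ []
    pointwise : ∀ i → L.env (e tₛ′ ∷ e hₛ′ ∷ e (D₂ tₛ′) ∷ []) i ≈ᴸ L.env top i
    pointwise 0 = t′-form
    pointwise 1 = h′-form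
    pointwise 2 = t₂′-form
    pointwise (suc (suc (suc i))) = L.≈-refl

-- Uniqueness of the common solution of F and G

module Rigidity where
  open Equations using (F-eq; G-eq; F-eq′; G-eq′)

  hₑ : Expr → Expr
  hₑ H = v 0 :^ 2 :* H

  F̂l F̂r Ĝl : Expr → Expr → Expr
  F̂l T H = T :^ 2 :* Φₑ (hₑ H)
  F̂r T H = H :* (# 1 :+ v 0 :* T :* (# 9 :- # 16 :* hₑ H))
  Ĝl T H = H :* T :^ 2

  Ĝr : Expr → Expr → Expr → Expr
  Ĝr T H T₂ = T₂ :^ 2 :* (# 1 :+ # 7 :* (v 0 :* T) :- # 7 :* hₑ H :* (v 0 :* T))

  reduceF : ∀ T H → ⟦ F-lhs (v 0) (v 1) ⟧ (env (q ⊗ T ∷ q ↑ 2 ⊗ H ∷ [])) ≋ ⟦ F-rhs (v 0) (v 1) ⟧ (env (q ⊗ T ∷ q ↑ 2 ⊗ H ∷ [])) →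
    ⟦ F̂l (v 1) (v 2) ⟧ (env (q ∷ T ∷ H ∷ [])) ≋ ⟦ F̂r (v 1) (v 2) ⟧ (env (q ∷ T ∷ H ∷ []))
  reduceF T H p = q↑-cancel 2 (lincomb (q ∷ T ∷ H ∷ []) (v 0 :^ 2 :* F̂l (v 1) (v 2)) (v 0 :^ 2 :* F̂r (v 1) (v 2))
    ((# 1 , F-lhs (v 0 :* v 1) (v 0 :^ 2 :* v 2) ≐ F-rhs (v 0 :* v 1) (v 0 :^ 2 :* v 2)) ∷ []) refl (p ∷ []))

  reduceG : ∀ T H T₂ → ⟦ G-lhs (v 0) (v 1) ⟧ (env (q ⊗ T ∷ q ↑ 2 ⊗ H ∷ q ↑ 2 ⊗ T₂ ∷ [])) ≋ ⟦ G-rhs (v 0) (v 1) (v 2) ⟧ (env (q ⊗ T ∷ q ↑ 2 ⊗ H ∷ q ↑ 2 ⊗ T₂ ∷ [])) →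
    ⟦ Ĝl (v 1) (v 2) ⟧ (env (q ∷ T ∷ H ∷ T₂ ∷ [])) ≋ ⟦ Ĝr (v 1) (v 2) (v 3) ⟧ (env (q ∷ T ∷ H ∷ T₂ ∷ []))
  reduceG T H T₂ p = q↑-cancel 4 (lincomb (q ∷ T ∷ H ∷ T₂ ∷ []) (v 0 :^ 4 :* Ĝl (v 1) (v 2)) (v 0 :^ 4 :* Ĝr (v 1) (v 2) (v 3))
    ((# 1 , G-lhs (v 0 :* v 1) (v 0 :^ 2 :* v 2) ≐ G-rhs (v 0 :* v 1) (v 0 :^ 2 :* v 2) (v 0 :^ 2 :* v 3)) ∷ []) refl (p ∷ []))

  D₂q : ∀ f → D₂ (q ⊗ f) ≋ q ↑ 2 ⊗ D₂ f
  D₂q f = ≈-trans (DH.F-⊗ q f) (*-congʳ (dil-q 1))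

  rewrite-env : ∀ {xs ys} l r → (∀ i → env xs i ≋ env ys i) → ⟦ l ⟧ (env xs) ≋ ⟦ r ⟧ (env xs) → ⟦ l ⟧ (env ys) ≋ ⟦ r ⟧ (env ys)
  rewrite-env l r p e = ≈-trans (⟦⟧-cong l (λ i → ≈-sym (p i))) (≈-trans e (⟦⟧-cong r p))

  F̂ : ⟦ F̂l (v 1) (v 2) ⟧ (env (q ∷ t̂ ∷ ĥ ∷ [])) ≋ ⟦ F̂r (v 1) (v 2) ⟧ (env (q ∷ t̂ ∷ ĥ ∷ []))
  F̂ = reduceF t̂ ĥ (rewrite-env {tₛ ∷ h ∷ []} {tₛ ∷ q ↑ 2 ⊗ ĥ ∷ []} (F-lhs (v 0) (v 1)) (F-rhs (v 0) (v 1))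
    (λ { 0 → ≈-refl ; 1 → h-ĥ ; (suc (suc i)) → ≈-refl }) F-eq)

  F̂′ : ⟦ F̂l (v 1) (v 2) ⟧ (env (q ∷ t̂′ ∷ ĥ′ ∷ [])) ≋ ⟦ F̂r (v 1) (v 2) ⟧ (env (q ∷ t̂′ ∷ ĥ′ ∷ []))
  F̂′ = reduceF t̂′ ĥ′ F-eq′

  Ĝ : ⟦ Ĝl (v 1) (v 2) ⟧ (env (q ∷ t̂ ∷ ĥ ∷ D₂ t̂ ∷ [])) ≋ ⟦ Ĝr (v 1) (v 2) (v 3) ⟧ (env (q ∷ t̂ ∷ ĥ ∷ D₂ t̂ ∷ []))
  Ĝ = reduceG t̂ ĥ (D₂ t̂) (rewrite-env {tₛ ∷ h ∷ D₂ tₛ ∷ []} {tₛ ∷ q ↑ 2 ⊗ ĥ ∷ q ↑ 2 ⊗ D₂ t̂ ∷ []} (G-lhs (v 0) (v 1)) (G-rhs (v 0) (v 1) (v 2))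
    (λ { 0 → ≈-refl ; 1 → h-ĥ ; 2 → D₂q t̂ ; (suc (suc (suc i))) → ≈-refl }) G-eq)

  Ĝ′ : ⟦ Ĝl (v 1) (v 2) ⟧ (env (q ∷ t̂′ ∷ ĥ′ ∷ D₂ t̂′ ∷ [])) ≋ ⟦ Ĝr (v 1) (v 2) (v 3) ⟧ (env (q ∷ t̂′ ∷ ĥ′ ∷ D₂ t̂′ ∷ []))
  Ĝ′ = reduceG t̂′ ĥ′ (D₂ t̂′) (rewrite-env {tₛ′ ∷ hₛ′ ∷ D₂ tₛ′ ∷ []} {tₛ′ ∷ hₛ′ ∷ q ↑ 2 ⊗ D₂ t̂′ ∷ []} (G-lhs (v 0) (v 1)) (G-rhs (v 0) (v 1) (v 2))
    (λ { 0 → ≈-refl ; 1 → ≈-refl ; 2 → D₂q t̂′ ; (suc (suc (suc i))) → ≈-refl }) G-eq′)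

  zs : List Series
  zs = q ∷ t̂ ∷ t̂′ ∷ ĥ ∷ ĥ′ ∷ D₂ t̂ ∷ D₂ t̂′ ∷ []

  -- Divided differences: subtracting the two instances of F gives f₁ δ + f₂ ε = 0, and subtracting
  -- those of G gives g₁ δ + g₂ ε = X′ (T + T′) D₂ δ, where T and T′ are t̂ and t̂′ at q². `M` and
  -- `N` arise by eliminating ε.
  f₁ f₂ g₁ g₂ X′ M N : Expr
  f₁ = (v 1 :+ v 2) :* Φₑ (hₑ (v 3)) :- v 3 :* v 0 :* (# 9 :- # 16 :* hₑ (v 3))
  f₂ = v 2 :^ 2 :* v 0 :^ 2 :* (# 80 :* (hₑ (v 3) :+ hₑ (v 4)) :- # 17 :- # 64 :* (hₑ (v 3) :^ 2 :+ hₑ (v 3) :* hₑ (v 4) :+ hₑ (v 4) :^ 2))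
    :- (# 1 :+ v 0 :* v 2 :* (# 9 :- # 16 :* hₑ (v 4))) :+ # 16 :* v 0 :^ 3 :* v 3 :* v 2
  g₁ = v 3 :* (v 1 :+ v 2) :- v 5 :^ 2 :* (# 7 :* v 0 :- # 7 :* v 0 :^ 3 :* v 3)
  g₂ = v 2 :^ 2 :+ # 7 :* v 0 :^ 3 :* v 5 :^ 2 :* v 2
  X′ = # 1 :+ # 7 :* (v 0 :* v 2) :- # 7 :* hₑ (v 4) :* (v 0 :* v 2)
  M  = g₁ :* f₂ :- g₂ :* f₁
  N  = f₂ :* X′ :* (v 5 :+ v 6)

  δ ε : Series
  δ = t̂ ⊝ t̂′
  ε = ĥ ⊝ ĥ′

  contraction : ⟦ M ⟧ (env zs) ⊗ δ ≋ ⟦ N ⟧ (env zs) ⊗ D₂ δ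
  contraction = ≈-trans (lincomb zs (M :* (v 1 :- v 2)) (N :* (v 5 :- v 6))
    ((f₂ , Ĝl (v 1) (v 3) ≐ Ĝr (v 1) (v 3) (v 5)) ∷ (:- f₂ , Ĝl (v 2) (v 4) ≐ Ĝr (v 2) (v 4) (v 6))
      ∷ (:- g₂ , F̂l (v 1) (v 3) ≐ F̂r (v 1) (v 3)) ∷ (g₂ , F̂l (v 2) (v 4) ≐ F̂r (v 2) (v 4)) ∷ []) refl
    (Ĝ ∷ Ĝ′ ∷ F̂ ∷ F̂′ ∷ [])) (*-congˡ (≈-sym (DH.F-⊝ t̂ t̂′)))

  heads : Heads zs (+ 0 ∷ + 1 ∷ + 1 ∷ + 1 ∷ + 1 ∷ + 1 ∷ + 1 ∷ [])
  heads = refl ∷ inv-head ĝ ∷ t̂′-head ∷ ĥ-head ∷ ĥ′-head ∷ inv-head ĝ ∷ t̂′-head ∷ []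
    where
    t̂′-head : t̂′ 0 ≡ + 1
    t̂′-head = head-⟦⟧ {û ∷ V ĝ ∷ []} (v 0 :^ 4 :* v 1) (inv-head ξ₀ ∷ ĝ-head ∷ [])
    κ-head : κ 0 ≡ + 1
    κ-head = head-⟦⟧ {q ∷ t̂ ∷ h ∷ []} (# 1 :+ # 7 :* (v 0 :* v 1) :- # 7 :* (v 2 :* (v 0 :* v 1)))
      (refl ∷ inv-head ĝ ∷ trans (at h-ĥ 0) (head-⟦⟧ {q ∷ ĥ ∷ []} (v 0 :^ 2 :* v 1) (refl ∷ ĥ-head ∷ [])) ∷ [])
    ĥ′-head : ĥ′ 0 ≡ + 1
    ĥ′-head = head-⟦⟧ {η₀ ∷ û ∷ V κ ∷ []} (v 0 :* v 1 :* v 2) (η₀-head ∷ inv-head ξ₀ ∷ κ-head ∷ [])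

  D₂-small : ∀ n f → f ≋[ suc n ] 0# → D₂ f ≋[ suc (suc n) ] 0#
  D₂-small n f p = []-trans (≋⇒[] (dil-step 1 f)) ([]-trans ([]-⊕ (≋⇒[] (≈-reflexive (cong const (below p 0 (s≤s z≤n)))))
      ([]-q↑ 2 (dil-mod 1 (mk λ i l → trans (below p (suc i) (s≤s l)) (sym (0#-at i))))))
    (≋⇒[] (≈-trans (+-congˡ (≈-trans (*-congˡ (dil-zero 1)) (zeroʳ _))) (+-identityʳ 0#))))

  -- δ(0) = 0 because both leading coefficients are 1. If δ vanishes below n ≥ 1, then D₂ δ vanishes
  -- up to n, hence so does M δ, and M(0) = -4 passes this on to δ.
  δ-zero : δ ≋ 0#
  δ-zero = vanish-by (⟦ M ⟧ (env zs)) δ (λ e → absurd (trans (sym (head-⟦⟧ M heads)) e)) step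
    where
    absurd : -[1+ 3 ] ≢ + 0
    absurd ()
    step : ∀ n → δ ≋[ n ] 0# → (⟦ M ⟧ (env zs) ⊗ δ) n ≡ + 0
    step zero    _ = trans (at-⊗ _ δ 0) (trans (cong (⟦ M ⟧ (env zs) 0 ℤ.*_) (head-⟦⟧ (v 1 :- v 2) heads)) (ℤₚ.*-zeroʳ (⟦ M ⟧ (env zs) 0)))
    step (suc n) p = trans (at contraction (suc n)) (trans (below ([]-⊗ (≋⇒[] (≈-refl {⟦ N ⟧ (env zs)})) (D₂-small n δ p)) (suc n) ℕₚ.≤-refl)
      (trans (at (zeroʳ _) (suc n)) refl))

  t̂-func : t̂ ≋ t̂′
  t̂-func = ⊝-move δ-zero

  ĥ-func : ĥ ≋ ĥ′
  ĥ-func = ⊝-move (head-nonzero-cancel (⟦ f₂ ⟧ (env zs)) ε (λ e → absurd (trans (sym (head-⟦⟧ f₂ heads)) e))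
    (lincomb zs (f₂ :* (v 3 :- v 4)) (# 0)
      ((# 1 , F̂l (v 1) (v 3) ≐ F̂r (v 1) (v 3)) ∷ (:- # 1 , F̂l (v 2) (v 4) ≐ F̂r (v 2) (v 4)) ∷ (:- f₁ , v 1 ≐ v 2) ∷ []) refl
      (F̂ ∷ F̂′ ∷ t̂-func ∷ [])))
    where
    absurd : -[1+ 0 ] ≢ + 0
    absurd ()

full-setting : FullSetting
full-setting = record
  { S = Instance.setting ; t = tᴸ ; u = uᴸ ; t-g = t-g ; u-ξ = u-ξ
  ; t-func = L.≈-trans (embed-cong (*-congˡ Rigidity.t̂-func)) t′-form
  ; h-func = L.≈-trans (L.≈-sym (embed-⟦⟧ (α ∷ β ∷ γ ∷ []) (v 0 :* v 1 :* v 2)))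
      (L.≈-trans (embed-cong (≈-trans h-ĥ (*-congˡ Rigidity.ĥ-func))) h′-form)
  ; η-ξ₂ = η-ξ₂ }
  where open Equations

-- The generating function of PDN1

mul1-q^-series : ∀ k a → mul1-q^ k a ≋ (1# ⊝ q ↑ k) ⊗ a
mul1-q^-series k a = mk λ n → sym (trans (at (solve (q ↑ k ∷ a ∷ []) ((# 1 :- v 0) :* v 1) (v 1 :- v 0 :* v 1) refl) n)
  (trans (at-⊕ a (⊖ (q ↑ k ⊗ a)) n) (trans (cong (λ z → a n ℤ.+ z) (at-⊖ (q ↑ k ⊗ a) n)) (go n))))
  where
  go : ∀ n → a n ℤ.- (q ↑ k ⊗ a) n ≡ mul1-q^ k a n
  go n with k ≤ᵇ n in le
  ... | true  = cong (λ z → a n ℤ.- z) (trans (cong (q ↑ k ⊗ a) (sym (ℕₚ.m+[n∸m]≡n (ℕₚ.≤ᵇ⇒≤ k n (subst T (sym le) tt))))) (q↑-+ k a (n ∸ k)))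
  ... | false = trans (cong (λ z → a n ℤ.- z) (q↑-< k a n (ℕₚ.≰⇒> λ k≤n → subst T le (ℕₚ.≤⇒≤ᵇ k≤n)))) (ℤₚ.+-identityʳ (a n))

module Division (k : ℕ) where
  open import Data.Nat.Divisibility using (_∣?_; >⇒∤; ∣m∣n⇒∣m+n; ∣m+n∣m⇒∣n; ∣-refl; _∣0)
  open import Data.List using (foldr; applyUpTo)
  open import Relation.Nullary.Decidable using (does; dec-true; dec-false)

  d = suc k

  total : (ℕ → ℤ) → ℕ → ℤ
  total f zero    = + 0
  total f (suc n) = f 0 ℤ.+ total (f ∘ suc) n

  foldr-total : ∀ (f : ℕ → ℤ) g n → foldr ℤ._+_ (+ 0) (map f (applyUpTo g n)) ≡ total (f ∘ g) n
  foldr-total f g zero    = refl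
  foldr-total f g (suc n) = cong (λ z → f (g 0) ℤ.+ z) (foldr-total f (g ∘ suc) n)

  total-cong : ∀ {f g} n → (∀ i → i < n → f i ≡ g i) → total f n ≡ total g n
  total-cong zero    p = refl
  total-cong (suc n) p = cong₂ ℤ._+_ (p 0 (s≤s z≤n)) (total-cong n (λ i l → p (suc i) (s≤s l)))

  total-zero : ∀ {f} n → (∀ i → i < n → f i ≡ + 0) → total f n ≡ + 0
  total-zero zero    p = refl
  total-zero (suc n) p = cong₂ ℤ._+_ (p 0 (s≤s z≤n)) (total-zero n (λ i l → p (suc i) (s≤s l)))

  total-split : ∀ f m n → total f (m + n) ≡ total f m ℤ.+ total (λ i → f (m + i)) n
  total-split f zero    n = sym (ℤₚ.+-identityˡ _)
  total-split f (suc m) n = trans (cong (λ z → f 0 ℤ.+ z) (total-split (f ∘ suc) m n)) (sym (ℤₚ.+-assoc (f 0) _ _))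

  term : Series → ℕ → ℕ → ℤ
  term a n i = if does (d ∣? i) then a (n ∸ i) else + 0

  term-0 : ∀ a n → term a n 0 ≡ a n
  term-0 a n = cong (λ b → if b then a n else + 0) (dec-true (d ∣? 0) (d ∣0))

  term-< : ∀ a n i → i < k → term a n (suc i) ≡ + 0
  term-< a n i l = cong (λ b → if b then a (n ∸ suc i) else + 0) (dec-false (d ∣? suc i) (>⇒∤ (s≤s l)))

  term-+ : ∀ a n i → term a (d + n) (d + i) ≡ term a n i
  term-+ a n i = cong₂ (λ b z → if b then a z else + 0) same-does (ℕₚ.[m+n]∸[m+o]≡n∸o d n i)
    where
    same-does : does (d ∣? (d + i)) ≡ does (d ∣? i)
    same-does = case d ∣? i of λ
      { (yes p) → trans (dec-true (d ∣? (d + i)) (∣m∣n⇒∣m+n ∣-refl p)) (sym (dec-true (d ∣? i) p))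
      ; (no ¬p) → trans (dec-false (d ∣? (d + i)) (λ r → ¬p (∣m+n∣m⇒∣n r ∣-refl))) (sym (dec-false (d ∣? i) ¬p)) }

  div-total : ∀ a n → div1-q^ d a n ≡ total (term a n) (suc n)
  div-total a n = foldr-total (term a n) (λ i → i) (suc n)

  div-low : ∀ a n → n < d → div1-q^ d a n ≡ a n
  div-low a n (s≤s n≤k) = trans (div-total a n) (trans (cong₂ ℤ._+_ (term-0 a n) (total-zero n (λ i l → term-< a n i (ℕₚ.≤-trans l n≤k)))) (ℤₚ.+-identityʳ (a n)))

  div-high : ∀ a n → div1-q^ d a (d + n) ≡ a (d + n) ℤ.+ div1-q^ d a n
  div-high a n = trans (div-total a (d + n)) (trans (cong (total (term a (d + n))) (sym (ℕₚ.+-suc d n))) (trans (total-split (term a (d + n)) d (suc n))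
    (cong₂ ℤ._+_ (trans (cong₂ ℤ._+_ (term-0 a (d + n)) (total-zero k (λ i l → term-< a (d + n) i l))) (ℤₚ.+-identityʳ (a (d + n))))
      (trans (total-cong (suc n) (λ i _ → term-+ a n i)) (sym (div-total a n))))))

  -- Divisibility by d is d-periodic, so the defining sum b satisfies b(d + n) = a(d + n) + b(n),
  -- and b = a below d. This is the recursion of (1 - qᵈ) b = a.
  div1-q^-series : ∀ a → (1# ⊝ q ↑ d) ⊗ div1-q^ d a ≋ a
  div1-q^-series a = ≈-trans (≈-sym (mul1-q^-series d (div1-q^ d a))) (mk go)
    where
    go : ∀ n → mul1-q^ d (div1-q^ d a) n ≡ a n
    go n with d ≤ᵇ n in le
    ... | false = div-low a n (ℕₚ.≰⇒> λ l → subst T le (ℕₚ.≤⇒≤ᵇ l))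
    ... | true  = trans (cong (λ z → div1-q^ d a z ℤ.- div1-q^ d a (n ∸ d)) (sym n≡)) (trans (cong (ℤ._- div1-q^ d a (n ∸ d)) (div-high a (n ∸ d)))
        (trans (cancel (a (d + (n ∸ d))) (div1-q^ d a (n ∸ d))) (cong a n≡)))
      where
      open import Data.Integer.Tactic.RingSolver using (solve-∀)
      n≡ : d + (n ∸ d) ≡ n
      n≡ = ℕₚ.m+[n∸m]≡n (ℕₚ.≤ᵇ⇒≤ d n (subst T (sym le) tt))
      cancel : ∀ x y → x ℤ.+ y ℤ.- y ≡ x
      cancel = solve-∀

factor-series : ∀ m a → (1# ⊝ q ↑ suc m) ↑ 5 ⊗ factor (suc m) a ≋ (1# ⊝ q ↑ (2 * suc m)) ↑ 2 ⊗ a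
factor-series m a = lincomb (1# ⊝ q ↑ suc m ∷ 1# ⊝ q ↑ (2 * suc m) ∷ a ∷ d₁ ∷ d₂ ∷ d₃ ∷ d₄ ∷ d₅ ∷ m₁ ∷ factor (suc m) a ∷ [])
  (v 0 :^ 5 :* v 9) (v 1 :^ 2 :* v 2)
  ((v 0 :^ 5 , v 9 ≐ v 1 :* v 8) ∷ (v 0 :^ 5 :* v 1 , v 8 ≐ v 1 :* v 7) ∷ (v 0 :^ 4 :* v 1 :^ 2 , v 0 :* v 7 ≐ v 6) ∷ (v 0 :^ 3 :* v 1 :^ 2 , v 0 :* v 6 ≐ v 5)
    ∷ (v 0 :^ 2 :* v 1 :^ 2 , v 0 :* v 5 ≐ v 4) ∷ (v 0 :* v 1 :^ 2 , v 0 :* v 4 ≐ v 3) ∷ (v 1 :^ 2 , v 0 :* v 3 ≐ v 2) ∷ []) refl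
  (mul1-q^-series (2 * suc m) m₁ ∷ mul1-q^-series (2 * suc m) d₅ ∷ div1-q^-series d₄ ∷ div1-q^-series d₃ ∷ div1-q^-series d₂ ∷ div1-q^-series d₁ ∷ div1-q^-series a ∷ [])
  where
  open Division m using (div1-q^-series)
  d₁ d₂ d₃ d₄ d₅ m₁ : Series
  d₁ = div1-q^ (suc m) a
  d₂ = div1-q^ (suc m) d₁
  d₃ = div1-q^ (suc m) d₂
  d₄ = div1-q^ (suc m) d₃
  d₅ = div1-q^ (suc m) d₄
  m₁ = mul1-q^ (2 * suc m) d₅

factor-agrees : ∀ m a → factor (suc m) a ≋[ suc m ] a
factor-agrees m a = []-trans (≋⇒[] (≈-sym (solve (factor (suc m) a ∷ []) (one5 :* v 0) (v 0) refl))) ([]-trans ([]-⊗ (one-mod 5 (suc m) ℕₚ.≤-refl) (≋⇒[] ≈-refl))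
  ([]-trans (≋⇒[] (factor-series m a)) ([]-trans ([]-⊗ ([]-sym (one-mod 2 (2 * suc m) (ℕₚ.m≤m+n (suc m) _))) (≋⇒[] ≈-refl)) (≋⇒[] (solve (a ∷ []) (((# 1 :- # 0) :^ 2) :* v 0) (v 0) refl)))))
  where
  one5 = (# 1 :- # 0) :^ 5
  one-mod : ∀ e k → suc m ≤ k → (1# ⊝ 0#) ↑ e ≋[ suc m ] (1# ⊝ q ↑ k) ↑ e
  one-mod zero    k l = ≋⇒[] ≈-refl
  one-mod (suc e) k l = []-⊗ ([]-⊕ (≋⇒[] ≈-refl) ([]-⊖ ([]-sym (q↑-vanish k (suc m) l)))) (one-mod e k l)

D₂-q↑ : ∀ m → D₂ (q ↑ m) ≋ q ↑ (2 * m)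
D₂-q↑ zero    = DH.F-1
D₂-q↑ (suc m) = ≈-trans (DH.F-⊗ q (q ↑ m)) (≈-trans (*-cong (dil-q 1) (D₂-q↑ m)) (≈-trans (≈-sym (↑-+ q 2 (2 * m)))
  (≈-reflexive (cong (q ↑_) (sym (ℕₚ.*-suc 2 m))))))

partialProd-product : ∀ N → partialProd N ⊗ P N ↑ 5 ≋ D₂ (P N) ↑ 2
partialProd-product zero    = ≈-trans (≈-trans (*-congʳ (mk λ { zero → refl ; (suc n) → refl })) (solve [] (# 1 :* # 1 :^ 5) (# 1 :^ 2) refl)) (↑-cong 2 (≈-sym DH.F-1))
partialProd-product (suc N) = lincomb (partialProd N ∷ P N ∷ D₂ (P N) ∷ partialProd (suc N) ∷ P (suc N) ∷ D₂ (P (suc N)) ∷ 1# ⊝ q ↑ suc N ∷ 1# ⊝ q ↑ (2 * suc N) ∷ [])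
  (v 3 :* v 4 :^ 5) (v 5 :^ 2)
  ((v 3 :* quot (v 4) (v 1 :* v 6) , v 4 ≐ v 1 :* v 6) ∷ (v 1 :^ 5 , v 6 :^ 5 :* v 3 ≐ v 7 :^ 2 :* v 0) ∷ (v 7 :^ 2 , v 0 :* v 1 :^ 5 ≐ v 2 :^ 2)
    ∷ (:- (v 5 :+ v 2 :* v 7) , v 5 ≐ v 2 :* v 7) ∷ []) refl
  (D-back 0 N ∷ factor-series N (partialProd N) ∷ partialProd-product N
    ∷ ≈-trans (DH.F-cong (D-back 0 N)) (≈-trans (DH.F-⊗ _ _) (*-congˡ (≈-trans (DH.F-⊝ _ _) (+-cong DH.F-1 (-‿cong (D₂-q↑ (suc N))))))) ∷ [])
  where
  quot : Expr → Expr → Expr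
  quot a b = a :^ 4 :+ a :^ 3 :* b :+ a :^ 2 :* b :^ 2 :+ a :* b :^ 3 :+ b :^ 4

pd : Series
pd = PDN1

-- The definition reads coefficient n at stage n, whereas `lim` reads it at stage n + 1; factor n +
-- 1 leaves coefficients up to n unchanged.
pd-agrees : ∀ n → pd ≋[ n ] partialProd n
pd-agrees n = mk λ i l → trans (sym (below (factor-agrees i (partialProd i)) i ℕₚ.≤-refl)) (below (lim-agrees partialProd cauchy n) i l)
  where
  cauchy : ∀ k → partialProd (suc k) ≋[ k ] partialProd k
  cauchy k = []-weaken (ℕₚ.n≤1+n k) (factor-agrees k (partialProd k))

↑-mod : ∀ {f g n} k → f ≋[ n ] g → f ↑ k ≋[ n ] g ↑ k
↑-mod zero    p = ≋⇒[] ≈-refl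
↑-mod (suc k) p = []-⊗ p (↑-mod k p)

pd-J : pd ⊗ J ↑ 5 ≋ D₂ J ↑ 2
pd-J = []⇒≋ λ n → []-trans ([]-⊗ (pd-agrees n) (↑-mod 5 (J-agrees n))) ([]-trans (≋⇒[] (partialProd-product n)) (↑-mod 2 ([]-sym (dil-mod 1 (J-agrees n)))))

Ω iΩ : Series
Ω = J ⊗ φ ⊗ φ
iΩ = iJ ⊗ iφ ⊗ iφ

pd-Ω : pd ⊗ Ω ≋ 1#
pd-Ω = lincomb (pd ∷ J ∷ φ ∷ D₂ J ∷ iJ ∷ []) (v 0 :* (v 1 :* v 2 :* v 2)) (# 1)
  ((:- (v 0 :* v 1 :* v 2 :^ 2 :* geo) , v 1 :* v 4 ≐ # 1) ∷ (v 2 :^ 2 :* v 4 :^ 4 , v 0 :* v 1 :^ 5 ≐ v 3 :^ 2)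
    ∷ (v 4 :^ 4 :* (v 2 :* v 3 :+ v 1 :* v 1) , v 2 :* v 3 ≐ v 1 :* v 1) ∷ (geo , v 1 :* v 4 ≐ # 1) ∷ []) refl
  (J-iJ ∷ pd-J ∷ φ-product ∷ J-iJ ∷ [])
  where
  s = v 1 :* v 4
  geo = s :^ 3 :+ s :^ 2 :+ s :+ # 1

Ω-iΩ : Ω ⊗ iΩ ≋ 1#
Ω-iΩ = lincomb (J ∷ φ ∷ iJ ∷ iφ ∷ []) (v 0 :* v 1 :* v 1 :* (v 2 :* v 3 :* v 3)) (# 1)
  (((v 1 :* v 3) :^ 2 , v 0 :* v 2 ≐ # 1) ∷ (v 1 :* v 3 :+ # 1 , v 1 :* v 3 ≐ # 1) ∷ []) refl (J-iJ ∷ φ-iφ ∷ [])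

Z-series : û ↑ 5 ⊗ (ξ₂ ⊗ ξ₂) ≋ pd ⊗ V (V Ω)
Z-series = lincomb (û ∷ ξ₂ ∷ pd ∷ J ∷ φ ∷ V (V iJ) ∷ V (V J) ∷ V (V iφ) ∷ V (V φ) ∷ V (V Ω) ∷ []) (v 0 :^ 5 :* (v 1 :* v 1)) (v 2 :* v 9)
  ((:- (v 0 :^ 5 :* v 1 :^ 2) , v 2 :* (v 3 :* v 4 :* v 4) ≐ # 1) ∷ (:- e₁ , v 6 :* v 5 ≐ # 1) ∷ (:- (e₁ :* v 5 :* v 6 :* (v 8 :* v 7 :+ # 1)) , v 8 :* v 7 ≐ # 1)
    ∷ (v 0 :^ 5 :* v 2 :* v 6 :* v 8 :^ 2 :* X :* (Y :* v 1 :+ X :* X) , Y :* v 1 ≐ X :* X) ∷ (v 2 :* v 6 :* v 8 :^ 2 :* (s :^ 4 :+ s :^ 3 :+ s :^ 2 :+ s :+ # 1) , X :* v 0 ≐ # 1)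
    ∷ (:- v 2 , v 9 ≐ v 6 :* v 8 :* v 8) ∷ []) refl
  (pd-Ω ∷ V-unit (V-unit J-iJ) ∷ V-unit (V-unit φ-iφ) ∷ η₀-ξ₂ ∷ inv-inverse ξ₀ ξ₀-head
    ∷ ≈-trans (VH.F-cong (VH.F-⟦⟧ (J ∷ φ ∷ []) (v 0 :* v 1 :* v 1))) (VH.F-⟦⟧ (V J ∷ V φ ∷ []) (v 0 :* v 1 :* v 1)) ∷ [])
  where
  e₁ = v 0 :^ 5 :* v 1 :^ 2 :* v 2 :* v 3 :* v 4 :^ 2
  X = v 3 :* v 5
  Y = v 4 :* v 7
  s = X :* v 0

-- From spans to divisibility of the coefficients

module Descent where
  open FullSetting full-setting
  open Divisibility full-setting
  open Spans full-setting
  open Instance using (e; qq)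
  open L using () renaming (_⊗_ to infixl 7 _∙_; _⊕_ to infixl 6 _∔_; _↑_ to infixr 9 _↟_)

  -- The iterates with the units Ω and V(Ω) stripped off. The q² of Z moves coefficient 7n + 5 to
  -- 7(n + 1), so the progressions begin at index 1.
  oddS evenS : ℕ → Series
  evenS a       = sec 6 (oddS a)
  oddS zero     = sec 6 (q ↑ 2 ⊗ pd)
  oddS (suc a)  = sec 6 (q ↑ 2 ⊗ evenS a)

  oddL evenL : ℕ → Laurent
  evenL a      = Uᴸ (oddL a)
  oddL zero    = Uᴸ Z
  oddL (suc a) = Uᴸ (Z ∙ evenL a)

  odd-span : ∀ a → Span (Odd (suc a)) (oddL a)
  even-span : ∀ a → Span (Even (suc a)) (evenL a)
  odd-span zero     = first-odd
  odd-span (suc a)  = even⇒odd (even-span a)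
  even-span a       = odd⇒even (odd-span a)

  Z-embed : Z ≈ᴸ e (V (V Ω) ⊗ (q ↑ 2 ⊗ pd))
  Z-embed = L.lincomb (qᴸ ∷ q⁻¹ ∷ e û ∷ e ξ₂ ∷ Equations.T.ξ₂ ∷ e pd ∷ e (V (V Ω)) ∷ e (V (V Ω) ⊗ (q ↑ 2 ⊗ pd)) ∷ [])
    ((v 0 :^ 2 :* v 2) :^ 5 :* (v 4 :* v 4)) (v 7)
    (((v 0 :^ 2 :* v 2) :^ 5 :* (v 4 :+ v 3 :* v 1 :^ 4) , v 4 ≐ v 3 :* v 1 :^ 4)
      ∷ (v 0 :^ 2 :* v 2 :^ 5 :* v 3 :^ 2 :* (s :^ 7 :+ s :^ 6 :+ s :^ 5 :+ s :^ 4 :+ s :^ 3 :+ s :^ 2 :+ s :+ # 1) , s ≐ # 1)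
      ∷ (v 0 :^ 2 , v 2 :^ 5 :* (v 3 :* v 3) ≐ v 5 :* v 6) ∷ (:- # 1 , v 7 ≐ v 6 :* (v 0 :^ 2 :* v 5)) ∷ []) refl
    (Equations.ξ₂-form ∷ qq ∷ embed-eqn (û ∷ ξ₂ ∷ pd ∷ V (V Ω) ∷ []) (v 0 :^ 5 :* (v 1 :* v 1)) (v 2 :* v 3) Z-series
      ∷ embed-⟦⟧ (V (V Ω) ∷ q ∷ pd ∷ []) (v 0 :* (v 1 :^ 2 :* v 2)) ∷ [])
    where s = v 0 :* v 1

  odd-series : ∀ a → oddL a ≈ᴸ e (V Ω ⊗ oddS a)
  even-series : ∀ a → evenL a ≈ᴸ e (Ω ⊗ evenS a)
  odd-series zero    = L.≈-trans (Uᴸ-cong Z-embed) (L.≈-trans (Uᴸ-embed _) (embed-cong (sec-dil-⊗ 6 (V Ω) _)))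
  odd-series (suc a) = L.≈-trans (Uᴸ-cong (L.≈-trans (L.*-cong Z-embed (even-series a)) (L.≈-trans (L.≈-sym (embed-⊗ _ _)) (embed-cong
      (lincomb (V (V Ω) ∷ q ∷ pd ∷ Ω ∷ evenS a ∷ []) (v 0 :* (v 1 :^ 2 :* v 2) :* (v 3 :* v 4)) (v 0 :* (v 1 :^ 2 :* v 4))
        ((v 0 :* v 1 :^ 2 :* v 4 , v 2 :* v 3 ≐ # 1) ∷ []) refl (pd-Ω ∷ []))))))
    (L.≈-trans (Uᴸ-embed _) (embed-cong (sec-dil-⊗ 6 (V Ω) _)))
  even-series a      = L.≈-trans (Uᴸ-cong (odd-series a)) (L.≈-trans (Uᴸ-embed _) (embed-cong (sec-dil-⊗ 6 Ω _)))

  -- The power of 4 accumulates the uses of `quarter` in a span.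
  record Divisible (b : ℕ) (f : Laurent) : Set where
    constructor divisible
    field
      k        : ℕ
      quotient : Series
      equation : ιᴸ (+ (4 ^ k)) ∙ f ≈ᴸ ιᴸ (+ (7 ^ b)) ∙ e quotient

  ι-^ : ∀ m n → ιᴸ (+ (4 ^ (m + n))) ≈ᴸ ιᴸ (+ (4 ^ m)) ∙ ιᴸ (+ (4 ^ n))
  ι-^ m n = L.≈-trans (L.≈-reflexive (cong ιᴸ (trans (cong +_ (ℕₚ.^-distribˡ-+-* 4 m n)) (ℤₚ.pos-* (4 ^ m) (4 ^ n))))) (ιᴸ-* _ _)

  span-divisible : ∀ {K} b → (∀ v i j → K v i j → b ≤ v) → ∀ {f} → Span K f → Divisible b f
  span-divisible b p zeroˢ = divisible 0 0# (L.solve (ιᴸ (+ (7 ^ b)) ∷ []) (# 1 :* # 0) (v 0 :* # 0) refl)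
  span-divisible b p (gen c d i j k) = divisible 0 (const (c ℤ.* + (7 ^ (d ∸ b))) ⊗ (tₛ ↑ i ⊗ h ↑ j))
    (L.lincomb (ιᴸ (c ℤ.* + (7 ^ d)) ∷ t ↟ i ∷ Equations.T.h ↟ j ∷ ιᴸ (+ (7 ^ b)) ∷ ιᴸ (c ℤ.* + (7 ^ (d ∸ b))) ∷ e (const (c ℤ.* + (7 ^ (d ∸ b))) ⊗ (tₛ ↑ i ⊗ h ↑ j)) ∷ e (tₛ ↑ i) ∷ e (h ↑ j) ∷ [])
      (# 1 :* (v 0 :* (v 1 :* v 2))) (v 3 :* v 5)
      ((v 1 :* v 2 , v 0 ≐ v 3 :* v 4) ∷ (v 3 :* v 4 :* v 2 , v 1 ≐ v 6) ∷ (v 3 :* v 4 :* v 6 , v 2 ≐ v 7) ∷ (:- v 3 , v 5 ≐ v 4 :* (v 6 :* v 7)) ∷ []) refl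
      (L.≈-trans (L.≈-reflexive (cong ιᴸ split)) (ιᴸ-* _ _) ∷ Instance.embed-↑ tₛ i
        ∷ L.≈-trans (L.↑-cong j (L.≈-sym (embed-⟦⟧ (α ∷ β ∷ γ ∷ []) (v 0 :* v 1 :* v 2)))) (Instance.embed-↑ h j)
        ∷ L.≈-trans (embed-⊗ _ _) (L.*-congˡ (embed-⊗ _ _)) ∷ []))
    where
    open import Data.Integer.Tactic.RingSolver using (solve-∀)
    regroup : ∀ x y z → x ℤ.* (y ℤ.* z) ≡ y ℤ.* (x ℤ.* z)
    regroup = solve-∀
    split : c ℤ.* + (7 ^ d) ≡ + (7 ^ b) ℤ.* (c ℤ.* + (7 ^ (d ∸ b)))
    split = trans (cong (c ℤ.*_) (trans (cong (λ m → + (7 ^ m)) (sym (ℕₚ.m+[n∸m]≡n (p d i j k))))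
      (trans (cong +_ (ℕₚ.^-distribˡ-+-* 7 b (d ∸ b))) (ℤₚ.pos-* (7 ^ b) (7 ^ (d ∸ b)))))) (regroup c (+ (7 ^ b)) (+ (7 ^ (d ∸ b))))
  span-divisible b p (_⊞_ {f} {g} x y) = plus (span-divisible b p x) (span-divisible b p y)
    where
    plus : Divisible b f → Divisible b g → Divisible b (f ∔ g)
    plus (divisible k s p₁) (divisible l r p₂) = divisible (k + l) (const (+ (4 ^ l)) ⊗ s ⊕ const (+ (4 ^ k)) ⊗ r)
      (L.lincomb (f ∷ g ∷ ιᴸ (+ (4 ^ k)) ∷ ιᴸ (+ (4 ^ l)) ∷ ιᴸ (+ (4 ^ (k + l))) ∷ ιᴸ (+ (7 ^ b)) ∷ e s ∷ e r ∷ e (const (+ (4 ^ l)) ⊗ s ⊕ const (+ (4 ^ k)) ⊗ r) ∷ [])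
        (v 4 :* (v 0 :+ v 1)) (v 5 :* v 8)
        ((v 0 :+ v 1 , v 4 ≐ v 2 :* v 3) ∷ (v 3 , v 2 :* v 0 ≐ v 5 :* v 6) ∷ (v 2 , v 3 :* v 1 ≐ v 5 :* v 7) ∷ (:- v 5 , v 8 ≐ v 3 :* v 6 :+ v 2 :* v 7) ∷ []) refl
        (ι-^ k l ∷ p₁ ∷ p₂ ∷ embed-⟦⟧ (const (+ (4 ^ l)) ∷ s ∷ const (+ (4 ^ k)) ∷ r ∷ []) (v 0 :* v 1 :+ v 2 :* v 3) ∷ []))
  span-divisible b p (resp r x) = along (span-divisible b p x)
    where
    along : Divisible b _ → Divisible b _
    along (divisible k s p₁) = divisible k s (L.≈-trans (L.*-congˡ (L.≈-sym r)) p₁)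
  span-divisible b p (quarter {f} x) = up (span-divisible b p x)
    where
    up : Divisible b (ιᴸ (+ 4) ∙ f) → Divisible b f
    up (divisible k s p₁) = divisible (k + 1) s (L.lincomb (f ∷ ιᴸ (+ (4 ^ k)) ∷ ιᴸ (+ (4 ^ (k + 1))) ∷ ιᴸ (+ (7 ^ b)) ∷ e s ∷ []) (v 2 :* v 0) (v 3 :* v 4)
      ((v 0 , v 2 ≐ v 1 :* # 4) ∷ (# 1 , v 1 :* (# 4 :* v 0) ≐ v 3 :* v 4) ∷ []) refl (ι-^ k 1 ∷ p₁ ∷ []))

  module _ where
    open import Data.Nat.Divisibility as ℕᵈ using (divides)
    open import Data.Nat.Coprimality using (Coprime; coprime?; coprime-divisor)
    open import Relation.Nullary.Decidable using (from-yes)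

    7-4 : Coprime 7 4
    7-4 = from-yes (coprime? 7 4)

    cancel-4 : ∀ b m → 7 ^ b ℕᵈ.∣ 4 * m → 7 ^ b ℕᵈ.∣ m
    cancel-4 zero    m _ = ℕᵈ.1∣ m
    cancel-4 (suc b) m p with coprime-divisor {7} {4} {m} 7-4 (ℕᵈ.∣-trans (ℕᵈ.m∣m*n (7 ^ b)) p)
    ... | divides m′ refl = subst (7 * 7 ^ b ℕᵈ.∣_) (ℕₚ.*-comm 7 m′) (ℕᵈ.*-monoʳ-∣ 7 (cancel-4 b m′
      (ℕᵈ.*-cancelˡ-∣ 7 (subst (7 * 7 ^ b ℕᵈ.∣_) (trans (sym (ℕₚ.*-assoc 4 m′ 7)) (ℕₚ.*-comm (4 * m′) 7)) p))))

    cancel-4^ : ∀ k b m → 7 ^ b ℕᵈ.∣ 4 ^ k * m → 7 ^ b ℕᵈ.∣ m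
    cancel-4^ zero    b m p = subst (7 ^ b ℕᵈ.∣_) (ℕₚ.+-identityʳ m) p
    cancel-4^ (suc k) b m p = cancel-4^ k b m (cancel-4 b (4 ^ k * m) (subst (7 ^ b ℕᵈ.∣_) (ℕₚ.*-assoc 4 (4 ^ k) m) p))

    divisible-coefficients : ∀ {b f} s c → f ≈ᴸ e (c ⊗ s) → ∀ c′ → c ⊗ c′ ≋ 1# → Divisible b f → ∀ n → + (7 ^ b) ∣ s n
    divisible-coefficients {b} {f} s c p c′ cc′ (divisible k r eqn) n = cancel-4^ k b ℤ.∣ s n ∣ (divides ℤ.∣ (c′ ⊗ r) n ∣
      (trans (sym (ℤₚ.abs-* (+ (4 ^ k)) (s n))) (trans (cong ℤ.∣_∣ pointwise) (trans (ℤₚ.abs-* (+ (7 ^ b)) ((c′ ⊗ r) n)) (ℕₚ.*-comm (7 ^ b) _)))))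
      where
      series : const (+ (4 ^ k)) ⊗ (c ⊗ s) ≋ const (+ (7 ^ b)) ⊗ r
      series = embed-injective (L.≈-trans (embed-⊗ _ _) (L.≈-trans (L.*-congˡ (L.≈-sym p)) (L.≈-trans eqn (L.≈-sym (embed-⊗ _ _)))))
      pointwise : + (4 ^ k) ℤ.* s n ≡ + (7 ^ b) ℤ.* (c′ ⊗ r) n
      pointwise = trans (sym (const⊗-at _ s n)) (trans (at (lincomb (const (+ (4 ^ k)) ∷ s ∷ const (+ (7 ^ b)) ∷ r ∷ c ∷ c′ ∷ []) (v 0 :* v 1) (v 2 :* (v 5 :* v 3))
        ((:- (v 0 :* v 1) , v 4 :* v 5 ≐ # 1) ∷ (v 5 , v 0 :* (v 4 :* v 1) ≐ v 2 :* v 3) ∷ []) refl (cc′ ∷ series ∷ [])) n) (const⊗-at _ (c′ ⊗ r) n))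

  odd-divides : ∀ a n → + (7 ^ suc a) ∣ oddS a n
  odd-divides a = divisible-coefficients (oddS a) (V Ω) (odd-series a) (V iΩ) (V-unit Ω-iΩ) (span-divisible (suc a) (λ _ _ _ → Odd.val) (odd-span a))

  even-divides : ∀ a n → + (7 ^ suc (suc a)) ∣ evenS a n
  even-divides a = divisible-coefficients (evenS a) Ω (even-series a) iΩ Ω-iΩ (span-divisible (suc (suc a)) (λ _ _ _ → Even.val) (even-span a))

-- Identification of the arithmetic progressions

module Indices where
  open Descent using (oddS; evenS)
  open import Data.Nat.Tactic.RingSolver using (solve-∀)
  open import Data.Nat.DivMod using (m*n/n≡m)

  -- Offsets as the recursion produces them: index suc n comes from index suc (6 + 7n) without a
  -- shift and from suc (4 + 7n) after multiplication by q². The closed forms with denominator 24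
  -- are recovered afterwards.
  dO dE : ℕ → ℕ
  dO zero    = 5
  dO (suc a) = 4 * 7 ^ (2 * suc a) + dE a
  dE a       = 6 * 7 ^ suc (2 * a) + dO a

  two : ∀ a → 2 * suc a ≡ suc (suc (2 * a))
  two = ℕₚ.*-suc 2

  dO-24 : ∀ a → dO a * 24 ≡ 17 * 7 ^ suc (2 * a) + 1
  dE-24 : ∀ a → dE a * 24 ≡ 23 * 7 ^ (2 * suc a) + 1
  dO-24 zero    = refl
  dO-24 (suc a) = trans (ℕₚ.*-distribʳ-+ 24 (4 * 7 ^ (2 * suc a)) (dE a)) (trans (cong (λ z → 4 * 7 ^ (2 * suc a) * 24 + z) (dE-24 a)) (lemma (7 ^ (2 * suc a))))
    where
    lemma : ∀ x → 4 * x * 24 + (23 * x + 1) ≡ 17 * (7 * x) + 1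
    lemma = solve-∀
  dE-24 a = trans (ℕₚ.*-distribʳ-+ 24 (6 * 7 ^ suc (2 * a)) (dO a)) (trans (cong (λ z → 6 * 7 ^ suc (2 * a) * 24 + z) (dO-24 a))
      (trans (lemma (7 ^ suc (2 * a))) (cong (λ m → 23 * 7 ^ m + 1) (sym (two a)))))
    where
    lemma : ∀ x → 6 * x * 24 + (17 * x + 1) ≡ 23 * (7 * x) + 1
    lemma = solve-∀

  odd-index : ∀ a n → oddS a (suc n) ≡ PDN1 (7 ^ suc (2 * a) * n + dO a)
  even-index : ∀ a n → evenS a (suc n) ≡ PDN1 (7 ^ (2 * suc a) * n + dE a)
  odd-index zero    n = trans (q↑-+ 2 pd (5 + n * 7)) (cong PDN1 (lemma n))
    where
    lemma : ∀ n → 5 + n * 7 ≡ 7 * n + 5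
    lemma = solve-∀
  odd-index (suc a) n = trans (q↑-+ 2 (evenS a) (5 + n * 7)) (trans (even-index a (4 + n * 7)) (cong PDN1 (lemma (7 ^ (2 * suc a)) n (dE a))))
    where
    lemma : ∀ x n e → x * (4 + n * 7) + e ≡ 7 * x * n + (4 * x + e)
    lemma = solve-∀
  even-index a n = trans (odd-index a (6 + n * 7)) (cong PDN1 (trans (lemma (7 ^ suc (2 * a)) n (dO a)) (cong (λ m → 7 ^ m * n + dE a) (sym (two a)))))
    where
    lemma : ∀ x n e → x * (6 + n * 7) + e ≡ 7 * x * n + (6 * x + e)
    lemma = solve-∀

  quotient : ∀ d m → d * 24 ≡ m → m / 24 ≡ d
  quotient d m refl = m*n/n≡m d 24

theorem1p2 : (n α : ℕ) → α ≥ 1 →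
    ((+ (7 ^ α)) ∣ PDN1 (7 ^ (2 * α ∸ 1) * n + (17 * 7 ^ (2 * α ∸ 1) + 1) / 24))
    × ((+ (7 ^ (α + 1))) ∣ PDN1 (7 ^ (2 * α) * n + (23 * 7 ^ (2 * α) + 1) / 24))
theorem1p2 n (suc a) (s≤s _) =
    -- Index `suc n`, since coefficient 0 of these sections is only an effect of the shift by q².
    subst (λ z → + (7 ^ suc a) ∣ z) odd-eq (odd-divides a (suc n))
  , subst₂ _∣_ (cong (λ m → + (7 ^ m)) (ℕₚ.+-comm 1 (suc a))) even-eq (even-divides a (suc n))
  where
  open Descent
  open Indices
  odd-eq : oddS a (suc n) ≡ PDN1 (7 ^ (2 * suc a ∸ 1) * n + (17 * 7 ^ (2 * suc a ∸ 1) + 1) / 24)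
  odd-eq = trans (odd-index a n) (trans (cong (λ d → PDN1 (7 ^ suc (2 * a) * n + d)) (sym (quotient (dO a) (17 * 7 ^ suc (2 * a) + 1) (dO-24 a))))
    (cong (λ m → PDN1 (7 ^ m * n + (17 * 7 ^ m + 1) / 24)) (cong (_∸ 1) (sym (two a)))))
  even-eq : evenS a (suc n) ≡ PDN1 (7 ^ (2 * suc a) * n + (23 * 7 ^ (2 * suc a) + 1) / 24)
  even-eq = trans (even-index a n) (cong (λ d → PDN1 (7 ^ (2 * suc a) * n + d)) (sym (quotient (dE a) (23 * 7 ^ (2 * suc a) + 1) (dE-24 a))))
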